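{- Let $n\ge 1$ be an integer, let $q$ be a prime power, and let $T$ be an $n$-vertex bypass transition graph. Then the graph $G(n,q,T)$ is Hamilton connected unless it is a cycle.
   Context: $GL(n,q)$ is the group of invertible $n\times n$ matrices over the finite field $\mathbb{F}_q$, and $[n]=\{1,\dots,n\}$. Fix a generator $\alpha$ of the multiplicative group of $\mathbb{F}_q$. A transition graph is a directed graph $T$ (without loops) on the vertex set $[n]$, with edge set $E(T)$. A transition graph $T$ on $[n]$ is a bypass transition graph if either $n=1$, or $n\ge 2$ and (i) there exist an edge $(i,n)$ and an edge $(n,j)$ of $T$ for some $i,j\in[n-1]$, and (ii) the graph $T-n$ obtained by removing the vertex $n$ from $T$ is a bypass transition graph on $[n-1]$. For distinct $x,y\in[n]$ let $A_{xy}$ be the $n\times n$ matrix with entry $1$ at position $(i,j)$ if $i=j$ or ($i=y$ and $j=x$), and $0$ elsewhere (left multiplication by $A_{xy}$ adds row $x$ to row $y$). For $x\in[n]$ let $M_x$ be the diagonal matrix with $\alpha$ at position $(x,x)$ and $1$ at the other diagonal positions. Define $\mathrm{ops}(T)=\{A_{ij},A_{ij}^{ -1}:(i,j)\in E(T)\}\cup\{M_i,M_i^{ -1}:i\in[n]\}$ if $q>2$, and $\mathrm{ops}(T)=\{A_{ij},A_{ij}^{ -1}:(i,j)\in E(T)\}$ if $q=2$. $G(n,q,T)$ is the undirected simple graph with vertex set $GL(n,q)$ and edges $\{X,SX\}$ for $X\in GL(n,q)$, $S\in\mathrm{ops}(T)$ (the Cayley graph with generators acting on the left). A graph is Hamilton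 connected if for any two distinct vertices there is a Hamilton path between them (so the one-vertex graph is Hamilton connected). -}

module Defs where

open import Algebra.Bundles using (CommutativeRing)
import Algebra.Definitions as AlgDefs
import Algebra.Properties.Semiring.Exp as Exp
import Algebra.Properties.Semiring.Sum as Summation
open import Data.Bool.Base using (if_then_else_; _∧_; _∨_)
open import Data.Fin.Base using (Fin; toℕ; fromℕ; inject₁)
open import Data.Fin.Properties using (_≟_; toℕ<n)
open import Data.List.Base using (List; head; last)
open import Data.List.Relation.Unary.Enumerates.Setoid using (IsEnumeration)
open import Data.List.Relation.Unary.Linked using (Linked)
import Data.List.Relation.Unary.Unique.Setoid as UniqueSetoid
open import Data.Maybe.Base using (just)
open import Data.Nat.Base using (ℕ; suc; _^_; _≥_; _>_)
open import Data.Nat.DivMod using (_%_; m<n⇒m%n≡m; n%n≡0)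
open import Data.Nat.Primality using (Prime)
open import Data.Nat.Properties using (m≤n⇒m<n∨m≡n; suc-injective; 1+n≢n)
open import Data.Product.Base using (Σ-syntax; ∃-syntax; ∃₂; _×_; _,_; proj₁)
open import Data.Sum.Base as Sum using (_⊎_; inj₁; inj₂; [_,_])
open import Function.Base using (_on_)
open import Function.Bundles using (Inverse; _⇔_)
open import Level using (Level; _⊔_; 0ℓ) renaming (suc to lsuc)
open import Relation.Binary.Bundles using (Setoid)
open import Relation.Binary.Core using (Rel)
open import Relation.Binary.Definitions using (Decidable; Irreflexive; Symmetric; _Respects₂_)
import Relation.Binary.Construct.On as On
open import Relation.Binary.PropositionalEquality as ≡ using (_≡_; refl)
open import Relation.Nullary.Decidable using (does)
open import Relation.Nullary.Negation using (¬_)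
open import Relation.Unary using (Pred)

private
  variable
    c ℓ a e r a′ e′ r′ : Level
    m n q : ℕ

IsPrimePower : ℕ → Set
IsPrimePower q = ∃₂ λ p k → Prime p × k ≥ 1 × q ≡ p ^ k

------------------------------------------------------------------------
-- Finite fields

record FiniteField c ℓ (q : ℕ) : Set (lsuc (c ⊔ ℓ)) where
  field
    commutativeRing : CommutativeRing c ℓ
  open CommutativeRing commutativeRing public
  field
    1≉0         : ¬ (1# ≈ 0#)
    invertible  : ∀ x → ¬ (x ≈ 0#) → AlgDefs.Invertible _≈_ 1# _*_ x
    enumeration : Inverse setoid (≡.setoid (Fin q))

-- The multiplicative group is finite, so natural exponents suffice.
IsGenerator : (F : FiniteField c ℓ q) → FiniteField.Carrier F → Set (c ⊔ ℓ)
IsGenerator F α = ¬ (α ≈ 0#) × (∀ x → ¬ (x ≈ 0#) → ∃[ k ] (x ≈ α ^F k))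
  where
  open FiniteField F
  open Exp semiring renaming (_^_ to _^F_)

------------------------------------------------------------------------
-- Simple graphs

record SimpleGraph a e r : Set (lsuc (a ⊔ e ⊔ r)) where
  field
    vertices : Setoid a e
  open Setoid vertices public using (_≈_) renaming (Carrier to Vertex)
  field
    Adj    : Rel Vertex r
    resp   : Adj Respects₂ _≈_
    sym    : Symmetric Adj
    irrefl : Irreflexive _≈_ Adj

record HamiltonPath (G : SimpleGraph a e r)
                    (u v : SimpleGraph.Vertex G) : Set (a ⊔ e ⊔ r) where
  open SimpleGraph G
  field
    path     : List Vertex
    starts   : head path ≡ just u
    ends     : last path ≡ just v
    adjacent : Linked Adj path
    unique   : UniqueSetoid.Unique vertices path
    spanning : IsEnumeration vertices path

HamiltonConnected : SimpleGraph a e r → Set (a ⊔ e ⊔ r)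
HamiltonConnected G = ∀ u v → ¬ (u ≈ v) → HamiltonPath G u v
  where open SimpleGraph G

record _≅_ (G : SimpleGraph a e r) (H : SimpleGraph a′ e′ r′) :
           Set (a ⊔ e ⊔ r ⊔ a′ ⊔ e′ ⊔ r′) where
  private
    module G = SimpleGraph G
    module H = SimpleGraph H
  field
    bijection : Inverse G.vertices H.vertices
  open Inverse bijection public using (to)
  field
    adjacency : ∀ u v → G.Adj u v ⇔ H.Adj (to u) (to v)

-- The cycle with k + 3 vertices.
cycleGraph : ℕ → SimpleGraph 0ℓ 0ℓ 0ℓ
cycleGraph k = record
  { vertices = ≡.setoid (Fin N)
  ; Adj      = λ i j → Next i j ⊎ Next j i
  ; resp     = ≡.resp₂ _
  ; sym      = Sum.swap
  ; irrefl   = λ { {i} refl → [ next-irrefl i , next-irrefl i ] }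
  }
  where
  N = suc (suc (suc k))

  Next : Rel (Fin N) 0ℓ
  Next i j = toℕ j ≡ suc (toℕ i) % N

  next-irrefl : ∀ i → ¬ Next i i
  next-irrefl i eq with m≤n⇒m<n∨m≡n (toℕ<n i)
  ... | inj₁ 1+i<N = 1+n≢n (≡.sym (≡.trans eq (m<n⇒m%n≡m 1+i<N)))
  ... | inj₂ 1+i≡N with ≡.trans (≡.sym i≡0) (suc-injective 1+i≡N)
    where
    i≡0 : toℕ i ≡ 0
    i≡0 = ≡.trans eq (≡.trans (≡.cong (_% N) 1+i≡N) (n%n≡0 N))
  ...   | ()

IsCycle : SimpleGraph a e r → Set (a ⊔ e ⊔ r)
IsCycle G = ∃[ k ] (G ≅ cycleGraph k)

------------------------------------------------------------------------
-- Transition graphs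

record TransitionGraph (n : ℕ) : Set₁ where
  field
    Edge     : Rel (Fin n) 0ℓ
    edge?    : Decidable Edge
    loopless : Irreflexive _≡_ Edge

open TransitionGraph

-- Vertex n of [n] is the last element `fromℕ` of `Fin n`, and `inject₁`
-- embeds [n - 1] as the remaining vertices.
removeLast : TransitionGraph (suc n) → TransitionGraph n
removeLast T = record
  { Edge     = Edge T on inject₁
  ; edge?    = λ i j → edge? T (inject₁ i) (inject₁ j)
  ; loopless = λ { refl → loopless T refl }
  }

data IsBypass : TransitionGraph n → Set₁ where
  single : {T : TransitionGraph 1} → IsBypass T
  extend : {T : TransitionGraph (suc (suc m))} →
           (∃[ i ] Edge T (inject₁ i) (fromℕ (suc m))) →
           (∃[ j ] Edge T (fromℕ (suc m)) (inject₁ j)) →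
           IsBypass (removeLast T) →
           IsBypass T

------------------------------------------------------------------------
-- Matrices and the general linear group

module Matrices (F : FiniteField c ℓ q) (n : ℕ) where
  open FiniteField F
  open Summation semiring using (sum; sum-cong-≋)

  Matrix : Set c
  Matrix = Fin n → Fin n → Carrier

  infix 4 _≋_
  _≋_ : Rel Matrix ℓ
  X ≋ Y = ∀ i j → X i j ≈ Y i j

  matrixSetoid : Setoid c ℓ
  matrixSetoid = record
    { Carrier       = Matrix
    ; _≈_           = _≋_
    ; isEquivalence = record
      { refl  = λ i j → FiniteField.refl F
      ; sym   = λ p i j → FiniteField.sym F (p i j)
      ; trans = λ p q i j → FiniteField.trans F (p i j) (q i j)
      }
    }

  infixl 7 _⊗_
  _⊗_ : Matrix → Matrix → Matrix
  (X ⊗ Y) i j = sum λ k → X i k * Y k j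

  ⊗-cong : ∀ {X X′ Y Y′} → X ≋ X′ → Y ≋ Y′ → X ⊗ Y ≋ X′ ⊗ Y′
  ⊗-cong p q i j = sum-cong-≋ λ k → *-cong (p i k) (q k j)

  𝟙 : Matrix
  𝟙 i j = if does (i ≟ j) then 1# else 0#

  GL : Set (c ⊔ ℓ)
  GL = Σ[ X ∈ Matrix ] AlgDefs.Invertible _≋_ 𝟙 _⊗_ X

  mat : GL → Matrix
  mat = proj₁

  _⁻¹ : GL → GL
  (X , Y , YX≋𝟙 , XY≋𝟙) ⁻¹ = Y , X , XY≋𝟙 , YX≋𝟙

  glSetoid : Setoid (c ⊔ ℓ) ℓ
  glSetoid = On.setoid matrixSetoid mat

  -- Left multiplication by `addMatrix x y` adds row x to row y, so the
  -- off-diagonal 1 sits at position (y , x).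
  addMatrix : Fin n → Fin n → Matrix
  addMatrix x y i j =
    if does (i ≟ j) ∨ (does (i ≟ y) ∧ does (j ≟ x)) then 1# else 0#

  scaleMatrix : Carrier → Fin n → Matrix
  scaleMatrix α x i j =
    if does (i ≟ j) then (if does (i ≟ x) then α else 1#) else 0#

  data Ops (α : Carrier) (T : TransitionGraph n) (S : GL) : Set ℓ where
    add     : ∀ i j → Edge T i j → mat S ≋ addMatrix i j → Ops α T S
    add⁻¹   : ∀ i j → Edge T i j → mat (S ⁻¹) ≋ addMatrix i j → Ops α T S
    scale   : q > 2 → ∀ i → mat S ≋ scaleMatrix α i → Ops α T S
    scale⁻¹ : q > 2 → ∀ i → mat (S ⁻¹) ≋ scaleMatrix α i → Ops α T S

-- {X , Y} is an edge when X ≠ Y and it has the form {Z , SZ} with S ∈ ops(T).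
operationGraph : (F : FiniteField c ℓ q) → FiniteField.Carrier F →
                 TransitionGraph n → SimpleGraph (c ⊔ ℓ) ℓ (c ⊔ ℓ)
operationGraph {n = n} F α T = record
  { vertices = glSetoid
  ; Adj      = Adjacent
  ; resp     = (λ {X} {Y} {Z} Y≈Z → adj-resp {X} {X} {Y} {Z} ≋-refl Y≈Z)
             , (λ {Y} {X} {Z} X≈Z → adj-resp {X} {Z} {Y} {Y} X≈Z ≋-refl)
  ; sym      = λ (X≉Y , step) → (λ Y≈X → X≉Y (≋-sym Y≈X)) , Sum.swap step
  ; irrefl   = λ X≈Y (X≉Y , _) → X≉Y X≈Y
  }
  where
  open Matrices F n
  open Setoid matrixSetoid
    using () renaming (refl to ≋-refl; sym to ≋-sym; trans to ≋-trans)

  Step : Rel GL _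
  Step X Y = ∃[ S ] Ops α T S × mat Y ≋ mat S ⊗ mat X

  Adjacent : Rel GL _
  Adjacent X Y = ¬ (mat X ≋ mat Y) × (Step X Y ⊎ Step Y X)

  step-resp : ∀ {X X′ Y Y′} → mat X ≋ mat X′ → mat Y ≋ mat Y′ →
              Step X Y → Step X′ Y′
  step-resp X≈X′ Y≈Y′ (S , S∈ops , Y≋SX) =
    S , S∈ops , ≋-trans (≋-sym Y≈Y′) (≋-trans Y≋SX (⊗-cong (≋-refl {mat S}) X≈X′))

  adj-resp : ∀ {X X′ Y Y′} → mat X ≋ mat X′ → mat Y ≋ mat Y′ →
             Adjacent X Y → Adjacent X′ Y′
  adj-resp {X} {X′} {Y} {Y′} X≈X′ Y≈Y′ (X≉Y , step) =
    (λ X′≈Y′ → X≉Y (≋-trans X≈X′ (≋-trans X′≈Y′ (≋-sym Y≈Y′)))) ,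
    Sum.map (step-resp {X} {X′} {Y} {Y′} X≈X′ Y≈Y′)
             (step-resp {Y} {Y′} {X} {X′} Y≈Y′ X≈X′) step

-- Let e be the last basis vector of 𝔽_qⁿ. The theorem is proved along the chain
--   GL(n−1,q) = Block ⊆ Affine ⊆ Parabolic ⊆ GL(n,q),
-- where Affine fixes e and Parabolic fixes the line of e: at each step H ⊆ H′ a Hamilton
-- connected Cayley graph of H gives one of H′. From Affine to Parabolic the cosets of H are the
-- powers of a generator that normalises H, and they are traversed one after the other. At the
-- other two steps H′ = H ∪ H s H for a generator s, so that any two cosets of H are joined by
-- edges x — s x, enough of them to run through the cosets in any given order, entering and leaving
-- each coset at different vertices. If both ends lie in one coset, the path leaves this coset at an
-- end of an edge of a Hamilton path inside it and comes back at the other end of this edge.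
--
-- The induction starts at n = 2 when q > 2. There H = Parabolic consists of the matrices
-- [[αⁱ , 0] , [αʲ x , αʲ]], which for each x form a torus ℤ/(q−1) × ℤ/(q−1); H is connected only off
-- the diagonal matrices, which still suffices for the last step. For q = 2 it starts at
-- n = 3, where the 23 Hamilton paths needed in Affine are listed. In the remaining cases n = 1,
-- and n = q = 2, the graph is a cycle or has at most two vertices.
module Submission where

open import Data.Nat.Base using (ℕ; _≥_)
open import Relation.Nullary.Negation using (¬_)
open import Defs
open import Algebra.Bundles using (CommutativeRing; Group)
import Algebra.Properties.AbelianGroup as AbelianGroupP
import Algebra.Properties.Group as GroupP
import Algebra.Properties.Ring as RingP
import Algebra.Properties.Semiring.Exp as Exp
import Algebra.Properties.Semiring.Mult.TCOptimised as MultP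
import Algebra.Properties.Semiring.Sum as Summation
import Algebra.Solver.Ring as RingSolver
import Algebra.Solver.Ring.AlmostCommutativeRing as ACR
open import Algebra.Structures using (IsGroup)
open import Data.Bool.Base using (Bool; true; false; not; if_then_else_; _xor_; _∧_; _∨_)
import Data.Bool.Properties as Bool
open import Data.Empty using (⊥; ⊥-elim)
open import Data.Fin.Base using (Fin; zero; suc; toℕ; fromℕ; fromℕ<; inject₁)
import Data.Fin.Properties as Fin
open import Data.Fin.Relation.Unary.Top using (view; ‵fromℕ; ‵inject₁)
import Data.Integer.Base as ℤ
import Data.Integer.Properties as ℤ
open import Data.List.Base using (List; []; _∷_; _++_; map; filter; cartesianProductWith; cartesianProduct; allFin)
import Data.List.Membership.Propositional.Properties as ∈P
import Data.List.Membership.Setoid as Membership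
import Data.List.Membership.Setoid.Properties as MembershipP
open import Data.List.Relation.Unary.All as All using (All; []; _∷_)
import Data.List.Relation.Unary.All.Properties as AllP
open import Data.List.Relation.Unary.AllPairs using (AllPairs; []; _∷_)
open import Data.List.Relation.Unary.Any as Any using (Any; here; there)
import Data.List.Relation.Unary.Any.Properties as AnyP
import Data.List.Relation.Unary.Unique.Setoid as UniqueS
import Data.List.Relation.Unary.Unique.Setoid.Properties as UniqueP
open import Data.Maybe.Base as Maybe using (Maybe; just; nothing)
open import Data.Nat.Base using (zero; suc; z≤n; s≤s; _<_; _>_; _≤_; _∸_; NonZero; >-nonZero) renaming (_+_ to _+ℕ_; _*_ to _*ℕ_)
open import Data.Nat.DivMod using (_%_; _/_; _mod_; m%n<n; n%n≡0; m≡m%n+[m/n]*n; m<n⇒m%n≡m)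
open import Data.Nat.Divisibility using (_∣_; ∣⇒≤; n∣m*n; ∣m+n∣m⇒∣n; m%n≡0⇒n∣m)
import Data.Nat.Properties as ℕ
open import Data.Nat.Solver using (module +-*-Solver)
open import Data.Product.Base using (∃; ∃₂; _×_; _,_; proj₁; proj₂)
import Data.Product.Properties as Product
open import Data.Sum.Base using (_⊎_; inj₁; inj₂; [_,_]′)
open import Data.Unit.Polymorphic.Base using (⊤; tt)
open import Data.Vec.Base as Vec using (Vec)
open import Function.Base using (_∘_; id)
open import Function.Bundles using (Inverse; mk⇔)
open import Level using (Level; _⊔_) renaming (suc to lsuc)
open import Relation.Binary.Bundles using (Setoid)
open import Relation.Binary.Core using (Rel)
import Relation.Binary.Definitions as B
open import Relation.Binary.Definitions using (Symmetric; tri<; tri≈; tri>)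
open import Relation.Binary.PropositionalEquality as ≡ using (_≡_; _≢_)
import Relation.Binary.Reasoning.Setoid as SetoidReasoning
import Relation.Binary.Reflection as Reflection
open import Relation.Nullary.Decidable using (Dec; yes; no; does; ¬?; map′; toWitness; _×-dec_; _⊎-dec_; _→-dec_)
open import Relation.Unary using (Pred; Decidable; _∪_)

-- Hamilton paths in Cayley graphs

-- Parity shapes the planar case. For odd q the torus ℤ/(q-1) × ℤ/(q-1) is bipartite, so a tour of
-- it must change colour, while an edge from the torus of x to that of x′ exists only at an offset i
-- - j with x′ - x = ± αⁱ⁻ʲ. The nonzero labels are therefore taken in the order x, g x, g² x, ...
-- with g = α or α⁻¹ chosen so that g - 1 is ± an odd power of α: every torus is then entered and
-- left in different colours. One such run ends only where i + j is odd and the label is, up to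
-- sign, an even power of α; inverting matrices, and visiting the torus of the end twice, give the
-- other ends.
--
-- Often two vertices have to be avoided at once, which takes three candidates. So a torus must
-- offer three exits, q - 1 ≥ 3, and q = 3 is reduced further to the three unipotent matrices.
-- Likewise two cosets must be joined by three edges, so H ∩ s⁻¹ H s needs three elements. For q = 2
-- and n = 3 it has only two at the step from Block to Affine, whence the list there.

module Paths {a ℓ r : Level} (V : Setoid a ℓ)
             (_~_ : Rel (Setoid.Carrier V) r)
             (~-resp : ∀ {x x′ y y′} → Setoid._≈_ V x x′ → Setoid._≈_ V y y′ → x ~ y → x′ ~ y′)
             (~-sym : Symmetric _~_) where
  open Setoid V
  open Membership V using (_∈_)
  open UniqueS V using (Unique)

  -- The list begins with the start itself but reaches the end only up to `≈`. Prepending is then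
  -- free, and the end moves within its class without touching the list.
  data Walk : Carrier → List Carrier → Carrier → Set (a ⊔ ℓ ⊔ r) where
    stop : ∀ {u v} → u ≈ v → Walk u (u ∷ []) v
    step : ∀ {u w v xs} → u ~ w → Walk w xs v → Walk u (u ∷ xs) v

  -- The vertex set is a predicate, not a list: pieces are glued along disjoint predicates by
  -- `join`, and `recast` then renames the union.
  record Ham {p} (P : Pred Carrier p) (u v : Carrier) : Set (a ⊔ ℓ ⊔ r ⊔ p) where
    constructor ham
    field
      {vertices} : List Carrier
      walk       : Walk u vertices v
      unique     : Unique vertices
      sound      : ∀ {z} → z ∈ vertices → P z
      complete   : ∀ {z} → P z → z ∈ vertices

  walk-start∈ : ∀ {u v xs} → Walk u xs v → u ∈ xs
  walk-start∈ (stop _)   = here refl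
  walk-start∈ (step _ _) = here refl

  walk-end∈ : ∀ {u v xs} → Walk u xs v → v ∈ xs
  walk-end∈ (stop u≈v) = here (sym u≈v)
  walk-end∈ (step _ w) = there (walk-end∈ w)

  start∈ : ∀ {p} {P : Pred Carrier p} {u v} → Ham P u v → P u
  start∈ h = Ham.sound h (walk-start∈ (Ham.walk h))

  end∈ : ∀ {p} {P : Pred Carrier p} {u v} → Ham P u v → P v
  end∈ h = Ham.sound h (walk-end∈ (Ham.walk h))

  singleton : ∀ u → Ham (_≈ u) u u
  singleton u = ham (stop refl) ([] ∷ []) (λ { (here p) → p }) here

  recast : ∀ {p q} {P : Pred Carrier p} {Q : Pred Carrier q} {u v} →
           (∀ {z} → P z → Q z) → (∀ {z} → Q z → P z) → Ham P u v → Ham Q u v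
  recast to from (ham w ! s c) = ham w ! (to ∘ s) (c ∘ from)

  walk-end : ∀ {u v v′ xs} → v ≈ v′ → Walk u xs v → Walk u xs v′
  walk-end v≈v′ (stop u≈v) = stop (trans u≈v v≈v′)
  walk-end v≈v′ (step e w) = step e (walk-end v≈v′ w)

  ends : ∀ {p} {P : Pred Carrier p} {u u′ v v′} → u ≈ u′ → v ≈ v′ → Ham P u v → Ham P u′ v′
  ends {P = P} {u} {u′} u≈u′ v≈v′ (ham (stop e) (_ ∷ _) s c) =
    ham (stop (trans (sym u≈u′) (trans e v≈v′))) ([] ∷ [])
        (λ { (here z≈) → s (here (trans z≈ (sym u≈u′))) })
        (λ pz → retarget (c pz))
    where
    retarget : ∀ {z} → z ∈ (u ∷ []) → z ∈ (u′ ∷ [])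
    retarget (here e) = here (trans e u≈u′)
  ends {P = P} {u} {u′} u≈u′ v≈v′ (ham {._ ∷ xs} (step e w) (u∉ ∷ !) s c) =
    ham (step (~-resp u≈u′ refl e) (walk-end v≈v′ w))
        (All.map (λ u≉x u′≈x → u≉x (trans u≈u′ u′≈x)) u∉ ∷ !)
        (λ { (here z≈) → s (here (trans z≈ (sym u≈u′))) ; (there z∈) → s (there z∈) })
        (λ pz → retarget (c pz))
    where
    retarget : ∀ {z} → z ∈ (u ∷ xs) → z ∈ (u′ ∷ xs)
    retarget (here e) = here (trans e u≈u′)
    retarget (there i) = there i

  walk-++ : ∀ {u p q v xs ys} → Walk u xs p → p ~ q → Walk q ys v → Walk u (xs ++ ys) v
  walk-++ (stop u≈p) e w′ = step (~-resp (sym u≈p) refl e) w′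
  walk-++ (step d w) e w′ = step d (walk-++ w e w′)

  join : ∀ {p q} {P : Pred Carrier p} {Q : Pred Carrier q} {u x y v} →
         Ham P u x → x ~ y → Ham Q y v → (∀ {z} → P z → Q z → ⊥) → Ham (P ∪ Q) u v
  join {P = P} {Q} (ham {xs} w ! s c) e (ham {ys} w′ !′ s′ c′) disjoint =
    ham (walk-++ w e w′)
        (UniqueP.++⁺ V ! !′ (λ (z∈ , z∈′) → disjoint (s z∈) (s′ z∈′)))
        (λ z∈ → [ (λ i → inj₁ (s i)) , (λ i → inj₂ (s′ i)) ]′ (MembershipP.∈-++⁻ V xs z∈))
        (λ { (inj₁ pz) → MembershipP.∈-++⁺ˡ V (c pz) ; (inj₂ qz) → MembershipP.∈-++⁺ʳ V xs (c′ qz) })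

  -- A path cut at an edge that leaves `C`. The halves are kept as bare vertex sets, which is all
  -- that `splice` needs in order to insert something between them.
  record Crossing {p c} (P : Pred Carrier p) (C : Pred Carrier c) (u v : Carrier) :
                  Set (lsuc (a ⊔ ℓ) ⊔ r ⊔ p ⊔ c) where
    field
      {last first}   : Carrier
      {Before After} : Pred Carrier (a ⊔ ℓ)
      inside   : C last
      outside  : ¬ C first
      before   : Ham Before u last
      edge     : last ~ first
      after    : Ham After first v
      disjoint : ∀ {z} → Before z → After z → ⊥
      cover    : ∀ {z} → P z → Before z ⊎ After z
      Before⊆  : ∀ {z} → Before z → P z
      After⊆   : ∀ {z} → After z → P z

  listHam : ∀ {u v xs} → Walk u xs v → Unique xs → Ham (_∈ xs) u v
  listHam w ! = ham w ! id id

  private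
    -- The path is followed as long as it stays in `C`; as some vertex lies outside, an edge leaving
    -- `C` is met before the end.
    crossingList : ∀ {c} {C : Pred Carrier c} → Decidable C →
                   (∀ {x y} → x ≈ y → C x → C y) →
                   ∀ {u v xs} → Walk u xs v → Unique xs → C u →
                   ∀ {z} → z ∈ xs → ¬ C z → Crossing (_∈ xs) C u v
    crossingList C? resp (stop _) _ Cu (here z≈u) ¬Cz = ⊥-elim (¬Cz (resp (sym z≈u) Cu))
    crossingList C? resp (step _ _) _ Cu (here z≈u) ¬Cz = ⊥-elim (¬Cz (resp (sym z≈u) Cu))
    crossingList C? resp {u} {xs = ._ ∷ xs} (step {w = w} e p) (u∉ ∷ !) Cu (there z∈) ¬Cz with C? w
    ... | no ¬Cw = record
      { inside = Cu ; outside = ¬Cw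
      ; before = listHam (stop refl) ([] ∷ []) ; edge = e ; after = listHam p !
      ; disjoint = λ { (here z≈u) z∈xs → All.lookupₛ V u∉-resp u∉ z∈xs (sym z≈u) }
      ; cover = λ { (here q) → inj₁ (here q) ; (there q) → inj₂ q }
      ; Before⊆ = λ { (here q) → here q } ; After⊆ = there }
      where
      u∉-resp : ∀ {x y} → x ≈ y → ¬ (u ≈ x) → ¬ (u ≈ y)
      u∉-resp x≈y u≉x u≈y = u≉x (trans u≈y (sym x≈y))
    ... | yes Cw = record
      { inside = inside ; outside = outside
      ; before = join (listHam (stop refl) ([] ∷ [])) e before (λ { (here z≈u) b → u∉xs (Before⊆ b) z≈u })
      ; edge = edge ; after = after
      ; disjoint = λ { (inj₁ (here z≈u)) d → u∉xs (After⊆ d) z≈u ; (inj₂ b) d → disjoint b d }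
      ; cover = λ { (here q) → inj₁ (inj₁ (here q))
                  ; (there q) → [ (λ b → inj₁ (inj₂ b)) , inj₂ ]′ (cover q) }
      ; Before⊆ = λ { (inj₁ (here q)) → here q ; (inj₂ b) → there (Before⊆ b) }
      ; After⊆ = λ d → there (After⊆ d) }
      where
      open Crossing (crossingList C? resp p ! Cw z∈ ¬Cz)
      u∉-resp : ∀ {x y} → x ≈ y → ¬ (u ≈ x) → ¬ (u ≈ y)
      u∉-resp x≈y u≉x u≈y = u≉x (trans u≈y (sym x≈y))
      u∉xs : ∀ {z} → z ∈ xs → ¬ (z ≈ u)
      u∉xs z∈xs z≈u = All.lookupₛ V u∉-resp u∉ z∈xs (sym z≈u)

  crossing : ∀ {p c} {P : Pred Carrier p} {C : Pred Carrier c} → Decidable C →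
             (∀ {x y} → x ≈ y → C x → C y) →
             ∀ {u v} → Ham P u v → C u → ∀ {z} → P z → ¬ C z → Crossing P C u v
  crossing C? resp (ham w ! s c) Cu Pz ¬Cz = record
    { inside = inside ; outside = outside ; before = before ; edge = edge ; after = after
    ; disjoint = disjoint ; cover = λ pz → cover (c pz)
    ; Before⊆ = λ b → s (Before⊆ b) ; After⊆ = λ d → s (After⊆ d) }
    where open Crossing (crossingList C? resp w ! Cu (c Pz) ¬Cz)

  -- The first edge is split off so that `Chain.sweep` can put a detour in its place.
  record Departure {p} (P : Pred Carrier p) (u v : Carrier) : Set (a ⊔ ℓ ⊔ r ⊔ p) where
    field
      {next} : Carrier
      edge   : u ~ next
      rest   : Ham (λ z → P z × ¬ (z ≈ u)) next v

  departure : ∀ {p} {P : Pred Carrier p} {u v} → Ham P u v → ¬ (u ≈ v) → Departure P u v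
  departure (ham (stop u≈v) _ _ _) u≉v = ⊥-elim (u≉v u≈v)
  departure {u = u} (ham {._ ∷ xs} (step e w) (u∉ ∷ !) s c) _ = record
    { edge = e
    ; rest = ham w ! (λ z∈ → s (there z∈) , λ z≈u → All.lookupₛ V u∉-resp u∉ z∈ (sym z≈u))
                 (λ (pz , z≉u) → drop z≉u (c pz)) }
    where
    u∉-resp : ∀ {x y} → x ≈ y → ¬ (u ≈ x) → ¬ (u ≈ y)
    u∉-resp x≈y u≉x u≈y = u≉x (trans u≈y (sym x≈y))
    drop : ∀ {z} → ¬ (z ≈ u) → z ∈ (u ∷ xs) → z ∈ xs
    drop z≉u (here q) = ⊥-elim (z≉u q)
    drop z≉u (there q) = q

  reverse : ∀ {p} {P : Pred Carrier p} {u v} → Ham P u v → Ham P v u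
  reverse (ham w ! s c) = recast s c (go w !)
    where
    go : ∀ {u v xs} → Walk u xs v → Unique xs → Ham (_∈ xs) v u
    go (stop u≈v) ! = ends u≈v refl (listHam (stop refl) !)
    go {u} {xs = ._ ∷ xs} (step e w) (u∉ ∷ !) =
      recast (λ { (inj₁ i) → there i ; (inj₂ q) → here q })
             (λ { (here q) → inj₂ q ; (there i) → inj₁ i })
             (join (go w !) (~-sym e) (singleton u)
                   (λ z∈ z≈u → All.lookupₛ V u∉-resp u∉ z∈ (sym z≈u)))
      where
      u∉-resp : ∀ {x y} → x ≈ y → ¬ (u ≈ x) → ¬ (u ≈ y)
      u∉-resp x≈y u≉x u≈y = u≉x (trans u≈y (sym x≈y))

module _ {a ℓ r a′ ℓ′ r′ : Level}
         {V : Setoid a ℓ} {_~_ : Rel (Setoid.Carrier V) r}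
         {~-resp : ∀ {x x′ y y′} → Setoid._≈_ V x x′ → Setoid._≈_ V y y′ → x ~ y → x′ ~ y′}
         {~-sym : Symmetric _~_}
         {V′ : Setoid a′ ℓ′} {_~′_ : Rel (Setoid.Carrier V′) r′}
         {~′-resp : ∀ {x x′ y y′} → Setoid._≈_ V′ x x′ → Setoid._≈_ V′ y y′ → x ~′ y → x′ ~′ y′}
         {~′-sym : Symmetric _~′_} where
  private
    module V = Setoid V
    module V′ = Setoid V′
    module G = Paths V _~_ ~-resp ~-sym
    module G′ = Paths V′ _~′_ ~′-resp ~′-sym

  -- `Q` is exactly the image of `P`, so preserving adjacency is enough. It serves twice: for right
  -- translation onto a coset, and for the block embedding of the smaller group.
  embed : ∀ {p q} {P : Pred V.Carrier p} {Q : Pred V′.Carrier q} (f : V.Carrier → V′.Carrier) →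
          (∀ {x y} → x V.≈ y → f x V′.≈ f y) →
          (∀ {x y} → f x V′.≈ f y → x V.≈ y) →
          (∀ {x y} → x ~ y → f x ~′ f y) →
          (∀ {z} → P z → Q (f z)) →
          (∀ {x y} → x V′.≈ y → Q x → Q y) →
          (∀ {z} → Q z → ∃ λ y → P y × z V′.≈ f y) →
          ∀ {u v} → G.Ham P u v → G′.Ham Q (f u) (f v)
  embed f f-cong f-inj f-adj to Q-resp from (G.ham {xs} w ! s c) =
    G′.ham (walk w) (UniqueP.map⁺ V V′ f-inj !)
      (λ z∈ → let (y , y∈ , z≈) = MembershipP.∈-map⁻ V V′ z∈ in Q-resp (V′.sym z≈) (to (s y∈)))
      (λ qz → let (y , py , z≈) = from qz in
              MembershipP.∈-resp-≈ V′ (V′.sym z≈) (MembershipP.∈-map⁺ V V′ f-cong (c py)))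
    where
    open import Data.List.Base using (map)
    walk : ∀ {u v xs} → G.Walk u xs v → G′.Walk (f u) (map f xs) (f v)
    walk (G.stop e) = G′.stop (f-cong e)
    walk (G.step e w) = G′.step (f-adj e) (walk w)

-- Free reduction of words in a group

module GroupSolver {a ℓ : Level} (𝒢 : Group a ℓ) where
  open Group 𝒢
  open GroupP 𝒢 using (⁻¹-anti-homo-∙; ⁻¹-involutive; ε⁻¹≈ε)
  open SetoidReasoning setoid

  infixl 7 _⊙_
  data Expr (n : ℕ) : Set where
    var : Fin n → Expr n
    one : Expr n
    _⊙_ : Expr n → Expr n → Expr n
    inv : Expr n → Expr n

  Word : ℕ → Set
  Word n = List (Fin n × Bool)

  ⟦_⟧ : ∀ {n} → Expr n → Vec Carrier n → Carrier
  ⟦ var i ⟧ ρ = Vec.lookup ρ i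
  ⟦ one ⟧ ρ = ε
  ⟦ x ⊙ y ⟧ ρ = ⟦ x ⟧ ρ ∙ ⟦ y ⟧ ρ
  ⟦ inv x ⟧ ρ = ⟦ x ⟧ ρ ⁻¹

  private
    power : Carrier → Bool → Carrier
    power x true = x
    power x false = x ⁻¹

    evalWord : ∀ {n} → Word n → Vec Carrier n → Carrier
    evalWord [] ρ = ε
    evalWord ((i , b) ∷ w) ρ = power (Vec.lookup ρ i) b ∙ evalWord w ρ

    push : ∀ {n} → Fin n → Bool → Word n → Word n
    push i b [] = (i , b) ∷ []
    push i b ((j , c) ∷ w) with i Fin.≟ j | b | c
    ... | yes _ | true  | false = w
    ... | yes _ | false | true  = w
    ... | _     | _     | _     = (i , b) ∷ (j , c) ∷ w

    -- The flag is `false` under an odd number of inversions, where a product is read backwards.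
    -- Writing onto an accumulator lets `push` cancel at every letter.
    prepend : ∀ {n} → Expr n → Bool → Word n → Word n
    prepend (var i) b w = push i b w
    prepend one b w = w
    prepend (x ⊙ y) true w = prepend x true (prepend y true w)
    prepend (x ⊙ y) false w = prepend y false (prepend x false w)
    prepend (inv x) b w = prepend x (not b) w

    cancelʳ : ∀ x y → y ≈ x ∙ (x ⁻¹ ∙ y)
    cancelʳ x y = sym (trans (sym (assoc _ _ _)) (trans (∙-congʳ (inverseʳ x)) (identityˡ y)))

    cancelˡ : ∀ x y → y ≈ x ⁻¹ ∙ (x ∙ y)
    cancelˡ x y = sym (trans (sym (assoc _ _ _)) (trans (∙-congʳ (inverseˡ x)) (identityˡ y)))

    push-correct : ∀ {n} (i : Fin n) b w ρ → evalWord (push i b w) ρ ≈ power (Vec.lookup ρ i) b ∙ evalWord w ρ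
    push-correct i b [] ρ = refl
    push-correct i b ((j , c) ∷ w) ρ with i Fin.≟ j | b | c
    ... | yes ≡.refl | true  | false = cancelʳ _ _
    ... | yes ≡.refl | false | true  = cancelˡ _ _
    ... | yes _ | true  | true  = refl
    ... | yes _ | false | false = refl
    ... | no _  | true  | true  = refl
    ... | no _  | true  | false = refl
    ... | no _  | false | true  = refl
    ... | no _  | false | false = refl

    power-not : ∀ x b → power x (not b) ≈ power (x ⁻¹) b
    power-not x true = refl
    power-not x false = sym (⁻¹-involutive x)

    prepend-correct : ∀ {n} (e : Expr n) b w ρ →
                      evalWord (prepend e b w) ρ ≈ power (⟦ e ⟧ ρ) b ∙ evalWord w ρ
    prepend-correct (var i) b w ρ = push-correct i b w ρ
    prepend-correct one true w ρ = sym (identityˡ _)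
    prepend-correct one false w ρ = sym (trans (∙-congʳ ε⁻¹≈ε) (identityˡ _))
    prepend-correct (x ⊙ y) true w ρ =
      trans (prepend-correct x true _ ρ)
        (trans (∙-congˡ (prepend-correct y true w ρ)) (sym (assoc _ _ _)))
    prepend-correct (x ⊙ y) false w ρ =
      trans (prepend-correct y false _ ρ)
        (trans (∙-congˡ (prepend-correct x false w ρ))
          (trans (sym (assoc _ _ _)) (∙-congʳ (sym (⁻¹-anti-homo-∙ _ _)))))
    prepend-correct (inv x) b w ρ =
      trans (prepend-correct x (not b) w ρ) (∙-congʳ (power-not (⟦ x ⟧ ρ) b))

  ⟦_⇓⟧ : ∀ {n} → Expr n → Vec Carrier n → Carrier
  ⟦ e ⇓⟧ ρ = evalWord (prepend e true []) ρ

  private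
    correct : ∀ {n} (e : Expr n) ρ → ⟦ e ⇓⟧ ρ ≈ ⟦ e ⟧ ρ
    correct e ρ = trans (prepend-correct e true [] ρ) (identityʳ _)

  open Reflection setoid var ⟦_⟧ ⟦_⇓⟧ correct public using (solve; _⊜_)

module _ {p q} {P : Pred (Fin 3) p} {Q : Pred (Fin 3) q} where

  -- Each of `P` and `Q` spoils at most one index, and there are three. This is why three candidates
  -- are provided at every choice of an exit.
  avoidTwo : Decidable P → Decidable Q →
             (∀ {i j} → i ≢ j → P i → P j → ⊥) → (∀ {i j} → i ≢ j → Q i → Q j → ⊥) →
             ∃ λ i → ¬ P i × ¬ Q i
  avoidTwo P? Q? P! Q! with P? zero ⊎-dec Q? zero | P? (suc zero) ⊎-dec Q? (suc zero)
  ... | no ¬b | _ = zero , ¬b ∘ inj₁ , ¬b ∘ inj₂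
  ... | yes _ | no ¬b = suc zero , ¬b ∘ inj₁ , ¬b ∘ inj₂
  ... | yes (inj₁ x) | yes (inj₁ y) = ⊥-elim (P! (λ ()) x y)
  ... | yes (inj₁ x) | yes (inj₂ y) = suc (suc zero) , P! (λ ()) x , Q! (λ ()) y
  ... | yes (inj₂ x) | yes (inj₁ y) = suc (suc zero) , P! (λ ()) y , Q! (λ ()) x
  ... | yes (inj₂ x) | yes (inj₂ y) = ⊥-elim (Q! (λ ()) x y)

-- Cosets in a Cayley graph, and passing from a subgroup to a larger one

module Cayley {a ℓ r : Level} (𝒢 : Group a ℓ)
              (_≟_ : B.Decidable (Group._≈_ 𝒢))
              (elements : List (Group.Carrier 𝒢))
              (listed : ∀ x → Membership._∈_ (Group.setoid 𝒢) x elements)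
              (_~_ : Rel (Group.Carrier 𝒢) r)
              (~-resp : ∀ {x x′ y y′} → Group._≈_ 𝒢 x x′ → Group._≈_ 𝒢 y y′ → x ~ y → x′ ~ y′)
              (~-sym : Symmetric _~_)
              (~-∙ʳ : ∀ {x y} z → x ~ y → Group._∙_ 𝒢 x z ~ Group._∙_ 𝒢 y z) where
  open Group 𝒢
  open Paths setoid _~_ ~-resp ~-sym public
  open GroupSolver 𝒢 using (solve; _⊜_; _⊙_; inv; one)
  open Membership setoid using (_∈_)

  record Subgroup : Set (a ⊔ lsuc ℓ) where
    field
      Mem  : Pred Carrier ℓ
      resp : ∀ {x y} → x ≈ y → Mem x → Mem y
      ε∈   : Mem ε
      ∙∈   : ∀ {x y} → Mem x → Mem y → Mem (x ∙ y)
      ⁻¹∈  : ∀ {x} → Mem x → Mem (x ⁻¹)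
      mem? : Decidable Mem

    -- Right cosets `H x`: generators multiply on the left, so right translation is an automorphism
    -- of the graph and carries `H` onto each of them.
    Same : Carrier → Carrier → Set ℓ
    Same x y = Mem (x ∙ y ⁻¹)

    same? : ∀ x y → Dec (Same x y)
    same? x y = mem? (x ∙ y ⁻¹)

    same-refl : ∀ {x} → Same x x
    same-refl {x} = resp (sym (inverseʳ x)) ε∈

    same-sym : ∀ {x y} → Same x y → Same y x
    same-sym {x} {y} p = resp (solve 2 (λ x y → inv (x ⊙ inv y) ⊜ y ⊙ inv x) refl x y) (⁻¹∈ p)

    same-trans : ∀ {x y z} → Same x y → Same y z → Same x z
    same-trans {x} {y} {z} p q =
      resp (solve 3 (λ x y z → (x ⊙ inv y) ⊙ (y ⊙ inv z) ⊜ x ⊙ inv z) refl x y z) (∙∈ p q)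

    same-resp : ∀ {x x′ y y′} → x ≈ x′ → y ≈ y′ → Same x y → Same x′ y′
    same-resp p q = resp (∙-cong p (⁻¹-cong q))

    same-reflexive : ∀ {x y} → x ≈ y → Same x y
    same-reflexive p = same-resp refl p same-refl

    left : ∀ {h x} → Mem h → Same (h ∙ x) x
    left {h} {x} p = resp (solve 2 (λ h x → h ⊜ (h ⊙ x) ⊙ inv x) refl h x) p

  open Subgroup

  trivial : Subgroup
  trivial = record
    { Mem = _≈ ε ; resp = λ p q → trans (sym p) q ; ε∈ = refl
    ; ∙∈ = λ p q → trans (∙-cong p q) (identityˡ ε)
    ; ⁻¹∈ = λ p → trans (⁻¹-cong p) (solve 0 (inv one ⊜ one) refl) ; mem? = _≟ ε }

  same-trivial : ∀ {x y} → Same trivial x y → x ≈ y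
  same-trivial {x} {y} p = trans (solve 2 (λ x y → x ⊜ (x ⊙ inv y) ⊙ y) refl x y)
                                 (trans (∙-congʳ p) (identityˡ y))

  -- Paths from `ε` suffice, since right translation moves the start anywhere. Ends in `H₀` are
  -- exempt for the sake of the diagonal matrices in dimension two; elsewhere `H₀` is trivial.
  ConnectedOff : Subgroup → Subgroup → Set _
  ConnectedOff H₀ H = ∀ {h} → Mem H h → ¬ Mem H₀ h → Ham (Mem H) ε h

  Connected : Subgroup → Set _
  Connected = ConnectedOff trivial

  generator : ∀ {s} x → ε ~ s → x ~ (s ∙ x)
  generator x e = ~-resp (identityˡ x) refl (~-∙ʳ x e)

  translate : ∀ (H : Subgroup) {u v w} → Ham (Mem H) u v →
              Ham (λ z → Same H z w) (u ∙ w) (v ∙ w)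
  translate H {w = w} = embed {V = setoid} {~-resp = ~-resp} {~-sym = ~-sym}
    {V′ = setoid} {~′-resp = ~-resp} {~′-sym = ~-sym} (_∙ w) ∙-congʳ
    (λ {x} {y} p → trans (solve 2 (λ x w → x ⊜ (x ⊙ w) ⊙ inv w) refl x w)
                         (trans (∙-congʳ p) (solve 2 (λ y w → (y ⊙ w) ⊙ inv w ⊜ y) refl y w)))
    (~-∙ʳ w) (left H) (λ p → same-resp H p refl)
    (λ {z} p → z ∙ w ⁻¹ , p , solve 2 (λ z w → z ⊜ (z ⊙ inv w) ⊙ w) refl z w)

  withinCoset : ∀ {H₀ H} → ConnectedOff H₀ H → ∀ {u v} → Same H v u → ¬ Same H₀ v u →
                Ham (λ z → Same H z u) u v
  withinCoset {H = H} hc {u} {v} v∈ v∉ =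
    ends (identityˡ u) (solve 2 (λ v u → (v ⊙ inv u) ⊙ u ⊜ v) refl v u) (translate H (hc v∈ v∉))

  -- The `κ i` lie in H ∩ s⁻¹ H s. From one edge x  -  s x between two cosets they make three edges
  -- κᵢ x  -  s κᵢ x between the same cosets, and one of these avoids two given vertices modulo
  -- `H₀`. `mover` witnesses that `s` does not send a whole coset into one coset, which is needed
  -- when both ends share a coset; `inner` covers ends that agree modulo `H₀`.
  module Join (H₀ H H′ : Subgroup)
              (H₀⊆H : ∀ {x} → Mem H₀ x → Mem H x) (H⊆H′ : ∀ {x} → Mem H x → Mem H′ x)
              (hc : ConnectedOff H₀ H)
              (s : Carrier) (ε~s : ε ~ s) (s∈H′ : Mem H′ s) (s∉H : ¬ Mem H s)
              (double : ∀ {x} → Mem H′ x → ¬ Mem H x →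
                        ∃₂ λ h h′ → Mem H h × Mem H h′ × x ≈ h ∙ s ∙ h′)
              (κ : Fin 3 → Carrier)
              (κ∈ : ∀ i → Mem H (κ i)) (κˢ∈ : ∀ i → Mem H (s ∙ κ i ∙ s ⁻¹))
              (κ-apart : ∀ {i j} → i ≢ j → ¬ Mem H₀ (κ i ∙ κ j ⁻¹))
              (κˢ-apart : ∀ {i j} → i ≢ j → ¬ Mem H₀ (s ∙ (κ i ∙ κ j ⁻¹) ∙ s ⁻¹))
              (mover : Carrier) (mover∈ : Mem H mover) (moves : ¬ Mem H (s ∙ mover ∙ s ⁻¹))
              (inner : (∀ {x} → Mem H₀ x → x ≈ ε) ⊎
                       (∀ {g} → ε ~ g → Mem H g → ¬ Mem H (s ∙ g ∙ s ⁻¹)))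
              where
    private
      module H₀ = Subgroup H₀
      module H = Subgroup H
      module H′ = Subgroup H′

    step-out : ∀ {x} → ¬ H.Same (s ∙ x) x
    step-out {x} p = s∉H (H.resp (solve 2 (λ s x → (s ⊙ x) ⊙ inv x ⊜ s) refl s x) p)

    -- Write b′ b⁻¹ = h s h′. Then every κᵢ h′ b lies in the coset of `b`, and `s` sends it to s κᵢ
    -- s⁻¹ · s h′ b, which lies in the coset of s h′ b, that is, of `b′`.
    exit : ∀ {b b′ y z} → H′.Same b′ b → ¬ H.Same b′ b → H.Same z b′ →
           ∃ λ x → H.Same x b × ¬ H₀.Same x y × H.Same (s ∙ x) b′ × ¬ H₀.Same (s ∙ x) z
    exit {b} {b′} {y} {z} b′∈ b′∉ z∈ with double b′∈ b′∉
    ... | h , h′ , h∈ , h′∈ , eq = x i , x∈ i , proj₁ (proj₂ choice) , sx∈ i , proj₂ (proj₂ choice)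
      where
      x : Fin 3 → Carrier
      x i = κ i ∙ h′ ∙ b
      x∈ : ∀ i → H.Same (x i) b
      x∈ i = H.left (H.∙∈ (κ∈ i) h′∈)
      b′-eq : b′ ≈ h ∙ s ∙ h′ ∙ b
      b′-eq = trans (solve 2 (λ c b → c ⊜ (c ⊙ inv b) ⊙ b) refl b′ b) (∙-congʳ eq)
      sx∈ : ∀ i → H.Same (s ∙ x i) b′
      sx∈ i = H.same-resp refl (sym b′-eq)
        (H.resp (solve 5 (λ s k h h′ b → (s ⊙ k ⊙ inv s) ⊙ inv h ⊜ (s ⊙ (k ⊙ h′ ⊙ b)) ⊙ inv (h ⊙ s ⊙ h′ ⊙ b))
                         refl s (κ i) h h′ b)
                (H.∙∈ (κˢ∈ i) (H.⁻¹∈ h∈)))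
      choice = avoidTwo {P = λ i → H₀.Same (x i) y} {Q = λ i → H₀.Same (s ∙ x i) z}
        (λ i → H₀.same? (x i) y) (λ i → H₀.same? (s ∙ x i) z)
        (λ {i} {j} i≢j p q → κ-apart i≢j (H₀.resp
          (solve 4 (λ k l h b → (k ⊙ h ⊙ b) ⊙ inv (l ⊙ h ⊙ b) ⊜ k ⊙ inv l) refl (κ i) (κ j) h′ b)
          (H₀.same-trans p (H₀.same-sym q))))
        (λ {i} {j} i≢j p q → κˢ-apart i≢j (H₀.resp
          (solve 5 (λ s k l h b → (s ⊙ (k ⊙ h ⊙ b)) ⊙ inv (s ⊙ (l ⊙ h ⊙ b)) ⊜ s ⊙ (k ⊙ inv l) ⊙ inv s)
                   refl s (κ i) (κ j) h′ b)
          (H₀.same-trans p (H₀.same-sym q))))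
      i = proj₁ choice

    cross : ∀ {q} {Q : Pred Carrier q} {y b x v} → H.Same y b → H.Same x b → ¬ H₀.Same x y →
            Ham Q (s ∙ x) v → (∀ {t} → Q t → ¬ H.Same t b) → Ham ((λ t → H.Same t b) ∪ Q) y v
    cross {Q = Q} {y} {b} {x} y∈ x∈ x∉ rest apart =
      join {Q = Q}
           (recast {P = λ t → H.Same t y} {Q = λ t → H.Same t b}
                   (λ p → H.same-trans p y∈) (λ p → H.same-trans p (H.same-sym y∈))
                   (withinCoset {H₀} {H} hc (H.same-trans x∈ (H.same-sym y∈)) x∉))
           (generator x ε~s) rest (λ p q → apart q p)

    -- The exit of each coset has to differ modulo `H₀` from the entry `y`, which the previous step
    -- has fixed. Only the entry to the last coset has a second constraint: it must differ from `z`.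
    tour : ∀ {c} b ms {y z} → H.Same y b →
           AllPairs (λ p q → ¬ H.Same q p) (b ∷ ms) → All (λ p → ¬ H.Same z p) (b ∷ ms) →
           All (λ p → H′.Same p c) (b ∷ ms) → H′.Same z c →
           Ham (λ t → H.Same t z ⊎ Any (H.Same t) (b ∷ ms)) y z
    tour {c} b [] {y} {z} y∈ _ (z∉ ∷ _) (b∈ ∷ _) z∈ = arrive (exit (H′.same-trans z∈ (H′.same-sym b∈)) z∉ H.same-refl)
      where
      arrive : (∃ λ x → H.Same x b × ¬ H₀.Same x y × H.Same (s ∙ x) z × ¬ H₀.Same (s ∙ x) z) →
               Ham (λ t → H.Same t z ⊎ Any (H.Same t) (b ∷ [])) y z
      arrive (x , x∈ , x∉ , sx∈ , sx∉) =
        recast {P = (λ t → H.Same t b) ∪ (λ t → H.Same t (s ∙ x))}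
          (λ { (inj₁ p) → inj₂ (here p) ; (inj₂ p) → inj₁ (H.same-trans p sx∈) })
          (λ { (inj₁ p) → inj₂ (H.same-trans p (H.same-sym sx∈)) ; (inj₂ (here p)) → inj₁ p })
          (cross {Q = λ t → H.Same t (s ∙ x)} y∈ x∈ x∉
            (withinCoset {H₀} {H} hc (H.same-sym sx∈) (λ p → sx∉ (H₀.same-sym p)))
            (λ q p → z∉ (H.same-trans (H.same-sym (H.same-trans q sx∈)) p)))
    tour {c} b (m ∷ ms) {y} {z} y∈ ((m∉ ∷ b#) ∷ ms#) (z∉ ∷ zs∉) (b∈ ∷ ms∈) z∈ =
      arrive (exit (H′.same-trans (All.head ms∈) (H′.same-sym b∈)) m∉ H.same-refl)
      where
      Q : Pred Carrier _
      Q t = H.Same t z ⊎ Any (H.Same t) (m ∷ ms)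
      apart : ∀ {t} → Q t → ¬ H.Same t b
      apart (inj₁ q) p = z∉ (H.same-trans (H.same-sym q) p)
      apart (inj₂ q) p = AllP.All¬⇒¬Any (m∉ ∷ b#) (Any.map (λ t → H.same-trans (H.same-sym t) p) q)
      arrive : (∃ λ x → H.Same x b × ¬ H₀.Same x y × H.Same (s ∙ x) m × ¬ H₀.Same (s ∙ x) m) →
               Ham (λ t → H.Same t z ⊎ Any (H.Same t) (b ∷ m ∷ ms)) y z
      arrive (x , x∈ , x∉ , sx∈ , _) =
        recast {P = (λ t → H.Same t b) ∪ Q}
          (λ { (inj₁ p) → inj₂ (here p) ; (inj₂ (inj₁ p)) → inj₁ p ; (inj₂ (inj₂ p)) → inj₂ (there p) })
          (λ { (inj₁ p) → inj₂ (inj₁ p) ; (inj₂ (here p)) → inj₁ p ; (inj₂ (there p)) → inj₂ (inj₂ p) })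
          (cross {Q = Q} y∈ x∈ x∉ (tour m ms sx∈ ms# zs∉ ms∈ z∈) apart)

    -- A transversal found greedily in the list of all elements: an element is kept when its coset
    -- meets neither `avoid` nor the choices made in the tail of the list.
    record Representatives (c : Carrier) (avoid xs : List Carrier) : Set (a ⊔ ℓ) where
      field
        {reps}  : List Carrier
        pairs   : AllPairs (λ p q → ¬ H.Same q p) reps
        within  : All (λ p → H′.Same p c) reps
        new     : All (λ p → ¬ Any (H.Same p) avoid) reps
        covers  : ∀ {t} → t ∈ xs → H′.Same t c → Any (H.Same t) avoid ⊎ Any (H.Same t) reps

    representatives : ∀ c avoid xs → Representatives c avoid xs
    representatives c avoid [] = record { pairs = [] ; within = [] ; new = [] ; covers = λ () }
    representatives c avoid (x ∷ xs) = decide (H′.same? x c) (Any.any? (H.same? x) avoid) (Any.any? (H.same? x) reps)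
      where
      open Representatives (representatives c avoid xs)
      old : (H′.Same x c → Any (H.Same x) avoid ⊎ Any (H.Same x) reps) → Representatives c avoid (x ∷ xs)
      old f = record { pairs = pairs ; within = within ; new = new
        ; covers = λ { (here t≈x) t∈ → [ (λ q → inj₁ (Any.map (H.same-resp (sym t≈x) refl) q))
                                       , (λ q → inj₂ (Any.map (H.same-resp (sym t≈x) refl) q)) ]′
                                       (f (H′.same-resp t≈x refl t∈))
                     ; (there t∈xs) t∈ → covers t∈xs t∈ } }
      decide : Dec (H′.Same x c) → Dec (Any (H.Same x) avoid) → Dec (Any (H.Same x) reps) →
               Representatives c avoid (x ∷ xs)
      decide (no x∉) _ _ = old (⊥-elim ∘ x∉)
      decide (yes _) (yes q) _ = old (λ _ → inj₁ q)
      decide (yes _) (no _) (yes q) = old (λ _ → inj₂ q)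
      decide (yes x∈) (no q) (no q′) = record
        { pairs = All.map (λ n e → n (H.same-sym e)) (AllP.¬Any⇒All¬ reps q′) ∷ pairs
        ; within = x∈ ∷ within ; new = q ∷ new
        ; covers = λ { (here t≈x) _ → inj₂ (here (H.same-reflexive t≈x))
                     ; (there t∈xs) t∈ → [ inj₁ , (λ p → inj₂ (there p)) ]′ (covers t∈xs t∈) } }

    -- The cosets of `u` and `v` come first and last, all others between them in the order in which
    -- they were found. `ex` leaves room for a coset that `splice` treats separately.
    tourAvoiding : ∀ ex {c u v} → H′.Same u c → H′.Same v c → ¬ H.Same v u →
                   ¬ Any (H.Same u) ex → ¬ Any (H.Same v) ex →
                   Ham (λ t → H′.Same t c × ¬ Any (H.Same t) ex) u v
    tourAvoiding ex {c} {u} {v} u∈ v∈ v∉u u∉ v∉ =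
      recast {P = λ t → H.Same t v ⊎ Any (H.Same t) (u ∷ reps)}
        (λ { (inj₁ p) → within′ v∈ v∉ p ; (inj₂ (here p)) → within′ u∈ u∉ p
           ; (inj₂ (there p)) → inside p within new })
        (λ {t} (t∈ , t∉) → sort t∉ (covers (listed t) t∈))
        (tour u reps H.same-refl
          (All.map (λ n e → n (here e)) new ∷ pairs)
          (v∉u ∷ All.map (λ n e → n (there (here (H.same-sym e)))) new)
          (u∈ ∷ within) v∈)
      where
      open Representatives (representatives c (u ∷ v ∷ ex) elements)
      within′ : ∀ {t w} → H′.Same w c → ¬ Any (H.Same w) ex → H.Same t w → H′.Same t c × ¬ Any (H.Same t) ex
      within′ w∈ w∉ p = H′.same-trans (H⊆H′ p) w∈ , λ q → w∉ (Any.map (H.same-trans (H.same-sym p)) q)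
      inside : ∀ {t ms} → Any (H.Same t) ms → All (λ p → H′.Same p c) ms →
               All (λ p → ¬ Any (H.Same p) (u ∷ v ∷ ex)) ms → H′.Same t c × ¬ Any (H.Same t) ex
      inside (here p) (w∈ ∷ _) (n ∷ _) = within′ w∈ (λ q → n (there (there q))) p
      inside (there p) (_ ∷ ws) (_ ∷ ns) = inside p ws ns
      sort : ∀ {t} → ¬ Any (H.Same t) ex → Any (H.Same t) (u ∷ v ∷ ex) ⊎ Any (H.Same t) reps →
             H.Same t v ⊎ Any (H.Same t) (u ∷ reps)
      sort t∉ (inj₁ (here p)) = inj₂ (here p)
      sort t∉ (inj₁ (there (here p))) = inj₁ p
      sort t∉ (inj₁ (there (there p))) = ⊥-elim (t∉ p)
      sort t∉ (inj₂ p) = inj₂ (there p)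

    private
      s∙∈ : ∀ {x u} → H′.Same x u → H′.Same (s ∙ x) u
      s∙∈ p = H′.same-trans (H′.left s∈H′) p

      leaves : ∀ {x u} → H.Same x u → ¬ Any (H.Same (s ∙ x)) (u ∷ [])
      leaves x∈ (here p) = step-out (H.same-trans p (H.same-sym x∈))

    -- The gap between `p` and `q` is filled by `s ∙ p`, a tour of all other cosets, and `s ∙ q`.
    -- Such a tour exists because these two lie in different cosets, neither of which is that of
    -- `u`.
    splice : ∀ {u p q v} (A B : Pred Carrier (a ⊔ ℓ)) → Ham A u p → Ham B q v → (∀ {t} → A t → B t → ⊥) →
             (∀ {t} → A t → H.Same t u) → (∀ {t} → B t → H.Same t u) →
             (∀ {t} → H.Same t u → A t ⊎ B t) → ¬ H.Same (s ∙ q) (s ∙ p) →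
             Ham (λ t → H′.Same t u) u v
    splice {u} {p} {q} {v} A B α β A#B A⊆ B⊆ cover p∦q =
      recast {P = A ∪ (O ∪ B)}
        (λ { (inj₁ x) → H⊆H′ (A⊆ x) ; (inj₂ (inj₁ (x , _))) → x ; (inj₂ (inj₂ x)) → H⊆H′ (B⊆ x) })
        (λ {t} x → classify x (H.same? t u))
        (join {P = A} {Q = O ∪ B} α (generator p ε~s)
          (join {P = O} {Q = B}
            (tourAvoiding (u ∷ []) (s∙∈ (H⊆H′ p∈)) (s∙∈ (H⊆H′ q∈)) p∦q (leaves p∈) (leaves q∈))
            (~-sym (generator q ε~s)) β (λ (_ , n) x → n (here (B⊆ x))))
          (λ { x (inj₁ (_ , n)) → n (here (A⊆ x)) ; x (inj₂ y) → A#B x y }))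
      where
      O : Pred Carrier _
      O t = H′.Same t u × ¬ Any (H.Same t) (u ∷ [])
      p∈ = A⊆ (end∈ α)
      q∈ = B⊆ (start∈ β)
      classify : ∀ {t} → H′.Same t u → Dec (H.Same t u) → A t ⊎ (O t ⊎ B t)
      classify x (no n) = inj₂ (inj₁ (x , λ { (here y) → n y }))
      classify x (yes y) = [ inj₁ , inj₂ ∘ inj₂ ]′ (cover y)

    -- The path inside the coset of u is cut at an edge whose ends are sent by s to different cosets.
    detour : ∀ {u v} → H.Same v u → ¬ H₀.Same v u → Ham (λ t → H′.Same t u) u v
    detour {u} {v} v∈ v∉ = cut (crossing (λ x → H.same? (s ∙ x) (s ∙ u)) (λ p → H.same-resp (∙-congˡ p) refl)
                                 (withinCoset {H₀} {H} hc v∈ v∉) H.same-refl (H.left mover∈) moved)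
      where
      exitSame : Carrier → Set ℓ
      exitSame x = H.Same (s ∙ x) (s ∙ u)
      moved : ¬ exitSame (mover ∙ u)
      moved p = moves (H.resp (solve 3 (λ s m u → (s ⊙ (m ⊙ u)) ⊙ inv (s ⊙ u) ⊜ s ⊙ m ⊙ inv s) refl s mover u) p)
      cut : Crossing (λ z → H.Same z u) exitSame u v → Ham (λ t → H′.Same t u) u v
      cut κ′ = splice Before After before after disjoint Before⊆ After⊆ cover
                      (λ e → outside (H.same-trans e inside))
        where open Crossing κ′

    -- A path from u to a vertex w which s sends to the coset of s ∙ v, but no neighbour of v, is cut before v.
    rotate : (∀ {g} → ε ~ g → H.Mem g → ¬ H.Mem (s ∙ g ∙ s ⁻¹)) →
             ∀ {u v} → H₀.Same v u → ¬ v ≈ u → Ham (λ t → H′.Same t u) u v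
    rotate far {u} {v} v∈₀ v≉u = cut (crossing (λ x → ¬? (x ≟ v)) (λ p n q → n (trans p q))
             (withinCoset {H₀} {H} hc w∈ w∉) (λ e → v≉u (sym e)) v∈ (λ n → n refl))
      where
      -- Conjugation by `s` keeps this quotient in `H`, which puts `s ∙ w` into the coset of
      -- `s ∙ v`; and it lies outside `H₀`, so that a path from `u` to `w` is available.
      k = κ zero ∙ κ (suc zero) ⁻¹
      w = k ∙ v
      v∈ : H.Same v u
      v∈ = H₀⊆H v∈₀
      w∈ : H.Same w u
      w∈ = H.same-trans (H.left (H.∙∈ (κ∈ zero) (H.⁻¹∈ (κ∈ (suc zero))))) v∈
      w∉ : ¬ H₀.Same w u
      w∉ p = κ-apart {zero} {suc zero} (λ ())
        (H₀.resp (solve 2 (λ k v → (k ⊙ v) ⊙ inv v ⊜ k) refl k v) (H₀.same-trans p (H₀.same-sym v∈₀)))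
      k∈ : H.Mem (s ∙ k ∙ s ⁻¹)
      k∈ = H.resp (solve 3 (λ s k l → (s ⊙ k ⊙ inv s) ⊙ inv (s ⊙ l ⊙ inv s) ⊜ s ⊙ (k ⊙ inv l) ⊙ inv s)
                           refl s (κ zero) (κ (suc zero)))
                  (H.∙∈ (κˢ∈ zero) (H.⁻¹∈ (κˢ∈ (suc zero))))
      sw∈ : H.Same (s ∙ w) (s ∙ v)
      sw∈ = H.resp (solve 3 (λ s k v → s ⊙ k ⊙ inv s ⊜ (s ⊙ (k ⊙ v)) ⊙ inv (s ⊙ v)) refl s k v) k∈
      -- Otherwise `s` would send `p` and `v` to the same coset, and the neighbour p v⁻¹ of `ε`
      -- would contradict `far`.
      apart : ∀ {p} → H.Same p u → p ~ v → ¬ H.Same (s ∙ w) (s ∙ p)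
      apart {p} p∈ p~v q = far (~-resp (inverseʳ v) refl (~-∙ʳ (v ⁻¹) (~-sym p~v)))
        (H.same-trans p∈ (H.same-sym v∈))
        (H.resp (solve 3 (λ s l v → (s ⊙ l) ⊙ inv (s ⊙ v) ⊜ s ⊙ (l ⊙ inv v) ⊙ inv s) refl s p v)
          (H.same-trans (H.same-sym q) sw∈))
      -- The path reads u ... p, v ... w. With its second half reversed it becomes u ... p and w ...
      -- v, to be joined through the other cosets by way of `s ∙ p` and `s ∙ w`.
      cut : Crossing (λ z → H.Same z u) (λ x → ¬ x ≈ v) u w → Ham (λ t → H′.Same t u) u v
      cut κ′ = splice Before After before (reverse (ends first≈v refl after)) disjoint Before⊆ After⊆ cover
                      (apart (Before⊆ (end∈ before)) (~-resp refl first≈v edge))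
        where
        open Crossing κ′
        first≈v : first ≈ v
        first≈v with first ≟ v
        ... | yes p = p
        ... | no n = ⊥-elim (outside n)

    connected : Connected H′
    connected {h} h∈ h≉ε = recast to-H′ from-H′ (cases (H.same? h ε) (H₀.same? h ε))
      where
      h≈ : h ∙ ε ⁻¹ ≈ h
      h≈ = solve 1 (λ h → h ⊙ inv one ⊜ h) refl h
      from-H′ : ∀ {t} → H′.Mem t → H′.Same t ε
      from-H′ {t} = H′.resp (solve 1 (λ h → h ⊜ h ⊙ inv one) refl t)
      to-H′ : ∀ {t} → H′.Same t ε → H′.Mem t
      to-H′ {t} = H′.resp (solve 1 (λ h → h ⊙ inv one ⊜ h) refl t)
      cases : Dec (H.Same h ε) → Dec (H₀.Same h ε) → Ham (λ t → H′.Same t ε) ε h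
      cases (no h∉) _ = recast proj₁ (λ p → p , λ ())
        (tourAvoiding [] H′.same-refl (from-H′ h∈) h∉ (λ ()) (λ ()))
      cases (yes h∈H) (no h∉) = detour h∈H h∉
      cases (yes _) (yes h∈₀) = [ (λ triv → ⊥-elim (h≉ε (trans (sym h≈) (triv h∈₀))))
                                              , (λ far → rotate (λ {g} → far {g}) h∈₀ h≉ε) ]′ inner

  infixl 8 _^_
  _^_ : Carrier → ℕ → Carrier
  x ^ zero = ε
  x ^ suc k = x ∙ x ^ k

  ^-shift : ∀ x k → x ^ k ∙ x ≈ x ∙ x ^ k
  ^-shift x zero = trans (identityˡ x) (sym (identityʳ x))
  ^-shift x (suc k) = trans (assoc x (x ^ k) x) (∙-congˡ (^-shift x k))

  -- Since `c` normalises `H`, every vertex x of a coset has an edge x  -  c x to the next coset.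
  -- Only the ends inside the cosets need care, and `another` lets a choice avoid two vertices.
  module Chain (H H′ : Subgroup) (H⊆H′ : ∀ {x} → Mem H x → Mem H′ x)
               (hc : Connected H)
               (another : ∀ x y → ∃ λ z → Mem H z × ¬ z ≈ x × ¬ z ≈ y)
               (c : Carrier) (ε~c : ε ~ c) (c∈H′ : Mem H′ c)
               (normal : ∀ {x} → Mem H x → Mem H (c ∙ x ∙ c ⁻¹))
               (N : ℕ) (apart : ∀ k → 0 < k → k ≤ N → ¬ Mem H (c ^ k))
               (cosets : ∀ {x} → Mem H′ x → ∃ λ k → k ≤ N × Same H x (c ^ k))
               where
    private
      module H = Subgroup H
      module H′ = Subgroup H′

    Block : ℕ → Carrier → Pred Carrier ℓ
    Block r u t = ∃ λ i → i ≤ r × H.Same t (c ^ i ∙ u)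

    same-c : ∀ {x y} → H.Same x y → H.Same (c ∙ x) (c ∙ y)
    same-c {x} {y} p = H.resp (solve 3 (λ c x y → c ⊙ (x ⊙ inv y) ⊙ inv c ⊜ (c ⊙ x) ⊙ inv (c ⊙ y)) refl c x y) (normal p)

    same-^ : ∀ k {x y} → H.Same x y → H.Same (c ^ k ∙ x) (c ^ k ∙ y)
    same-^ zero p = H.same-resp (sym (identityˡ _)) (sym (identityˡ _)) p
    same-^ (suc k) p = H.same-resp (sym (assoc c _ _)) (sym (assoc c _ _)) (same-c (same-^ k p))

    ^-∙ : ∀ i u → c ^ i ∙ (c ∙ u) ≈ c ^ suc i ∙ u
    ^-∙ i u = trans (sym (assoc _ c u)) (∙-congʳ (^-shift c i))

    block-split : ∀ {r u t} → Block (suc r) u t → H.Same t u ⊎ Block r (c ∙ u) t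
    block-split (zero , _ , p) = inj₁ (H.same-resp refl (identityˡ _) p)
    block-split {u = u} (suc i , s≤s i≤r , p) = inj₂ (i , i≤r , H.same-resp refl (sym (^-∙ i u)) p)

    block-here : ∀ {r u t} → H.Same t u → Block r u t
    block-here p = 0 , z≤n , H.same-resp refl (sym (identityˡ _)) p

    block-there : ∀ {r u t} → Block r (c ∙ u) t → Block (suc r) u t
    block-there {u = u} (i , i≤r , p) = suc i , s≤s i≤r , H.same-resp refl (^-∙ i u) p

    block-disjoint : ∀ {r u t} → suc r ≤ N → H.Same t u → ¬ Block r (c ∙ u) t
    block-disjoint {u = u} r<N p (i , i≤r , q) =
      apart (suc i) (s≤s z≤n) (ℕ.≤-trans (s≤s i≤r) r<N)
        (H.resp (solve 2 (λ x u → (x ⊙ u) ⊙ inv u ⊜ x) refl (c ^ suc i) u)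
          (H.same-trans (H.same-resp (^-∙ i u) refl (H.same-sym q)) p))

    block-cong : ∀ {r u u′ t} → H.Same u u′ → Block r u t → Block r u′ t
    block-cong p (i , i≤r , q) = i , i≤r , H.same-trans q (same-^ i p)

    -- Both ends lie in the lowest coset. The first edge u  -  b of a path inside it is replaced by
    -- u  -  c u ... c b  -  b, where the dots sweep the cosets above by recursion.
    sweep : ∀ r {u v} → r ≤ N → H.Same v u → ¬ u ≈ v → Ham (Block r u) u v
    sweep zero {u} {v} _ v∈ u≉v = recast {P = λ t → H.Same t u} block-here
      (λ { (zero , _ , p) → H.same-resp refl (identityˡ _) p })
      (withinCoset {trivial} {H} hc v∈ (λ p → u≉v (sym (same-trivial p))))
    sweep (suc r) {u} {v} r<N v∈ u≉v = detour
      (departure (withinCoset {trivial} {H} hc v∈ (λ p → u≉v (sym (same-trivial p)))) u≉v)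
      where
      detour : Departure (λ t → H.Same t u) u v → Ham (Block (suc r) u) u v
      detour d = recast {P = (_≈ u) ∪ (Block r (c ∙ u) ∪ R)}
        (λ { (inj₁ p) → block-here (H.same-reflexive p) ; (inj₂ (inj₁ p)) → block-there p
           ; (inj₂ (inj₂ (p , _))) → block-here p })
        (λ {t} p → [ (λ q → sort q (t ≟ u)) , (λ q → inj₂ (inj₁ q)) ]′ (block-split p))
        (join {Q = Block r (c ∙ u) ∪ R} (singleton u) (generator u ε~c)
          (join {Q = R} (sweep r (ℕ.<⇒≤ r<N) (same-c b∈) cu≉cb) (~-sym (generator next ε~c)) rest
            (λ p (q , _) → block-disjoint r<N q p))
          (λ { p (inj₁ q) → block-disjoint r<N (H.same-reflexive p) q ; p (inj₂ (_ , n)) → n p }))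
        where
        open Departure d
        R : Pred Carrier _
        R t = H.Same t u × ¬ (t ≈ u)
        b∈ = proj₁ (start∈ rest)
        cu≉cb : ¬ c ∙ u ≈ c ∙ next
        cu≉cb p = proj₂ (start∈ rest) (trans (solve 2 (λ c b → b ⊜ inv c ⊙ (c ⊙ b)) refl c next)
          (trans (∙-congˡ (sym p)) (solve 2 (λ c b → inv c ⊙ (c ⊙ b) ⊜ b) refl c u)))
        sort : ∀ {t} → H.Same t u → Dec (t ≈ u) → (t ≈ u) ⊎ (Block r (c ∙ u) t ⊎ R t)
        sort _ (yes q) = inj₁ q
        sort p (no n) = inj₂ (inj₂ (p , n))

    -- The cosets below that of `v` are finished one by one. From the coset of `v` on, `sweep` takes
    -- in the cosets above and returns.
    climb : ∀ j r {u v} → j ≤ r → r ≤ N → H.Same v (c ^ j ∙ u) → ¬ u ≈ v → Ham (Block r u) u v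
    climb zero r _ r≤N v∈ u≉v = sweep r r≤N (H.same-resp refl (identityˡ _) v∈) u≉v
    climb (suc j) (suc r) {u} {v} (s≤s j≤r) r<N v∈ u≉v
      -- The first condition makes z u a possible exit from the coset of `u`, the second makes the
      -- entry c z u of the next coset different from `v`.
      with another ε (c ⁻¹ ∙ v ∙ u ⁻¹)
    ... | z , z∈ , z≉ε , z≉ = recast {P = (λ t → H.Same t u) ∪ Block r (c ∙ x)}
        (λ { (inj₁ p) → block-here p ; (inj₂ p) → block-there (block-cong (same-c x∈) p) })
        (λ p → [ inj₁ , (λ q → inj₂ (block-cong (same-c (H.same-sym x∈)) q)) ]′ (block-split p))
        (join {P = λ t → H.Same t u} {Q = Block r (c ∙ x)}
          (withinCoset {trivial} {H} hc x∈ (λ p → z≉ε (trans (solve 2 (λ z u → z ⊜ (z ⊙ u) ⊙ inv u) refl z u)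
             (trans (∙-congʳ (same-trivial p)) (inverseʳ u)))))
          (generator x ε~c)
          (climb j r j≤r (ℕ.<⇒≤ r<N)
            (H.same-trans v∈ (H.same-resp (^-∙ j u) refl (same-^ j (same-c (H.same-sym x∈)))))
            (λ p → z≉ (trans (solve 3 (λ z c u → z ⊜ inv c ⊙ (c ⊙ (z ⊙ u)) ⊙ inv u) refl z c u)
                              (∙-congʳ (∙-congˡ p)))))
          (λ p q → block-disjoint r<N p (block-cong (same-c x∈) q)))
      where
      x = z ∙ u
      x∈ : H.Same x u
      x∈ = H.left z∈

    c^∈ : ∀ k → H′.Mem (c ^ k)
    c^∈ zero = H′.ε∈
    c^∈ (suc k) = H′.∙∈ c∈H′ (c^∈ k)

    connected : Connected H′
    connected {h} h∈ h≉ε = recast {P = Block N ε} to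
      (λ {t} p → let (i , i≤N , q) = cosets p in i , i≤N , H.same-resp refl (sym (identityʳ _)) q)
      (climb k N k≤N ℕ.≤-refl (H.same-resp refl (sym (identityʳ _)) h≈) (λ p → h≉ε (sym p)))
      where
      k = proj₁ (cosets h∈)
      k≤N = proj₁ (proj₂ (cosets h∈))
      h≈ = proj₂ (proj₂ (cosets h∈))
      to : ∀ {t} → Block N ε t → H′.Mem t
      to {t} (i , _ , p) = H′.resp (solve 2 (λ t x → (t ⊙ inv (x ⊙ one)) ⊙ x ⊜ t) refl t (c ^ i))
                             (H′.∙∈ (H⊆H′ p) (c^∈ i))

  -- The usual case: `ε`, `k₁`, `k₂` are the three elements. A conjugate is trivial only if the
  -- element is, so distinctness alone gives both separation conditions.
  module JoinTrivial (H H′ : Subgroup) (H⊆H′ : ∀ {x} → Mem H x → Mem H′ x) (hc : Connected H)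
              (s : Carrier) (ε~s : ε ~ s) (s∈H′ : Mem H′ s) (s∉H : ¬ Mem H s)
              (double : ∀ {x} → Mem H′ x → ¬ Mem H x →
                        ∃₂ λ h h′ → Mem H h × Mem H h′ × x ≈ h ∙ s ∙ h′)
              (k₁ k₂ : Carrier) (k₁≉ε : ¬ k₁ ≈ ε) (k₂≉ε : ¬ k₂ ≈ ε) (k₁≉k₂ : ¬ k₁ ≈ k₂)
              (k₁∈ : Mem H k₁) (k₂∈ : Mem H k₂)
              (k₁ˢ∈ : Mem H (s ∙ k₁ ∙ s ⁻¹)) (k₂ˢ∈ : Mem H (s ∙ k₂ ∙ s ⁻¹))
              (mover : Carrier) (mover∈ : Mem H mover) (moves : ¬ Mem H (s ∙ mover ∙ s ⁻¹))
              where
    private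
      κ : Fin 3 → Carrier
      κ zero = ε
      κ (suc zero) = k₁
      κ (suc (suc zero)) = k₂

      κ-injective : ∀ i j → i ≢ j → ¬ κ i ≈ κ j
      κ-injective zero zero n _ = n ≡.refl
      κ-injective zero (suc zero) _ e = k₁≉ε (sym e)
      κ-injective zero (suc (suc zero)) _ e = k₂≉ε (sym e)
      κ-injective (suc zero) zero _ e = k₁≉ε e
      κ-injective (suc zero) (suc zero) n _ = n ≡.refl
      κ-injective (suc zero) (suc (suc zero)) _ e = k₁≉k₂ e
      κ-injective (suc (suc zero)) zero _ e = k₂≉ε e
      κ-injective (suc (suc zero)) (suc zero) _ e = k₁≉k₂ (sym e)
      κ-injective (suc (suc zero)) (suc (suc zero)) n _ = n ≡.refl

      apart : ∀ {i j} → i ≢ j → ¬ κ i ∙ κ j ⁻¹ ≈ ε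
      apart {i} {j} n e = κ-injective i j n (same-trivial e)

    connected : Connected H′
    connected = Join.connected trivial H H′ (λ e → resp H (sym e) (ε∈ H)) H⊆H′ hc s ε~s s∈H′ s∉H double κ
      (λ { zero → ε∈ H ; (suc zero) → k₁∈ ; (suc (suc zero)) → k₂∈ })
      (λ { zero → resp H (solve 1 (λ s → one ⊜ s ⊙ one ⊙ inv s) refl s) (ε∈ H) ; (suc zero) → k₁ˢ∈ ; (suc (suc zero)) → k₂ˢ∈ })
      apart
      (λ {i} {j} n e → apart n (trans (solve 2 (λ s k → k ⊜ inv s ⊙ (s ⊙ k ⊙ inv s) ⊙ s) refl s (κ i ∙ κ j ⁻¹))
        (trans (∙-congʳ (∙-congˡ e)) (solve 1 (λ s → inv s ⊙ one ⊙ s ⊜ one) refl s))))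
      mover mover∈ moves (inj₁ id)

-- Tours of a torus

odd : ℕ → Bool
odd zero = false
odd (suc n) = not (odd n)

odd-+ : ∀ m n → odd (m +ℕ n) ≡ odd m xor odd n
odd-+ zero n = ≡.refl
odd-+ (suc m) n = ≡.trans (≡.cong not (odd-+ m n)) (not-xor (odd m) (odd n))
  where
  not-xor : ∀ a b → not (a xor b) ≡ not a xor b
  not-xor true true = ≡.refl
  not-xor true false = ≡.refl
  not-xor false b = ≡.refl

odd-double : ∀ k → odd (k +ℕ k) ≡ false
odd-double k = ≡.trans (odd-+ k k) (self (odd k))
  where
  self : ∀ a → a xor a ≡ false
  self true = ≡.refl
  self false = ≡.refl

odd-* : ∀ m n → odd (m *ℕ n) ≡ odd m ∧ odd n
odd-* zero n = ≡.refl
odd-* (suc m) n = ≡.trans (odd-+ n (m *ℕ n)) (≡.trans (≡.cong (odd n xor_) (odd-* m n)) (lemma (odd m) (odd n)))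
  where
  lemma : ∀ a b → b xor (a ∧ b) ≡ not a ∧ b
  lemma true true = ≡.refl
  lemma true false = ≡.refl
  lemma false true = ≡.refl
  lemma false false = ≡.refl

half : ∀ n → (odd n ≡ false × ∃ λ k → n ≡ k +ℕ k) ⊎ (odd n ≡ true × ∃ λ k → n ≡ suc (k +ℕ k))
half zero = inj₁ (≡.refl , 0 , ≡.refl)
half (suc n) with half n
... | inj₁ (p , k , q) = inj₂ (≡.cong not p , k , ≡.cong suc q)
... | inj₂ (p , k , q) = inj₁ (≡.cong not p , suc k , ≡.cong suc (≡.trans q (≡.sym (ℕ.+-suc k k))))

odd⇒ : ∀ {n} → odd n ≡ true → ∃ λ k → n ≡ suc (k +ℕ k)
odd⇒ {n} p with half n
... | inj₂ (_ , q) = q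
... | inj₁ (q , _) with ≡.trans (≡.sym p) q
... | ()

xor-false : ∀ a → a ≡ a xor false
xor-false true = ≡.refl
xor-false false = ≡.refl

-- Used with the parities of k, i, j where k + i + 1 is the odd side of a torus: if i + 1 + j is
-- even, then k + j is odd.
xor-lemma : ∀ a b c → not (a xor b) ≡ true → not (b xor c) ≡ false → a xor c ≡ true
xor-lemma true true false _ _ = ≡.refl
xor-lemma false false true _ _ = ≡.refl

module Tori {a ℓ r : Level} (𝒢 : Group a ℓ)
              (_≟_ : B.Decidable (Group._≈_ 𝒢))
              (elements : List (Group.Carrier 𝒢))
              (listed : ∀ x → Membership._∈_ (Group.setoid 𝒢) x elements)
              (_~_ : Rel (Group.Carrier 𝒢) r)
              (~-resp : ∀ {x x′ y y′} → Group._≈_ 𝒢 x x′ → Group._≈_ 𝒢 y y′ → x ~ y → x′ ~ y′)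
              (~-sym : Symmetric _~_)
              (~-∙ʳ : ∀ {x y} z → x ~ y → Group._∙_ 𝒢 x z ~ Group._∙_ 𝒢 y z) where
  open Group 𝒢
  open Cayley 𝒢 _≟_ elements listed _~_ ~-resp ~-sym ~-∙ʳ
  open GroupSolver 𝒢 using (solve; _⊜_; _⊙_; inv; one)
  open SetoidReasoning setoid

  ^-+ : ∀ x i j → x ^ (i +ℕ j) ≈ x ^ i ∙ x ^ j
  ^-+ x zero j = sym (identityˡ _)
  ^-+ x (suc i) j = trans (∙-congˡ (^-+ x i j)) (sym (assoc x _ _))

  ^-cong : ∀ i {x y} → x ≈ y → x ^ i ≈ y ^ i
  ^-cong zero p = refl
  ^-cong (suc i) p = ∙-cong p (^-cong i p)

  ε^ : ∀ i → ε ^ i ≈ ε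
  ε^ zero = refl
  ε^ (suc i) = trans (identityˡ _) (ε^ i)

  ^-* : ∀ x i j → x ^ (i *ℕ j) ≈ (x ^ j) ^ i
  ^-* x zero j = refl
  ^-* x (suc i) j = trans (^-+ x j (i *ℕ j)) (∙-congˡ (^-* x i j))

  ^-1 : ∀ x → x ^ 1 ≈ x
  ^-1 x = identityʳ x

  commute-^ : ∀ {x y} j → x ∙ y ≈ y ∙ x → x ∙ y ^ j ≈ y ^ j ∙ x
  commute-^ zero c = trans (identityʳ _) (sym (identityˡ _))
  commute-^ {x} {y} (suc j) c = begin
    x ∙ (y ∙ y ^ j)   ≈⟨ assoc x y _ ⟨
    (x ∙ y) ∙ y ^ j   ≈⟨ ∙-congʳ c ⟩
    (y ∙ x) ∙ y ^ j   ≈⟨ assoc y x _ ⟩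
    y ∙ (x ∙ y ^ j)   ≈⟨ ∙-congˡ (commute-^ j c) ⟩
    y ∙ (y ^ j ∙ x)   ≈⟨ assoc y _ x ⟨
    (y ∙ y ^ j) ∙ x   ∎

  commute-^^ : ∀ {x y} i j → x ∙ y ≈ y ∙ x → x ^ i ∙ y ^ j ≈ y ^ j ∙ x ^ i
  commute-^^ i j c = sym (commute-^ i (sym (commute-^ j c)))

  inverse-^ : ∀ x b → (x ⁻¹) ^ b ∙ x ^ b ≈ ε
  inverse-^ x zero = identityˡ ε
  inverse-^ x (suc b) = begin
    x ⁻¹ ∙ x ⁻¹ ^ b ∙ (x ∙ x ^ b)   ≈⟨ ∙-congʳ (sym (^-shift (x ⁻¹) b)) ⟩
    x ⁻¹ ^ b ∙ x ⁻¹ ∙ (x ∙ x ^ b)   ≈⟨ solve 3 (λ u x v → (u ⊙ inv x) ⊙ (x ⊙ v) ⊜ u ⊙ v) refl _ x _ ⟩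
    x ⁻¹ ^ b ∙ x ^ b                ≈⟨ inverse-^ x b ⟩
    ε                               ∎

  commute-⁻¹ : ∀ {x y} → x ∙ y ≈ y ∙ x → x ⁻¹ ∙ y ≈ y ∙ x ⁻¹
  commute-⁻¹ {x} {y} c = begin
    x ⁻¹ ∙ y                 ≈⟨ solve 2 (λ x y → inv x ⊙ y ⊜ inv x ⊙ (y ⊙ x) ⊙ inv x) refl x y ⟩
    x ⁻¹ ∙ (y ∙ x) ∙ x ⁻¹    ≈⟨ ∙-congʳ (∙-congˡ (sym c)) ⟩
    x ⁻¹ ∙ (x ∙ y) ∙ x ⁻¹    ≈⟨ solve 2 (λ x y → inv x ⊙ (x ⊙ y) ⊙ inv x ⊜ y ⊙ inv x) refl x y ⟩
    y ∙ x ⁻¹                 ∎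

  -- Commuting generators x and y spanning a copy of ℤ/(suc p) × ℤ/(suc p).
  record Torus (p : ℕ) (x y : Carrier) : Set (a ⊔ ℓ ⊔ r) where
    field
      ε~x  : ε ~ x
      ε~y  : ε ~ y
      comm : x ∙ y ≈ y ∙ x
      x^m  : x ^ suc p ≈ ε
      y^m  : y ^ suc p ≈ ε
      free : ∀ i j → x ^ i ∙ y ^ j ≈ ε → suc p ∣ i × suc p ∣ j

    x^* : ∀ k → x ^ (k *ℕ suc p) ≈ ε
    x^* k = trans (^-* x k (suc p)) (trans (^-cong k x^m) (ε^ k))

    x^% : ∀ i → x ^ i ≈ x ^ (i % suc p)
    x^% i = begin
      x ^ i                                        ≡⟨ ≡.cong (x ^_) (m≡m%n+[m/n]*n i (suc p)) ⟩
      x ^ (i % suc p +ℕ (i / suc p) *ℕ suc p)        ≈⟨ ^-+ x (i % suc p) _ ⟩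
      x ^ (i % suc p) ∙ x ^ ((i / suc p) *ℕ suc p)  ≈⟨ ∙-congˡ (x^* (i / suc p)) ⟩
      x ^ (i % suc p) ∙ ε                          ≈⟨ identityʳ _ ⟩
      x ^ (i % suc p)                              ∎

    x⁻¹≈ : x ⁻¹ ≈ x ^ p
    x⁻¹≈ = begin
      x ⁻¹                ≈⟨ identityʳ _ ⟨
      x ⁻¹ ∙ ε            ≈⟨ ∙-congˡ x^m ⟨
      x ⁻¹ ∙ (x ∙ x ^ p)  ≈⟨ solve 2 (λ x y → inv x ⊙ (x ⊙ y) ⊜ y) refl x (x ^ p) ⟩
      x ^ p               ∎

    x⁻¹^ : ∀ i → x ⁻¹ ^ i ≈ x ^ (i *ℕ p)
    x⁻¹^ i = trans (^-cong i x⁻¹≈) (sym (^-* x i p))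

    ε~x⁻¹ : ε ~ (x ⁻¹)
    ε~x⁻¹ = ~-sym (~-resp (identityˡ _) (inverseʳ x) (~-∙ʳ (x ⁻¹) ε~x))

    swap : Torus p y x
    swap = record { ε~x = ε~y ; ε~y = ε~x ; comm = sym comm ; x^m = y^m ; y^m = x^m
      ; free = λ i j e → let (u , v) = free j i (trans (commute-^^ j i comm) e) in v , u }

    -- Powers of `x ⁻¹` are the powers of `x` with exponents i p, as p ≡ -1 modulo `suc p`; for the
    -- same reason `suc p` divides i p only if it divides i.
    flip : Torus p (x ⁻¹) y
    flip = record { ε~x = ε~x⁻¹ ; ε~y = ε~y ; comm = commute-⁻¹ comm
      ; x^m = trans (x⁻¹^ (suc p)) (trans (reflexive (≡.cong (x ^_) (ℕ.*-comm (suc p) p))) (x^* p)) ; y^m = y^m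
      ; free = λ i j e → let (u , v) = free (i *ℕ p) j (trans (∙-congʳ (sym (x⁻¹^ i))) e) in unfactor i u , v }
      where
      unfactor : ∀ i → suc p ∣ i *ℕ p → suc p ∣ i
      unfactor i u = ∣m+n∣m⇒∣n (≡.subst (suc p ∣_) (≡.trans (≡.cong (i *ℕ_) (ℕ.+-comm 1 p))
                       (≡.trans (ℕ.*-distribˡ-+ i p 1) (≡.cong (i *ℕ p +ℕ_) (ℕ.*-identityʳ i)))) (n∣m*n i)) u

  open Torus

  Row : Carrier → Carrier → Pred Carrier ℓ
  Row x X t = ∃ λ i → t ≈ x ^ i ∙ X

  Rows : ℕ → Carrier → Carrier → Carrier → Pred Carrier ℓ
  Rows K x y X t = ∃₂ λ i j → j < K × t ≈ x ^ i ∙ (y ^ j ∙ X)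

  toRows : ∀ {K x y X t} j → j < K → Row x (y ^ j ∙ X) t → Rows K x y X t
  toRows j j<K (i , e) = i , j , j<K , e

  module _ {p : ℕ} where

    ¬∣< : ∀ {k} → 0 < k → k < suc p → ¬ suc p ∣ k
    ¬∣< {suc k} _ k<m m∣k = ℕ.<⇒≱ k<m (∣⇒≤ m∣k)

    arc : ∀ {x y} (T : Torus p x y) k X → k < suc p → Ham (λ t → ∃ λ i → i ≤ k × t ≈ x ^ i ∙ X) X (x ^ k ∙ X)
    arc {x} T zero X _ = ends refl (sym (identityˡ X))
      (recast (λ e → 0 , z≤n , trans e (sym (identityˡ X))) (λ { (zero , _ , e) → trans e (identityˡ X) }) (singleton X))
    arc {x} T (suc k) X k<m = recast {P = (_≈ X) ∪ A}
      (λ { (inj₁ e) → 0 , z≤n , trans e (sym (identityˡ X))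
         ; (inj₂ (i , i≤k , e)) → suc i , s≤s i≤k , trans e (shift i) })
      (λ { (zero , _ , e) → inj₁ (trans e (identityˡ X))
         ; (suc i , s≤s i≤k , e) → inj₂ (i , i≤k , trans e (sym (shift i))) })
      (join {Q = A} (singleton X) (generator X (ε~x T))
        (ends refl (shift k) (arc T k (x ∙ X) (ℕ.<-trans (ℕ.n<1+n k) k<m)))
        (λ { {t} e (i , i≤k , e′) → ¬∣< (s≤s z≤n) (ℕ.≤-<-trans (s≤s i≤k) k<m) (proj₁ (free T (suc i) 0 (begin
          x ^ suc i ∙ ε                ≈⟨ solve 2 (λ a X → a ⊙ one ⊜ (a ⊙ X) ⊙ inv X) refl (x ^ suc i) X ⟩
          x ^ suc i ∙ X ∙ X ⁻¹         ≈⟨ ∙-congʳ (trans (sym (shift i)) (trans (sym e′) e)) ⟩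
          X ∙ X ⁻¹                     ≈⟨ inverseʳ X ⟩
          ε                            ∎))) }))
      where
      A : Pred Carrier ℓ
      A t = ∃ λ i → i ≤ k × t ≈ x ^ i ∙ (x ∙ X)
      shift : ∀ i → x ^ i ∙ (x ∙ X) ≈ x ^ suc i ∙ X
      shift i = trans (sym (assoc _ x X)) (∙-congʳ (^-shift x i))

    reduce : ∀ {x y} → Torus p x y → ∀ {X t} → Row x X t → ∃ λ i → i < suc p × t ≈ x ^ i ∙ X
    reduce T (i , e) = i % suc p , m%n<n i (suc p) , trans e (∙-congʳ (x^% T i))

    row : ∀ {x y} → Torus p x y → ∀ X → Ham (Row x X) X (x ⁻¹ ∙ X)
    row {x} T X = ends refl (∙-congʳ (sym (x⁻¹≈ T)))
      (recast (λ (i , _ , e) → i , e) (λ q → let (i , i<m , e) = reduce T q in i , ℕ.≤-pred i<m , e)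
        (arc T p X (ℕ.n<1+n p)))

    row-flip : ∀ {x y} → Torus p x y → ∀ {X t} → Row (x ⁻¹) X t → Row x X t
    row-flip T (i , e) = i *ℕ p , trans e (∙-congʳ (x⁻¹^ T i))

    row-unflip : ∀ {x y} → Torus p x y → ∀ {X t} → Row x X t → Row (x ⁻¹) X t
    row-unflip {x} T (i , e) = let (j , e′) = row-flip (flip T) (i , trans e (∙-congʳ (^-cong i (sym (inv² x))))) in j , e′
      where
      inv² : ∀ x → x ⁻¹ ⁻¹ ≈ x
      inv² = solve 1 (λ x → inv (inv x) ⊜ x) refl

    row⁺ : ∀ {x y} → Torus p x y → ∀ X → Ham (Row x X) X (x ∙ X)
    row⁺ {x} T X = ends refl (∙-congʳ (solve 1 (λ x → inv (inv x) ⊜ x) refl x))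
                     (recast (row-flip T) (row-unflip T) (row (flip T) X))

    rows-flip : ∀ {K x y} → Torus p x y → ∀ {X t} → Rows K (x ⁻¹) y X t → Rows K x y X t
    rows-flip T (i , j , j<K , e) = toRows j j<K (row-flip T (i , e))

    rows-unflip : ∀ {K x y} → Torus p x y → ∀ {X t} → Rows K x y X t → Rows K (x ⁻¹) y X t
    rows-unflip T (i , j , j<K , e) = toRows j j<K (row-unflip T (i , e))

    -- `b` is the horizontal shift at which the rows above are entered; as a set these rows do not
    -- depend on it.
    rows-suc : ∀ {K x y} → Torus p x y → ∀ b {X t} → Rows K x y (y ∙ (x ^ b ∙ X)) t → Rows (suc K) x y X t
    rows-suc {K} {x} {y} T b {X} (i , j , j<K , e) = i +ℕ b , suc j , s≤s j<K , trans e (begin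
      x ^ i ∙ (y ^ j ∙ (y ∙ (x ^ b ∙ X)))   ≈⟨ ∙-congˡ (solve 4 (λ u y z X → u ⊙ (y ⊙ (z ⊙ X)) ⊜ (u ⊙ y) ⊙ z ⊙ X) refl _ _ _ _) ⟩
      x ^ i ∙ (y ^ j ∙ y ∙ x ^ b ∙ X)       ≈⟨ ∙-congˡ (∙-congʳ (trans (∙-congʳ (^-shift y j)) (sym (commute-^^ b (suc j) (comm T))))) ⟩
      x ^ i ∙ (x ^ b ∙ y ^ suc j ∙ X)       ≈⟨ solve 4 (λ u y z X → u ⊙ ((y ⊙ z) ⊙ X) ⊜ (u ⊙ y) ⊙ (z ⊙ X)) refl _ _ _ _ ⟩
      x ^ i ∙ x ^ b ∙ (y ^ suc j ∙ X)       ≈⟨ ∙-congʳ (sym (^-+ x i b)) ⟩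
      x ^ (i +ℕ b) ∙ (y ^ suc j ∙ X)         ∎)

    rows-split : ∀ {K x y} → Torus p x y → ∀ b {X t} → Rows (suc K) x y X t →
                 Row x X t ⊎ Rows K x y (y ∙ (x ^ b ∙ X)) t
    rows-split T b (i , zero , _ , e) = inj₁ (i , trans e (∙-congˡ (identityˡ _)))
    rows-split {x = x} {y} T b {X} (i , suc j , s≤s j<K , e) = inj₂ (i +ℕ b *ℕ p , j , j<K , trans e (sym (begin
      x ^ (i +ℕ b *ℕ p) ∙ (y ^ j ∙ (y ∙ (x ^ b ∙ X)))
        ≈⟨ ∙-cong (^-+ x i (b *ℕ p)) (solve 4 (λ u y z X → u ⊙ (y ⊙ (z ⊙ X)) ⊜ (u ⊙ y) ⊙ z ⊙ X) refl _ _ _ _) ⟩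
      x ^ i ∙ x ^ (b *ℕ p) ∙ (y ^ j ∙ y ∙ x ^ b ∙ X)
        ≈⟨ ∙-congˡ (∙-congʳ (trans (∙-congʳ (^-shift y j)) (sym (commute-^^ b (suc j) (comm T))))) ⟩
      x ^ i ∙ x ^ (b *ℕ p) ∙ (x ^ b ∙ y ^ suc j ∙ X)
        ≈⟨ solve 5 (λ u v w z X → (u ⊙ v) ⊙ ((w ⊙ z) ⊙ X) ⊜ u ⊙ (v ⊙ w) ⊙ (z ⊙ X)) refl _ _ _ _ _ ⟩
      x ^ i ∙ (x ^ (b *ℕ p) ∙ x ^ b) ∙ (y ^ suc j ∙ X)
        ≈⟨ ∙-congʳ (∙-congˡ (trans (∙-congʳ (sym (x⁻¹^ T b))) (inverse-^ x b))) ⟩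
      x ^ i ∙ ε ∙ (y ^ suc j ∙ X)                    ≈⟨ ∙-congʳ (identityʳ _) ⟩
      x ^ i ∙ (y ^ suc j ∙ X)                        ∎)))

    -- Moving xⁱ to the other side, as the exponent i p, leaves a relation between powers of `x` and
    -- `y`, and freeness applies.
    clash : ∀ {x y} → Torus p x y → ∀ i i′ j {X} → x ^ i ∙ X ≈ x ^ i′ ∙ (y ^ j ∙ X) → suc p ∣ j
    clash {x} {y} T i i′ j {X} e = proj₂ (free T (i *ℕ p +ℕ i′) j (begin
      x ^ (i *ℕ p +ℕ i′) ∙ y ^ j                      ≈⟨ ∙-congʳ (^-+ x (i *ℕ p) i′) ⟩
      x ^ (i *ℕ p) ∙ x ^ i′ ∙ y ^ j                  ≈⟨ solve 4 (λ u v w X → (u ⊙ v) ⊙ w ⊜ u ⊙ (v ⊙ (w ⊙ X)) ⊙ inv X) refl _ _ _ X ⟩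
      x ^ (i *ℕ p) ∙ (x ^ i′ ∙ (y ^ j ∙ X)) ∙ X ⁻¹   ≈⟨ ∙-congʳ (∙-congˡ (sym e)) ⟩
      x ^ (i *ℕ p) ∙ (x ^ i ∙ X) ∙ X ⁻¹              ≈⟨ solve 3 (λ u v X → u ⊙ (v ⊙ X) ⊙ inv X ⊜ u ⊙ v) refl _ _ X ⟩
      x ^ (i *ℕ p) ∙ x ^ i                           ≈⟨ ∙-congʳ (x⁻¹^ T i) ⟨
      x ⁻¹ ^ i ∙ x ^ i                              ≈⟨ inverse-^ x i ⟩
      ε                                             ∎))

    rows-disjoint : ∀ {K x y} → Torus p x y → K < suc p → ∀ b {X t} →
                    Row x X t → ¬ Rows K x y (y ∙ (x ^ b ∙ X)) t
    rows-disjoint T K<m b (i , e) (i′ , j , j<K , e′) = ¬∣< (s≤s z≤n) (ℕ.≤-<-trans j<K K<m)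
      (clash T i (i′ +ℕ b) (suc j) (trans (sym e) (proj₂ (proj₂ (proj₂ (rows-suc T b (i′ , j , j<K , e′)))))))

    ups : ∀ {x y} → Torus p x y → ∀ X → X ~ (y ∙ X)
    ups T X = generator X (ε~y T)

  -- The side is at least two, so that `x ∙ X` and `x ⁻¹ ∙ X` differ from `X`; for side two they
  -- coincide and the path is a single vertex.
  rowRest : ∀ {o x y} → Torus (suc o) x y → ∀ X → Ham (λ t → Row x X t × ¬ t ≈ X) (x ∙ X) (x ⁻¹ ∙ X)
  rowRest {o} {x} {y} T X = ends refl (trans (shift o) (∙-congʳ (sym (x⁻¹≈ T))))
    (recast (λ (i , i≤o , e) → (suc i , trans e (shift i)) , λ e′ → ¬∣< {suc o} (s≤s z≤n) (s≤s (s≤s i≤o))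
                (proj₁ (free T (suc i) 0 (begin
                  x ^ suc i ∙ ε                ≈⟨ solve 2 (λ a X → a ⊙ one ⊜ (a ⊙ X) ⊙ inv X) refl (x ^ suc i) X ⟩
                  x ^ suc i ∙ X ∙ X ⁻¹         ≈⟨ ∙-congʳ (trans (sym (shift i)) (trans (sym e) e′)) ⟩
                  X ∙ X ⁻¹                     ≈⟨ inverseʳ X ⟩
                  ε                            ∎))))
            (λ (q , n) → rest n (reduce T q))
            (arc T o (x ∙ X) (ℕ.<-trans (ℕ.n<1+n o) (ℕ.n<1+n (suc o)))))
    where
    shift : ∀ i → x ^ i ∙ (x ∙ X) ≈ x ^ suc i ∙ X
    shift i = trans (sym (assoc _ x X)) (∙-congʳ (^-shift x i))
    rest : ∀ {t} → ¬ t ≈ X → (∃ λ i → i < suc (suc o) × t ≈ x ^ i ∙ X) → ∃ λ i → i ≤ o × t ≈ x ^ i ∙ (x ∙ X)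
    rest n (zero , _ , e) = ⊥-elim (n (trans e (identityˡ X)))
    rest n (suc i , s≤s (s≤s i≤o) , e) = i , i≤o , trans e (sym (shift i))

  -- Rows are filled by detours: the row of X is traversed from X to x⁻¹ ∙ X the long way round,
  -- and its first edge X — x ∙ X is replaced by a path through the remaining rows.
  adjacent : ∀ {p x y} (T : Torus p x y) K X → K < suc p → Ham (Rows (suc K) x y X) X (x ⁻¹ ∙ X)
  adjacent {p} {x} {y} T zero X _ = recast
    (λ (i , e) → i , 0 , s≤s z≤n , trans e (∙-congˡ (sym (identityˡ X))))
    (λ { (i , zero , _ , e) → i , trans e (∙-congˡ (identityˡ X)) ; (i , suc j , s≤s () , e) })
    (row T X)
  adjacent {zero} T (suc K) X K<m = ⊥-elim (ℕ.<⇒≱ K<m (s≤s z≤n))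
  adjacent {suc o} {x} {y} T (suc K) X K<m = recast {P = (_≈ X) ∪ (U ∪ R)}
    (λ { (inj₁ e) → toRows 0 (s≤s z≤n) (0 , trans e (solve 1 (λ X → X ⊜ one ⊙ (one ⊙ X)) refl X))
       ; (inj₂ (inj₁ q)) → rows-suc T 0 q
       ; (inj₂ (inj₂ ((i , e) , _))) → toRows 0 (s≤s z≤n) (i , trans e (∙-congˡ (sym (identityˡ X)))) })
    (λ {t} q → [ (λ q′ → sort q′ (t ≟ X)) , (λ q′ → inj₂ (inj₁ q′)) ]′ (rows-split T 0 q))
    (join {Q = U ∪ R} (singleton X)
      (~-resp refl (∙-congˡ (sym (identityˡ X))) (ups T X))
      (join {P = U} {Q = R}
        (recast (rows-flip T) (rows-unflip T) (adjacent (flip T) K (y ∙ (ε ∙ X)) (ℕ.<-trans (ℕ.n<1+n K) K<m)))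
        (~-sym (~-resp refl (trans (solve 3 (λ x y X → y ⊙ (x ⊙ X) ⊜ (y ⊙ x) ⊙ X) refl x y X)
                  (trans (∙-congʳ (sym (comm T))) (solve 3 (λ x y X → (x ⊙ y) ⊙ X ⊜ inv (inv x) ⊙ (y ⊙ (one ⊙ X))) refl x y X)))
               (ups T (x ∙ X))))
        (rowRest T X)
        (λ p (q , _) → rows-disjoint T K<m 0 q p))
      (λ { e (inj₁ q) → rows-disjoint T K<m 0 (0 , trans e (sym (identityˡ X))) q ; e (inj₂ (_ , n)) → n e }))
    where
    U R : Pred Carrier ℓ
    U = Rows (suc K) x y (y ∙ (ε ∙ X))
    R t = Row x X t × ¬ t ≈ X
    sort : ∀ {t} → Row x X t → Dec (t ≈ X) → (t ≈ X) ⊎ (U t ⊎ R t)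
    sort _ (yes e) = inj₁ e
    sort q (no n) = inj₂ (inj₂ (q , n))

  -- The lowest row is traversed and left upwards at x X or x⁻¹ X. This lowers `j` by one and moves
  -- `i` by one, so i + j stays odd, and the bound on `i` survives. The descent ends at offset (1 ,
  -- 0), where `adjacent` fills all remaining rows.
  band : ∀ {p x y} (T : Torus p x y) i j K X → i ≤ suc j → odd (i +ℕ j) ≡ true → j < K → K ≤ suc p →
         Ham (Rows K x y X) X (x ^ i ∙ (y ^ j ∙ X))
  band T zero zero K X _ () _ _
  band T (suc (suc i)) zero K X (s≤s ()) _ _ _
  band {x = x} T (suc zero) zero (suc K) X _ _ _ K≤m =
    ends refl (solve 2 (λ x X → inv (inv x) ⊙ X ⊜ (x ⊙ one) ⊙ (one ⊙ X)) refl x X)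
      (recast (rows-flip T) (rows-unflip T) (adjacent (flip T) K X K≤m))
  -- With no horizontal offset left the row is run the other way, to x⁻¹ X, which turns (0 , j + 1)
  -- into (1 , j).
  band {p} {x} {y} T zero (suc j) (suc K) X _ o (s≤s j<K) K≤m =
    recast {P = Row x X ∪ Rows K x y X′}
      (λ { (inj₁ q) → toRows 0 (s≤s z≤n) (proj₁ q , trans (proj₂ q) (∙-congˡ (sym (identityˡ X)))) ; (inj₂ q) → rows-suc T p (change q) })
      (λ q → [ inj₁ , (λ q → inj₂ (unchange q)) ]′ (rows-split T p q))
      (join {Q = Rows K x y X′} (row T X) (ups T _)
        (ends refl finish (band T 1 j K X′ (s≤s z≤n) (flip-odd j o) j<K (ℕ.<⇒≤ K≤m)))
        (λ q q′ → rows-disjoint T K≤m p q (change q′)))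
    where
    X′ = y ∙ (x ⁻¹ ∙ X)
    X″ = y ∙ (x ^ p ∙ X)
    X″≈ : X″ ≈ X′
    X″≈ = ∙-congˡ (∙-congʳ (sym (x⁻¹≈ T)))
    change : ∀ {t} → Rows K x y X′ t → Rows K x y X″ t
    change (i , j , j<K , e) = i , j , j<K , trans e (∙-congˡ (∙-congˡ (sym X″≈)))
    unchange : ∀ {t} → Rows K x y X″ t → Rows K x y X′ t
    unchange (i , j , j<K , e) = i , j , j<K , trans e (∙-congˡ (∙-congˡ X″≈))
    flip-odd : ∀ j → odd (suc j) ≡ true → odd (suc j) ≡ true
    flip-odd _ e = e
    finish : x ^ 1 ∙ (y ^ j ∙ X′) ≈ ε ∙ (y ^ suc j ∙ X)
    finish = begin
      (x ∙ ε) ∙ (y ^ j ∙ (y ∙ (x ⁻¹ ∙ X)))   ≈⟨ solve 4 (λ x u y X → (x ⊙ one) ⊙ (u ⊙ (y ⊙ (inv x ⊙ X))) ⊜ x ⊙ (u ⊙ y) ⊙ inv x ⊙ X) refl x (y ^ j) y X ⟩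
      x ∙ (y ^ j ∙ y) ∙ x ⁻¹ ∙ X             ≈⟨ ∙-congʳ (∙-congʳ (trans (∙-congˡ (^-shift y j)) (commute-^ (suc j) (comm T)))) ⟩
      y ^ suc j ∙ x ∙ x ⁻¹ ∙ X               ≈⟨ solve 3 (λ u x X → u ⊙ x ⊙ inv x ⊙ X ⊜ one ⊙ (u ⊙ X)) refl (y ^ suc j) x X ⟩
      ε ∙ (y ^ suc j ∙ X)                    ∎
  band {p} {x} {y} T (suc i) (suc j) (suc K) X (s≤s i≤j) o (s≤s j<K) K≤m =
    recast {P = Row x X ∪ Rows K x y X′}
      (λ { (inj₁ q) → toRows 0 (s≤s z≤n) (proj₁ q , trans (proj₂ q) (∙-congˡ (sym (identityˡ X)))) ; (inj₂ q) → rows-suc T 1 (change q) })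
      (λ q → [ inj₁ , (λ q → inj₂ (unchange q)) ]′ (rows-split T 1 q))
      (join {Q = Rows K x y X′} (row⁺ T X) (ups T _)
        (ends refl finish (band T i j K X′ i≤j o′ j<K (ℕ.<⇒≤ K≤m)))
        (λ q q′ → rows-disjoint T K≤m 1 q (change q′)))
    where
    X′ = y ∙ (x ∙ X)
    X″ = y ∙ (x ^ 1 ∙ X)
    X″≈ : X″ ≈ X′
    X″≈ = ∙-congˡ (∙-congʳ (^-1 x))
    change : ∀ {t} → Rows K x y X′ t → Rows K x y X″ t
    change (i , j , j<K , e) = i , j , j<K , trans e (∙-congˡ (∙-congˡ (sym X″≈)))
    unchange : ∀ {t} → Rows K x y X″ t → Rows K x y X′ t
    unchange (i , j , j<K , e) = i , j , j<K , trans e (∙-congˡ (∙-congˡ X″≈))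
    o′ : odd (i +ℕ j) ≡ true
    o′ = ≡.trans (not² _) (≡.trans (≡.cong (λ k → not (odd k)) (≡.sym (ℕ.+-suc i j))) o)
      where
      not² : ∀ b → b ≡ not (not b)
      not² true = ≡.refl
      not² false = ≡.refl
    finish : x ^ i ∙ (y ^ j ∙ X′) ≈ x ^ suc i ∙ (y ^ suc j ∙ X)
    finish = begin
      x ^ i ∙ (y ^ j ∙ (y ∙ (x ∙ X)))    ≈⟨ solve 5 (λ v u y x X → v ⊙ (u ⊙ (y ⊙ (x ⊙ X))) ⊜ v ⊙ ((u ⊙ y) ⊙ x) ⊙ X) refl (x ^ i) (y ^ j) y x X ⟩
      x ^ i ∙ (y ^ j ∙ y ∙ x) ∙ X        ≈⟨ ∙-congʳ (∙-congˡ (trans (∙-congʳ (^-shift y j)) (sym (commute-^ (suc j) (comm T))))) ⟩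
      x ^ i ∙ (x ∙ y ^ suc j) ∙ X        ≈⟨ solve 4 (λ v x u X → v ⊙ (x ⊙ u) ⊙ X ⊜ (v ⊙ x) ⊙ (u ⊙ X)) refl (x ^ i) x (y ^ suc j) X ⟩
      x ^ i ∙ x ∙ (y ^ suc j ∙ X)        ≈⟨ ∙-congʳ (^-shift x i) ⟩
      x ^ suc i ∙ (y ^ suc j ∙ X)        ∎

  Grid : Carrier → Carrier → Carrier → Pred Carrier ℓ
  Grid x y X t = ∃₂ λ i j → t ≈ x ^ i ∙ (y ^ j ∙ X)

  grid-swap : ∀ {p x y} → Torus p x y → ∀ {X t} → Grid x y X t → Grid y x X t
  grid-swap T (i , j , e) = j , i , trans e (trans (sym (assoc _ _ _)) (trans (∙-congʳ (commute-^^ i j (comm T))) (assoc _ _ _)))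

  grid-flip : ∀ {p x y} → Torus p x y → ∀ {X t} → Grid (x ⁻¹) y X t → Grid x y X t
  grid-flip T (i , j , e) = let (i′ , e′) = row-flip T (i , e) in i′ , j , e′

  grid-unflip : ∀ {p x y} → Torus p x y → ∀ {X t} → Grid x y X t → Grid (x ⁻¹) y X t
  grid-unflip T (i , j , e) = let (i′ , e′) = row-unflip T (i , e) in i′ , j , e′

  -- The bound that `band` imposes holds for (i , j) or for (j , i), and the torus is symmetric in
  -- its two generators.
  oddTour : ∀ {p x y} → Torus p x y → ∀ i j X → i < suc p → j < suc p → odd (i +ℕ j) ≡ true →
            Ham (Grid x y X) X (x ^ i ∙ (y ^ j ∙ X))
  oddTour {p} {x} {y} T i j X i<m j<m o with i ℕ.≤? suc j
  ... | yes i≤ = whole T (band T i j (suc p) X i≤ o j<m ℕ.≤-refl)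
    where
    whole : ∀ {x y v} → Torus p x y → Ham (Rows (suc p) x y X) X v → Ham (Grid x y X) X v
    whole T = recast (λ (i , j , _ , e) → i , j , e)
      (λ (i , j , e) → i , j % suc p , m%n<n j (suc p) , trans e (∙-congˡ (∙-congʳ (x^% (swap T) j))))
  ... | no i≰ = ends refl (trans (sym (assoc _ _ _)) (trans (∙-congʳ (sym (commute-^^ i j (comm T)))) (assoc _ _ _)))
    (recast (grid-swap (swap T)) (grid-swap T)
      (whole (swap T) (band (swap T) j i (suc p) X j≤ (≡.trans (≡.cong odd (ℕ.+-comm j i)) o) i<m ℕ.≤-refl)))
    where
    j≤ : j ≤ suc i
    j≤ = ℕ.≤-trans (ℕ.n≤1+n j) (ℕ.≤-trans (ℕ.<⇒≤ (ℕ.≰⇒> i≰)) (ℕ.n≤1+n i))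
    whole : ∀ {x y v} → Torus p x y → Ham (Rows (suc p) x y X) X v → Ham (Grid x y X) X v
    whole T = recast (λ (i , j , _ , e) → i , j , e)
      (λ (i , j , e) → i , j % suc p , m%n<n j (suc p) , trans e (∙-congˡ (∙-congʳ (x^% (swap T) j))))

  flip-^ : ∀ {p x y} → Torus p x y → ∀ i → i ≤ suc p → x ⁻¹ ^ (suc p ∸ i) ≈ x ^ i
  flip-^ {p} {x} T i i≤m = begin
    x ⁻¹ ^ k                        ≈⟨ identityʳ _ ⟨
    x ⁻¹ ^ k ∙ ε                    ≈⟨ ∙-congˡ (trans (reflexive (≡.cong (x ^_) (ℕ.m∸n+n≡m i≤m))) (x^m T)) ⟨
    x ⁻¹ ^ k ∙ x ^ (k +ℕ i)          ≈⟨ ∙-congˡ (^-+ x k i) ⟩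
    x ⁻¹ ^ k ∙ (x ^ k ∙ x ^ i)      ≈⟨ assoc _ _ _ ⟨
    x ⁻¹ ^ k ∙ x ^ k ∙ x ^ i        ≈⟨ ∙-congʳ (inverse-^ x k) ⟩
    ε ∙ x ^ i                       ≈⟨ identityˡ _ ⟩
    x ^ i                           ∎
    where k = suc p ∸ i

  -- When the side suc p of the torus is odd, replacing x or y by its inverse changes the parity of the displacement.
  tour : ∀ {p x y} → Torus p x y → ∀ i j X → i < suc p → j < suc p →
         odd (i +ℕ j) ≡ true ⊎ (odd (suc p) ≡ true × 0 < i +ℕ j) →
         Ham (Grid x y X) X (x ^ i ∙ (y ^ j ∙ X))
  tour T i j X i<m j<m (inj₁ o) = oddTour T i j X i<m j<m o
  tour {p} T i j X i<m j<m (inj₂ (om , pos)) with odd (i +ℕ j) in eq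
  ... | true = oddTour T i j X i<m j<m eq
  tour {p} T (suc i) j X i<m j<m (inj₂ (om , pos)) | false =
    ends refl (∙-congʳ (flip-^ T (suc i) (ℕ.<⇒≤ i<m)))
      (recast (grid-flip T) (grid-unflip T)
        (oddTour (flip T) (p ∸ i) j X (s≤s (ℕ.m∸n≤m p i)) j<m (parity (p ∸ i) (ℕ.m∸n+n≡m (ℕ.≤-pred (ℕ.<⇒≤ i<m))))))
    where
    parity : ∀ k → k +ℕ i ≡ p → odd (k +ℕ j) ≡ true
    parity k e = ≡.trans (odd-+ k j) (xor-lemma (odd k) (odd i) (odd j)
      (≡.trans (≡.cong not (≡.sym (odd-+ k i))) (≡.trans (≡.cong (λ n → not (odd n)) e) om))
      (≡.trans (≡.cong not (≡.sym (odd-+ i j))) eq))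
  tour {p} T zero (suc j) X i<m j<m (inj₂ (om , pos)) | false =
    ends refl (∙-congˡ (∙-congʳ (flip-^ (swap T) (suc j) (ℕ.<⇒≤ j<m))))
      (recast (grid-swap (swap T) ∘ grid-flip (swap T) ∘ grid-swap T′) (grid-swap (swap T′) ∘ grid-unflip (swap T) ∘ grid-swap T)
        (oddTour T′ 0 (p ∸ j) X i<m (s≤s (ℕ.m∸n≤m p j)) (parity (p ∸ j) (ℕ.m∸n+n≡m (ℕ.≤-pred (ℕ.<⇒≤ j<m))))))
    where
    T′ = swap (flip (swap T))
    parity : ∀ k → k +ℕ j ≡ p → odd k ≡ true
    parity k e = ≡.trans (xor-false (odd k)) (xor-lemma (odd k) (odd j) false
      (≡.trans (≡.cong not (≡.sym (odd-+ k j))) (≡.trans (≡.cong (λ n → not (odd n)) e) om))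
      (≡.trans (≡.cong not (≡.sym (xor-false (odd j)))) eq))

-- Matrices over a finite field

-- Rings are solved with integer coefficients, so that cancellation is visible to the normaliser.
module IntegerSolver {c ℓ : Level} (R : CommutativeRing c ℓ) where
  open import Data.Integer.Base using (ℤ; +_; -[1+_]; _⊖_; _◃_; sign; ∣_∣)
  open import Data.Nat.Base using (_+_; _*_)
  open import Data.Sign.Base as Sign using (Sign)
  open CommutativeRing R renaming (_+_ to _⊕_; _*_ to _⊛_)
  open RingP ring using (-‿distribˡ-*; -‿distribʳ-*; -‿involutive; -0#≈0#)
  open AbelianGroupP +-abelianGroup using () renaming (⁻¹-∙-comm to -‿+-comm)
  open MultP semiring using (×-homo-+; ×1-homo-*) renaming (_×_ to _·_)
  open SetoidReasoning setoid

  private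
    ⟦_⟧ : ℤ → Carrier
    ⟦ + n ⟧ = n · 1#
    ⟦ -[1+ n ] ⟧ = - (suc n · 1#)

    ⊖-homo : ∀ m n → ⟦ m ⊖ n ⟧ ≈ m · 1# ⊕ - (n · 1#)
    ⊖-homo m zero = begin
      ⟦ m ⊖ 0 ⟧         ≡⟨ ≡.cong ⟦_⟧ (ℤ.⊖-≥ {m} z≤n) ⟩
      m · 1#            ≈⟨ +-identityʳ _ ⟨
      m · 1# ⊕ 0#       ≈⟨ +-congˡ -0#≈0# ⟨
      m · 1# ⊕ - 0#     ∎
    ⊖-homo zero (suc n) = sym (+-identityˡ _)
    ⊖-homo (suc m) (suc n) = begin
      ⟦ suc m ⊖ suc n ⟧                      ≡⟨ ≡.cong ⟦_⟧ (ℤ.[1+m]⊖[1+n]≡m⊖n m n) ⟩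
      ⟦ m ⊖ n ⟧                              ≈⟨ ⊖-homo m n ⟩
      a ⊕ - b                                ≈⟨ +-congˡ (sym (trans (sym (+-assoc _ _ _)) (trans (+-congʳ (-‿inverseʳ 1#)) (+-identityˡ _)))) ⟩
      a ⊕ (1# ⊕ (- 1# ⊕ - b))                ≈⟨ +-assoc _ _ _ ⟨
      (a ⊕ 1#) ⊕ (- 1# ⊕ - b)                ≈⟨ +-cong (+-comm _ _) (-‿+-comm _ _) ⟩
      (1# ⊕ a) ⊕ - (1# ⊕ b)                  ≈⟨ +-cong (×-homo-+ 1# 1 m) (-‿cong (×-homo-+ 1# 1 n)) ⟨
      suc m · 1# ⊕ - (suc n · 1#)            ∎
      where
      a = m · 1#
      b = n · 1#

    +-homo : ∀ i j → ⟦ i ℤ.+ j ⟧ ≈ ⟦ i ⟧ ⊕ ⟦ j ⟧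
    +-homo (+ m) (+ n) = ×-homo-+ 1# m n
    +-homo (+ m) -[1+ n ] = ⊖-homo m (suc n)
    +-homo -[1+ m ] (+ n) = trans (⊖-homo n (suc m)) (+-comm _ _)
    +-homo -[1+ m ] -[1+ n ] = begin
      - (suc (suc (m + n)) · 1#)              ≡⟨ ≡.cong (λ k → - (suc k · 1#)) (≡.sym (ℕ.+-suc m n)) ⟩
      - ((suc m + suc n) · 1#)                ≈⟨ -‿cong (×-homo-+ 1# (suc m) (suc n)) ⟩
      - (suc m · 1# ⊕ suc n · 1#)             ≈⟨ -‿+-comm _ _ ⟨
      - (suc m · 1#) ⊕ - (suc n · 1#)         ∎
      where import Data.Nat.Properties as ℕ

    signed : Sign → Carrier → Carrier
    signed Sign.+ x = x
    signed Sign.- x = - x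

    ◃-homo : ∀ s n → ⟦ s ◃ n ⟧ ≈ signed s (n · 1#)
    ◃-homo Sign.+ zero = refl
    ◃-homo Sign.- zero = sym -0#≈0#
    ◃-homo Sign.+ (suc n) = refl
    ◃-homo Sign.- (suc n) = refl

    ∣∣-homo : ∀ i → ⟦ i ⟧ ≈ signed (sign i) (∣ i ∣ · 1#)
    ∣∣-homo (+ n) = refl
    ∣∣-homo -[1+ n ] = refl

    signed-* : ∀ s t x y → signed (s Sign.* t) (x ⊛ y) ≈ signed s x ⊛ signed t y
    signed-* Sign.+ Sign.+ x y = refl
    signed-* Sign.+ Sign.- x y = -‿distribʳ-* x y
    signed-* Sign.- Sign.+ x y = -‿distribˡ-* x y
    signed-* Sign.- Sign.- x y = trans (sym (-‿involutive _))
      (trans (-‿cong (-‿distribʳ-* x y)) (-‿distribˡ-* x (- y)))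

    signed-cong : ∀ s {x y} → x ≈ y → signed s x ≈ signed s y
    signed-cong Sign.+ e = e
    signed-cong Sign.- e = -‿cong e

    *-homo : ∀ i j → ⟦ i ℤ.* j ⟧ ≈ ⟦ i ⟧ ⊛ ⟦ j ⟧
    *-homo i j = begin
      ⟦ sign i Sign.* sign j ◃ ∣ i ∣ * ∣ j ∣ ⟧                           ≈⟨ ◃-homo (sign i Sign.* sign j) (∣ i ∣ * ∣ j ∣) ⟩
      signed (sign i Sign.* sign j) ((∣ i ∣ * ∣ j ∣) · 1#)               ≈⟨ signed-cong (sign i Sign.* sign j) (×1-homo-* ∣ i ∣ ∣ j ∣) ⟩
      signed (sign i Sign.* sign j) ((∣ i ∣ · 1#) ⊛ (∣ j ∣ · 1#))        ≈⟨ signed-* (sign i) (sign j) _ _ ⟩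
      signed (sign i) (∣ i ∣ · 1#) ⊛ signed (sign j) (∣ j ∣ · 1#)        ≈⟨ *-cong (∣∣-homo i) (∣∣-homo j) ⟨
      ⟦ i ⟧ ⊛ ⟦ j ⟧                                                      ∎

    -‿homo : ∀ i → ⟦ ℤ.- i ⟧ ≈ - ⟦ i ⟧
    -‿homo (+ zero) = sym -0#≈0#
    -‿homo (+ suc n) = refl
    -‿homo -[1+ n ] = sym (-‿involutive _)

    homomorphism : ACR._-Raw-AlmostCommutative⟶_ ℤ.+-*-rawRing (ACR.fromCommutativeRing R)
    homomorphism = record
      { ⟦_⟧ = ⟦_⟧ ; +-homo = +-homo ; *-homo = *-homo ; -‿homo = -‿homo ; 0-homo = refl ; 1-homo = refl }

    _coeff≟_ : ∀ i j → Maybe (⟦ i ⟧ ≈ ⟦ j ⟧)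
    i coeff≟ j with i ℤ.≟ j
    ... | yes e = just (reflexive (≡.cong ⟦_⟧ e))
    ... | no _ = nothing

  open RingSolver ℤ.+-*-rawRing (ACR.fromCommutativeRing R) homomorphism _coeff≟_ public
    using (solve; _:=_; con; var; _:+_; _:*_; _:-_; :-_; _:^_)

-- Enumerations and finite fields

functions : ∀ {a} {A : Set a} → List A → ∀ n → List (Fin n → A)
functions xs zero = (λ ()) ∷ []
functions xs (suc n) = cartesianProductWith (λ x f → λ { zero → x ; (suc i) → f i }) xs (functions xs n)

-- Pointwise, because equality of matrices is entrywise; the lemma is applied once to rows and once
-- to matrices as functions into rows.
functions-complete : ∀ {a r} {A : Set a} (_≈_ : A → A → Set r) xs n (f : Fin n → A) →
                     (∀ i → Any (f i ≈_) xs) → Any (λ g → ∀ i → f i ≈ g i) (functions xs n)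
functions-complete _≈_ xs zero f _ = here (λ ())
functions-complete _≈_ xs (suc n) f p = AnyP.cartesianProductWith⁺ _
  (λ e h → λ { zero → e ; (suc i) → h i }) (p zero) (functions-complete _≈_ xs n (f ∘ suc) (p ∘ suc))

module FieldFacts {c ℓ : Level} {q : ℕ} (F : FiniteField c ℓ q) where
  open FiniteField F hiding (zero)
  open Inverse enumeration using (to; from; to-cong; strictlyInverseʳ)
  open IntegerSolver commutativeRing using (solve; _:=_; con; _:+_; _:*_; _:-_; :-_)
  open SetoidReasoning setoid

  to-injective : ∀ {x y} → to x ≡ to y → x ≈ y
  to-injective {x} {y} e = begin
    x            ≈⟨ strictlyInverseʳ x ⟨
    from (to x)  ≡⟨ ≡.cong from e ⟩
    from (to y)  ≈⟨ strictlyInverseʳ y ⟩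
    y            ∎

  infix 4 _≟F_
  _≟F_ : B.Decidable _≈_
  x ≟F y = map′ to-injective to-cong (to x Fin.≟ to y)

  fieldElements : List Carrier
  fieldElements = map from (allFin q)

  fieldListed : ∀ x → Any (x ≈_) fieldElements
  fieldListed x = AnyP.map⁺ (Any.map (λ e → trans (sym (strictlyInverseʳ x)) (reflexive (≡.cong from e))) (∈P.∈-allFin (to x)))

  recip : ∀ {x} → ¬ x ≈ 0# → ∃ λ y → y * x ≈ 1#
  recip {x} x≉0 = let (y , yx≈1 , _) = invertible x x≉0 in y , yx≈1

  cancel : ∀ {x y z} → ¬ x ≈ 0# → x * y ≈ x * z → y ≈ z
  cancel {x} {y} {z} x≉0 e = let (w , wx≈1) = recip x≉0 in begin
    y            ≈⟨ *-identityˡ y ⟨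
    1# * y       ≈⟨ *-congʳ wx≈1 ⟨
    w * x * y    ≈⟨ *-assoc w x y ⟩
    w * (x * y)  ≈⟨ *-congˡ e ⟩
    w * (x * z)  ≈⟨ *-assoc w x z ⟨
    w * x * z    ≈⟨ *-congʳ wx≈1 ⟩
    1# * z       ≈⟨ *-identityˡ z ⟩
    z            ∎

  nonzero-* : ∀ {x y} → ¬ x ≈ 0# → ¬ y ≈ 0# → ¬ x * y ≈ 0#
  nonzero-* {x} x≉0 y≉0 e = y≉0 (cancel x≉0 (trans e (sym (zeroʳ x))))

  nonzero-factor : ∀ {x y} → x * y ≈ 1# → ¬ x ≈ 0#
  nonzero-factor {x} {y} e x≈0 = 1≉0 (trans (sym e) (trans (*-congʳ x≈0) (zeroˡ y)))

  difference : ∀ {x y} → x - y ≈ 0# → x ≈ y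
  difference {x} {y} e = begin
    x            ≈⟨ solve 2 (λ x y → x := (x :- y) :+ y) refl x y ⟩
    (x - y) + y  ≈⟨ +-congʳ e ⟩
    0# + y       ≈⟨ +-identityˡ y ⟩
    y            ∎

-- Matrices acting on rows and columns

module Linear {c ℓ : Level} {q : ℕ} (F : FiniteField c ℓ q) (n : ℕ) where
  open FiniteField F hiding (zero)
  open FieldFacts F
  open Matrices F n public hiding (_⁻¹)
  open IntegerSolver commutativeRing using (solve; _:=_; con; _:+_; _:*_; _:-_; :-_)
  open Summation semiring
  open SetoidReasoning setoid

  Vect : Set c
  Vect = Fin n → Carrier

  infix 4 _≗_
  _≗_ : Vect → Vect → Set ℓ
  v ≗ w = ∀ i → v i ≈ w i

  infixr 8 _▹_
  infixl 8 _◃_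
  _▹_ : Matrix → Vect → Vect
  (X ▹ w) i = sum λ k → X i k * w k

  _◃_ : Vect → Matrix → Vect
  (v ◃ X) j = sum λ k → v k * X k j

  dot : Vect → Vect → Carrier
  dot v w = sum λ k → v k * w k

  -- The law (v X) w = v (X w), by exchanging two sums. Associativity of all the products below is
  -- an instance.
  sum-assoc : ∀ {m k} (v : Fin m → Carrier) (X : Fin m → Fin k → Carrier) (w : Fin k → Carrier) →
              sum (λ j → sum (λ i → v i * X i j) * w j) ≈ sum (λ i → v i * sum (λ j → X i j * w j))
  sum-assoc v X w = begin
    sum (λ j → sum (λ i → v i * X i j) * w j)    ≈⟨ sum-cong-≋ (λ j → *-distribʳ-sum (w j) (λ i → v i * X i j)) ⟩
    sum (λ j → sum (λ i → v i * X i j * w j))    ≈⟨ ∑-comm (λ j i → v i * X i j * w j) ⟩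
    sum (λ i → sum (λ j → v i * X i j * w j))    ≈⟨ sum-cong-≋ (λ i → sum-cong-≋ (λ j → *-assoc (v i) (X i j) (w j))) ⟩
    sum (λ i → sum (λ j → v i * (X i j * w j)))  ≈⟨ sum-cong-≋ (λ i → *-distribˡ-sum (v i) (λ j → X i j * w j)) ⟨
    sum (λ i → v i * sum (λ j → X i j * w j))    ∎

  δ-sym : ∀ {m} (i j : Fin m) → does (i Fin.≟ j) ≡ does (j Fin.≟ i)
  δ-sym i j with i Fin.≟ j | j Fin.≟ i
  ... | yes _ | yes _ = ≡.refl
  ... | no _ | no _ = ≡.refl
  ... | yes e | no ne = ⊥-elim (ne (≡.sym e))
  ... | no ne | yes e = ⊥-elim (ne (≡.sym e))

  𝟙-sym : ∀ i j → 𝟙 i j ≡ 𝟙 j i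
  𝟙-sym i j = ≡.cong (if_then 1# else 0#) (δ-sym i j)

  private
    δ : ∀ {m} → Fin m → Fin m → Carrier
    δ i j = if does (i Fin.≟ j) then 1# else 0#

    sum-δ : ∀ {m} (i : Fin m) (f : Fin m → Carrier) → sum (λ k → δ i k * f k) ≈ f i
    sum-δ {suc m} zero f = begin
      1# * f zero + sum (λ k → 0# * f (suc k))  ≈⟨ +-cong (*-identityˡ _) (sum-cong-≋ {m} (λ k → zeroˡ (f (suc k)))) ⟩
      f zero + sum {m} (λ k → 0#)               ≈⟨ +-congˡ (sum-replicate-zero m) ⟩
      f zero + 0#                               ≈⟨ +-identityʳ _ ⟩
      f zero                                    ∎
    sum-δ {suc m} (suc i) f = begin
      0# * f zero + sum (λ k → δ i k * f (suc k))  ≈⟨ +-cong (zeroˡ _) (sum-δ i (f ∘ suc)) ⟩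
      0# + f (suc i)                               ≈⟨ +-identityˡ _ ⟩
      f (suc i)                                    ∎

  ▹-cong : ∀ {X Y v w} → X ≋ Y → v ≗ w → X ▹ v ≗ Y ▹ w
  ▹-cong p q i = sum-cong-≋ (λ k → *-cong (p i k) (q k))

  ◃-cong : ∀ {X Y v w} → v ≗ w → X ≋ Y → v ◃ X ≗ w ◃ Y
  ◃-cong q p j = sum-cong-≋ (λ k → *-cong (q k) (p k j))

  ▹-assoc : ∀ X Y w → (X ⊗ Y) ▹ w ≗ X ▹ (Y ▹ w)
  ▹-assoc X Y w i = sum-assoc (X i) Y w

  ◃-assoc : ∀ v X Y → v ◃ (X ⊗ Y) ≗ (v ◃ X) ◃ Y
  ◃-assoc v X Y j = sym (sum-assoc v X (λ k → Y k j))

  ⊗-assoc : ∀ X Y Z → (X ⊗ Y) ⊗ Z ≋ X ⊗ (Y ⊗ Z)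
  ⊗-assoc X Y Z i j = sum-assoc (X i) Y (λ k → Z k j)

  𝟙▹ : ∀ w → 𝟙 ▹ w ≗ w
  𝟙▹ w i = sum-δ i w

  ◃𝟙 : ∀ v → v ◃ 𝟙 ≗ v
  ◃𝟙 v j = trans (sum-cong-≋ (λ k → trans (*-comm _ _) (*-congʳ (reflexive (𝟙-sym k j))))) (sum-δ j v)

  𝟙⊗ : ∀ X → 𝟙 ⊗ X ≋ X
  𝟙⊗ X i j = 𝟙▹ (λ k → X k j) i

  ⊗𝟙 : ∀ X → X ⊗ 𝟙 ≋ X
  ⊗𝟙 X i j = ◃𝟙 (X i) j

  unit : Fin n → Vect
  unit x i = 𝟙 i x

  unit◃ : ∀ x X → unit x ◃ X ≗ X x
  unit◃ x X j = trans (sum-cong-≋ (λ k → *-congʳ (reflexive (𝟙-sym k x)))) (sum-δ x (λ k → X k j))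

  ▹unit : ∀ X x i → (X ▹ unit x) i ≈ X i x
  ▹unit X x i = ⊗𝟙 X i x

  open Setoid matrixSetoid public using () renaming (refl to ≋-refl; sym to ≋-sym; trans to ≋-trans)

  -- Makes inversion well defined, as elements of `GL` are compared by their matrices alone.
  inverse-unique : ∀ {X X′ Y Y′} → Y ⊗ X ≋ 𝟙 → X′ ⊗ Y′ ≋ 𝟙 → X ≋ X′ → Y ≋ Y′
  inverse-unique {X} {X′} {Y} {Y′} p q e = ≋-trans (≋-sym (⊗𝟙 Y)) (≋-trans (⊗-cong (≋-refl {Y}) (≋-sym q))
    (≋-trans (≋-sym (⊗-assoc Y X′ Y′)) (≋-trans (⊗-cong (≋-trans (⊗-cong (≋-refl {Y}) (≋-sym e)) p) (≋-refl {Y′})) (𝟙⊗ Y′))))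

  -- Wrapped, so that the two group elements can be inferred from a proof.
  infix 4 _≃_
  record _≃_ (X Y : GL) : Set ℓ where
    constructor entrywise
    field entries : mat X ≋ mat Y
  open _≃_ public

  -- Abstract, so that products of group elements are compared without unfolding their inverses.
  abstract
    product : GL → GL → GL
    product (X , X⁻¹ , p , p′) (Y , Y⁻¹ , q , q′) = X ⊗ Y , Y⁻¹ ⊗ X⁻¹ , middle p q , middle q′ p′
      where
      middle : ∀ {A B C D} → B ⊗ C ≋ 𝟙 → A ⊗ D ≋ 𝟙 → (A ⊗ B) ⊗ (C ⊗ D) ≋ 𝟙
      middle {A} {B} {C} {D} p q = ≋-trans (⊗-assoc A B (C ⊗ D))
        (≋-trans (⊗-cong (≋-refl {A}) (≋-trans (≋-sym (⊗-assoc B C D)) (≋-trans (⊗-cong p (≋-refl {D})) (𝟙⊗ D)))) q)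

    inverse : GL → GL
    inverse = Matrices._⁻¹ F n

    identity : GL
    identity = 𝟙 , 𝟙 , 𝟙⊗ 𝟙 , 𝟙⊗ 𝟙

    mat-∙ : ∀ X Y → mat (product X Y) ≋ mat X ⊗ mat Y
    mat-∙ X Y = ≋-refl {mat X ⊗ mat Y}

    mat-ε : mat identity ≋ 𝟙
    mat-ε = ≋-refl {𝟙}

    mat-⁻¹ : ∀ X → mat (inverse X) ≋ mat (Matrices._⁻¹ F n X)
    mat-⁻¹ X = ≋-refl {mat (Matrices._⁻¹ F n X)}

    group-laws : IsGroup _≃_ product identity inverse
    group-laws = record
      { isMonoid = record
        { isSemigroup = record
          { isMagma = record
            { isEquivalence = record
              { refl = λ {X} → entrywise (≋-refl {mat X})
              ; sym = λ (entrywise e) → entrywise (≋-sym e)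
              ; trans = λ (entrywise e) (entrywise e′) → entrywise (≋-trans e e′) }
            ; ∙-cong = λ (entrywise e) (entrywise e′) → entrywise (⊗-cong e e′) }
          ; assoc = λ X Y Z → entrywise (⊗-assoc (mat X) (mat Y) (mat Z)) }
        ; identity = (λ X → entrywise (𝟙⊗ (mat X))) , (λ X → entrywise (⊗𝟙 (mat X))) }
      ; inverse = (λ (_ , _ , p , _) → entrywise p) , (λ (_ , _ , _ , p) → entrywise p)
      ; ⁻¹-cong = λ { {X , X⁻¹ , p , _} {Y , Y⁻¹ , _ , q} (entrywise e) → entrywise (inverse-unique p q e) } }

  𝔾 : Group (c ⊔ ℓ) ℓ
  𝔾 = record { Carrier = GL ; _≈_ = _≃_ ; _∙_ = product ; ε = identity ; _⁻¹ = inverse ; isGroup = group-laws }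

  infix 4 _≋?_
  _≋?_ : B.Decidable _≋_
  X ≋? Y = Fin.all? (λ i → Fin.all? (λ j → X i j ≟F Y i j))

  private
    matrices : List Matrix
    matrices = functions (functions fieldElements n) n

    matrices-complete : ∀ X → Any (X ≋_) matrices
    matrices-complete X = functions-complete _≗_ (functions fieldElements n) n X
      (λ i → functions-complete _≈_ fieldElements n (X i) (λ j → fieldListed (X i j)))

    -- An element of `GL` carries its inverse, so the search runs over pairs of matrices and keeps
    -- those that are inverse to each other.
    invertibles : List (Matrix × Matrix) → List GL
    invertibles [] = []
    invertibles ((X , Y) ∷ ps) with (Y ⊗ X ≋? 𝟙) ×-dec (X ⊗ Y ≋? 𝟙)
    ... | yes (p , q) = (X , Y , p , q) ∷ invertibles ps
    ... | no _ = invertibles ps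

    invertibles-complete : ∀ (g : GL) {ps} → Any (λ (X , Y) → mat g ≋ X × mat (Matrices._⁻¹ F n g) ≋ Y) ps →
                           Any (g ≃_) (invertibles ps)
    invertibles-complete g@(G , H , p , q) {(X , Y) ∷ ps} i with (Y ⊗ X ≋? 𝟙) ×-dec (X ⊗ Y ≋? 𝟙) | i
    ... | yes _ | here (e , _) = here (entrywise e)
    ... | yes _ | there j = there (invertibles-complete g j)
    ... | no ¬inv | here (e , e′) = ⊥-elim (¬inv ( ≋-trans (⊗-cong (≋-sym e′) (≋-sym e)) p
                                                  , ≋-trans (⊗-cong (≋-sym e) (≋-sym e′)) q))
    ... | no _ | there j = invertibles-complete g j

  glElements : List GL
  glElements = invertibles (cartesianProduct matrices matrices)

  glListed : ∀ g → Any (g ≃_) glElements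
  glListed g = invertibles-complete g
    (AnyP.cartesianProduct⁺ (matrices-complete (mat g)) (matrices-complete (mat (Matrices._⁻¹ F n g))))

  -- The matrix 1 + a bᵀ. Generators and auxiliary elements are built from it: multiplying by it
  -- costs one row or column product, never a new entrywise sum.
  pert : Vect → Vect → Matrix
  pert a b i j = 𝟙 i j + a i * b j

  pert⊗ : ∀ a b X i j → (pert a b ⊗ X) i j ≈ X i j + a i * (b ◃ X) j
  pert⊗ a b X i j = begin
    sum (λ k → (𝟙 i k + a i * b k) * X k j)                         ≈⟨ sum-cong-≋ (λ k → solve 4 (λ d a b x → (d :+ a :* b) :* x := d :* x :+ a :* (b :* x)) refl (𝟙 i k) (a i) (b k) (X k j)) ⟩
    sum (λ k → 𝟙 i k * X k j + a i * (b k * X k j))                 ≈⟨ ∑-distrib-+ (λ k → 𝟙 i k * X k j) (λ k → a i * (b k * X k j)) ⟩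
    sum (λ k → 𝟙 i k * X k j) + sum (λ k → a i * (b k * X k j))     ≈⟨ +-cong (𝟙⊗ X i j) (sym (*-distribˡ-sum (a i) (λ k → b k * X k j))) ⟩
    X i j + a i * (b ◃ X) j                                         ∎

  ⊗pert : ∀ X a b i j → (X ⊗ pert a b) i j ≈ X i j + (X ▹ a) i * b j
  ⊗pert X a b i j = begin
    sum (λ k → X i k * (𝟙 k j + a k * b j))                         ≈⟨ sum-cong-≋ (λ k → solve 4 (λ d a b x → x :* (d :+ a :* b) := x :* d :+ (x :* a) :* b) refl (𝟙 k j) (a k) (b j) (X i k)) ⟩
    sum (λ k → X i k * 𝟙 k j + (X i k * a k) * b j)                 ≈⟨ ∑-distrib-+ (λ k → X i k * 𝟙 k j) (λ k → (X i k * a k) * b j) ⟩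
    sum (λ k → X i k * 𝟙 k j) + sum (λ k → (X i k * a k) * b j)     ≈⟨ +-cong (⊗𝟙 X i j) (sym (*-distribʳ-sum (b j) (λ k → X i k * a k))) ⟩
    X i j + (X ▹ a) i * b j                                         ∎

  pert▹ : ∀ a b w i → (pert a b ▹ w) i ≈ w i + a i * dot b w
  pert▹ a b w i = pert⊗ a b (λ k _ → w k) i i

  ◃pert : ∀ v a b j → (v ◃ pert a b) j ≈ v j + dot v a * b j
  ◃pert v a b j = ⊗pert (λ _ → v) a b j j

  dot-unitˡ : ∀ x w → dot (unit x) w ≈ w x
  dot-unitˡ x w = unit◃ x (λ k _ → w k) x

  dot-unitʳ : ∀ v x → dot v (unit x) ≈ v x
  dot-unitʳ v x = ◃𝟙 v x

  -- The inverse of 1 + a bᵀ is 1 − r a bᵀ with r = (1 + b · a)⁻¹.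
  rankOne : ∀ (a b : Vect) r → r * (1# + dot b a) ≈ 1# → GL
  rankOne a b r e = pert a b , pert a b′ , left , right
    where
    b′ : Vect
    b′ j = - r * b j
    d = dot b a
    left : pert a b′ ⊗ pert a b ≋ 𝟙
    left i j = begin
      (pert a b′ ⊗ pert a b) i j                           ≈⟨ ⊗pert (pert a b′) a b i j ⟩
      pert a b′ i j + (pert a b′ ▹ a) i * b j              ≈⟨ +-congˡ (*-congʳ (pert▹ a b′ a i)) ⟩
      pert a b′ i j + (a i + a i * dot b′ a) * b j         ≈⟨ +-congˡ (*-congʳ (+-congˡ (*-congˡ dot′))) ⟩
      𝟙 i j + a i * (- r * b j) + (a i + a i * (- r * d)) * b j
        ≈⟨ solve 5 (λ o a b r d → o :+ a :* (:- r :* b) :+ (a :+ a :* (:- r :* d)) :* b := o :+ a :* b :* (con ℤ.1ℤ :- r :* (con ℤ.1ℤ :+ d))) refl (𝟙 i j) (a i) (b j) r d ⟩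
      𝟙 i j + a i * b j * (1# - r * (1# + d))              ≈⟨ +-congˡ (trans (*-congˡ (trans (+-congˡ (-‿cong e)) (-‿inverseʳ 1#))) (zeroʳ _)) ⟩
      𝟙 i j + 0#                                           ≈⟨ +-identityʳ _ ⟩
      𝟙 i j                                                ∎
      where
      dot′ : dot b′ a ≈ - r * d
      dot′ = trans (sum-cong-≋ (λ k → *-assoc (- r) (b k) (a k))) (sym (*-distribˡ-sum (- r) (λ k → b k * a k)))
    right : pert a b ⊗ pert a b′ ≋ 𝟙
    right i j = begin
      (pert a b ⊗ pert a b′) i j                           ≈⟨ ⊗pert (pert a b) a b′ i j ⟩
      pert a b i j + (pert a b ▹ a) i * b′ j               ≈⟨ +-congˡ (*-congʳ (pert▹ a b a i)) ⟩
      𝟙 i j + a i * b j + (a i + a i * d) * (- r * b j)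
        ≈⟨ solve 5 (λ o a b r d → o :+ a :* b :+ (a :+ a :* d) :* (:- r :* b) := o :+ a :* b :* (con ℤ.1ℤ :- r :* (con ℤ.1ℤ :+ d))) refl (𝟙 i j) (a i) (b j) r d ⟩
      𝟙 i j + a i * b j * (1# - r * (1# + d))              ≈⟨ +-congˡ (trans (*-congˡ (trans (+-congˡ (-‿cong e)) (-‿inverseʳ 1#))) (zeroʳ _)) ⟩
      𝟙 i j + 0#                                           ≈⟨ +-identityʳ _ ⟩
      𝟙 i j                                                ∎

  𝟙-diag : ∀ x → 𝟙 x x ≈ 1#
  𝟙-diag x with x Fin.≟ x
  ... | yes _ = refl
  ... | no n = ⊥-elim (n ≡.refl)

  𝟙-off : ∀ {x y} → x ≢ y → 𝟙 x y ≈ 0#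
  𝟙-off {x} {y} ne with x Fin.≟ y
  ... | yes e = ⊥-elim (ne e)
  ... | no _ = refl

  addition : ∀ x y → x ≢ y → GL
  addition x y x≢y = rankOne (unit y) (unit x) 1# (begin
    1# * (1# + dot (unit x) (unit y))  ≈⟨ *-identityˡ _ ⟩
    1# + dot (unit x) (unit y)         ≈⟨ +-congˡ (trans (dot-unitˡ x (unit y)) (𝟙-off x≢y)) ⟩
    1# + 0#                            ≈⟨ +-identityʳ 1# ⟩
    1#                                 ∎)

  addition≋ : ∀ x y (x≢y : x ≢ y) → mat (addition x y x≢y) ≋ addMatrix x y
  addition≋ x y x≢y i j with i Fin.≟ j | i Fin.≟ y | j Fin.≟ x
  ... | yes i≡j | yes i≡y | yes j≡x = ⊥-elim (x≢y (≡.trans (≡.sym j≡x) (≡.trans (≡.sym i≡j) i≡y)))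
  ... | yes _ | yes _ | no _ = trans (+-congˡ (zeroʳ 1#)) (+-identityʳ 1#)
  ... | yes _ | no _ | yes _ = trans (+-congˡ (zeroˡ 1#)) (+-identityʳ 1#)
  ... | yes _ | no _ | no _ = trans (+-congˡ (zeroʳ 0#)) (+-identityʳ 1#)
  ... | no _ | yes _ | yes _ = trans (+-identityˡ _) (*-identityˡ 1#)
  ... | no _ | yes _ | no _ = trans (+-identityˡ _) (zeroʳ 1#)
  ... | no _ | no _ | yes _ = trans (+-identityˡ _) (zeroˡ 1#)
  ... | no _ | no _ | no _ = trans (+-identityˡ _) (zeroʳ 0#)

  -- As 1 + (a - 1) eₓ eₓᵀ; the number that `rankOne` asks to be inverted is then `a` itself.
  scaling : ∀ {a} → ¬ a ≈ 0# → Fin n → GL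
  scaling {a} a≉0 x = rankOne (unit x) (λ j → (a - 1#) * unit x j) (proj₁ (recip a≉0)) (begin
    r * (1# + dot (λ j → (a - 1#) * unit x j) (unit x))   ≈⟨ *-congˡ (+-congˡ (trans (dot-unitʳ _ x) (*-congˡ (𝟙-diag x)))) ⟩
    r * (1# + (a - 1#) * 1#)                             ≈⟨ solve 2 (λ r a → r :* (con ℤ.1ℤ :+ (a :- con ℤ.1ℤ) :* con ℤ.1ℤ) := r :* a) refl r a ⟩
    r * a                                                ≈⟨ proj₂ (recip a≉0) ⟩
    1#                                                   ∎)
    where r = proj₁ (recip a≉0)

  scaling≋ : ∀ {a} (a≉0 : ¬ a ≈ 0#) x → mat (scaling a≉0 x) ≋ scaleMatrix a x
  scaling≋ {a} a≉0 x i j with i Fin.≟ j | i Fin.≟ x | j Fin.≟ x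
  ... | yes _ | yes _ | yes _ = solve 1 (λ a → con ℤ.1ℤ :+ con ℤ.1ℤ :* ((a :- con ℤ.1ℤ) :* con ℤ.1ℤ) := a) refl a
  ... | yes _ | no _ | no _ = trans (+-congˡ (zeroˡ _)) (+-identityʳ _)
  ... | no _ | no _ | _ = trans (+-identityˡ _) (zeroˡ _)
  ... | no _ | yes _ | no _ = trans (+-identityˡ _) (trans (*-congˡ (zeroʳ _)) (zeroʳ _))
  ... | no i≢j | yes i≡x | yes j≡x = ⊥-elim (i≢j (≡.trans i≡x (≡.sym j≡x)))
  ... | yes i≡j | yes i≡x | no j≢x = ⊥-elim (j≢x (≡.trans (≡.sym i≡j) i≡x))
  ... | yes i≡j | no i≢x | yes j≡x = ⊥-elim (i≢x (≡.trans i≡j j≡x))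

-- The Cayley graph on the invertible matrices

module OperationGroup {c ℓ : Level} {q : ℕ} (F : FiniteField c ℓ q) (α : FiniteField.Carrier F)
                      {n : ℕ} (T : TransitionGraph n) where
  open Linear F n public hiding (product; inverse; identity; group-laws)
  open Group 𝔾 public
  open SimpleGraph (operationGraph F α T) public using () renaming (Adj to _~_)

  private module F = FiniteField F

  _≟G_ : B.Decidable _≈_
  X ≟G Y = map′ entrywise entries (mat X ≋? mat Y)

  ~-resp : ∀ {X X′ Y Y′} → X ≈ X′ → Y ≈ Y′ → X ~ Y → X′ ~ Y′
  ~-resp {X} {X′} {Y} {Y′} (entrywise p) (entrywise q) e =
    proj₂ (SimpleGraph.resp (operationGraph F α T)) {Y′} {X} {X′} p
      (proj₁ (SimpleGraph.resp (operationGraph F α T)) {X} {Y} {Y′} q e)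

  ~-sym : ∀ {X Y} → X ~ Y → Y ~ X
  ~-sym {X} {Y} = SimpleGraph.sym (operationGraph F α T) {X} {Y}

  ~-∙ʳ : ∀ {X Y} Z → X ~ Y → (X ∙ Z) ~ (Y ∙ Z)
  ~-∙ʳ {X} {Y} Z (X≉Y , steps) =
    (λ e → X≉Y (entries (cancelʳ (entrywise e)))) , [ (λ s → inj₁ (shift {X} {Y} s)) , (λ s → inj₂ (shift {Y} {X} s)) ]′ steps
    where
    cancelʳ : X ∙ Z ≈ Y ∙ Z → X ≈ Y
    cancelʳ e = trans (solve 2 (λ x z → x ⊜ (x ⊙ z) ⊙ inv z) refl X Z)
      (trans (∙-congʳ {Z ⁻¹} e) (solve 2 (λ x z → (x ⊙ z) ⊙ inv z ⊜ x) refl Y Z))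
      where open GroupSolver 𝔾 using (solve; _⊜_; _⊙_; inv)
    shift : ∀ {A B} → (∃ λ S → Ops α T S × mat B ≋ mat S ⊗ mat A) →
            ∃ λ S → Ops α T S × mat (B ∙ Z) ≋ mat S ⊗ mat (A ∙ Z)
    shift {A} {B} (S , S∈ , e) = S , S∈ ,
      ≋-trans (mat-∙ B Z) (≋-trans (⊗-cong e (≋-refl {mat Z})) (≋-trans (⊗-assoc (mat S) (mat A) (mat Z))
        (⊗-cong (≋-refl {mat S}) (≋-sym (mat-∙ A Z)))))

  adjacent : ∀ {S} → Ops α T S → ¬ ε ≈ S → ε ~ S
  adjacent {S} S∈ ε≉S = (λ e → ε≉S (entrywise e)) , inj₁ (S , S∈ , ≋-sym (≋-trans (⊗-cong (≋-refl {mat S}) mat-ε) (⊗𝟙 (mat S))))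

  ε~addition : ∀ {x y} (x≢y : x ≢ y) → TransitionGraph.Edge T x y → ε ~ addition x y x≢y
  ε~addition {x} {y} x≢y e = adjacent {addition x y x≢y} (add x y e (addition≋ x y x≢y))
    (λ (entrywise p) → F.1≉0 (F.trans (F.sym (entry (≋-trans (≋-sym mat-ε) p))) (𝟙-off y≢x)))
    where
    y≢x = λ e → x≢y (≡.sym e)
    entry : 𝟙 ≋ mat (addition x y x≢y) → 𝟙 y x F.≈ F.1#
    entry p = F.trans (p y x) (F.trans (F.+-cong (𝟙-off y≢x)
      (F.trans (F.*-cong (𝟙-diag y) (𝟙-diag x)) (F.*-identityˡ F.1#))) (F.+-identityˡ F.1#))

  ε~scaling : ∀ (α≉0 : ¬ α F.≈ F.0#) → q > 2 → ¬ α F.≈ F.1# → ∀ x → ε ~ scaling α≉0 x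
  ε~scaling α≉0 q>2 α≉1 x = adjacent {scaling α≉0 x} (scale q>2 x (scaling≋ α≉0 x))
    (λ (entrywise p) → α≉1 (F.trans (F.sym entry) (F.trans (F.sym (scaling≋ α≉0 x x x)) (F.trans (F.sym (p x x)) (F.trans (mat-ε x x) (𝟙-diag x))))))
    where
    entry : scaleMatrix α x x x F.≈ α
    entry with x Fin.≟ x
    ... | yes _ = F.refl
    ... | no n = ⊥-elim (n ≡.refl)

-- Powers of the generator and discrete logarithms

module Generator {c ℓ : Level} {q : ℕ} (F : FiniteField c ℓ q) (α : FiniteField.Carrier F)
                 (generates : IsGenerator F α) where
  open FiniteField F hiding (zero)
  open FieldFacts F
  open Exp semiring public using (^-homo-*; ^-assocʳ; ^-congˡ) renaming (_^_ to _^F_)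
  open SetoidReasoning setoid

  α≉0 : ¬ α ≈ 0#
  α≉0 = proj₁ generates

  recip≉0 : ∀ {x} (x≉0 : ¬ x ≈ 0#) → ¬ proj₁ (recip x≉0) ≈ 0#
  recip≉0 x≉0 = nonzero-factor (proj₂ (recip x≉0))

  power≉0 : ∀ k → ¬ α ^F k ≈ 0#
  power≉0 zero = 1≉0
  power≉0 (suc k) = nonzero-* α≉0 (power≉0 k)

  private
    -- The reciprocal of `α` is itself a power of `α`.
    someOrder : ∃ λ k → α ^F suc k ≈ 1#
    someOrder = let (k , e) = proj₂ generates (proj₁ (recip α≉0)) (recip≉0 α≉0) in
      k , trans (*-congˡ (sym e)) (trans (*-comm _ _) (proj₂ (recip α≉0)))

    least : ∀ fuel k → k ≤ fuel → α ^F suc k ≈ 1# →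
            ∃ λ p → α ^F suc p ≈ 1# × (∀ {j} → j < p → ¬ α ^F suc j ≈ 1#)
    least fuel k k≤ e with ℕ.anyUpTo? (λ j → α ^F suc j ≟F 1#) k
    ... | no n = k , e , λ j<k e′ → n (_ , j<k , e′)
    least zero zero k≤ e | yes (j , () , e′)
    least (suc fuel) k k≤ e | yes (j , j<k , e′) = least fuel j (ℕ.≤-pred (ℕ.≤-trans j<k k≤)) e′

  abstract
    -- Opaque, so that the search is not unfolded wherever the order occurs.
    leastOrder : ∃ λ p → α ^F suc p ≈ 1# × (∀ {j} → j < p → ¬ α ^F suc j ≈ 1#)
    leastOrder = least _ (proj₁ someOrder) ℕ.≤-refl (proj₂ someOrder)

  -- The order of `α` is `m = suc p`, so that `p` acts as -1 in exponents and reduction modulo `m`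
  -- is by a visibly nonzero number. It is q - 1, but no counting is involved.
  p : ℕ
  p = proj₁ leastOrder

  m : ℕ
  m = suc p

  α^m : α ^F m ≈ 1#
  α^m = proj₁ (proj₂ leastOrder)

  1^ : ∀ k → 1# ^F k ≈ 1#
  1^ zero = refl
  1^ (suc k) = trans (*-identityˡ _) (1^ k)

  α^*m : ∀ k → α ^F (k *ℕ m) ≈ 1#
  α^*m k = begin
    α ^F (k *ℕ m)    ≡⟨ ≡.cong (α ^F_) (ℕ.*-comm k m) ⟩
    α ^F (m *ℕ k)    ≈⟨ ^-assocʳ α m k ⟨
    (α ^F m) ^F k    ≈⟨ ^-congˡ k α^m ⟩
    1# ^F k          ≈⟨ 1^ k ⟩
    1#               ∎

  α^+m : ∀ a k → α ^F (a +ℕ k *ℕ m) ≈ α ^F a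
  α^+m a k = trans (^-homo-* α a (k *ℕ m)) (trans (*-congˡ (α^*m k)) (*-identityʳ _))

  α^% : ∀ k → α ^F k ≈ α ^F (k % m)
  α^% k = trans (reflexive (≡.cong (α ^F_) (m≡m%n+[m/n]*n k m))) (α^+m (k % m) (k / m))

  divides-order : ∀ k → α ^F k ≈ 1# → m ∣ k
  divides-order k e with k % m in eq | α^% k | m%n<n k m
  ... | zero | _ | _ = m%n≡0⇒n∣m k m eq
  ... | suc j | e′ | s≤s j<p = ⊥-elim (proj₂ (proj₂ leastOrder) j<p (trans (sym e′) e))

  power-cancel : ∀ a b → α ^F (a +ℕ b) ≈ α ^F a → m ∣ b
  power-cancel a b e = divides-order b (cancel (power≉0 a) (trans (sym (^-homo-* α a b)) (trans e (sym (*-identityʳ _)))))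

  private
    ordered : ∀ {a b} → a ≤ b → b < m → α ^F a ≈ α ^F b → a ≡ b
    ordered {a} {b} a≤b b<m e with b ∸ a in eq | power-cancel a (b ∸ a) (trans (reflexive (≡.cong (α ^F_) (ℕ.m+[n∸m]≡n a≤b))) (sym e))
    ... | zero | _ = ℕ.≤-antisym a≤b (ℕ.m∸n≡0⇒m≤n eq)
    ... | suc d | div = ⊥-elim (ℕ.<⇒≱ b<m (ℕ.≤-trans (∣⇒≤ div) (ℕ.≤-trans (ℕ.≤-reflexive (≡.sym eq)) (ℕ.m∸n≤m b a))))

  power-injective : ∀ {a b} → a < m → b < m → α ^F a ≈ α ^F b → a ≡ b
  power-injective {a} {b} a<m b<m e with ℕ.≤-total a b
  ... | inj₁ a≤b = ordered a≤b b<m e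
  ... | inj₂ b≤a = ≡.sym (ordered b≤a a<m (sym e))

  logarithm : ∀ {x} → ¬ x ≈ 0# → ∃ λ k → x ≈ α ^F k
  logarithm {x} x≉0 = proj₂ generates x x≉0

  bounded : ∀ {x} → ¬ x ≈ 0# → ∃ λ k → k ≤ p × x ≈ α ^F k
  bounded x≉0 = let (k , e) = logarithm x≉0 in k % m , ℕ.≤-pred (m%n<n k m) , trans e (α^% k)

  p≢0⇒α≉1 : 0 < p → ¬ α ≈ 1#
  p≢0⇒α≉1 0<p e with power-injective {1} {0} (s≤s 0<p) (s≤s z≤n) (trans (*-identityʳ α) e)
  ... | ()

  α≉1⇒0<p : ¬ α ≈ 1# → 0 < p
  α≉1⇒0<p α≉1 with p in eq
  ... | zero = ⊥-elim (α≉1 (trans (sym (*-identityʳ α)) (trans (reflexive (≡.cong (λ k → α ^F suc k) (≡.sym eq))) α^m)))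
  ... | suc _ = s≤s z≤n

  q>2 : ¬ α ≈ 1# → q > 2
  q>2 α≉1 = three-distinct (to 0#) (to 1#) (to α)
    (λ e → 1≉0 (sym (to-injective e))) (λ e → α≉0 (sym (to-injective e))) (λ e → α≉1 (sym (to-injective e)))
    where
    open Inverse enumeration using (to)
    three-distinct : ∀ {n} (i j k : Fin n) → i ≢ j → i ≢ k → j ≢ k → n > 2
    three-distinct {suc zero} zero zero _ n _ _ = ⊥-elim (n ≡.refl)
    three-distinct {suc (suc zero)} zero zero _ n _ _ = ⊥-elim (n ≡.refl)
    three-distinct {suc (suc zero)} zero (suc zero) zero _ n _ = ⊥-elim (n ≡.refl)
    three-distinct {suc (suc zero)} zero (suc zero) (suc zero) _ _ n = ⊥-elim (n ≡.refl)
    three-distinct {suc (suc zero)} (suc zero) (suc zero) _ n _ _ = ⊥-elim (n ≡.refl)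
    three-distinct {suc (suc zero)} (suc zero) zero zero _ _ n = ⊥-elim (n ≡.refl)
    three-distinct {suc (suc zero)} (suc zero) zero (suc zero) _ n _ = ⊥-elim (n ≡.refl)
    three-distinct {suc (suc (suc n))} _ _ _ _ _ _ = s≤s (s≤s (s≤s z≤n))

  -- If α = 1 then the field has only the elements 0 and 1, so that q > 2 fails.
  q≯2 : α ≈ 1# → ¬ q > 2
  q≯2 α≈1 (s≤s (s≤s (s≤s _))) = missing value
    where
    open Inverse enumeration using (to; from; strictlyInverseˡ)
    value : ∀ x → x ≈ 0# ⊎ x ≈ 1#
    value x with x ≟F 0#
    ... | yes e = inj₁ e
    ... | no n = let (k , e) = logarithm n in inj₂ (trans e (trans (^-congˡ k α≈1) (1^ k)))
    clash : ∀ i j → i ≢ j → ¬ from i ≈ from j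
    clash i j n e = n (≡.trans (≡.sym (strictlyInverseˡ i)) (≡.trans (Inverse.to-cong enumeration e) (strictlyInverseˡ j)))
    missing : (∀ x → x ≈ 0# ⊎ x ≈ 1#) → ⊥
    missing v with v (from zero) | v (from (suc zero)) | v (from (suc (suc zero)))
    ... | inj₁ a | inj₁ b | _ = clash zero (suc zero) (λ ()) (trans a (sym b))
    ... | inj₁ a | inj₂ b | inj₁ c = clash zero (suc (suc zero)) (λ ()) (trans a (sym c))
    ... | inj₁ a | inj₂ b | inj₂ c = clash (suc zero) (suc (suc zero)) (λ ()) (trans b (sym c))
    ... | inj₂ a | inj₁ b | inj₁ c = clash (suc zero) (suc (suc zero)) (λ ()) (trans b (sym c))
    ... | inj₂ a | inj₁ b | inj₂ c = clash zero (suc (suc zero)) (λ ()) (trans a (sym c))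
    ... | inj₂ a | inj₂ b | _ = clash zero (suc zero) (λ ()) (trans a (sym b))

-- Stabilisers of the last basis vector

module Stabilizers {c ℓ : Level} {q : ℕ} (F : FiniteField c ℓ q) (α : FiniteField.Carrier F)
                   {n : ℕ} (T : TransitionGraph n) where
  open OperationGroup F α T public
  open Cayley 𝔾 _≟G_ glElements glListed _~_ (λ {x} {x′} {y} {y′} → ~-resp {x} {x′} {y} {y′})
    (λ {x} {y} → ~-sym {x} {y}) (λ {x} {y} z → ~-∙ʳ {x} {y} z) public
  private module F = FiniteField F
  open F using (0#; 1#) renaming (_≈_ to _≈F_; _+_ to _+F_; _*_ to _*F_; -_ to -F_; _-_ to _-F_; Carrier to K)
  open FieldFacts F
  open Summation F.semiring using (sum; sum-cong-≋; *-distribˡ-sum; ∑-distrib-+; sum-replicate-zero)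

  whole : Subgroup
  whole = record { Mem = λ _ → ⊤ ; resp = λ _ _ → tt ; ε∈ = tt ; ∙∈ = λ _ _ → tt ; ⁻¹∈ = λ _ → tt ; mem? = λ _ → yes tt }

  ▹-inverse : ∀ X {v w} → mat X ▹ v ≗ w → mat (X ⁻¹) ▹ w ≗ v
  ▹-inverse X@(_ , Y , YX , _) {v} {w} e i =
    F.trans (▹-cong (mat-⁻¹ X) (λ k → F.sym (e k)) i)
      (F.trans (F.sym (▹-assoc Y (mat X) v i)) (F.trans (▹-cong YX (λ _ → F.refl) i) (𝟙▹ v i)))

  ◃-inverse : ∀ X {v w} → v ◃ mat X ≗ w → w ◃ mat (X ⁻¹) ≗ v
  ◃-inverse X@(_ , Y , _ , XY) {v} {w} e i =
    F.trans (◃-cong (λ k → F.sym (e k)) (mat-⁻¹ X) i)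
      (F.trans (F.sym (◃-assoc v (mat X) Y i)) (F.trans (◃-cong (λ _ → F.refl) XY i) (◃𝟙 v i)))

  ▹-∙ : ∀ X Y {u v w} → mat Y ▹ u ≗ v → mat X ▹ v ≗ w → mat (X ∙ Y) ▹ u ≗ w
  ▹-∙ X Y {u} e e′ i = F.trans (▹-cong (mat-∙ X Y) (λ _ → F.refl) i)
    (F.trans (▹-assoc (mat X) (mat Y) u i) (F.trans (▹-cong (≋-refl {mat X}) e i) (e′ i)))

  ◃-∙ : ∀ X Y {u v w} → u ◃ mat X ≗ v → v ◃ mat Y ≗ w → u ◃ mat (X ∙ Y) ≗ w
  ◃-∙ X Y {u} e e′ i = F.trans (◃-cong (λ _ → F.refl) (mat-∙ X Y) i)
    (F.trans (◃-assoc u (mat X) (mat Y) i) (F.trans (◃-cong e (≋-refl {mat Y}) i) (e′ i)))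

  ▹-ε : ∀ v → mat ε ▹ v ≗ v
  ▹-ε v i = F.trans (▹-cong mat-ε (λ _ → F.refl) i) (𝟙▹ v i)

  ◃-ε : ∀ v → v ◃ mat ε ≗ v
  ◃-ε v i = F.trans (◃-cong (λ _ → F.refl) mat-ε i) (◃𝟙 v i)

  ▹-scale : ∀ X s v → X ▹ (λ k → s *F v k) ≗ λ i → s *F (X ▹ v) i
  ▹-scale X s v i = F.trans
    (sum-cong-≋ {x = λ k → X i k *F (s *F v k)} {y = λ k → s *F (X i k *F v k)}
      (λ k → R.solve 3 (λ x s v → x R.:* (s R.:* v) R.:= s R.:* (x R.:* v)) F.refl (X i k) s (v k)))
    (F.sym (*-distribˡ-sum s (λ k → X i k *F v k)))
    where module R = IntegerSolver F.commutativeRing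

  fixesColumn : Vect → Subgroup
  fixesColumn w = record
    { Mem = λ X → mat X ▹ w ≗ w
    ; resp = λ (entrywise e) p i → F.trans (▹-cong (≋-sym e) (λ _ → F.refl) i) (p i)
    ; ε∈ = ▹-ε w
    ; ∙∈ = λ {X} {Y} p q → ▹-∙ X Y q p
    ; ⁻¹∈ = λ {X} p → ▹-inverse X p
    ; mem? = λ X → Fin.all? (λ i → (mat X ▹ w) i ≟F w i) }

  fixesRow : Vect → Subgroup
  fixesRow v = record
    { Mem = λ X → v ◃ mat X ≗ v
    ; resp = λ (entrywise e) p i → F.trans (◃-cong (λ _ → F.refl) (≋-sym e) i) (p i)
    ; ε∈ = ◃-ε v
    ; ∙∈ = λ {X} {Y} p q → ◃-∙ X Y p q
    ; ⁻¹∈ = λ {X} p → ◃-inverse X p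
    ; mem? = λ X → Fin.all? (λ i → (v ◃ mat X) i ≟F v i) }

  infixr 6 _∩_
  _∩_ : Subgroup → Subgroup → Subgroup
  A ∩ B = record
    { Mem = λ X → Mem A X × Mem B X
    ; resp = λ e (p , p′) → resp A e p , resp B e p′
    ; ε∈ = ε∈ A , ε∈ B
    ; ∙∈ = λ (p , p′) (q , q′) → ∙∈ A p q , ∙∈ B p′ q′
    ; ⁻¹∈ = λ (p , p′) → ⁻¹∈ A p , ⁻¹∈ B p′
    ; mem? = λ X → mem? A X ×-dec mem? B X }
    where open Subgroup

  -- The eigenvalue is read off the matrix as its entry at (x , x), which leaves nothing to be
  -- searched for when membership is decided.
  fixesLine : Fin n → Subgroup
  fixesLine x = record
    { Mem = λ X → mat X ▹ unit x ≗ λ i → mat X x x *F unit x i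
    ; resp = λ (entrywise e) p i → F.trans (▹-cong (≋-sym e) (λ _ → F.refl) i) (F.trans (p i) (F.*-congʳ (e x x)))
    ; ε∈ = λ i → F.trans (▹-ε (unit x) i) (F.sym (F.trans (F.*-congʳ (F.trans (mat-ε x x) (𝟙-diag x))) (F.*-identityˡ _)))
    ; ∙∈ = λ {X} {Y} p q → eigen→line (X ∙ Y) (▹-∙ X Y q (λ i →
        F.trans (▹-scale (mat X) (mat Y x x) (unit x) i) (F.trans (F.*-congˡ (p i)) (F.sym (F.*-assoc _ _ _)))))
    ; ⁻¹∈ = λ {X} p → eigen→line (X ⁻¹) (inverted X p)
    ; mem? = λ X → Fin.all? (λ i → (mat X ▹ unit x) i ≟F (mat X x x *F unit x i)) }
    where
    eigen→line : ∀ X {s} → mat X ▹ unit x ≗ (λ i → s *F unit x i) → mat X ▹ unit x ≗ λ i → mat X x x *F unit x i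
    eigen→line X {s} p i = F.trans (p i) (F.*-congʳ (F.sym (F.trans (F.sym (▹unit (mat X) x x))
      (F.trans (p x) (F.trans (F.*-congˡ (𝟙-diag x)) (F.*-identityʳ s))))))
    inverted : ∀ X → mat X ▹ unit x ≗ (λ i → mat X x x *F unit x i) →
              mat (X ⁻¹) ▹ unit x ≗ λ i → mat (X ⁻¹) x x *F unit x i
    inverted X p i = F.trans (F.sym (F.trans (F.*-congˡ r≈) (F.*-identityʳ _)))
      (F.trans (F.*-comm _ _) (F.trans (F.*-assoc _ _ _) (F.trans (F.*-congˡ (back i)) F.refl)))
      where
      r = mat (X ⁻¹) x x
      back : (λ i → mat X x x *F (mat (X ⁻¹) ▹ unit x) i) ≗ unit x
      back i = F.trans (F.sym (▹-scale (mat (X ⁻¹)) (mat X x x) (unit x) i)) (▹-inverse X p i)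
      r≈ : r *F mat X x x ≈F 1#
      r≈ = F.trans (F.*-comm _ _) (F.trans (F.*-congˡ (F.sym (▹unit (mat (X ⁻¹)) x x))) (F.trans (back x) (𝟙-diag x)))

  column⇒line : ∀ {x X} → Subgroup.Mem (fixesColumn (unit x)) X → Subgroup.Mem (fixesLine x) X
  column⇒line {x} {X} p i = F.trans (p i) (F.sym (F.trans (F.*-congʳ
    (F.trans (F.sym (▹unit (mat X) x x)) (F.trans (p x) (𝟙-diag x)))) (F.*-identityˡ _)))

  eigenline : ∀ {x X s} → mat X ▹ unit x ≗ (λ i → s *F unit x i) → Subgroup.Mem (fixesLine x) X
  eigenline {x} {X} {s} p i = F.trans (p i) (F.*-congʳ (F.sym (F.trans (F.sym (▹unit (mat X) x x))
      (F.trans (p x) (F.trans (F.*-congˡ (𝟙-diag x)) (F.*-identityʳ s))))))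

  ◃-resp : ∀ {X Y v w} → X ≈ Y → v ◃ mat X ≗ w → v ◃ mat Y ≗ w
  ◃-resp (entrywise e) p i = F.trans (◃-cong (λ _ → F.refl) (≋-sym e) i) (p i)

  ▹-resp : ∀ {X Y v w} → X ≈ Y → mat X ▹ v ≗ w → mat Y ▹ v ≗ w
  ▹-resp (entrywise e) p i = F.trans (▹-cong (≋-sym e) (λ _ → F.refl) i) (p i)

  dot-+ʳ : ∀ b u w → dot b (λ l → u l +F w l) ≈F dot b u +F dot b w
  dot-+ʳ b u w = F.trans (sum-cong-≋ {x = λ l → b l *F (u l +F w l)} {y = λ l → b l *F u l +F b l *F w l}
    (λ l → F.distribˡ (b l) (u l) (w l))) (∑-distrib-+ (λ l → b l *F u l) (λ l → b l *F w l))

  dot-+ˡ : ∀ u w a → dot (λ l → u l +F w l) a ≈F dot u a +F dot w a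
  dot-+ˡ u w a = F.trans (sum-cong-≋ {x = λ l → (u l +F w l) *F a l} {y = λ l → u l *F a l +F w l *F a l}
    (λ l → F.distribʳ (a l) (u l) (w l))) (∑-distrib-+ (λ l → u l *F a l) (λ l → w l *F a l))

  addition-entry : ∀ x y (n : x ≢ y) → mat (addition x y n) y x ≈F 1#
  addition-entry x y n = F.trans (F.+-cong (𝟙-off (λ e → n (≡.sym e)))
    (F.trans (F.*-cong (𝟙-diag y) (𝟙-diag x)) (F.*-identityˡ 1#))) (F.+-identityˡ 1#)

  addition-off : ∀ x y (n : x ≢ y) {i j} → i ≢ j → i ≢ y → mat (addition x y n) i j ≈F 0#
  addition-off x y n i≢j i≢y = F.trans (F.+-cong (𝟙-off i≢j) (F.trans (F.*-congʳ (𝟙-off i≢y)) (F.zeroˡ _))) (F.+-identityˡ 0#)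

  addition-row : ∀ x y (n : x ≢ y) X i j → mat (addition x y n ∙ X) i j ≈F mat X i j +F unit y i *F mat X x j
  addition-row x y n X i j = F.trans (mat-∙ (addition x y n) X i j)
    (F.trans (pert⊗ (unit y) (unit x) (mat X) i j) (F.+-congˡ (F.*-congˡ (unit◃ x (mat X) j))))

  scaleRow : ∀ {a} (a≉0 : ¬ a ≈F 0#) x Y j → mat (scaling a≉0 x ∙ Y) x j ≈F a *F mat Y x j
  scaleRow {a} a≉0 x Y j = begin
    mat (scaling a≉0 x ∙ Y) x j                         ≈⟨ mat-∙ (scaling a≉0 x) Y x j ⟩
    (mat (scaling a≉0 x) ⊗ mat Y) x j                   ≈⟨ pert⊗ (unit x) b (mat Y) x j ⟩
    mat Y x j +F unit x x *F (b ◃ mat Y) j              ≈⟨ F.+-congˡ (F.*-cong (𝟙-diag x) (b◃ j)) ⟩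
    mat Y x j +F 1# *F ((a -F 1#) *F mat Y x j)         ≈⟨ R.solve 2 (λ y a → y R.:+ R.con ℤ.1ℤ R.:* ((a R.:- R.con ℤ.1ℤ) R.:* y) R.:= a R.:* y) F.refl (mat Y x j) a ⟩
    a *F mat Y x j                                      ∎
    where
    open SetoidReasoning F.setoid
    module R = IntegerSolver F.commutativeRing
    b : Vect
    b j = (a -F 1#) *F unit x j
    b◃ : ∀ j → (b ◃ mat Y) j ≈F (a -F 1#) *F mat Y x j
    b◃ j = F.trans (sum-cong-≋ {x = λ k → b k *F mat Y k j} {y = λ k → (a -F 1#) *F (unit x k *F mat Y k j)}
        (λ k → F.*-assoc (a -F 1#) (unit x k) (mat Y k j)))
      (F.trans (F.sym (*-distribˡ-sum (a -F 1#) (λ k → unit x k *F mat Y k j))) (F.*-congˡ (unit◃ x (mat Y) j)))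

  otherRow : ∀ {a} (a≉0 : ¬ a ≈F 0#) x Y {i} j → i ≢ x → mat (scaling a≉0 x ∙ Y) i j ≈F mat Y i j
  otherRow {a} a≉0 x Y {i} j i≢x = F.trans (mat-∙ (scaling a≉0 x) Y i j) (F.trans (pert⊗ (unit x) b (mat Y) i j)
    (F.trans (F.+-congˡ (F.trans (F.*-congʳ (𝟙-off i≢x)) (F.zeroˡ _))) (F.+-identityʳ _)))
    where
    b : Vect
    b j = (a -F 1#) *F unit x j

  nonzeroRow : ∀ X i → ¬ (∀ j → mat X i j ≈F 0#)
  nonzeroRow X@(Y , W , _ , YW) i z = F.1≉0 (begin
    1#                        ≈⟨ 𝟙-diag i ⟨
    𝟙 i i                     ≈⟨ YW i i ⟨
    (Y ⊗ W) i i               ≈⟨ sum-cong-≋ {x = λ k → Y i k *F W k i} {y = λ _ → 0#} (λ k → F.trans (F.*-congʳ (z k)) (F.zeroˡ (W k i))) ⟩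
    sum (λ (_ : Fin n) → 0#)  ≈⟨ sum-replicate-zero n ⟩
    0#                        ∎)
    where open SetoidReasoning F.setoid

  scaling-off : ∀ {a} (a≉0 : ¬ a ≈F 0#) {i j x} → i ≢ j → mat (scaling a≉0 x) i j ≈F 0#
  scaling-off {a} a≉0 {i} {j} {x} i≢j = F.trans (scaling≋ a≉0 x i j) off
    where
    off : scaleMatrix a x i j ≈F 0#
    off with i Fin.≟ j
    ... | yes e = ⊥-elim (i≢j e)
    ... | no _ = F.refl

  addition≉ε : ∀ x y (n : x ≢ y) → ¬ addition x y n ≈ ε
  addition≉ε x y n e = F.1≉0 (F.trans (F.sym (addition-entry x y n)) (F.trans (entries e y x) (F.trans (mat-ε y x) (𝟙-off (λ e → n (≡.sym e))))))

  scaling-entry : ∀ {a} (a≉0 : ¬ a ≈F 0#) x → mat (scaling a≉0 x) x x ≈F a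
  scaling-entry {a} a≉0 x = F.trans (F.+-cong (𝟙-diag x) (F.*-cong (𝟙-diag x) (F.*-congˡ (𝟙-diag x))))
    (R.solve 1 (λ a → R.con ℤ.1ℤ R.:+ R.con ℤ.1ℤ R.:* ((a R.:- R.con ℤ.1ℤ) R.:* R.con ℤ.1ℤ) R.:= a) F.refl a)
    where module R = IntegerSolver F.commutativeRing

  scaling≉ε : ∀ {a} (a≉0 : ¬ a ≈F 0#) → ¬ a ≈F 1# → ∀ x → ¬ scaling a≉0 x ≈ ε
  scaling≉ε a≉0 a≉1 x e = a≉1 (F.trans (F.sym (scaling-entry a≉0 x)) (F.trans (entries e x x) (F.trans (mat-ε x x) (𝟙-diag x))))

  -- When the two cross products b · a′ and b′ · a vanish, either order gives 1 + a bᵀ + a′ b′ᵀ.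
  pert-commute : ∀ a b a′ b′ → dot b a′ ≈F 0# → dot b′ a ≈F 0# → pert a b ⊗ pert a′ b′ ≋ pert a′ b′ ⊗ pert a b
  pert-commute a b a′ b′ p q i j = F.trans (expand a b a′ b′ p i j)
    (F.trans (F.trans (F.+-assoc _ _ _) (F.trans (F.+-congˡ (F.+-comm _ _)) (F.sym (F.+-assoc _ _ _))))
             (F.sym (expand a′ b′ a b q i j)))
    where
    expand : ∀ a b a′ b′ → dot b a′ ≈F 0# → ∀ i j → (pert a b ⊗ pert a′ b′) i j ≈F (𝟙 i j +F a i *F b j) +F a′ i *F b′ j
    expand a b a′ b′ p i j = F.trans (⊗pert (pert a b) a′ b′ i j) (F.+-congˡ (F.*-congʳ
      (F.trans (pert▹ a b a′ i) (F.trans (F.+-congˡ (F.trans (F.*-congˡ p) (F.zeroʳ _))) (F.+-identityʳ _)))))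

  commute : ∀ {X Y} → mat X ⊗ mat Y ≋ mat Y ⊗ mat X → X ∙ Y ≈ Y ∙ X
  commute {X} {Y} e = entrywise (≋-trans (mat-∙ X Y) (≋-trans e (≋-sym (mat-∙ Y X))))

  pert-fixes : ∀ a b w → dot b w ≈F 0# → pert a b ▹ w ≗ w
  pert-fixes a b w p i = F.trans (pert▹ a b w i) (F.trans (F.+-congˡ (F.trans (F.*-congˡ p) (F.zeroʳ _))) (F.+-identityʳ _))

  fixes-pert : ∀ v a b → dot v a ≈F 0# → v ◃ pert a b ≗ v
  fixes-pert v a b p j = F.trans (◃pert v a b j) (F.trans (F.+-congˡ (F.trans (F.*-congʳ p) (F.zeroˡ _))) (F.+-identityʳ _))

  dot-units : ∀ {x y} → x ≢ y → dot (unit x) (unit y) ≈F 0#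
  dot-units {x} {y} ne = F.trans (dot-unitˡ x (unit y)) (𝟙-off ne)

  commuting : ∀ (H : Subgroup) s {k} → s ∙ k ≈ k ∙ s → Subgroup.Mem H k → Subgroup.Mem H (s ∙ k ∙ s ⁻¹)
  commuting H s {k} e p = Subgroup.resp H (trans (solve 2 (λ s k → k ⊜ (k ⊙ s) ⊙ inv s) refl s k) (∙-congʳ (sym e))) p
    where open GroupSolver 𝔾 using (solve; _⊜_; _⊙_; inv)

-- From the block matrices to the affine matrices

module Levels {c ℓ : Level} {q : ℕ} (F : FiniteField c ℓ q) (α : FiniteField.Carrier F) (generates : IsGenerator F α)
              {k : ℕ} (T : TransitionGraph (suc k)) where
  open Stabilizers F α T public
  open Generator F α generates
  private module F = FiniteField F
  open F using (0#; 1#) renaming (_≈_ to _≈F_; _+_ to _+F_; _*_ to _*F_; -_ to -F_; _-_ to _-F_; Carrier to K)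
  open FieldFacts F
  open Subgroup
  open GroupSolver 𝔾 using (solve; _⊜_; _⊙_; inv)
  private module R = IntegerSolver F.commutativeRing

  end : Fin (suc k)
  end = fromℕ k

  Block Affine Parabolic : Subgroup
  Affine = fixesColumn (unit end)
  Block = Affine ∩ fixesRow (unit end)
  Parabolic = fixesLine end

  end≢ : ∀ (i : Fin k) → end ≢ inject₁ i
  end≢ i = Fin.fromℕ≢inject₁

  ≢end : ∀ (i : Fin k) → inject₁ i ≢ end
  ≢end i e = end≢ i (≡.sym e)

  inject≢ : ∀ {i j : Fin k} → i ≢ j → inject₁ i ≢ inject₁ j
  inject≢ n e = n (Fin.inject₁-injective e)

  affine-pert : ∀ a b → b end ≈F 0# → pert a b ▹ unit end ≗ unit end
  affine-pert a b e = pert-fixes a b (unit end) (F.trans (dot-unitʳ b end) e)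

  row-pert : ∀ a b → a end ≈F 0# → unit end ◃ pert a b ≗ unit end
  row-pert a b e = fixes-pert (unit end) a b (F.trans (dot-unitˡ end a) e)

  somewhere : ∀ {v w : Vect} → ¬ v ≗ w → ∃ λ i → ¬ v i ≈F w i
  somewhere {v} {w} n = let (i , m , _) = Fin.¬∀⟶∃¬-smallest _ (λ i → v i ≈F w i) (λ i → v i ≟F w i) n in i , m

  -- Within `Affine` the last row decides: it is that of the identity exactly on `Block`, and right
  -- cosets of `Block` are told apart by it. The last row of `s` is the sum of the unit rows at
  -- `end` and `i`.
  module BlockToAffine (i : Fin k) (edge : TransitionGraph.Edge T (inject₁ i) end) where
    s : GL
    s = addition (inject₁ i) end (≢end i)

    ε~s : ε ~ s
    ε~s = ε~addition (≢end i) edge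

    s∈ : Mem Affine s
    s∈ = affine-pert (unit end) (unit (inject₁ i)) (𝟙-off (end≢ i))

    row-s : unit end ◃ mat s ≗ λ j → unit end j +F unit (inject₁ i) j
    row-s j = F.trans (◃pert (unit end) (unit end) (unit (inject₁ i)) j)
      (F.+-congˡ (F.trans (F.*-congʳ (F.trans (dot-unitˡ end (unit end)) (𝟙-diag end))) (F.*-identityˡ _)))

    s∉ : ¬ Mem Block s
    s∉ (_ , p) = F.1≉0 (F.trans (F.sym (𝟙-diag (inject₁ i)))
      (F.trans (F.sym (F.+-identityˡ _)) (F.trans (F.+-congʳ (F.sym (𝟙-off (≢end i)))) (F.trans (F.sym (row-s (inject₁ i)))
        (F.trans (p (inject₁ i)) (𝟙-off (≢end i)))))))

    i′ : Fin (suc k)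
    i′ = inject₁ i

    -- A column vector a whose rank-one perturbation 1 + a bᵀ with b = v − eᵢ is invertible and has row v in position i.
    pivot : ∀ (v : Vect) → v end ≈F 0# → ∀ j → ¬ v j ≈F 0# →
            ∃ λ a → a end ≈F 0# × a i′ ≈F 1# × ¬ 1# +F dot (λ l → v l -F unit i′ l) a ≈F 0#
    pivot v v-end j vj≉0 with v i′ ≟F 0#
    ... | no n = unit i′ , 𝟙-off (end≢ i) , 𝟙-diag i′ , λ e → n (F.trans (F.sym (begin
      1# +F dot b (unit i′)              ≈⟨ F.+-congˡ (dot-unitʳ b i′) ⟩
      1# +F (v i′ -F unit i′ i′)         ≈⟨ F.+-congˡ (F.+-congˡ (F.-‿cong (𝟙-diag i′))) ⟩
      1# +F (v i′ -F 1#)                 ≈⟨ R.solve 1 (λ v → R.con ℤ.1ℤ R.:+ (v R.:- R.con ℤ.1ℤ) R.:= v) F.refl (v i′) ⟩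
      v i′                               ∎)) e)
      where
      open SetoidReasoning F.setoid
      b : Vect
      b l = v l -F unit i′ l
    -- The unit vector at `i` would give 0 here. Adding the unit vector at `j` makes 1 + b · a equal
    -- to the nonzero entry `v j`.
    ... | yes z = (λ l → unit i′ l +F unit j l)
      , F.trans (F.+-cong (𝟙-off (end≢ i)) (𝟙-off j≢end)) (F.+-identityˡ 0#)
      , F.trans (F.+-cong (𝟙-diag i′) (𝟙-off i′≢j)) (F.+-identityʳ 1#)
      , λ e → vj≉0 (F.trans (F.sym (begin
      1# +F dot b (λ l → unit i′ l +F unit j l)           ≈⟨ F.+-congˡ (dot-+ʳ b (unit i′) (unit j)) ⟩
      1# +F (dot b (unit i′) +F dot b (unit j))           ≈⟨ F.+-congˡ (F.+-cong (dot-unitʳ b i′) (dot-unitʳ b j)) ⟩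
      1# +F (b i′ +F b j)                                 ≈⟨ F.+-congˡ (F.+-cong (F.+-cong z (F.-‿cong (𝟙-diag i′))) (F.+-congˡ (F.-‿cong (𝟙-off (λ e → i′≢j (≡.sym e)))))) ⟩
      1# +F ((0# -F 1#) +F (v j -F 0#))                   ≈⟨ R.solve 1 (λ v → R.con ℤ.1ℤ R.:+ ((R.con ℤ.0ℤ R.:- R.con ℤ.1ℤ) R.:+ (v R.:- R.con ℤ.0ℤ)) R.:= v) F.refl (v j) ⟩
      v j                                                 ∎)) e)
      where
      open SetoidReasoning F.setoid
      b : Vect
      b l = v l -F unit i′ l
      i′≢j : i′ ≢ j
      i′≢j e = vj≉0 (≡.subst (λ l → v l ≈F 0#) e z)
      j≢end : end ≢ j
      j≢end e = vj≉0 (≡.subst (λ l → v l ≈F 0#) e v-end)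

    -- `h′` keeps the last row and has its row `i` adjusted so that `s ∙ h′` gets the last row of
    -- `x`. Hence `x ∙ (s ∙ h′) ⁻¹` fixes the last unit row.
    throughPivot : ∀ {x} → Mem Affine x → ∀ a → a end ≈F 0# → a i′ ≈F 1# → ∀ r →
                   (let b = λ l → (mat x end l -F unit end l) -F unit i′ l) →
                   b end ≈F 0# → r *F (1# +F dot b a) ≈F 1# →
                   ∃₂ λ h h′ → Mem Block h × Mem Block h′ × x ≈ h ∙ s ∙ h′
    throughPivot {x} x∈ a a-end a-i r b-end unitary =
      x ∙ (s ∙ h′) ⁻¹ , h′ , (h∈ , h-row) , h′∈ , solve 3 (λ x s h → x ⊜ (x ⊙ inv (s ⊙ h)) ⊙ s ⊙ h) refl x s h′
      where
      b u : Vect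
      b l = (mat x end l -F unit end l) -F unit i′ l
      u l = unit end l +F unit i′ l
      h′ : GL
      h′ = rankOne a b r unitary
      h′∈ : Mem Block h′
      h′∈ = affine-pert a b b-end , row-pert a b a-end
      h∈ : Mem Affine (x ∙ (s ∙ h′) ⁻¹)
      h∈ = ∙∈ Affine {x} {(s ∙ h′) ⁻¹} x∈ (⁻¹∈ Affine {s ∙ h′} (∙∈ Affine {s} {h′} s∈ (proj₁ h′∈)))
      dot-a : dot u a ≈F 1#
      dot-a = F.trans (dot-+ˡ (unit end) (unit i′) a)
        (F.trans (F.+-cong (F.trans (dot-unitˡ end a) a-end) (F.trans (dot-unitˡ i′ a) a-i)) (F.+-identityˡ 1#))
      sh′-row : unit end ◃ mat (s ∙ h′) ≗ mat x end
      sh′-row j = F.trans (◃-∙ s h′ {unit end} {u} row-s (◃pert u a b) j)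
        (F.trans (F.+-congˡ (F.trans (F.*-congʳ dot-a) (F.*-identityˡ (b j))))
          (R.solve 3 (λ e u x → (e R.:+ u) R.:+ ((x R.:- e) R.:- u) R.:= x) F.refl (unit end j) (unit i′ j) (mat x end j)))
      h-row : unit end ◃ mat (x ∙ (s ∙ h′) ⁻¹) ≗ unit end
      h-row = ◃-∙ x ((s ∙ h′) ⁻¹) {unit end} {mat x end} {unit end} (unit◃ end (mat x)) (◃-inverse (s ∙ h′) {unit end} {mat x end} sh′-row)

    Factors : GL → Set _
    Factors x = ∃₂ λ h h′ → Mem Block h × Mem Block h′ × x ≈ h ∙ s ∙ h′

    double : ∀ {x} → Mem Affine x → ¬ Mem Block x → Factors x
    double {x} x∈ x∉ = finish (somewhere {unit end ◃ mat x} {unit end} (λ p → x∉ (x∈ , p)))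
      where
      v b : Vect
      v j = mat x end j -F unit end j
      b l = v l -F unit i′ l
      v-end : v end ≈F 0#
      v-end = F.trans (F.+-congʳ (F.trans (F.sym (▹unit (mat x) end end)) (x∈ end))) (F.-‿inverseʳ (unit end end))
      b-end : b end ≈F 0#
      b-end = F.trans (F.+-cong v-end (F.-‿cong (𝟙-off (end≢ i)))) (F.-‿inverseʳ 0#)
      withPivot : (∃ λ a → a end ≈F 0# × a i′ ≈F 1# × ¬ 1# +F dot b a ≈F 0#) → Factors x
      withPivot (a , a-end , a-i , invertible) =
        throughPivot {x} x∈ a a-end a-i (proj₁ (recip invertible)) b-end (proj₂ (recip invertible))
      finish : (∃ λ j → ¬ (unit end ◃ mat x) j ≈F unit end j) → Factors x
      finish (j , n) = withPivot (pivot v v-end j (λ e → n (F.trans (unit◃ end (mat x) j) (difference e))))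

    module _ {l : Fin k} (l≢i : l ≢ i) where
      private
        l′ = inject₁ l
        l′≢i′ : l′ ≢ i′
        l′≢i′ = inject≢ l≢i
        i′≢l′ : i′ ≢ l′
        i′≢l′ = inject≢ (λ e → l≢i (≡.sym e))

      addition∈Block : ∀ (x y : Fin k) (n : inject₁ x ≢ inject₁ y) → Mem Block (addition (inject₁ x) (inject₁ y) n)
      addition∈Block x y n = affine-pert (unit (inject₁ y)) (unit (inject₁ x)) (𝟙-off (end≢ x)) , row-pert (unit (inject₁ y)) (unit (inject₁ x)) (𝟙-off (end≢ y))

      mover : GL
      mover = addition l′ i′ l′≢i′

      -- If the conjugate were in `Block`, `mover` would fix the last row `u` of `s`. But `u` has a
      -- 1 at `i`, so `mover` adds the unit row at `l` to it.
      moves : ¬ Mem Block (s ∙ mover ∙ s ⁻¹)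
      moves (_ , p) = F.1≉0 (begin
        1#                                                    ≈⟨ F.*-identityˡ 1# ⟨
        1# *F 1#                                              ≈⟨ F.*-cong dot-u (𝟙-diag l′) ⟨
        dot u (unit i′) *F unit l′ l′                         ≈⟨ R.solve 2 (λ u d → d R.:= (u R.:+ d) R.:- u) F.refl (u l′) _ ⟩
        (u l′ +F dot u (unit i′) *F unit l′ l′) -F u l′       ≈⟨ F.+-congʳ (◃pert u (unit i′) (unit l′) l′) ⟨
        (u ◃ mat mover) l′ -F u l′                            ≈⟨ F.+-congʳ (◃-∙ s mover {unit end} {u} {u ◃ mat mover} row-s (λ _ → F.refl) l′) ⟨
        (unit end ◃ mat (s ∙ mover)) l′ -F u l′               ≈⟨ F.+-congʳ (◃-resp {v = unit end} {u} (solve 2 (λ s m → (s ⊙ m ⊙ inv s) ⊙ s ⊜ s ⊙ m) refl s mover) (◃-∙ (s ∙ mover ∙ s ⁻¹) s {unit end} {unit end} {u} p row-s) l′) ⟩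
        u l′ -F u l′                                          ≈⟨ F.-‿inverseʳ _ ⟩
        0#                                                    ∎)
        where
        open SetoidReasoning F.setoid
        u : Vect
        u j = unit end j +F unit i′ j
        dot-u : dot u (unit i′) ≈F 1#
        dot-u = F.trans (dot-unitʳ u i′) (F.trans (F.+-cong (𝟙-off (≢end i)) (𝟙-diag i′)) (F.+-identityˡ 1#))

      k₁ : GL
      k₁ = addition i′ l′ i′≢l′

      -- `k₁` adds row `i` to row `l`. It commutes with `s`, which adds row `i` elsewhere, so
      -- conjugation by `s` does not move it; the same is asked of `k₂`.
      connected : (k₂ : GL) → Mem Block k₂ → s ∙ k₂ ≈ k₂ ∙ s → ¬ k₂ ≈ ε → ¬ k₁ ≈ k₂ →
                  Connected Block → Connected Affine
      connected k₂ k₂∈ k₂-comm k₂≉ε k₁≉k₂ hc = JoinTrivial.connected Block Affine (λ {x} → Block⊆Affine {x}) hc s ε~s s∈ s∉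
        (λ {x} → double {x}) k₁ k₂ k₁≉ε k₂≉ε k₁≉k₂ k₁∈ k₂∈ k₁ˢ∈ k₂ˢ∈ mover mover∈ moves
        where
        k₁-comm : s ∙ k₁ ≈ k₁ ∙ s
        k₁-comm = commute {s} {k₁} (pert-commute (unit end) (unit i′) (unit l′) (unit i′) (dot-units i′≢l′) (dot-units (≢end i)))
        k₁≉ε : ¬ k₁ ≈ ε
        k₁≉ε = addition≉ε i′ l′ i′≢l′
        k₁∈ : Mem Block k₁
        k₁∈ = addition∈Block i l i′≢l′
        k₁ˢ∈ : Mem Block (s ∙ k₁ ∙ s ⁻¹)
        k₁ˢ∈ = commuting Block s {k₁} k₁-comm k₁∈
        k₂ˢ∈ : Mem Block (s ∙ k₂ ∙ s ⁻¹)
        k₂ˢ∈ = commuting Block s {k₂} k₂-comm k₂∈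
        mover∈ : Mem Block mover
        mover∈ = addition∈Block l i l′≢i′
        Block⊆Affine : ∀ {x} → Mem Block x → Mem Affine x
        Block⊆Affine (p , _) = p

      connectedByScaling : (α≉1 : ¬ α ≈F 1#) → Connected Block → Connected Affine
      connectedByScaling α≉1 = connected k₂ k₂∈ k₂-comm (scaling≉ε α≉0 α≉1 l′) k₁≉k₂
        where
        k₂ : GL
        k₂ = scaling α≉0 l′
        b : Vect
        b j = (α -F 1#) *F unit l′ j
        b-off : ∀ {j} → j ≢ l′ → b j ≈F 0#
        b-off n = F.trans (F.*-congˡ (𝟙-off n)) (F.zeroʳ (α -F 1#))
        k₂∈ : Mem Block k₂
        k₂∈ = affine-pert (unit l′) b (b-off (end≢ l)) , row-pert (unit l′) b (𝟙-off (end≢ l))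
        k₂-comm : s ∙ k₂ ≈ k₂ ∙ s
        k₂-comm = commute {s} {k₂} (pert-commute (unit end) (unit i′) (unit l′) b (dot-units i′≢l′)
          (F.trans (dot-unitʳ b end) (b-off (end≢ l))))
        k₁≉k₂ : ¬ k₁ ≈ k₂
        k₁≉k₂ e = F.1≉0 (begin
          1#                                 ≈⟨ addition-entry i′ l′ i′≢l′ ⟨
          mat k₁ l′ i′                       ≈⟨ entries e l′ i′ ⟩
          mat k₂ l′ i′                       ≈⟨ scaling-off α≉0 (λ e → i′≢l′ (≡.sym e)) ⟩
          0#                                 ∎)
          where open SetoidReasoning F.setoid

      -- Without scalings, `k₂` adds row `i` to a third row `o`. Three indices below the last one
      -- exist only from n = 4 on.
      connectedByAddition : ∀ {o : Fin k} → o ≢ i → o ≢ l → Connected Block → Connected Affine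
      connectedByAddition {o} o≢i o≢l = connected k₂ (addition∈Block i o i′≢o′) k₂-comm (addition≉ε i′ o′ i′≢o′) k₁≉k₂
        where
        o′ : Fin (suc k)
        o′ = inject₁ o
        i′≢o′ : i′ ≢ o′
        i′≢o′ = inject≢ (λ e → o≢i (≡.sym e))
        k₂ : GL
        k₂ = addition i′ o′ i′≢o′
        k₂-comm : s ∙ k₂ ≈ k₂ ∙ s
        k₂-comm = commute {s} {k₂} (pert-commute (unit end) (unit i′) (unit o′) (unit i′) (dot-units i′≢o′) (dot-units (≢end i)))
        k₁≉k₂ : ¬ k₁ ≈ k₂
        k₁≉k₂ e = F.1≉0 (begin
          1#                                 ≈⟨ addition-entry i′ l′ i′≢l′ ⟨
          mat k₁ l′ i′                       ≈⟨ entries e l′ i′ ⟩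
          mat k₂ l′ i′                       ≈⟨ addition-off i′ o′ i′≢o′ (λ e → i′≢l′ (≡.sym e)) (inject≢ (λ e → o≢l (≡.sym e))) ⟩
          0#                                 ∎)
          where open SetoidReasoning F.setoid

-- From the affine to the parabolic matrices and to the whole group

module UpperLevels {c ℓ : Level} {q : ℕ} (F : FiniteField c ℓ q) (α : FiniteField.Carrier F) (generates : IsGenerator F α)
              {k : ℕ} (T : TransitionGraph (suc k)) where
  open Levels F α generates T public
  open Generator F α generates
  private module F = FiniteField F
  open F using (0#; 1#) renaming (_≈_ to _≈F_; _+_ to _+F_; _*_ to _*F_; -_ to -F_; _-_ to _-F_; Carrier to K)
  open FieldFacts F
  open Subgroup
  open GroupSolver 𝔾 using (solve; _⊜_; _⊙_; inv)
  private module R = IntegerSolver F.commutativeRing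

  _·_ : K → Vect → Vect
  (s · v) i = s *F v i

  unscale : ∀ X {s} (v : Vect) → ¬ s ≈F 0# → mat X ▹ (s · v) ≗ s · v → mat X ▹ v ≗ v
  unscale X {s} v s≉0 e i = cancel s≉0 (F.trans (F.sym (▹-scale (mat X) s v i)) (e i))

  scaling▹ : ∀ {a} (a≉0 : ¬ a ≈F 0#) x → mat (scaling a≉0 x) ▹ unit x ≗ a · unit x
  scaling▹ {a} a≉0 x i = begin
    (mat (scaling a≉0 x) ▹ unit x) i           ≈⟨ pert▹ (unit x) b (unit x) i ⟩
    unit x i +F unit x i *F dot b (unit x)     ≈⟨ F.+-congˡ (F.*-congˡ (F.trans (dot-unitʳ b x) (F.*-congˡ (𝟙-diag x)))) ⟩
    unit x i +F unit x i *F ((a -F 1#) *F 1#)  ≈⟨ R.solve 2 (λ u a → u R.:+ u R.:* ((a R.:- R.con ℤ.1ℤ) R.:* R.con ℤ.1ℤ) R.:= a R.:* u) F.refl (unit x i) a ⟩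
    a *F unit x i                              ∎
    where
    open SetoidReasoning F.setoid
    b : Vect
    b j = (a -F 1#) *F unit x j

  scaling▹-off : ∀ {a} (a≉0 : ¬ a ≈F 0#) {x y} → x ≢ y → mat (scaling a≉0 x) ▹ unit y ≗ unit y
  scaling▹-off {a} a≉0 {x} {y} x≢y = pert-fixes (unit x) b (unit y)
    (F.trans (dot-unitʳ b y) (F.trans (F.*-congˡ (𝟙-off (λ e → x≢y (≡.sym e)))) (F.zeroʳ (a -F 1#))))
    where
    b : Vect
    b j = (a -F 1#) *F unit x j

  scale-cong : ∀ {s t} v → s ≈F t → s · v ≗ t · v
  scale-cong v e i = F.*-congʳ e

  values : Fin 3 → K
  values zero = 0#
  values (suc zero) = 1#
  values (suc (suc zero)) = α

  values-injective : ¬ α ≈F 1# → ∀ i j → i ≢ j → ¬ values i ≈F values j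
  values-injective α≉1 zero zero n _ = n ≡.refl
  values-injective α≉1 zero (suc zero) _ e = F.1≉0 (F.sym e)
  values-injective α≉1 zero (suc (suc zero)) _ e = α≉0 (F.sym e)
  values-injective α≉1 (suc zero) zero _ e = F.1≉0 e
  values-injective α≉1 (suc zero) (suc zero) n _ = n ≡.refl
  values-injective α≉1 (suc zero) (suc (suc zero)) _ e = α≉1 (F.sym e)
  values-injective α≉1 (suc (suc zero)) zero _ e = α≉0 e
  values-injective α≉1 (suc (suc zero)) (suc zero) _ e = α≉1 e
  values-injective α≉1 (suc (suc zero)) (suc (suc zero)) n _ = n ≡.refl

  module AffineToParabolic (α≉1 : ¬ α ≈F 1#) (i : Fin k) where
    private
      i′ : Fin (suc k)
      i′ = inject₁ i

      a : K → Vect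
      a t j = t *F unit end j

      -- An injective family inside `Affine`; its members at 0, 1 and `α` are the three elements
      -- among which `another` chooses.
      shear : K → GL
      shear t = rankOne (a t) (unit i′) 1# (F.trans (F.*-identityˡ _) (F.trans (F.+-congˡ
        (F.trans (dot-unitˡ i′ (a t)) (F.trans (F.*-congˡ (𝟙-off (≢end i))) (F.zeroʳ t)))) (F.+-identityʳ 1#)))

      shear∈ : ∀ t → Mem Affine (shear t)
      shear∈ t = affine-pert (a t) (unit i′) (𝟙-off (end≢ i))

      shear-entry : ∀ t → mat (shear t) end i′ ≈F t
      shear-entry t = F.trans (F.+-cong (𝟙-off (end≢ i)) (F.*-cong (F.trans (F.*-congˡ (𝟙-diag end)) (F.*-identityʳ t)) (𝟙-diag i′)))
        (F.trans (F.+-identityˡ (t *F 1#)) (F.*-identityʳ t))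

      shear-injective : ∀ {t u} → shear t ≈ shear u → t ≈F u
      shear-injective {t} {u} e = F.trans (F.sym (shear-entry t)) (F.trans (entries e end i′) (shear-entry u))

      another : ∀ x y → ∃ λ z → Mem Affine z × ¬ z ≈ x × ¬ z ≈ y
      another x y = pick (avoidTwo {P = λ i → shear (values i) ≈ x} {Q = λ i → shear (values i) ≈ y}
          (λ i → shear (values i) ≟G x) (λ i → shear (values i) ≟G y)
          (λ {i} {j} → distinct x i j) (λ {i} {j} → distinct y i j))
        where
        distinct : ∀ w i j → i ≢ j → shear (values i) ≈ w → shear (values j) ≈ w → ⊥
        distinct w i j n e e′ = values-injective α≉1 i j n (shear-injective {values i} {values j}
          (trans {shear (values i)} {w} {shear (values j)} e (sym {shear (values j)} {w} e′)))
        pick : (∃ λ i → ¬ shear (values i) ≈ x × ¬ shear (values i) ≈ y) → ∃ λ z → Mem Affine z × ¬ z ≈ x × ¬ z ≈ y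
        pick (i , n , n′) = shear (values i) , shear∈ (values i) , n , n′

      c∙ : GL
      c∙ = scaling α≉0 end

      power▹ : ∀ r → mat (c∙ ^ r) ▹ unit end ≗ (α ^F r) · unit end
      power▹ zero j = F.trans (▹-ε (unit end) j) (F.sym (F.*-identityˡ (unit end j)))
      power▹ (suc r) = ▹-∙ c∙ (c∙ ^ r) {unit end} {(α ^F r) · unit end} {(α ^F suc r) · unit end} (power▹ r) (λ j →
        F.trans (▹-scale (mat c∙) (α ^F r) (unit end) j) (F.trans (F.*-congˡ (scaling▹ α≉0 end j))
          (F.trans (F.sym (F.*-assoc (α ^F r) α (unit end j))) (F.*-congʳ (F.*-comm (α ^F r) α)))))

      normal : ∀ {x} → Mem Affine x → Mem Affine (c∙ ∙ x ∙ c∙ ⁻¹)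
      normal {x} x∈ = unscale (c∙ ∙ x ∙ c∙ ⁻¹) (unit end) α≉0
        (▹-∙ (c∙ ∙ x) (c∙ ⁻¹) {α · unit end} {unit end} {α · unit end}
          (▹-inverse c∙ {unit end} {α · unit end} (scaling▹ α≉0 end))
          (▹-∙ c∙ x {unit end} {unit end} {α · unit end} x∈ (scaling▹ α≉0 end)))

      apart : ∀ r → 0 < r → r ≤ p → ¬ Mem Affine (c∙ ^ r)
      apart (suc r) _ r≤p e = ℕ.<⇒≱ (s≤s r≤p) (∣⇒≤ (divides-order (suc r) (begin
        α ^F suc r                              ≈⟨ F.*-identityʳ _ ⟨
        α ^F suc r *F 1#                        ≈⟨ F.*-congˡ (𝟙-diag end) ⟨
        α ^F suc r *F unit end end              ≈⟨ power▹ (suc r) end ⟨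
        (mat (c∙ ^ suc r) ▹ unit end) end       ≈⟨ e end ⟩
        unit end end                            ≈⟨ 𝟙-diag end ⟩
        1#                                      ∎)))
        where open SetoidReasoning F.setoid

      eigenvalue≉0 : ∀ {x} → Mem Parabolic x → ¬ mat x end end ≈F 0#
      eigenvalue≉0 {x} x∈ z = F.1≉0 (begin
        1#                                                      ≈⟨ 𝟙-diag end ⟨
        unit end end                                            ≈⟨ ▹-inverse x {unit end} {mat x end end · unit end} x∈ end ⟨
        (mat (x ⁻¹) ▹ (mat x end end · unit end)) end           ≈⟨ ▹-scale (mat (x ⁻¹)) (mat x end end) (unit end) end ⟩
        mat x end end *F (mat (x ⁻¹) ▹ unit end) end            ≈⟨ F.*-congʳ z ⟩
        0# *F (mat (x ⁻¹) ▹ unit end) end                       ≈⟨ F.zeroˡ _ ⟩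
        0#                                                      ∎)
        where open SetoidReasoning F.setoid

      -- The eigenvalue at the last basis vector is nonzero, hence a power of `α`, and its exponent
      -- is the number of the coset.
      cosets : ∀ {x} → Mem Parabolic x → ∃ λ r → r ≤ p × Same Affine x (c∙ ^ r)
      cosets {x} x∈ = r , r≤p , unscale (x ∙ (c∙ ^ r) ⁻¹) (unit end) (power≉0 r)
        (▹-∙ x ((c∙ ^ r) ⁻¹) {(α ^F r) · unit end} {unit end} {(α ^F r) · unit end}
          (▹-inverse (c∙ ^ r) {unit end} {(α ^F r) · unit end} (power▹ r))
          (λ j → F.trans (x∈ j) (scale-cong (unit end) x≈ j)))
        where
        power = bounded (eigenvalue≉0 {x} x∈)
        r = proj₁ power
        r≤p = proj₁ (proj₂ power)
        x≈ : mat x end end ≈F α ^F r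
        x≈ = proj₂ (proj₂ power)

    connected : Connected Affine → Connected Parabolic
    connected hc = Chain.connected Affine Parabolic (λ {x} → column⇒line {end} {x}) hc another c∙
      (ε~scaling α≉0 (q>2 α≉1) α≉1 end) (eigenline {end} {c∙} {α} (scaling▹ α≉0 end)) (λ {x} → normal {x}) p apart (λ {x} → cosets {x})

  -- When α = 1 the field has two elements, and fixing a line is fixing its nonzero vector.
  affine⇒parabolic : α ≈F 1# → Connected Affine → Connected Parabolic
  affine⇒parabolic α≈1 hc {h} h∈ h≉ε = recast (λ {x} → column⇒line {end} {x}) (λ {x} → up x) (hc (up h h∈) h≉ε)
    where
    one : ∀ x → Mem Parabolic x → mat x end end ≈F 1#
    one x x∈ with mat x end end ≟F 0#
    ... | no n = let (r , e) = logarithm n in F.trans e (F.trans (^-congˡ r α≈1) (1^ r))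
    ... | yes z = ⊥-elim (F.1≉0 (begin
        1#                                                      ≈⟨ 𝟙-diag end ⟨
        unit end end                                            ≈⟨ ▹-inverse x {unit end} {mat x end end · unit end} x∈ end ⟨
        (mat (x ⁻¹) ▹ (mat x end end · unit end)) end           ≈⟨ ▹-scale (mat (x ⁻¹)) (mat x end end) (unit end) end ⟩
        mat x end end *F (mat (x ⁻¹) ▹ unit end) end            ≈⟨ F.*-congʳ z ⟩
        0# *F (mat (x ⁻¹) ▹ unit end) end                       ≈⟨ F.zeroˡ _ ⟩
        0#                                                      ∎))
        where open SetoidReasoning F.setoid
    up : ∀ x → Mem Parabolic x → Mem Affine x
    up x x∈ j = F.trans (x∈ j) (F.trans (F.*-congʳ (one x x∈)) (F.*-identityˡ (unit end j)))

  module ParabolicToWhole (j : Fin k) (edge : TransitionGraph.Edge T end (inject₁ j)) where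
    j′ : Fin (suc k)
    j′ = inject₁ j

    s : GL
    s = addition end j′ (end≢ j)

    ε~s : ε ~ s
    ε~s = ε~addition (end≢ j) edge

    s▹ : ∀ v → mat s ▹ v ≗ λ i → v i +F unit j′ i *F v end
    s▹ v i = F.trans (pert▹ (unit j′) (unit end) v i) (F.+-congˡ (F.*-congˡ (dot-unitˡ end v)))

    -- `w₀` and `v₀` are the images of the last basis vector under `s` and `s ⁻¹`. So H ∩ s⁻¹ H s
    -- consists of the matrices that have both the last basis vector and `v₀` as eigenvectors.
    w₀ v₀ : Vect
    w₀ i = unit end i +F unit j′ i
    v₀ i = unit end i -F unit j′ i

    s▹end : mat s ▹ unit end ≗ w₀
    s▹end i = F.trans (s▹ (unit end) i) (F.+-congˡ (F.trans (F.*-congˡ (𝟙-diag end)) (F.*-identityʳ _)))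

    v₀-end : v₀ end ≈F 1#
    v₀-end = F.trans (F.+-cong (𝟙-diag end) (F.-‿cong (𝟙-off (end≢ j)))) (R.solve 0 (R.con ℤ.1ℤ R.:- R.con ℤ.0ℤ R.:= R.con ℤ.1ℤ) F.refl)

    v₀-j : v₀ j′ ≈F -F 1#
    v₀-j = F.trans (F.+-cong (𝟙-off (≢end j)) (F.-‿cong (𝟙-diag j′))) (F.+-identityˡ _)

    s▹v₀ : mat s ▹ v₀ ≗ unit end
    s▹v₀ i = F.trans (s▹ v₀ i) (F.trans (F.+-congˡ (F.*-congˡ v₀-end))
      (R.solve 2 (λ e u → (e R.:- u) R.:+ u R.:* R.con ℤ.1ℤ R.:= e) F.refl (unit end i) (unit j′ i)))

    s⁻¹▹end : mat (s ⁻¹) ▹ unit end ≗ v₀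
    s⁻¹▹end = ▹-inverse s {v₀} {unit end} s▹v₀

    -- s conjugates the stabiliser of the line of v₀ into that of the last basis vector.
    conjugate : ∀ x t → mat x ▹ v₀ ≗ t · v₀ → Mem Parabolic (s ∙ x ∙ s ⁻¹)
    conjugate x t e = eigenline {end} {s ∙ x ∙ s ⁻¹} {t}
      (▹-∙ (s ∙ x) (s ⁻¹) {unit end} {v₀} {t · unit end} s⁻¹▹end
        (▹-∙ s x {v₀} {t · v₀} {t · unit end} e
          (λ i → F.trans (▹-scale (mat s) t v₀ i) (F.*-congˡ (s▹v₀ i)))))

    s∉ : ¬ Mem Parabolic s
    s∉ e = F.1≉0 (begin
      1#                                 ≈⟨ F.+-identityˡ 1# ⟨
      0# +F 1#                           ≈⟨ F.+-cong (𝟙-off (≢end j)) (𝟙-diag j′) ⟨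
      w₀ j′                              ≈⟨ s▹end j′ ⟨
      (mat s ▹ unit end) j′              ≈⟨ e j′ ⟩
      mat s end end *F unit end j′       ≈⟨ F.*-congˡ (𝟙-off (≢end j)) ⟩
      mat s end end *F 0#                ≈⟨ F.zeroʳ _ ⟩
      0#                                 ∎)
      where open SetoidReasoning F.setoid

    Factors : GL → Set _
    Factors x = ∃₂ λ h h′ → Mem Parabolic h × Mem Parabolic h′ × x ≈ h ∙ s ∙ h′

    -- Transposed analogue of the pivot for rows: with a = w - w₀, the matrix 1 + a bᵀ fixes the
    -- last basis vector if b vanishes at `end`, and maps `w₀` to `w` if moreover b is 1 at `j′`.
    -- What remains is to make it invertible.
    pivot : ∀ (w : Vect) l → l ≢ end → ¬ w l ≈F 0# →
            ∃ λ b → b end ≈F 0# × b j′ ≈F 1# × ¬ 1# +F dot b (λ i → w i -F w₀ i) ≈F 0#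
    pivot w l l≢end wl≉0 = decide (w j′ ≟F 0#)
      where
      open SetoidReasoning F.setoid
      a : Vect
      a i = w i -F w₀ i
      w₀-j : w₀ j′ ≈F 1#
      w₀-j = F.trans (F.+-cong (𝟙-off (≢end j)) (𝟙-diag j′)) (F.+-identityˡ 1#)
      decide : Dec (w j′ ≈F 0#) → ∃ λ b → b end ≈F 0# × b j′ ≈F 1# × ¬ 1# +F dot b a ≈F 0#
      decide (no n) = unit j′ , 𝟙-off (end≢ j) , 𝟙-diag j′ , λ e → n (F.trans (F.sym (begin
        1# +F dot (unit j′) a      ≈⟨ F.+-congˡ (dot-unitˡ j′ a) ⟩
        1# +F (w j′ -F w₀ j′)      ≈⟨ F.+-congˡ (F.+-congˡ (F.-‿cong w₀-j)) ⟩
        1# +F (w j′ -F 1#)         ≈⟨ R.solve 1 (λ v → R.con ℤ.1ℤ R.:+ (v R.:- R.con ℤ.1ℤ) R.:= v) F.refl (w j′) ⟩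
        w j′                       ∎)) e)
      decide (yes z) = (λ i → unit j′ i +F unit l i)
        , F.trans (F.+-cong (𝟙-off (end≢ j)) (𝟙-off (λ e → l≢end (≡.sym e)))) (F.+-identityˡ 0#)
        , F.trans (F.+-cong (𝟙-diag j′) (𝟙-off j≢l)) (F.+-identityʳ 1#)
        , λ e → wl≉0 (F.trans (F.sym (begin
        1# +F dot (λ i → unit j′ i +F unit l i) a     ≈⟨ F.+-congˡ (dot-+ˡ (unit j′) (unit l) a) ⟩
        1# +F (dot (unit j′) a +F dot (unit l) a)     ≈⟨ F.+-congˡ (F.+-cong (dot-unitˡ j′ a) (dot-unitˡ l a)) ⟩
        1# +F (a j′ +F a l)                           ≈⟨ F.+-congˡ (F.+-cong (F.+-cong z (F.-‿cong w₀-j)) (F.+-congˡ (F.-‿cong w₀-l))) ⟩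
        1# +F ((0# -F 1#) +F (w l -F 0#))             ≈⟨ R.solve 1 (λ v → R.con ℤ.1ℤ R.:+ ((R.con ℤ.0ℤ R.:- R.con ℤ.1ℤ) R.:+ (v R.:- R.con ℤ.0ℤ)) R.:= v) F.refl (w l) ⟩
        w l                                           ∎)) e)
        where
        j≢l : j′ ≢ l
        j≢l e = wl≉0 (≡.subst (λ i → w i ≈F 0#) e z)
        w₀-l : w₀ l ≈F 0#
        w₀-l = F.trans (F.+-cong (𝟙-off l≢end) (𝟙-off (λ e → j≢l (≡.sym e)))) (F.+-identityˡ 0#)

    throughPivot : ∀ x b → b end ≈F 0# → b j′ ≈F 1# → ∀ r →
                   r *F (1# +F dot b (λ i → (mat x ▹ unit end) i -F w₀ i)) ≈F 1# → Factors x
    throughPivot x b b-end b-j r unitary = h , (h ∙ s) ⁻¹ ∙ x , column⇒line {end} {h} (affine-pert a b b-end)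
      , column⇒line {end} {(h ∙ s) ⁻¹ ∙ x} h′∈ , solve 3 (λ h s x → x ⊜ h ⊙ s ⊙ (inv (h ⊙ s) ⊙ x)) refl h s x
      where
      w a : Vect
      w = mat x ▹ unit end
      a i = w i -F w₀ i
      h : GL
      h = rankOne a b r unitary
      dot-w₀ : dot b w₀ ≈F 1#
      dot-w₀ = F.trans (dot-+ʳ b (unit end) (unit j′)) (F.trans (F.+-cong (F.trans (dot-unitʳ b end) b-end) (F.trans (dot-unitʳ b j′) b-j)) (F.+-identityˡ 1#))
      h▹w₀ : mat h ▹ w₀ ≗ w
      h▹w₀ i = F.trans (pert▹ a b w₀ i) (F.trans (F.+-congˡ (F.trans (F.*-congˡ dot-w₀) (F.*-identityʳ (a i))))
        (R.solve 2 (λ u w → u R.:+ (w R.:- u) R.:= w) F.refl (w₀ i) (w i)))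
      h′∈ : Mem Affine ((h ∙ s) ⁻¹ ∙ x)
      h′∈ = ▹-∙ ((h ∙ s) ⁻¹) x {unit end} {w} {unit end} (λ _ → F.refl)
        (▹-inverse (h ∙ s) {unit end} {w} (▹-∙ h s {unit end} {w₀} {w} s▹end h▹w₀))

    double : ∀ {x} → Mem whole x → ¬ Mem Parabolic x → Factors x
    double {x} _ x∉ = finish (somewhere {mat x ▹ unit end} {mat x end end · unit end} x∉)
      where
      w : Vect
      w = mat x ▹ unit end
      withPivot : (∃ λ b → b end ≈F 0# × b j′ ≈F 1# × ¬ 1# +F dot b (λ i → w i -F w₀ i) ≈F 0#) → Factors x
      withPivot (b , b-end , b-j , invertible) =
        throughPivot x b b-end b-j (proj₁ (recip invertible)) (proj₂ (recip invertible))
      finish : (∃ λ l → ¬ w l ≈F mat x end end *F unit end l) → Factors x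
      finish (l , n) = withPivot (pivot w l l≢end (λ e → n (F.trans e (F.sym (F.trans (F.*-congˡ (𝟙-off l≢end)) (F.zeroʳ (mat x end end)))))))
        where
        l≢end : l ≢ end
        l≢end ≡.refl = n (F.trans (▹unit (mat x) end end) (F.sym (F.trans (F.*-congˡ (𝟙-diag end)) (F.*-identityʳ (mat x end end)))))

    mover : GL
    mover = addition j′ end (≢end j)

    mover∈ : Mem Parabolic mover
    mover∈ = column⇒line {end} {mover} (affine-pert (unit end) (unit j′) (𝟙-off (end≢ j)))

    -- `mover` sends `v₀` to minus the basis vector at `j`, which `s` fixes. Hence the conjugate
    -- maps the last basis vector off its line.
    moves : ¬ Mem Parabolic (s ∙ mover ∙ s ⁻¹)
    moves e = F.1≉0 (begin
      1#                                               ≈⟨ 𝟙-diag j′ ⟨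
      unit j′ j′                                       ≈⟨ R.solve 1 (λ u → u R.:= R.:- (R.:- u)) F.refl (unit j′ j′) ⟩
      -F (-F unit j′ j′)                               ≈⟨ F.-‿cong (image j′) ⟨
      -F (mat y ▹ unit end) j′                         ≈⟨ F.-‿cong (e j′) ⟩
      -F (mat y end end *F unit end j′)                ≈⟨ F.-‿cong (F.*-congˡ (𝟙-off (≢end j))) ⟩
      -F (mat y end end *F 0#)                         ≈⟨ R.solve 1 (λ y → R.:- (y R.:* R.con ℤ.0ℤ) R.:= R.con ℤ.0ℤ) F.refl (mat y end end) ⟩
      0#                                               ∎)
      where
      open SetoidReasoning F.setoid
      y : GL
      y = s ∙ mover ∙ s ⁻¹
      u : Vect
      u i = -F unit j′ i
      mover▹ : mat mover ▹ v₀ ≗ u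
      mover▹ i = F.trans (pert▹ (unit end) (unit j′) v₀ i) (F.trans (F.+-congˡ (F.*-congˡ (F.trans (dot-unitˡ j′ v₀) v₀-j)))
        (R.solve 2 (λ e u → (e R.:- u) R.:+ e R.:* (R.:- R.con ℤ.1ℤ) R.:= R.:- u) F.refl (unit end i) (unit j′ i)))
      s▹u : mat s ▹ u ≗ u
      s▹u i = F.trans (s▹ u i) (F.trans (F.+-congˡ (F.*-congˡ (F.-‿cong (𝟙-off (end≢ j)))))
        (R.solve 1 (λ u → R.:- u R.:+ u R.:* (R.:- R.con ℤ.0ℤ) R.:= R.:- u) F.refl (unit j′ i)))
      image : mat y ▹ unit end ≗ u
      image = ▹-∙ (s ∙ mover) (s ⁻¹) {unit end} {v₀} {u} s⁻¹▹end (▹-∙ s mover {v₀} {u} {u} mover▹ s▹u)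

    -- In the plane of the basis vectors at `j` and `end` it is diagonal with respect to `v₀` and
    -- the last basis vector, with eigenvalues `t` and 1. This puts both it and its conjugate by `s`
    -- into `Parabolic`.
    homothety : ∀ t → ¬ t ≈F 0# → GL
    homothety t t≉0 = rankOne (λ i → (t -F 1#) *F (unit j′ i -F unit end i)) (unit j′) (proj₁ (recip t≉0))
      (F.trans (F.*-congˡ (F.trans (F.+-congˡ (F.trans (dot-unitˡ j′ (λ i → (t -F 1#) *F (unit j′ i -F unit end i)))
         (F.*-congˡ (F.+-cong (𝟙-diag j′) (F.-‿cong (𝟙-off (≢end j)))))))
         (R.solve 1 (λ t → R.con ℤ.1ℤ R.:+ (t R.:- R.con ℤ.1ℤ) R.:* (R.con ℤ.1ℤ R.:- R.con ℤ.0ℤ) R.:= t) F.refl t))) (proj₂ (recip t≉0)))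

    homothety∈ : ∀ t t≉0 → Mem Affine (homothety t t≉0)
    homothety∈ t t≉0 = affine-pert (λ i → (t -F 1#) *F (unit j′ i -F unit end i)) (unit j′) (𝟙-off (end≢ j))

    homothety▹v₀ : ∀ t t≉0 → mat (homothety t t≉0) ▹ v₀ ≗ t · v₀
    homothety▹v₀ t t≉0 i = F.trans (pert▹ (λ i → (t -F 1#) *F (unit j′ i -F unit end i)) (unit j′) v₀ i)
      (F.trans (F.+-congˡ (F.*-congˡ (F.trans (dot-unitˡ j′ v₀) v₀-j)))
        (R.solve 3 (λ t e u → (e R.:- u) R.:+ ((t R.:- R.con ℤ.1ℤ) R.:* (u R.:- e)) R.:* (R.:- R.con ℤ.1ℤ) R.:= t R.:* (e R.:- u)) F.refl t (unit end i) (unit j′ i)))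

    homothety-entry : ∀ t t≉0 → mat (homothety t t≉0) end j′ ≈F 1# -F t
    homothety-entry t t≉0 = F.trans (F.+-cong (𝟙-off (end≢ j)) (F.*-cong (F.*-congˡ (F.+-cong (𝟙-off (end≢ j)) (F.-‿cong (𝟙-diag end)))) (𝟙-diag j′)))
      (R.solve 1 (λ t → R.con ℤ.0ℤ R.:+ ((t R.:- R.con ℤ.1ℤ) R.:* (R.con ℤ.0ℤ R.:- R.con ℤ.1ℤ)) R.:* R.con ℤ.1ℤ R.:= R.con ℤ.1ℤ R.:- t) F.refl t)

    connected : Connected Parabolic → ∀ k₁ k₂ → ¬ k₁ ≈ ε → ¬ k₂ ≈ ε → ¬ k₁ ≈ k₂ → Mem Parabolic k₁ → Mem Parabolic k₂ →
                ∀ t u → mat k₁ ▹ v₀ ≗ t · v₀ → mat k₂ ▹ v₀ ≗ u · v₀ → Connected whole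
    connected hc k₁ k₂ n₁ n₂ n k₁∈ k₂∈ t u e₁ e₂ = JoinTrivial.connected Parabolic whole (λ {x} _ → tt) hc s ε~s tt s∉
      (λ {x} → double {x}) k₁ k₂ n₁ n₂ n k₁∈ k₂∈ (conjugate k₁ t e₁) (conjugate k₂ u e₂) mover mover∈ moves

    connectedByScaling : ¬ α ≈F 1# → Connected Parabolic → Connected whole
    connectedByScaling α≉1 hc = connected hc k₁ k₂ k₁≉ε k₂≉ε k₁≉k₂ k₁∈ k₂∈ α α (homothety▹v₀ α α≉0) k₂▹v₀
      where
      k₁ m₁ m₂ k₂ : GL
      k₁ = homothety α α≉0
      m₁ = scaling α≉0 j′
      m₂ = scaling α≉0 end
      -- The scalar `α` on the plane of the basis vectors at `j` and `end`, which contains `v₀`.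
      k₂ = m₁ ∙ m₂
      k₁∈ : Mem Parabolic k₁
      k₁∈ = column⇒line {end} {k₁} (homothety∈ α α≉0)
      k₂▹end : mat k₂ ▹ unit end ≗ α · unit end
      k₂▹end = ▹-∙ m₁ m₂ {unit end} {α · unit end} {α · unit end} (scaling▹ α≉0 end)
        (λ i → F.trans (▹-scale (mat m₁) α (unit end) i) (F.*-congˡ (scaling▹-off α≉0 (≢end j) i)))
      k₂▹j : mat k₂ ▹ unit j′ ≗ α · unit j′
      k₂▹j = ▹-∙ m₁ m₂ {unit j′} {unit j′} {α · unit j′} (scaling▹-off α≉0 (end≢ j)) (scaling▹ α≉0 j′)
      k₂∈ : Mem Parabolic k₂
      k₂∈ = eigenline {end} {k₂} {α} k₂▹end
      k₂▹v₀ : mat k₂ ▹ v₀ ≗ α · v₀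
      k₂▹v₀ i = begin
        (mat k₂ ▹ v₀) i                                                 ≈⟨ ▹-cong (≋-refl {mat k₂}) (λ l → F.+-congˡ {unit end l} (minus (unit j′ l))) i ⟩
        (mat k₂ ▹ (λ l → unit end l +F (-F 1#) *F unit j′ l)) i         ≈⟨ dot-+ʳ (mat k₂ i) (unit end) ((-F 1#) · unit j′) ⟩
        (mat k₂ ▹ unit end) i +F (mat k₂ ▹ ((-F 1#) · unit j′)) i       ≈⟨ F.+-cong (k₂▹end i) (F.trans (▹-scale (mat k₂) (-F 1#) (unit j′) i) (F.*-congˡ (k₂▹j i))) ⟩
        α *F unit end i +F (-F 1#) *F (α *F unit j′ i)                  ≈⟨ R.solve 3 (λ a e u → a R.:* e R.:+ (R.:- R.con ℤ.1ℤ) R.:* (a R.:* u) R.:= a R.:* (e R.:- u)) F.refl α (unit end i) (unit j′ i) ⟩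
        α *F v₀ i                                                       ∎
        where
        open SetoidReasoning F.setoid
        minus : ∀ u → -F u ≈F (-F 1#) *F u
        minus = R.solve 1 (λ u → R.:- u R.:= (R.:- R.con ℤ.1ℤ) R.:* u) F.refl
      1-α : ¬ 1# -F α ≈F 0#
      1-α e = α≉1 (F.sym (difference e))
      k₁≉ε : ¬ k₁ ≈ ε
      k₁≉ε e = 1-α (F.trans (F.sym (homothety-entry α α≉0)) (F.trans (entries e end j′) (F.trans (mat-ε end j′) (𝟙-off (end≢ j)))))
      k₂≉ε : ¬ k₂ ≈ ε
      k₂≉ε e = α≉1 (begin
        α                                ≈⟨ F.*-identityʳ α ⟨
        α *F 1#                          ≈⟨ F.*-congˡ (𝟙-diag end) ⟨
        α *F unit end end                ≈⟨ k₂▹end end ⟨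
        (mat k₂ ▹ unit end) end          ≈⟨ ▹unit (mat k₂) end end ⟩
        mat k₂ end end                   ≈⟨ entries e end end ⟩
        mat ε end end                    ≈⟨ mat-ε end end ⟩
        𝟙 end end                        ≈⟨ 𝟙-diag end ⟩
        1#                               ∎)
        where open SetoidReasoning F.setoid
      k₁≉k₂ : ¬ k₁ ≈ k₂
      k₁≉k₂ e = 1-α (begin
        1# -F α                          ≈⟨ homothety-entry α α≉0 ⟨
        mat k₁ end j′                    ≈⟨ entries e end j′ ⟩
        mat k₂ end j′                    ≈⟨ ▹unit (mat k₂) j′ end ⟨
        (mat k₂ ▹ unit j′) end           ≈⟨ k₂▹j end ⟩
        α *F unit j′ end                 ≈⟨ F.*-congˡ (𝟙-off (end≢ j)) ⟩
        α *F 0#                          ≈⟨ F.zeroʳ α ⟩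
        0#                               ∎)
        where open SetoidReasoning F.setoid

    -- The coordinate `l` vanishes on `v₀` and on the last basis vector, so adding row `l` to any
    -- row fixes both.
    connectedByAddition : ∀ {l : Fin k} → l ≢ j → Connected Parabolic → Connected whole
    connectedByAddition {l} l≢j hc = connected hc k₁ k₂ (addition≉ε l′ j′ l′≢j′) (addition≉ε l′ end (≢end l)) k₁≉k₂
      (column⇒line {end} {k₁} (affine-pert (unit j′) (unit l′) (𝟙-off (end≢ l))))
      (column⇒line {end} {k₂} (affine-pert (unit end) (unit l′) (𝟙-off (end≢ l))))
      1# 1# (fixes (unit j′)) (fixes (unit end))
      where
      l′ : Fin (suc k)
      l′ = inject₁ l
      l′≢j′ : l′ ≢ j′
      l′≢j′ = inject≢ l≢j
      k₁ k₂ : GL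
      k₁ = addition l′ j′ l′≢j′
      k₂ = addition l′ end (≢end l)
      v₀-l : dot (unit l′) v₀ ≈F 0#
      v₀-l = F.trans (dot-unitˡ l′ v₀) (F.trans (F.+-cong (𝟙-off (≢end l)) (F.-‿cong (𝟙-off l′≢j′))) (F.-‿inverseʳ 0#))
      fixes : ∀ a → pert a (unit l′) ▹ v₀ ≗ 1# · v₀
      fixes a i = F.trans (pert-fixes a (unit l′) v₀ v₀-l i) (F.sym (F.*-identityˡ (v₀ i)))
      k₁≉k₂ : ¬ k₁ ≈ k₂
      k₁≉k₂ e = F.1≉0 (begin
        1#               ≈⟨ addition-entry l′ j′ l′≢j′ ⟨
        mat k₁ j′ l′     ≈⟨ entries e j′ l′ ⟩
        mat k₂ j′ l′     ≈⟨ addition-off l′ end (≢end l) (λ e → l′≢j′ (≡.sym e)) (≢end j) ⟩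
        0#               ∎)
        where open SetoidReasoning F.setoid

-- The smaller group as the group of block matrices

position : ∀ {k} → Fin (suc k) → Maybe (Fin k)
position {zero} zero = nothing
position {suc k} zero = just zero
position {suc k} (suc i) = Maybe.map suc (position i)

position-end : ∀ k → position (fromℕ k) ≡ nothing
position-end zero = ≡.refl
position-end (suc k) = ≡.cong (Maybe.map suc) (position-end k)

position-inject : ∀ {k} (i : Fin k) → position (inject₁ i) ≡ just i
position-inject zero = ≡.refl
position-inject (suc i) = ≡.cong (Maybe.map suc) (position-inject i)

does-inject : ∀ {k} (i j : Fin k) → does (i Fin.≟ j) ≡ does (inject₁ i Fin.≟ inject₁ j)
does-inject i j with i Fin.≟ j | inject₁ i Fin.≟ inject₁ j
... | yes _ | yes _ = ≡.refl
... | no _ | no _ = ≡.refl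
... | yes e | no n = ⊥-elim (n (≡.cong inject₁ e))
... | no n | yes e = ⊥-elim (n (Fin.inject₁-injective e))

module Extension {c ℓ : Level} {q : ℕ} (F : FiniteField c ℓ q) (α : FiniteField.Carrier F) (generates : IsGenerator F α)
              {k : ℕ} (T : TransitionGraph (suc k)) where
  private
    module L = Levels F α generates T
    module S = Stabilizers F α (removeLast T)
    module F = FiniteField F
  open F using (0#; 1#) renaming (_≈_ to _≈F_; _+_ to _+F_; _*_ to _*F_; Carrier to K)
  open Summation F.semiring using (sum; sum-cong-≋; sum-init-last)
  open Levels F α generates T using (end; end≢; ≢end; entrywise; entries)

  private
    snoc-elim : ∀ {p} (P : Fin (suc k) → Set p) → (∀ a → P (inject₁ a)) → P end → ∀ i → P i
    snoc-elim P f e i with view i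
    ... | ‵fromℕ = e
    ... | ‵inject₁ a = f a

    entry : (Fin k → Fin k → K) → Maybe (Fin k) → Maybe (Fin k) → K
    entry X (just i) (just j) = X i j
    entry X (just _) nothing = 0#
    entry X nothing (just _) = 0#
    entry X nothing nothing = 1#

    entry-cong : ∀ {X Y} → X S.≋ Y → ∀ a b → entry X a b ≈F entry Y a b
    entry-cong e (just i) (just j) = e i j
    entry-cong e (just _) nothing = F.refl
    entry-cong e nothing (just _) = F.refl
    entry-cong e nothing nothing = F.refl

  -- The block matrix with X in the upper left corner and 1 in the lower right one.
  border : S.Matrix → L.Matrix
  border X i j = entry X (position i) (position j)

  restrict : L.Matrix → S.Matrix
  restrict X i j = X (inject₁ i) (inject₁ j)

  private
    border-corner : ∀ X a b → border X (inject₁ a) (inject₁ b) ≡ X a b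
    border-corner X a b = ≡.cong₂ (entry X) (position-inject a) (position-inject b)

    border-column : ∀ X a → border X (inject₁ a) end ≡ 0#
    border-column X a = ≡.cong₂ (entry X) (position-inject a) (position-end k)

    border-row : ∀ X b → border X end (inject₁ b) ≡ 0#
    border-row X b = ≡.cong₂ (entry X) (position-end k) (position-inject b)

    border-end : ∀ X → border X end end ≡ 1#
    border-end X = ≡.cong₂ (entry X) (position-end k) (position-end k)

    split-sum : ∀ (X Y : L.Matrix) i j → (X L.⊗ Y) i j ≈F
                sum (λ l → X i (inject₁ l) *F Y (inject₁ l) j) +F X i end *F Y end j
    split-sum X Y i j = sum-init-last (λ l → X i l *F Y l j)

    zeros : ∀ {n} (f : Fin n → K) → (∀ l → f l ≈F 0#) → sum f ≈F 0#
    zeros {n} f e = F.trans (sum-cong-≋ {x = f} {y = λ _ → 0#} e) (Summation.sum-replicate-zero F.semiring n)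

  blockwise : ∀ {X Y : L.Matrix} → (∀ a b → X (inject₁ a) (inject₁ b) ≈F Y (inject₁ a) (inject₁ b)) →
              (∀ a → X (inject₁ a) end ≈F Y (inject₁ a) end) → (∀ b → X end (inject₁ b) ≈F Y end (inject₁ b)) →
              X end end ≈F Y end end → X L.≋ Y
  blockwise {X} {Y} corner column row e =
    snoc-elim (λ i → ∀ j → X i j ≈F Y i j)
      (λ a → snoc-elim (λ j → X (inject₁ a) j ≈F Y (inject₁ a) j) (corner a) (column a))
      (snoc-elim (λ j → X end j ≈F Y end j) row e)

  border-cong : ∀ {X Y} → X S.≋ Y → border X L.≋ border Y
  border-cong e i j = entry-cong e (position i) (position j)

  border-injective : ∀ {X Y} → border X L.≋ border Y → X S.≋ Y
  border-injective {X} {Y} e a b = F.trans (F.reflexive (≡.sym (border-corner X a b)))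
    (F.trans (e (inject₁ a) (inject₁ b)) (F.reflexive (border-corner Y a b)))

  border-𝟙 : border S.𝟙 L.≋ L.𝟙
  border-𝟙 = blockwise {border S.𝟙} {L.𝟙}
    (λ a b → F.trans (F.reflexive (border-corner S.𝟙 a b)) (delta a b))
    (λ a → F.trans (F.reflexive (border-column S.𝟙 a)) (F.sym (L.𝟙-off (≢end a))))
    (λ b → F.trans (F.reflexive (border-row S.𝟙 b)) (F.sym (L.𝟙-off (end≢ b))))
    (F.trans (F.reflexive (border-end S.𝟙)) (F.sym (L.𝟙-diag end)))
    where
    delta : ∀ a b → S.𝟙 a b ≈F L.𝟙 (inject₁ a) (inject₁ b)
    delta a b = F.reflexive (≡.cong (if_then 1# else 0#) (does-inject a b))

  border-⊗ : ∀ X Y → border X L.⊗ border Y L.≋ border (X S.⊗ Y)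
  border-⊗ X Y = blockwise {border X L.⊗ border Y} {border (X S.⊗ Y)}
    (λ a b → begin
      (X′ L.⊗ Y′) (inject₁ a) (inject₁ b)                                        ≈⟨ split-sum X′ Y′ (inject₁ a) (inject₁ b) ⟩
      sum (λ l → X′ (inject₁ a) (inject₁ l) *F Y′ (inject₁ l) (inject₁ b)) +F X′ (inject₁ a) end *F Y′ end (inject₁ b)
        ≈⟨ F.+-cong (sum-cong-≋ {x = λ l → X′ (inject₁ a) (inject₁ l) *F Y′ (inject₁ l) (inject₁ b)} {y = λ l → X a l *F Y l b}
             (λ l → F.*-cong (F.reflexive (border-corner X a l)) (F.reflexive (border-corner Y l b))))
             (F.trans (F.*-congʳ (F.reflexive (border-column X a))) (F.zeroˡ _)) ⟩
      (X S.⊗ Y) a b +F 0#                                                        ≈⟨ F.+-identityʳ _ ⟩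
      (X S.⊗ Y) a b                                                              ≡⟨ border-corner (X S.⊗ Y) a b ⟨
      border (X S.⊗ Y) (inject₁ a) (inject₁ b)                                   ∎)
    (λ a → begin
      (X′ L.⊗ Y′) (inject₁ a) end                                                ≈⟨ split-sum X′ Y′ (inject₁ a) end ⟩
      sum (λ l → X′ (inject₁ a) (inject₁ l) *F Y′ (inject₁ l) end) +F X′ (inject₁ a) end *F Y′ end end
        ≈⟨ F.+-cong (zeros (λ l → X′ (inject₁ a) (inject₁ l) *F Y′ (inject₁ l) end)
                       (λ l → F.trans (F.*-congˡ (F.reflexive (border-column Y l))) (F.zeroʳ _)))
             (F.trans (F.*-congʳ (F.reflexive (border-column X a))) (F.zeroˡ _)) ⟩
      0# +F 0#                                                                   ≈⟨ F.+-identityʳ _ ⟩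
      0#                                                                         ≡⟨ border-column (X S.⊗ Y) a ⟨
      border (X S.⊗ Y) (inject₁ a) end                                           ∎)
    (λ b → begin
      (X′ L.⊗ Y′) end (inject₁ b)                                                ≈⟨ split-sum X′ Y′ end (inject₁ b) ⟩
      sum (λ l → X′ end (inject₁ l) *F Y′ (inject₁ l) (inject₁ b)) +F X′ end end *F Y′ end (inject₁ b)
        ≈⟨ F.+-cong (zeros (λ l → X′ end (inject₁ l) *F Y′ (inject₁ l) (inject₁ b))
                       (λ l → F.trans (F.*-congʳ (F.reflexive (border-row X l))) (F.zeroˡ _)))
             (F.trans (F.*-congˡ (F.reflexive (border-row Y b))) (F.zeroʳ _)) ⟩
      0# +F 0#                                                                   ≈⟨ F.+-identityʳ _ ⟩
      0#                                                                         ≡⟨ border-row (X S.⊗ Y) b ⟨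
      border (X S.⊗ Y) end (inject₁ b)                                           ∎)
    (begin
      (X′ L.⊗ Y′) end end                                                        ≈⟨ split-sum X′ Y′ end end ⟩
      sum (λ l → X′ end (inject₁ l) *F Y′ (inject₁ l) end) +F X′ end end *F Y′ end end
        ≈⟨ F.+-cong (zeros (λ l → X′ end (inject₁ l) *F Y′ (inject₁ l) end)
                       (λ l → F.trans (F.*-congʳ (F.reflexive (border-row X l))) (F.zeroˡ _)))
             (F.*-cong (F.reflexive (border-end X)) (F.reflexive (border-end Y))) ⟩
      0# +F 1# *F 1#                                                             ≈⟨ F.trans (F.+-identityˡ _) (F.*-identityˡ 1#) ⟩
      1#                                                                         ≡⟨ border-end (X S.⊗ Y) ⟨
      border (X S.⊗ Y) end end                                                   ∎)
    where
    open SetoidReasoning F.setoid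
    X′ Y′ : L.Matrix
    X′ = border X
    Y′ = border Y

  private
    inverse-pair : ∀ {X Y} → Y S.⊗ X S.≋ S.𝟙 → border Y L.⊗ border X L.≋ L.𝟙
    inverse-pair {X} {Y} e = L.≋-trans (border-⊗ Y X) (L.≋-trans (border-cong e) border-𝟙)

  ι : S.GL → L.GL
  ι (X , Y , p , p′) = border X , border Y , inverse-pair {X} {Y} p , inverse-pair {Y} {X} p′

  private
    add-entry : ∀ x y → border (S.addMatrix x y) L.≋ L.addMatrix (inject₁ x) (inject₁ y)
    add-entry x y = blockwise {border (S.addMatrix x y)} {L.addMatrix (inject₁ x) (inject₁ y)}
      (λ a b → F.reflexive (≡.trans (border-corner (S.addMatrix x y) a b)
        (≡.cong (if_then 1# else 0#) (≡.cong₂ _∨_ (does-inject a b) (≡.cong₂ _∧_ (does-inject a y) (does-inject b x))))))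
      (λ a → F.trans (F.reflexive (border-column (S.addMatrix x y) a)) (F.sym (off (≢end a) (λ _ → end≢ x))))
      (λ b → F.trans (F.reflexive (border-row (S.addMatrix x y) b)) (F.sym (off (end≢ b) (λ e → ⊥-elim (end≢ y e)))))
      (F.trans (F.reflexive (border-end (S.addMatrix x y))) (F.sym on))
      where
      off : ∀ {i j} → i ≢ j → (i ≡ inject₁ y → j ≢ inject₁ x) → L.addMatrix (inject₁ x) (inject₁ y) i j ≈F 0#
      off {i} {j} n n′ with i Fin.≟ j | i Fin.≟ inject₁ y | j Fin.≟ inject₁ x
      ... | yes e | _ | _ = ⊥-elim (n e)
      ... | no _ | yes e | yes e′ = ⊥-elim (n′ e e′)
      ... | no _ | yes _ | no _ = F.refl
      ... | no _ | no _ | _ = F.refl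
      on : L.addMatrix (inject₁ x) (inject₁ y) end end ≈F 1#
      on with end Fin.≟ end
      ... | yes _ = F.refl
      ... | no n = ⊥-elim (n ≡.refl)

    scale-entry : ∀ a x → border (S.scaleMatrix a x) L.≋ L.scaleMatrix a (inject₁ x)
    scale-entry s x = blockwise {border (S.scaleMatrix s x)} {L.scaleMatrix s (inject₁ x)}
      (λ a b → F.reflexive (≡.trans (border-corner (S.scaleMatrix s x) a b)
        (≡.cong₂ (λ u v → if u then (if v then s else 1#) else 0#) (does-inject a b) (does-inject a x))))
      (λ a → F.trans (F.reflexive (border-column (S.scaleMatrix s x) a)) (F.sym (off (≢end a))))
      (λ b → F.trans (F.reflexive (border-row (S.scaleMatrix s x) b)) (F.sym (off (end≢ b))))
      (F.trans (F.reflexive (border-end (S.scaleMatrix s x))) (F.sym on))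
      where
      off : ∀ {i j} → i ≢ j → L.scaleMatrix s (inject₁ x) i j ≈F 0#
      off {i} {j} n with i Fin.≟ j
      ... | yes e = ⊥-elim (n e)
      ... | no _ = F.refl
      on : L.scaleMatrix s (inject₁ x) end end ≈F 1#
      on with end Fin.≟ end | end Fin.≟ inject₁ x
      ... | yes _ | no _ = F.refl
      ... | yes _ | yes e = ⊥-elim (end≢ x e)
      ... | no n | _ = ⊥-elim (n ≡.refl)

    ι-ops : ∀ {S} → S.Ops α (removeLast T) S → L.Ops α T (ι S)
    ι-ops (S.add i j e p) = L.add (inject₁ i) (inject₁ j) e (L.≋-trans (border-cong p) (add-entry i j))
    ι-ops (S.add⁻¹ i j e p) = L.add⁻¹ (inject₁ i) (inject₁ j) e (L.≋-trans (border-cong p) (add-entry i j))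
    ι-ops (S.scale q>2 i p) = L.scale q>2 (inject₁ i) (L.≋-trans (border-cong p) (scale-entry α i))
    ι-ops (S.scale⁻¹ q>2 i p) = L.scale⁻¹ q>2 (inject₁ i) (L.≋-trans (border-cong p) (scale-entry α i))

    ι-adjacent : ∀ {X Y} → X S.~ Y → ι X L.~ ι Y
    ι-adjacent {X} {Y} (n , steps) = (λ e → n (border-injective e)) ,
      [ (λ st → inj₁ (step {X} {Y} st)) , (λ st → inj₂ (step {Y} {X} st)) ]′ steps
      where
      step : ∀ {X Y} → (∃ λ S → S.Ops α (removeLast T) S × S.mat Y S.≋ S.mat S S.⊗ S.mat X) →
             ∃ λ S → L.Ops α T S × L.mat (ι Y) L.≋ L.mat S L.⊗ L.mat (ι X)
      step {X} (S , S∈ , e) = ι S , ι-ops S∈ ,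
        L.≋-trans (border-cong e) (L.≋-sym (border-⊗ (S.mat S) (S.mat X)))

    ι∈Block : ∀ z → L.Subgroup.Mem L.Block (ι z)
    ι∈Block z@(X , _) =
        (λ i → F.trans (L.▹unit (border X) end i) (snoc-elim (λ i → border X i end ≈F L.unit end i)
          (λ a → F.trans (F.reflexive (border-column X a)) (F.sym (L.𝟙-off (≢end a))))
          (F.trans (F.reflexive (border-end X)) (F.sym (L.𝟙-diag end))) i))
      , (λ j → F.trans (L.unit◃ end (border X) j) (snoc-elim (λ j → border X end j ≈F L.unit end j)
          (λ b → F.trans (F.reflexive (border-row X b)) (F.sym (L.𝟙-off (≢end b))))
          (F.trans (F.reflexive (border-end X)) (F.sym (L.𝟙-diag end))) j))

    -- The column above the corner of `X` vanishes, so the last summand drops out of each entry and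
    -- the blocks multiply among themselves.
    restrict-pair : ∀ {X Y : L.Matrix} → (∀ a → X (inject₁ a) end ≈F 0#) → X L.⊗ Y L.≋ L.𝟙 → restrict X S.⊗ restrict Y S.≋ S.𝟙
    restrict-pair {X} {Y} column e a b = begin
      (restrict X S.⊗ restrict Y) a b                                    ≈⟨ F.+-identityʳ _ ⟨
      (restrict X S.⊗ restrict Y) a b +F 0#                              ≈⟨ F.+-congˡ (F.trans (F.*-congʳ (column a)) (F.zeroˡ _)) ⟨
      (restrict X S.⊗ restrict Y) a b +F X (inject₁ a) end *F Y end (inject₁ b)  ≈⟨ split-sum X Y (inject₁ a) (inject₁ b) ⟨
      (X L.⊗ Y) (inject₁ a) (inject₁ b)                                  ≈⟨ e (inject₁ a) (inject₁ b) ⟩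
      L.𝟙 (inject₁ a) (inject₁ b)                                        ≡⟨ ≡.cong (if_then 1# else 0#) (does-inject a b) ⟨
      S.𝟙 a b                                                            ∎
      where open SetoidReasoning F.setoid

    columnEntries : ∀ {z} → L.Subgroup.Mem L.Block z → ∀ a → L.mat z (inject₁ a) end ≈F 0#
    columnEntries {z} (p , _) a = F.trans (F.sym (L.▹unit (L.mat z) end (inject₁ a))) (F.trans (p (inject₁ a)) (L.𝟙-off (≢end a)))

    -- The preimage needs an inverse of its own: `Block` is closed under inversion, so the inverse
    -- matrix restricts as well.
    preimage : ∀ z → L.Subgroup.Mem L.Block z → ∃ λ y → z L.≈ ι y
    preimage z@(X , Y , p , p′) z∈ = (restrict X , restrict Y , restrict-pair {Y} {X} columnY p , restrict-pair {X} {Y} (columnEntries {z} z∈) p′)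
      , entrywise (blockwise {X} {border (restrict X)}
          (λ a b → F.reflexive (≡.sym (border-corner (restrict X) a b)))
          (λ a → F.trans (columnEntries {z} z∈ a) (F.reflexive (≡.sym (border-column (restrict X) a))))
          (λ b → F.trans (F.sym (L.unit◃ end X (inject₁ b))) (F.trans (proj₂ z∈ (inject₁ b)) (F.trans (L.𝟙-off (≢end b)) (F.reflexive (≡.sym (border-row (restrict X) b))))))
          (F.trans (F.sym (L.unit◃ end X end)) (F.trans (proj₂ z∈ end) (F.trans (L.𝟙-diag end) (F.reflexive (≡.sym (border-end (restrict X))))))))
      where
      columnY : ∀ a → Y (inject₁ a) end ≈F 0#
      columnY a = F.trans (F.sym (L.mat-⁻¹ z (inject₁ a) end)) (columnEntries {z L.⁻¹} (L.Subgroup.⁻¹∈ L.Block {z} z∈) a)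

  connected : S.Connected S.whole → L.Connected L.Block
  connected hc {h} h∈ h≉ε = transport (preimage h h∈)
    where
    ι-ε : ι S.ε L.≈ L.ε
    ι-ε = entrywise (L.≋-trans (border-cong S.mat-ε) (L.≋-trans border-𝟙 (L.≋-sym L.mat-ε)))
    transport : (∃ λ y → h L.≈ ι y) → L.Ham (L.Subgroup.Mem L.Block) L.ε h
    transport (y , h≈) = L.ends ι-ε (L.sym h≈)
      (embed {V = S.setoid} {~-resp = λ {x} {x′} {y} {y′} → S.~-resp {x} {x′} {y} {y′}} {~-sym = λ {x} {y} → S.~-sym {x} {y}}
             {V′ = L.setoid} {~′-resp = λ {x} {x′} {y} {y′} → L.~-resp {x} {x′} {y} {y′}} {~′-sym = λ {x} {y} → L.~-sym {x} {y}}
         ι (λ (S.entrywise e) → entrywise (border-cong e)) (λ (entrywise e) → S.entrywise (border-injective e))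
         (λ {x} {y} → ι-adjacent {x} {y}) (λ {z} _ → ι∈Block z) (λ {x} {y} → L.Subgroup.resp L.Block {x} {y})
         (λ {z} z∈ → let (y , e) = preimage z z∈ in y , tt , e)
         (hc tt (λ y≈ε → h≉ε (L.trans h≈ (L.trans (entrywise (border-cong (S.entries y≈ε))) ι-ε)))))

-- Two by two matrices over a field with more than two elements

odd-sum : ∀ m n {a b} → odd m ≡ a → odd n ≡ b → odd (m +ℕ n) ≡ a xor b
odd-sum m n e e′ = ≡.trans (odd-+ m n) (≡.cong₂ _xor_ e e′)

odd-+double : ∀ m k → odd (m +ℕ (k +ℕ k)) ≡ odd m
odd-+double m k = ≡.trans (odd-sum m (k +ℕ k) ≡.refl (odd-double k)) (≡.sym (xor-false (odd m)))

module Plane {c ℓ : Level} {q : ℕ} (F : FiniteField c ℓ q) (α : FiniteField.Carrier F) (generates : IsGenerator F α)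
             (T : TransitionGraph 2) (α≉1 : ¬ FiniteField._≈_ F α (FiniteField.1# F))
             (e₁₂ : TransitionGraph.Edge T zero (suc zero)) where
  open UpperLevels F α generates T public
  open Generator F α generates public
  module F = FiniteField F
  open F public using (0#; 1#) renaming (_≈_ to _≈F_; _+_ to _+F_; _*_ to _*F_; -_ to -F_; _-_ to _-F_; Carrier to K)
  open FieldFacts F public
  open Subgroup public
  open GroupSolver 𝔾 using (solve; _⊜_; _⊙_; inv)
  open Tori 𝔾 _≟G_ glElements glListed _~_ (λ {x} {x′} {y} {y′} → ~-resp {x} {x′} {y} {y′})
    (λ {x} {y} → ~-sym {x} {y}) (λ {x} {y} z → ~-∙ʳ {x} {y} z) public
    using (Torus; Rows; Grid; band; tour; ^-1; rows-flip; rows-unflip; inverse-^)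
  module R = IntegerSolver F.commutativeRing

  top bot : Fin 2
  top = zero
  bot = suc zero

  top≢bot : top ≢ bot
  top≢bot ()

  record Entries (X : GL) (a b c d : K) : Set ℓ where
    field
      tt≈ : mat X top top ≈F a
      tb≈ : mat X top bot ≈F b
      bt≈ : mat X bot top ≈F c
      bb≈ : mat X bot bot ≈F d

  open Entries

  entries-ext : ∀ {X Y a b c d} → Entries X a b c d → Entries Y a b c d → X ≈ Y
  entries-ext e f = entrywise λ
    { zero zero → F.trans (tt≈ e) (F.sym (tt≈ f)) ; zero (suc zero) → F.trans (tb≈ e) (F.sym (tb≈ f))
    ; (suc zero) zero → F.trans (bt≈ e) (F.sym (bt≈ f)) ; (suc zero) (suc zero) → F.trans (bb≈ e) (F.sym (bb≈ f)) }

  entries-cong : ∀ {X a b c d a′ b′ c′ d′} → Entries X a b c d → a ≈F a′ → b ≈F b′ → c ≈F c′ → d ≈F d′ → Entries X a′ b′ c′ d′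
  entries-cong e p q r s = record { tt≈ = F.trans (tt≈ e) p ; tb≈ = F.trans (tb≈ e) q ; bt≈ = F.trans (bt≈ e) r ; bb≈ = F.trans (bb≈ e) s }

  entries-resp : ∀ {X Y a b c d} → X ≈ Y → Entries X a b c d → Entries Y a b c d
  entries-resp (entrywise p) e = record { tt≈ = F.trans (F.sym (p top top)) (tt≈ e) ; tb≈ = F.trans (F.sym (p top bot)) (tb≈ e)
                                        ; bt≈ = F.trans (F.sym (p bot top)) (bt≈ e) ; bb≈ = F.trans (F.sym (p bot bot)) (bb≈ e) }

  -- Opaque, so that products of these elements are compared only through their entries.
  abstract
    M₁ M₂ t : GL
    M₁ = scaling {α} α≉0 top
    M₂ = scaling {α} α≉0 bot
    t = addition top bot top≢bot

    ε~M₁ : ε ~ M₁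
    ε~M₁ = ε~scaling α≉0 (q>2 α≉1) α≉1 top

    ε~M₂ : ε ~ M₂
    ε~M₂ = ε~scaling α≉0 (q>2 α≉1) α≉1 bot

    ε~t : ε ~ t
    ε~t = ε~addition {top} {bot} top≢bot e₁₂

    lower : K → GL
    lower x = rankOne (λ i → x *F unit bot i) (unit top) 1# (F.trans (F.*-identityˡ _) (F.trans (F.+-congˡ
      (F.trans (dot-unitˡ top (λ i → x *F unit bot i)) (F.zeroʳ x))) (F.+-identityʳ 1#)))

    lower-entries : ∀ x → Entries (lower x) 1# 0# x 1#
    lower-entries x = record
      { tt≈ = R.solve 1 (λ x → R.con ℤ.1ℤ R.:+ x R.:* R.con ℤ.0ℤ R.:* R.con ℤ.1ℤ R.:= R.con ℤ.1ℤ) F.refl x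
      ; tb≈ = R.solve 1 (λ x → R.con ℤ.0ℤ R.:+ x R.:* R.con ℤ.0ℤ R.:* R.con ℤ.0ℤ R.:= R.con ℤ.0ℤ) F.refl x
      ; bt≈ = R.solve 1 (λ x → R.con ℤ.0ℤ R.:+ x R.:* R.con ℤ.1ℤ R.:* R.con ℤ.1ℤ R.:= x) F.refl x
      ; bb≈ = R.solve 1 (λ x → R.con ℤ.1ℤ R.:+ x R.:* R.con ℤ.1ℤ R.:* R.con ℤ.0ℤ R.:= R.con ℤ.1ℤ) F.refl x }

    M₁-top : ∀ X j → mat (M₁ ∙ X) top j ≈F α *F mat X top j
    M₁-top = scaleRow {α} α≉0 top

    M₁-bot : ∀ X j → mat (M₁ ∙ X) bot j ≈F mat X bot j
    M₁-bot X j = otherRow {α} α≉0 top X {bot} j (λ ())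

    M₂-top : ∀ X j → mat (M₂ ∙ X) top j ≈F mat X top j
    M₂-top X j = otherRow {α} α≉0 bot X {top} j (λ ())

    M₂-bot : ∀ X j → mat (M₂ ∙ X) bot j ≈F α *F mat X bot j
    M₂-bot = scaleRow {α} α≉0 bot

    t-row : ∀ X a l → mat (t ∙ X) a l ≈F mat X a l +F unit bot a *F mat X top l
    t-row = addition-row top bot top≢bot

  M₁-entries : ∀ {X a b c d} → Entries X a b c d → Entries (M₁ ∙ X) (α *F a) (α *F b) c d
  M₁-entries {X} e = record
    { tt≈ = F.trans (M₁-top X top) (F.*-congˡ (tt≈ e)) ; tb≈ = F.trans (M₁-top X bot) (F.*-congˡ (tb≈ e))
    ; bt≈ = F.trans (M₁-bot X top) (bt≈ e) ; bb≈ = F.trans (M₁-bot X bot) (bb≈ e) }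

  M₂-entries : ∀ {X a b c d} → Entries X a b c d → Entries (M₂ ∙ X) a b (α *F c) (α *F d)
  M₂-entries {X} e = record
    { tt≈ = F.trans (M₂-top X top) (tt≈ e) ; tb≈ = F.trans (M₂-top X bot) (tb≈ e)
    ; bt≈ = F.trans (M₂-bot X top) (F.*-congˡ (bt≈ e)) ; bb≈ = F.trans (M₂-bot X bot) (F.*-congˡ (bb≈ e)) }

  t-entries : ∀ {X a b c d} → Entries X a b c d → Entries (t ∙ X) a b (c +F a) (d +F b)
  t-entries {X} e = record
    { tt≈ = F.trans (t-row X top top) (F.trans (F.+-congˡ (F.zeroˡ _)) (F.trans (F.+-identityʳ _) (tt≈ e)))
    ; tb≈ = F.trans (t-row X top bot) (F.trans (F.+-congˡ (F.zeroˡ _)) (F.trans (F.+-identityʳ _) (tb≈ e)))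
    ; bt≈ = F.trans (t-row X bot top) (F.+-cong (bt≈ e) (F.trans (F.*-identityˡ _) (tt≈ e)))
    ; bb≈ = F.trans (t-row X bot bot) (F.+-cong (bb≈ e) (F.trans (F.*-identityˡ _) (tb≈ e))) }

  M₁^-entries : ∀ i {X a b c d} → Entries X a b c d → Entries (M₁ ^ i ∙ X) (α ^F i *F a) (α ^F i *F b) c d
  M₁^-entries zero {X} e = entries-resp (sym (identityˡ X)) (entries-cong e (F.sym (F.*-identityˡ _)) (F.sym (F.*-identityˡ _)) F.refl F.refl)
  M₁^-entries (suc i) {X} e = entries-resp (sym (assoc M₁ (M₁ ^ i) X)) (entries-cong (M₁-entries (M₁^-entries i e))
    (F.sym (F.*-assoc α (α ^F i) _)) (F.sym (F.*-assoc α (α ^F i) _)) F.refl F.refl)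

  M₂^-entries : ∀ i {X a b c d} → Entries X a b c d → Entries (M₂ ^ i ∙ X) a b (α ^F i *F c) (α ^F i *F d)
  M₂^-entries zero {X} e = entries-resp (sym (identityˡ X)) (entries-cong e F.refl F.refl (F.sym (F.*-identityˡ _)) (F.sym (F.*-identityˡ _)))
  M₂^-entries (suc i) {X} e = entries-resp (sym (assoc M₂ (M₂ ^ i) X)) (entries-cong (M₂-entries (M₂^-entries i e))
    F.refl F.refl (F.sym (F.*-assoc α (α ^F i) _)) (F.sym (F.*-assoc α (α ^F i) _)))

  abstract
    -- The lower left entry is αʲ x rather than x, so that the label `x` is invariant under `M₁` and
    -- `M₂`.
    V : ℕ → ℕ → K → GL
    V i j x = M₁ ^ i ∙ (M₂ ^ j ∙ lower x)

    V-def : ∀ i j x → V i j x ≈ M₁ ^ i ∙ (M₂ ^ j ∙ lower x)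
    V-def i j x = refl

  V-entries : ∀ i j x → Entries (V i j x) (α ^F i) 0# (α ^F j *F x) (α ^F j)
  V-entries i j x = entries-resp (sym (V-def i j x)) (entries-cong (M₁^-entries i (M₂^-entries j (lower-entries x)))
    (F.*-identityʳ _) (F.zeroʳ _) F.refl (F.*-identityʳ _))

  V-cong : ∀ {i j x i′ j′ x′} → α ^F i ≈F α ^F i′ → α ^F j ≈F α ^F j′ → x ≈F x′ → V i j x ≈ V i′ j′ x′
  V-cong {i} {j} {x} {i′} {j′} {x′} p q r = entries-ext (entries-cong (V-entries i j x) p F.refl (F.*-cong q r) q) (V-entries i′ j′ x′)

  V-injective : ∀ {i j x i′ j′ x′} → V i j x ≈ V i′ j′ x′ → α ^F i ≈F α ^F i′ × α ^F j ≈F α ^F j′ × x ≈F x′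
  V-injective {i} {j} {x} {i′} {j′} {x′} (entrywise p) = e₁ , e₂ , cancel (power≉0 j) (F.trans (F.trans (F.sym (bt≈ (V-entries i j x)))
    (F.trans (p bot top) (bt≈ (V-entries i′ j′ x′)))) (F.*-congʳ (F.sym e₂)))
    where
    e₁ : α ^F i ≈F α ^F i′
    e₁ = F.trans (F.sym (tt≈ (V-entries i j x))) (F.trans (p top top) (tt≈ (V-entries i′ j′ x′)))
    e₂ : α ^F j ≈F α ^F j′
    e₂ = F.trans (F.sym (bb≈ (V-entries i j x))) (F.trans (p bot bot) (bb≈ (V-entries i′ j′ x′)))

  V-shift : ∀ a b i j x → M₁ ^ a ∙ (M₂ ^ b ∙ V i j x) ≈ V (a +ℕ i) (b +ℕ j) x
  V-shift a b i j x = entries-ext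
    (entries-cong (M₁^-entries a (M₂^-entries b (V-entries i j x))) (F.sym (^-homo-* α a i)) (F.zeroʳ _)
      (F.trans (F.sym (F.*-assoc _ _ x)) (F.*-congʳ (F.sym (^-homo-* α b j)))) (F.sym (^-homo-* α b j)))
    (V-entries (a +ℕ i) (b +ℕ j) x)

  V-ε : V 0 0 0# ≈ ε
  V-ε = entries-ext (V-entries 0 0 0#) (record
    { tt≈ = F.trans (mat-ε top top) F.refl ; tb≈ = mat-ε top bot
    ; bt≈ = F.trans (mat-ε bot top) (F.sym (F.zeroʳ 1#)) ; bb≈ = mat-ε bot bot })

  -- V i j x lies in the torus of x; the edges of the operation t join tori.
  addEdge : ∀ {i j x x′} → α ^F j *F x′ ≈F α ^F j *F x +F α ^F i → V i j x ~ V i j x′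
  addEdge {i} {j} {x} {x′} e = ~-resp {V i j x} {V i j x} {t ∙ V i j x} {V i j x′} (refl {V i j x})
    (entries-ext (t-entries (V-entries i j x)) (entries-cong (V-entries i j x′) F.refl F.refl e (F.sym (F.+-identityʳ (α ^F j)))))
    (generator {t} (V i j x) ε~t)

  Sign : K → Set ℓ
  Sign s = s ≈F 1# ⊎ s ≈F -F 1#

  -- The difference of the labels fixes the offset `k` between the two exponents; the exponent `b`
  -- remains free. A minus sign means that the edge is traversed backwards.
  signEdge : ∀ {s} → Sign s → ∀ k b {x x′} → x′ ≈F x +F s *F α ^F k → V (k +ℕ b) b x ~ V (k +ℕ b) b x′
  signEdge {s} (inj₁ s≈1) k b {x} {x′} e = addEdge (begin
    α ^F b *F x′                               ≈⟨ F.*-congˡ (F.trans e (F.+-congˡ (F.trans (F.*-congʳ s≈1) (F.*-identityˡ _)))) ⟩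
    α ^F b *F (x +F α ^F k)                    ≈⟨ R.solve 3 (λ b x k → b R.:* (x R.:+ k) R.:= b R.:* x R.:+ k R.:* b) F.refl (α ^F b) x (α ^F k) ⟩
    α ^F b *F x +F α ^F k *F α ^F b            ≈⟨ F.+-congˡ (^-homo-* α k b) ⟨
    α ^F b *F x +F α ^F (k +ℕ b)               ∎)
    where open SetoidReasoning F.setoid
  signEdge {s} (inj₂ s≈-1) k b {x} {x′} e = ~-sym {V (k +ℕ b) b x′} {V (k +ℕ b) b x} (addEdge (begin
    α ^F b *F x                                            ≈⟨ R.solve 3 (λ b x k → b R.:* x R.:= b R.:* (x R.:+ (R.:- R.con ℤ.1ℤ) R.:* k) R.:+ k R.:* b) F.refl (α ^F b) x (α ^F k) ⟩
    α ^F b *F (x +F -F 1# *F α ^F k) +F α ^F k *F α ^F b   ≈⟨ F.+-cong (F.*-congˡ (F.trans (F.+-congˡ (F.*-congʳ (F.sym s≈-1))) (F.sym e))) (F.sym (^-homo-* α k b)) ⟩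
    α ^F b *F x′ +F α ^F (k +ℕ b)                          ∎))
    where open SetoidReasoning F.setoid

  Lab : K → Pred GL ℓ
  Lab x z = ∃₂ λ i j → z ≈ V i j x

  Lab-disjoint : ∀ {x y z} → Lab x z → Lab y z → x ≈F y
  Lab-disjoint {x} {y} (i , j , e) (i′ , j′ , e′) = proj₂ (proj₂ (V-injective {i} {j} {x} {i′} {j′} {y} (trans (sym e) e′)))

  Lab-cong : ∀ {x y z} → x ≈F y → Lab x z → Lab y z
  Lab-cong {x} {y} p (i , j , e) = i , j , trans e (V-cong {i} {j} {x} {i} {j} {y} F.refl F.refl p)

  torus : Torus p M₁ M₂
  torus = record
    { ε~x = ε~M₁
    ; ε~y = ε~M₂
    ; comm = trans (∙-cong (sym (^-1 M₁)) (sym (^-1 M₂))) (trans (commutes 1 1) (∙-cong (^-1 M₂) (^-1 M₁)))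
    ; x^m = trans (trans (sym (identityʳ _)) (pure m 0)) (trans (V-cong {m} {0} {0#} {0} {0} {0#} α^m F.refl F.refl) V-ε)
    ; y^m = trans (sym (identityˡ _)) (trans (pure 0 m) (trans (V-cong {0} {m} {0#} {0} {0} {0#} F.refl α^m F.refl) V-ε))
    ; free = λ i j e → let (u , v , _) = V-injective {i} {j} {0#} {0} {0} {0#} (trans (sym (pure i j)) (trans e (sym V-ε))) in
             divides-order i u , divides-order j v }
    where
    lower-0 : lower 0# ≈ ε
    lower-0 = trans (sym (trans (identityˡ _) (identityˡ _))) (trans (sym (V-def 0 0 0#)) V-ε)
    pure : ∀ i j → M₁ ^ i ∙ M₂ ^ j ≈ V i j 0#
    pure i j = trans (∙-congˡ (trans (sym (identityʳ _)) (∙-congˡ (sym lower-0)))) (sym (V-def i j 0#))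
    commutes : ∀ i j → M₁ ^ i ∙ M₂ ^ j ≈ M₂ ^ j ∙ M₁ ^ i
    commutes i j = entries-ext (entries-resp (sym (pure i j)) (V-entries i j 0#))
      (entries-resp (∙-congˡ (trans (V-def i 0 0#) (trans (∙-congˡ (trans (identityˡ _) lower-0)) (identityʳ (M₁ ^ i)))))
        (entries-cong (M₂^-entries j (V-entries i 0 0#)) F.refl F.refl (F.trans (F.*-congˡ (F.zeroʳ 1#)) F.refl) (F.*-identityʳ _)))

  V∈Parabolic : ∀ i j x → Mem Parabolic (V i j x)
  V∈Parabolic i j x = eigenline {end} {V i j x} {α ^F j} λ
    { zero → F.trans (▹unit (mat (V i j x)) bot top) (F.trans (tb≈ (V-entries i j x)) (F.sym (F.zeroʳ (α ^F j))))
    ; (suc zero) → F.trans (▹unit (mat (V i j x)) bot bot) (F.trans (bb≈ (V-entries i j x)) (F.sym (F.*-identityʳ (α ^F j)))) }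

  -- Triangularity makes both diagonal entries invertible, hence powers of `α`.
  parabolicForm : ∀ z → Mem Parabolic z → ∃ λ x → Lab x z
  parabolicForm z@(X , W , WX , XW) z∈ = form (logarithm tt≉0) (logarithm bb≉0)
    where
    open SetoidReasoning F.setoid
    tb : mat z top bot ≈F 0#
    tb = F.trans (F.sym (▹unit (mat z) bot top)) (F.trans (z∈ top) (F.zeroʳ (mat z bot bot)))
    tt≉0 : ¬ mat z top top ≈F 0#
    tt≉0 = nonzero-factor {mat z top top} {W top top} (begin
      X top top *F W top top                                             ≈⟨ R.solve 2 (λ a b → a R.:= a R.:+ (R.con ℤ.0ℤ R.:* b R.:+ R.con ℤ.0ℤ)) F.refl (X top top *F W top top) (W bot top) ⟩
      X top top *F W top top +F (0# *F W bot top +F 0#)                  ≈⟨ F.+-congˡ (F.+-congʳ (F.*-congʳ tb)) ⟨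
      X top top *F W top top +F (X top bot *F W bot top +F 0#)           ≈⟨ XW top top ⟩
      1#                                                                 ∎)
    bb≉0 : ¬ mat z bot bot ≈F 0#
    bb≉0 = nonzero-factor {mat z bot bot} {W bot bot} (begin
      X bot bot *F W bot bot                                             ≈⟨ R.solve 3 (λ a b c → a R.:* b R.:= c R.:* R.con ℤ.0ℤ R.:+ (b R.:* a R.:+ R.con ℤ.0ℤ)) F.refl (X bot bot) (W bot bot) (W bot top) ⟩
      W bot top *F 0# +F (W bot bot *F X bot bot +F 0#)                  ≈⟨ F.+-congʳ (F.*-congˡ tb) ⟨
      W bot top *F X top bot +F (W bot bot *F X bot bot +F 0#)           ≈⟨ WX bot bot ⟩
      1#                                                                 ∎)
    form : (∃ λ i → mat z top top ≈F α ^F i) → (∃ λ j → mat z bot bot ≈F α ^F j) → ∃ λ x → Lab x z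
    form (i , e) (j , e′) = x , i , j , entries-ext (record { tt≈ = e ; tb≈ = tb ; bt≈ = F.refl ; bb≈ = e′ })
        (entries-cong (V-entries i j x) F.refl F.refl x≈ F.refl)
      where
      r = recip (power≉0 j)
      x : K
      x = proj₁ r *F mat z bot top
      x≈ : α ^F j *F x ≈F mat z bot top
      x≈ = begin
        α ^F j *F (proj₁ r *F mat z bot top)   ≈⟨ R.solve 3 (λ a r c → a R.:* (r R.:* c) R.:= (r R.:* a) R.:* c) F.refl (α ^F j) (proj₁ r) (mat z bot top) ⟩
        (proj₁ r *F α ^F j) *F mat z bot top   ≈⟨ F.*-congʳ (proj₂ r) ⟩
        1# *F mat z bot top                    ≈⟨ F.*-identityˡ _ ⟩
        mat z bot top                          ∎

  product-entries : ∀ {X Y a c d a′ c′ d′} → Entries X a 0# c d → Entries Y a′ 0# c′ d′ →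
                    Entries (X ∙ Y) (a *F a′) 0# (c *F a′ +F d *F c′) (d *F d′)
  product-entries {X} {Y} {a} {c} {d} {a′} {c′} {d′} e f = record
    { tt≈ = F.trans (expand top top) (F.trans (F.+-cong (F.*-cong (tt≈ e) (tt≈ f)) (F.+-congʳ (F.*-congʳ (tb≈ e))))
              (R.solve 2 (λ u v → u R.:+ (R.con ℤ.0ℤ R.:* v R.:+ R.con ℤ.0ℤ) R.:= u) F.refl (a *F a′) (mat Y bot top)))
    ; tb≈ = F.trans (expand top bot) (F.trans (F.+-cong (F.*-congˡ (tb≈ f)) (F.+-congʳ (F.*-congʳ (tb≈ e))))
              (R.solve 2 (λ u v → u R.:* R.con ℤ.0ℤ R.:+ (R.con ℤ.0ℤ R.:* v R.:+ R.con ℤ.0ℤ) R.:= R.con ℤ.0ℤ) F.refl (mat X top top) (mat Y bot bot)))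
    ; bt≈ = F.trans (expand bot top) (F.+-cong (F.*-cong (bt≈ e) (tt≈ f)) (F.trans (F.+-identityʳ _) (F.*-cong (bb≈ e) (bt≈ f))))
    ; bb≈ = F.trans (expand bot bot) (F.trans (F.+-cong (F.*-congˡ (tb≈ f)) (F.+-congʳ (F.*-cong (bb≈ e) (bb≈ f))))
              (R.solve 2 (λ u v → u R.:* R.con ℤ.0ℤ R.:+ (v R.:+ R.con ℤ.0ℤ) R.:= v) F.refl (mat X bot top) (d *F d′))) }
    where
    expand : ∀ i j → mat (X ∙ Y) i j ≈F mat X i top *F mat Y top j +F (mat X i bot *F mat Y bot j +F 0#)
    expand i j = mat-∙ X Y i j

-- Runs through consecutive tori

module PlaneTours {c ℓ : Level} {q : ℕ} (F : FiniteField c ℓ q) (α : FiniteField.Carrier F) (generates : IsGenerator F α)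
             (T : TransitionGraph 2) (α≉1 : ¬ FiniteField._≈_ F α (FiniteField.1# F))
             (e₁₂ : TransitionGraph.Edge T zero (suc zero))
             (2≤p : 2 ≤ Generator.p F α generates) where
  open Plane F α generates T α≉1 e₁₂ public
  open GroupSolver 𝔾 using (solve; _⊜_; _⊙_; inv)
  private module N = +-*-Solver

  power-≡ : ∀ {a b} → a ≡ b → α ^F a ≈F α ^F b
  power-≡ e = F.reflexive (≡.cong (α ^F_) e)

  -- In exponents `p *ℕ i` stands for -i, as p i + i is a multiple of `m`. This avoids subtraction
  -- throughout.
  power-back : ∀ a i → α ^F ((a +ℕ p *ℕ i) +ℕ i) ≈F α ^F a
  power-back a i = F.trans (power-≡ (N.solve 3 (λ a p i → (a N.:+ p N.:* i) N.:+ i N.:= a N.:+ i N.:* (N.con 1 N.:+ p)) ≡.refl a p i)) (α^+m a i)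

  -- For even `m` the parity of an exponent depends only on the power of `α`; this is the
  -- two-colouring of a torus.
  odd-% : odd m ≡ false → ∀ x → odd (x % m) ≡ odd x
  odd-% em x = ≡.sym (≡.trans (≡.cong odd (m≡m%n+[m/n]*n x m)) (≡.trans
    (odd-sum (x % m) ((x / m) *ℕ m) ≡.refl (≡.trans (odd-* (x / m) m) (≡.trans (≡.cong (odd (x / m) ∧_) em) (∧-false (odd (x / m))))))
    (≡.sym (xor-false (odd (x % m))))))
    where
    ∧-false : ∀ a → a ∧ false ≡ false
    ∧-false true = ≡.refl
    ∧-false false = ≡.refl

  odd-p : odd m ≡ false → odd p ≡ true
  odd-p em with odd p | em
  ... | true | _ = ≡.refl

  odd-back : odd m ≡ false → ∀ a i → odd (a +ℕ p *ℕ i) ≡ odd (a +ℕ i)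
  odd-back em a i = ≡.trans (odd-sum a (p *ℕ i) ≡.refl (≡.trans (odd-* p i) (≡.cong (_∧ odd i) (odd-p em)))) (≡.sym (odd-+ a i))

  grid⇒lab : ∀ {i j x t} → Grid M₁ M₂ (V i j x) t → Lab x t
  grid⇒lab {i} {j} {x} (a , b , e) = a +ℕ i , b +ℕ j , trans e (V-shift a b i j x)

  lab⇒grid : ∀ {i j x t} → Lab x t → Grid M₁ M₂ (V i j x) t
  lab⇒grid {i} {j} {x} (a , b , e) = a +ℕ p *ℕ i , b +ℕ p *ℕ j ,
    trans e (sym (trans (V-shift (a +ℕ p *ℕ i) (b +ℕ p *ℕ j) i j x) (V-cong (power-back a i) (power-back b j) F.refl)))

  -- A torus of even side is bipartite with classes of equal size, so the ends must have different
  -- colours. For odd side it is enough that they differ.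
  Good : ℕ → ℕ → ℕ → ℕ → K → Set ℓ
  Good i j i′ j′ x = (odd m ≡ false × odd ((i +ℕ j) +ℕ (i′ +ℕ j′)) ≡ true) ⊎ (odd m ≡ true × ¬ V i j x ≈ V i′ j′ x)

  good : ∀ {i j i′ j′ x} → odd ((i +ℕ j) +ℕ (i′ +ℕ j′)) ≡ true → (odd m ≡ true → ¬ V i j x ≈ V i′ j′ x) → Good i j i′ j′ x
  good {i} {j} {i′} {j′} {x} o n = decide (odd m) ≡.refl
    where
    decide : ∀ b → odd m ≡ b → Good i j i′ j′ x
    decide true e = inj₂ (e , n e)
    decide false e = inj₁ (e , o)

  torusPath : ∀ i j i′ j′ x → Good i j i′ j′ x → Ham (Lab x) (V i j x) (V i′ j′ x)
  torusPath i j i′ j′ x g = recast (grid⇒lab {i} {j}) lab⇒grid (ends refl finish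
    (tour torus a b (V i j x) (m%n<n (i′ +ℕ p *ℕ i) m) (m%n<n (j′ +ℕ p *ℕ j) m) (parity g)))
    where
    a b : ℕ
    a = (i′ +ℕ p *ℕ i) % m
    b = (j′ +ℕ p *ℕ j) % m
    power-a : ∀ u v → α ^F ((u +ℕ p *ℕ v) % m +ℕ v) ≈F α ^F u
    power-a u v = begin
      α ^F ((u +ℕ p *ℕ v) % m +ℕ v)             ≈⟨ ^-homo-* α ((u +ℕ p *ℕ v) % m) v ⟩
      α ^F ((u +ℕ p *ℕ v) % m) *F α ^F v        ≈⟨ F.*-congʳ (α^% (u +ℕ p *ℕ v)) ⟨
      α ^F (u +ℕ p *ℕ v) *F α ^F v              ≈⟨ ^-homo-* α (u +ℕ p *ℕ v) v ⟨
      α ^F ((u +ℕ p *ℕ v) +ℕ v)                 ≈⟨ power-back u v ⟩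
      α ^F u                                    ∎
      where open SetoidReasoning F.setoid
    finish : M₁ ^ a ∙ (M₂ ^ b ∙ V i j x) ≈ V i′ j′ x
    finish = trans (V-shift a b i j x) (V-cong (power-a i′ i) (power-a j′ j) F.refl)
    parity : Good i j i′ j′ x → odd (a +ℕ b) ≡ true ⊎ (odd m ≡ true × 0 < a +ℕ b)
    parity (inj₁ (em , o)) = inj₁ (≡.trans (odd-sum a b (≡.trans (odd-% em (i′ +ℕ p *ℕ i)) (odd-back em i′ i))
        (≡.trans (odd-% em (j′ +ℕ p *ℕ j)) (odd-back em j′ j)))
      (≡.trans (≡.sym (odd-+ (i′ +ℕ i) (j′ +ℕ j)))
        (≡.trans (≡.cong odd (N.solve 4 (λ i j k l → (k N.:+ i) N.:+ (l N.:+ j) N.:= (i N.:+ j) N.:+ (k N.:+ l)) ≡.refl i j i′ j′)) o)))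
    parity (inj₂ (om , n)) = inj₂ (om , positive a b finish)
      where
      positive : ∀ a b → M₁ ^ a ∙ (M₂ ^ b ∙ V i j x) ≈ V i′ j′ x → 0 < a +ℕ b
      positive zero zero e = ⊥-elim (n (trans (sym (trans (identityˡ _) (identityˡ _))) e))
      positive zero (suc b) _ = s≤s z≤n
      positive (suc a) b _ = s≤s z≤n

  -- Serves to visit one torus twice, in two complementary bands of rows.
  Segment : ℕ → ℕ → K → Pred GL ℓ
  Segment k b x t = ∃₂ λ i r → r < k × t ≈ V i (r +ℕ b) x

  -- The offset from start to end is (-(r + 1) , r): its sum is odd, and with `M₁` replaced by its
  -- inverse it meets the bound of `band` exactly.
  segmentPath : ∀ k r a b a′ x → r < k → k ≤ m → α ^F (suc r +ℕ a′) ≈F α ^F a →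
                Ham (Segment k b x) (V a b x) (V a′ (r +ℕ b) x)
  segmentPath k r a b a′ x r<k k≤m e = recast to from (ends refl finish
    (recast (rows-flip torus) (rows-unflip torus)
      (band (Torus.flip torus) (suc r) r k (V a b x) ℕ.≤-refl (≡.cong not (odd-double r)) r<k k≤m)))
    where
    to : ∀ {t} → Rows k M₁ M₂ (V a b x) t → Segment k b x t
    to (i , j , j<k , e) = i +ℕ a , j , j<k , trans e (V-shift i j a b x)
    from : ∀ {t} → Segment k b x t → Rows k M₁ M₂ (V a b x) t
    from (i , j , j<k , e) = i +ℕ p *ℕ a , j , j<k ,
      trans e (sym (trans (V-shift (i +ℕ p *ℕ a) j a b x) (V-cong (power-back i a) F.refl F.refl)))
    finish : M₁ ⁻¹ ^ suc r ∙ (M₂ ^ r ∙ V a b x) ≈ V a′ (r +ℕ b) x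
    finish = trans (∙-congˡ {M₁ ⁻¹ ^ suc r} (sym target)) (trans (sym (assoc _ _ _)) (trans (∙-congʳ (inverse-^ M₁ (suc r))) (identityˡ _)))
      where
      target : M₁ ^ suc r ∙ V a′ (r +ℕ b) x ≈ M₂ ^ r ∙ V a b x
      target = trans (∙-congˡ {M₁ ^ suc r} (sym (identityˡ _))) (trans (V-shift (suc r) 0 a′ (r +ℕ b) x)
        (trans (V-cong {suc r +ℕ a′} {r +ℕ b} {x} {a} {r +ℕ b} {x} e F.refl F.refl) (sym (trans (sym (identityˡ _)) (V-shift 0 r a b x)))))

  -- A generator g = α ^ γ such that stepping from the torus of x to that of g x uses the operation at an odd offset from x.
  record Ratio : Set (c ⊔ ℓ) where
    field
      γ β    : ℕ
      τ      : K
      odd-γ  : odd γ ≡ true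
      odd-β  : odd β ≡ true
      sign   : Sign τ
      stepping : α ^F γ ≈F 1# +F τ *F α ^F β
      γ-free : ∀ k → α ^F (k *ℕ γ) ≈F 1# → m ∣ k
      reach  : ∀ k → ∃ λ r → r ≤ p × α ^F (r *ℕ γ) ≈F α ^F k

  -- Write α - 1 = α^β₀. If β₀ is odd, g = α works, since α = 1 + α^β₀. If β₀ is even, take g = α⁻¹
  -- = 1 - α⁻¹ α^β₀, whose exponent -1 + β₀ is odd. For -1 the exponent p + m = 2 p + 1 is used,
  -- which is odd whatever the parity of `p`.
  ratio : Ratio
  ratio with logarithm {α -F 1#} (λ e → α≉1 (difference e))
  ... | β₀ , e with half β₀
  ... | inj₂ (o , _) = record
    { γ = 1 ; β = β₀ ; τ = 1# ; odd-γ = ≡.refl ; odd-β = o ; sign = inj₁ F.refl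
    ; stepping = F.trans (F.*-identityʳ α) (F.trans (R.solve 1 (λ a → a R.:= R.con ℤ.1ℤ R.:+ R.con ℤ.1ℤ R.:* (a R.:- R.con ℤ.1ℤ)) F.refl α) (F.+-congˡ (F.*-congˡ e)))
    ; γ-free = λ k e → divides-order k (F.trans (power-≡ (≡.sym (ℕ.*-identityʳ k))) e)
    ; reach = λ k → k % m , ℕ.≤-pred (m%n<n k m) , F.trans (power-≡ (ℕ.*-identityʳ (k % m))) (F.sym (α^% k)) }
  ... | inj₁ (o , _) = record
    { γ = γ ; β = γ +ℕ β₀ ; τ = -F 1# ; odd-γ = odd-γ
    ; odd-β = odd-sum γ β₀ odd-γ o ; sign = inj₂ F.refl
    ; stepping = begin
        α ^F γ                                               ≈⟨ R.solve 2 (λ g a → g R.:= g R.:* a R.:+ (R.:- R.con ℤ.1ℤ) R.:* (g R.:* (a R.:- R.con ℤ.1ℤ))) F.refl (α ^F γ) α ⟩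
        α ^F γ *F α +F -F 1# *F (α ^F γ *F (α -F 1#))        ≈⟨ F.+-cong inverse-γ (F.*-congˡ (F.*-congˡ e)) ⟩
        1# +F -F 1# *F (α ^F γ *F α ^F β₀)                   ≈⟨ F.+-congˡ (F.*-congˡ (^-homo-* α γ β₀)) ⟨
        1# +F -F 1# *F α ^F (γ +ℕ β₀)                        ∎
    ; γ-free = λ k e → divides-order k (begin
        α ^F k                                               ≈⟨ F.*-identityˡ _ ⟨
        1# *F α ^F k                                         ≈⟨ F.*-congʳ e ⟨
        α ^F (k *ℕ γ) *F α ^F k                              ≈⟨ inverse-power k ⟩
        1#                                                   ∎)
    ; reach = λ k → (p *ℕ k) % m , ℕ.≤-pred (m%n<n (p *ℕ k) m) , cancel (power≉0 k) (begin
        α ^F k *F α ^F ((p *ℕ k) % m *ℕ γ)                   ≈⟨ F.*-congˡ (reduce (p *ℕ k)) ⟩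
        α ^F k *F α ^F (p *ℕ k *ℕ γ)                         ≈⟨ F.*-congˡ (F.trans (F.sym (F.*-identityʳ _)) (F.*-congˡ (F.sym (inverse-power k)))) ⟩
        α ^F k *F (α ^F (p *ℕ k *ℕ γ) *F (α ^F (k *ℕ γ) *F α ^F k))
          ≈⟨ R.solve 3 (λ a b c → a R.:* (b R.:* (c R.:* a)) R.:= a R.:* a R.:* (b R.:* c)) F.refl (α ^F k) (α ^F (p *ℕ k *ℕ γ)) (α ^F (k *ℕ γ)) ⟩
        α ^F k *F α ^F k *F (α ^F (p *ℕ k *ℕ γ) *F α ^F (k *ℕ γ))   ≈⟨ F.*-congˡ (F.trans (F.sym (^-homo-* α (p *ℕ k *ℕ γ) (k *ℕ γ)))
             (F.trans (power-≡ (N.solve 3 (λ p k g → p N.:* k N.:* g N.:+ k N.:* g N.:= (k N.:* g) N.:* (N.con 1 N.:+ p)) ≡.refl p k γ)) (α^*m (k *ℕ γ)))) ⟩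
        α ^F k *F α ^F k *F 1#                               ≈⟨ F.*-identityʳ _ ⟩
        α ^F k *F α ^F k                                     ∎) }
    where
    open SetoidReasoning F.setoid
    γ : ℕ
    γ = p +ℕ m
    odd-γ : odd γ ≡ true
    odd-γ = ≡.trans (≡.cong odd (ℕ.+-suc p p)) (≡.cong not (odd-double p))
    inverse-γ : α ^F γ *F α ≈F 1#
    inverse-γ = F.trans (F.*-comm _ _) (F.trans (power-≡ (≡.trans (≡.sym (ℕ.+-suc p m)) (N.solve 1 (λ p → p N.:+ (N.con 2 N.:+ p) N.:= N.con 2 N.:* (N.con 1 N.:+ p)) ≡.refl p))) (α^*m 2))
    inverse-power : ∀ k → α ^F (k *ℕ γ) *F α ^F k ≈F 1#
    inverse-power k = F.trans (F.sym (^-homo-* α (k *ℕ γ) k)) (F.trans (power-≡ (N.solve 2 (λ p k → k N.:* (p N.:+ (N.con 1 N.:+ p)) N.:+ k N.:= (N.con 2 N.:* k) N.:* (N.con 1 N.:+ p)) ≡.refl p k)) (α^*m (2 *ℕ k)))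
    reduce : ∀ k → α ^F (k % m *ℕ γ) ≈F α ^F (k *ℕ γ)
    reduce k = begin
      α ^F (k % m *ℕ γ)                     ≈⟨ ^-assocʳ α (k % m) γ ⟨
      (α ^F (k % m)) ^F γ                   ≈⟨ ^-congˡ γ (α^% k) ⟨
      (α ^F k) ^F γ                         ≈⟨ ^-assocʳ α k γ ⟩
      α ^F (k *ℕ γ)                         ∎

  open Ratio ratio public

  lab : K → ℕ → K
  lab s e = s *F α ^F e

  sign≉0 : ∀ {s} → Sign s → ¬ s ≈F 0#
  sign≉0 (inj₁ s≈1) z = F.1≉0 (F.trans (F.sym s≈1) z)
  sign≉0 (inj₂ s≈-1) z = F.1≉0 (F.trans (R.solve 0 (R.con ℤ.1ℤ R.:= R.:- (R.:- R.con ℤ.1ℤ)) F.refl)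
    (F.trans (F.-‿cong (F.trans (F.sym s≈-1) z)) (R.solve 0 (R.:- R.con ℤ.0ℤ R.:= R.con ℤ.0ℤ) F.refl)))

  sign-* : ∀ {s u} → Sign s → Sign u → Sign (s *F u)
  sign-* (inj₁ a) (inj₁ b) = inj₁ (F.trans (F.*-cong a b) (F.*-identityˡ 1#))
  sign-* (inj₁ a) (inj₂ b) = inj₂ (F.trans (F.*-cong a b) (F.*-identityˡ (-F 1#)))
  sign-* (inj₂ a) (inj₁ b) = inj₂ (F.trans (F.*-cong a b) (F.*-identityʳ (-F 1#)))
  sign-* (inj₂ a) (inj₂ b) = inj₁ (F.trans (F.*-cong a b) (R.solve 0 (R.:- R.con ℤ.1ℤ R.:* (R.:- R.con ℤ.1ℤ) R.:= R.con ℤ.1ℤ) F.refl))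

  sign² : ∀ {s} → Sign s → s *F s ≈F 1#
  sign² (inj₁ a) = F.trans (F.*-cong a a) (F.*-identityˡ 1#)
  sign² (inj₂ b) = F.trans (F.*-cong b b) (R.solve 0 (R.:- R.con ℤ.1ℤ R.:* (R.:- R.con ℤ.1ℤ) R.:= R.con ℤ.1ℤ) F.refl)

  lab≉0 : ∀ {s} → Sign s → ∀ e → ¬ lab s e ≈F 0#
  lab≉0 sg e = nonzero-* (sign≉0 sg) (power≉0 e)

  -- Identifies the exit from each torus of a run: the next torus is reached at offset `β +ℕ e`.
  lab-step : ∀ s e → lab s (γ +ℕ e) ≈F lab s e +F (s *F τ) *F α ^F (β +ℕ e)
  lab-step s e = begin
    s *F α ^F (γ +ℕ e)                                   ≈⟨ F.*-congˡ (F.trans (^-homo-* α γ e) (F.*-congʳ stepping)) ⟩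
    s *F ((1# +F τ *F α ^F β) *F α ^F e)                 ≈⟨ R.solve 4 (λ s t b e → s R.:* ((R.con ℤ.1ℤ R.:+ t R.:* b) R.:* e) R.:= s R.:* e R.:+ (s R.:* t) R.:* (b R.:* e)) F.refl s τ (α ^F β) (α ^F e) ⟩
    s *F α ^F e +F (s *F τ) *F (α ^F β *F α ^F e)        ≈⟨ F.+-congˡ (F.*-congˡ (^-homo-* α β e)) ⟨
    s *F α ^F e +F (s *F τ) *F α ^F (β +ℕ e)             ∎
    where open SetoidReasoning F.setoid

  lab-injective : ∀ {s} → Sign s → ∀ {a b e} → lab s (a *ℕ γ +ℕ e) ≈F lab s ((a +ℕ b) *ℕ γ +ℕ e) → m ∣ b
  lab-injective sg {a} {b} {e} eq = γ-free b (cancel (power≉0 (a *ℕ γ +ℕ e)) (begin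
    α ^F (a *ℕ γ +ℕ e) *F α ^F (b *ℕ γ)        ≈⟨ ^-homo-* α (a *ℕ γ +ℕ e) (b *ℕ γ) ⟨
    α ^F ((a *ℕ γ +ℕ e) +ℕ b *ℕ γ)             ≈⟨ power-≡ (N.solve 4 (λ a b g e → (a N.:* g N.:+ e) N.:+ b N.:* g N.:= (a N.:+ b) N.:* g N.:+ e) ≡.refl a b γ e) ⟩
    α ^F ((a +ℕ b) *ℕ γ +ℕ e)                  ≈⟨ cancel (sign≉0 sg) eq ⟨
    α ^F (a *ℕ γ +ℕ e)                         ≈⟨ F.*-identityʳ _ ⟨
    α ^F (a *ℕ γ +ℕ e) *F 1#                   ∎))
    where open SetoidReasoning F.setoid

  Labels : ℕ → K → ℕ → Pred GL ℓ
  Labels r s e t = ∃ λ k → k ≤ r × Lab (lab s (k *ℕ γ +ℕ e)) t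

  shift-≡ : ∀ k e → k *ℕ γ +ℕ (γ +ℕ e) ≡ suc k *ℕ γ +ℕ e
  shift-≡ k e = N.solve 3 (λ k g e → k N.:* g N.:+ (g N.:+ e) N.:= (N.con 1 N.:+ k) N.:* g N.:+ e) ≡.refl k γ e

  lab-≡ : ∀ s {a b} → a ≡ b → lab s a ≈F lab s b
  lab-≡ s e = F.*-congˡ (power-≡ e)

  labels-suc : ∀ {r s e t} → Labels r s (γ +ℕ e) t → Labels (suc r) s e t
  labels-suc {s = s} {e} (k , k≤r , l) = suc k , s≤s k≤r , Lab-cong (lab-≡ s (shift-≡ k e)) l

  labels-split : ∀ {r s e t} → Labels (suc r) s e t → Lab (lab s e) t ⊎ Labels r s (γ +ℕ e) t
  labels-split (zero , _ , l) = inj₁ l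
  labels-split {s = s} {e} (suc k , s≤s k≤r , l) = inj₂ (k , k≤r , Lab-cong (F.sym (lab-≡ s (shift-≡ k e))) l)

  labels-disjoint : ∀ {r s e t} → Sign s → r < p → Lab (lab s e) t → ¬ Labels r s (γ +ℕ e) t
  labels-disjoint {s = s} {e} sg r<p l (k , k≤r , l′) = ℕ.<⇒≱ (s≤s (ℕ.≤-<-trans k≤r r<p))
    (∣⇒≤ (lab-injective sg {0} {suc k} {e} (F.trans (Lab-disjoint l l′) (lab-≡ s (shift-≡ k e)))))

  -- An exit of given offset still has `b` free, and m ≥ 3 makes b = 0, 1, 2 give three different
  -- vertices.
  exitChoice : ∀ k x x′ (A Z : GL) → ∃ λ b → (¬ V (k +ℕ b) b x ≈ A) × (¬ V (k +ℕ b) b x′ ≈ Z)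
  exitChoice k x x′ A Z = pick (avoidTwo {P = λ i → V (k +ℕ toℕ i) (toℕ i) x ≈ A} {Q = λ i → V (k +ℕ toℕ i) (toℕ i) x′ ≈ Z}
      (λ i → V (k +ℕ toℕ i) (toℕ i) x ≟G A) (λ i → V (k +ℕ toℕ i) (toℕ i) x′ ≟G Z)
      (λ {i} {j} → distinct x A i j) (λ {i} {j} → distinct x′ Z i j))
    where
    bound : ∀ (i : Fin 3) → toℕ i < m
    bound i = ℕ.≤-trans (Fin.toℕ<n i) (s≤s 2≤p)
    distinct : ∀ x A i j → i ≢ j → V (k +ℕ toℕ i) (toℕ i) x ≈ A → V (k +ℕ toℕ j) (toℕ j) x ≈ A → ⊥
    distinct x A i j n e e′ = n (Fin.toℕ-injective (power-injective (bound i) (bound j)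
      (proj₁ (proj₂ (V-injective (trans e (sym e′)))))))
    pick : (∃ λ i → (¬ V (k +ℕ toℕ i) (toℕ i) x ≈ A) × (¬ V (k +ℕ toℕ i) (toℕ i) x′ ≈ Z)) →
           ∃ λ b → (¬ V (k +ℕ b) b x ≈ A) × (¬ V (k +ℕ b) b x′ ≈ Z)
    pick (i , n , n′) = toℕ i , n , n′

  -- Runs through the tori of x, g x, …, gʳ x; the parity of the entry determines that of every exit.
  pass : ∀ r {s} → Sign s → ∀ e i j i′ j′ → r ≤ p → odd ((i +ℕ j) +ℕ e) ≡ false → odd ((i′ +ℕ j′) +ℕ (e +ℕ r)) ≡ true →
         (r ≡ 0 → odd m ≡ true → ¬ V i j (lab s e) ≈ V i′ j′ (lab s e)) →
         Ham (Labels r s e) (V i j (lab s e)) (V i′ j′ (lab s (r *ℕ γ +ℕ e)))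
  pass zero {s} sg e i j i′ j′ _ o o′ n = recast (λ l → 0 , z≤n , l) (λ { (zero , _ , l) → l })
    (torusPath i j i′ j′ (lab s e) (good (≡.trans (odd-sum (i +ℕ j) (i′ +ℕ j′) ≡.refl ≡.refl)
      (combine (odd (i +ℕ j)) (odd e) (odd (i′ +ℕ j′)) (≡.trans (≡.sym (odd-+ (i +ℕ j) e)) o)
        (≡.trans (≡.sym (odd-+ (i′ +ℕ j′) e)) (≡.trans (≡.cong (λ k → odd ((i′ +ℕ j′) +ℕ k)) (≡.sym (ℕ.+-identityʳ e))) o′)))) (n ≡.refl)))
    where
    combine : ∀ a b c → a xor b ≡ false → c xor b ≡ true → a xor c ≡ true
    combine true true false _ _ = ≡.refl
    combine false false true _ _ = ≡.refl
  pass (suc r) {s} sg e i j i′ j′ r<p o o′ _ = proceed (exitChoice (β +ℕ e) x x′ (V i j x) (V i′ j′ x′))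
    where
    x x′ : K
    x = lab s e
    x′ = lab s (γ +ℕ e)
    Goal : Set _
    Goal = Ham (Labels (suc r) s e) (V i j x) (V i′ j′ (lab s (suc r *ℕ γ +ℕ e)))
    proceed : (∃ λ b → (¬ V ((β +ℕ e) +ℕ b) b x ≈ V i j x) × (¬ V ((β +ℕ e) +ℕ b) b x′ ≈ V i′ j′ x′)) → Goal
    proceed (b , n , n′) = recast {P = Lab x ∪ Labels r s (γ +ℕ e)}
      [ (λ l → 0 , z≤n , l) , labels-suc ]′ labels-split
      (join {Q = Labels r s (γ +ℕ e)}
        (torusPath i j k b x (good parity₁ (λ _ e → n (sym e))))
        (signEdge (sign-* sg sign) (β +ℕ e) b (lab-step s e))
        (ends refl (V-cong {i′} {j′} F.refl F.refl (lab-≡ s (shift-≡ r e)))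
          (pass r sg (γ +ℕ e) k b i′ j′ (ℕ.<⇒≤ r<p) parity₂ parity₃ (λ _ _ → n′)))
        (labels-disjoint sg r<p))
      where
      k : ℕ
      k = (β +ℕ e) +ℕ b
      -- The entry has the parity of `e`, the exit that of β + e with `β` odd. In the next torus,
      -- whose label exponent is γ + e with `γ` odd, the exit becomes an entry of the right parity
      -- again.
      parity₁ : odd ((i +ℕ j) +ℕ (k +ℕ b)) ≡ true
      parity₁ = ≡.trans (≡.cong odd (N.solve 5 (λ i j β e b → (i N.:+ j) N.:+ (((β N.:+ e) N.:+ b) N.:+ b) N.:= (((i N.:+ j) N.:+ e) N.:+ β) N.:+ (b N.:+ b)) ≡.refl i j β e b))
        (≡.trans (odd-+double (((i +ℕ j) +ℕ e) +ℕ β) b) (odd-sum ((i +ℕ j) +ℕ e) β o odd-β))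
      parity₂ : odd ((k +ℕ b) +ℕ (γ +ℕ e)) ≡ false
      parity₂ = ≡.trans (≡.cong odd (N.solve 4 (λ β e b γ → (((β N.:+ e) N.:+ b) N.:+ b) N.:+ (γ N.:+ e) N.:= (β N.:+ γ) N.:+ ((e N.:+ b) N.:+ (e N.:+ b))) ≡.refl β e b γ))
        (≡.trans (odd-+double (β +ℕ γ) (e +ℕ b)) (odd-sum β γ odd-β odd-γ))
      parity₃ : odd ((i′ +ℕ j′) +ℕ ((γ +ℕ e) +ℕ r)) ≡ true
      parity₃ = ≡.trans (≡.cong odd (N.solve 5 (λ i j γ e r → (i N.:+ j) N.:+ ((γ N.:+ e) N.:+ r) N.:= γ N.:+ ((i N.:+ j) N.:+ (e N.:+ r))) ≡.refl i′ j′ γ e r))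
        (≡.trans (odd-sum γ ((i′ +ℕ j′) +ℕ (e +ℕ r)) odd-γ ≡.refl)
          (≡.trans (≡.cong odd (N.solve 4 (λ i j e r → N.con 1 N.:+ ((i N.:+ j) N.:+ (e N.:+ r)) N.:= (i N.:+ j) N.:+ (e N.:+ (N.con 1 N.:+ r))) ≡.refl i′ j′ e r)) o′))

  Start : ℕ → K → ℕ → Pred GL ℓ
  Start r s e t = Lab 0# t ⊎ Labels r s e t

  0∉labels : ∀ {r s e t} → Sign s → Lab 0# t → ¬ Labels r s e t
  0∉labels {e = e} sg l (k , _ , l′) = lab≉0 sg (k *ℕ γ +ℕ e) (F.sym (Lab-disjoint l l′))

  -- The label ± α^e itself is the difference from 0, so the torus of 0 is left at offset `e`. This
  -- must be odd, as the start has even colour.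
  begin-tour : ∀ r {s} → Sign s → ∀ e i′ j′ → r ≤ p → odd e ≡ true → odd ((i′ +ℕ j′) +ℕ (e +ℕ r)) ≡ true →
               Ham (Start r s e) (V 0 0 0#) (V i′ j′ (lab s (r *ℕ γ +ℕ e)))
  begin-tour r {s} sg e i′ j′ r≤p oe o′ = proceed (exitChoice e 0# x (V 0 0 0#) (V i′ j′ x))
    where
    x : K
    x = lab s e
    proceed : (∃ λ b → (¬ V (e +ℕ b) b 0# ≈ V 0 0 0#) × (¬ V (e +ℕ b) b x ≈ V i′ j′ x)) →
              Ham (Start r s e) (V 0 0 0#) (V i′ j′ (lab s (r *ℕ γ +ℕ e)))
    proceed (b , n , n′) = join {Q = Labels r s e}
      (torusPath 0 0 (e +ℕ b) b 0# (good (≡.trans (≡.cong odd (ℕ.+-assoc e b b)) (≡.trans (odd-+double e b) oe)) (λ _ q → n (sym q))))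
      (signEdge sg e b (F.sym (F.+-identityˡ x)))
      (pass r sg e (e +ℕ b) b i′ j′ r≤p
        (≡.trans (≡.cong odd (N.solve 2 (λ e b → ((e N.:+ b) N.:+ b) N.:+ e N.:= (e N.:+ b) N.:+ (e N.:+ b)) ≡.refl e b)) (odd-double (e +ℕ b)))
        o′ (λ _ _ → n′))
      (0∉labels sg)

-- Hamilton paths in the parabolic group of the plane

module PlaneParabolic {c ℓ : Level} {q : ℕ} (F : FiniteField c ℓ q) (α : FiniteField.Carrier F) (generates : IsGenerator F α)
             (T : TransitionGraph 2) (α≉1 : ¬ FiniteField._≈_ F α (FiniteField.1# F))
             (e₁₂ : TransitionGraph.Edge T zero (suc zero))
             (2≤p : 2 ≤ Generator.p F α generates) where
  open PlaneTours F α generates T α≉1 e₁₂ 2≤p public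
  open GroupSolver 𝔾 using (solve; _⊜_; _⊙_; inv)
  private module N = +-*-Solver

  open Entries

  start⇒parabolic : ∀ {r s e t} → Start r s e t → Mem Parabolic t
  start⇒parabolic {t = t} (inj₁ (i , j , e)) = resp Parabolic {V i j 0#} {t} (sym e) (V∈Parabolic i j 0#)
  start⇒parabolic {s = s} {e₀} {t} (inj₂ (k , _ , i , j , e)) =
    resp Parabolic {V i j (lab s (k *ℕ γ +ℕ e₀))} {t} (sym e) (V∈Parabolic i j (lab s (k *ℕ γ +ℕ e₀)))

  atLabel : ∀ s → Sign s → ∀ e {x} → ¬ x ≈F 0# → ∃ λ r → r ≤ p × x ≈F lab s (r *ℕ γ +ℕ e)
  atLabel s sg e {x} x≉0 = find (logarithm {s *F x} (nonzero-* (sign≉0 sg) x≉0))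
    where
    open SetoidReasoning F.setoid
    find : (∃ λ k → s *F x ≈F α ^F k) → ∃ λ r → r ≤ p × x ≈F lab s (r *ℕ γ +ℕ e)
    find (k , eq) = r , proj₁ (proj₂ (reach (k +ℕ p *ℕ e))) , (begin
      x                                    ≈⟨ F.*-identityˡ x ⟨
      1# *F x                              ≈⟨ F.*-congʳ (sign² sg) ⟨
      s *F s *F x                          ≈⟨ F.*-assoc s s x ⟩
      s *F (s *F x)                        ≈⟨ F.*-congˡ eq ⟩
      s *F α ^F k                          ≈⟨ F.*-congˡ (power-back k e) ⟨
      s *F α ^F ((k +ℕ p *ℕ e) +ℕ e)       ≈⟨ F.*-congˡ (^-homo-* α (k +ℕ p *ℕ e) e) ⟩
      s *F (α ^F (k +ℕ p *ℕ e) *F α ^F e)  ≈⟨ F.*-congˡ (F.*-congʳ (proj₂ (proj₂ (reach (k +ℕ p *ℕ e))))) ⟨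
      s *F (α ^F (r *ℕ γ) *F α ^F e)       ≈⟨ F.*-congˡ (^-homo-* α (r *ℕ γ) e) ⟨
      s *F α ^F (r *ℕ γ +ℕ e)              ∎)
      where
      r : ℕ
      r = proj₁ (reach (k +ℕ p *ℕ e))

  parabolic⇒start : ∀ {s} → Sign s → ∀ e {t} → Mem Parabolic t → Start p s e t
  parabolic⇒start {s} sg e {t} t∈ = decide (parabolicForm t t∈)
    where
    decide : (∃ λ x → Lab x t) → Start p s e t
    decide (x , l) = split (x ≟F 0#)
      where
      split : Dec (x ≈F 0#) → Start p s e t
      split (yes z) = inj₁ (Lab-cong z l)
      split (no n) = let (r , r≤p , eq) = atLabel s sg e n in inj₂ (r , r≤p , Lab-cong eq l)

  -- A run through the torus of 0 and then all the others, begun so that the torus of the target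
  -- comes last.
  direct : ∀ {s} → Sign s → ∀ e i j x → x ≈F lab s (p *ℕ γ +ℕ e) → odd e ≡ true → odd ((i +ℕ j) +ℕ (e +ℕ p)) ≡ true →
           Ham (Mem Parabolic) ε (V i j x)
  direct {s} sg e i j x x≈ oe o = ends V-ε (V-cong {i} {j} F.refl F.refl (F.sym x≈))
    (recast (λ {t} → start⇒parabolic {p} {s} {e} {t}) (λ {t} → parabolic⇒start {s} sg e {t}) (begin-tour p sg e i j ℕ.≤-refl oe o))

  -- A run that begins at the label after α^k ends at α^k: altogether γ has been added `m` times.
  last-label : ∀ k → α ^F (p *ℕ γ +ℕ (γ +ℕ k)) ≈F α ^F k
  last-label k = F.trans (power-≡ (N.solve 3 (λ p g k → p N.:* g N.:+ (g N.:+ k) N.:= k N.:+ g N.:* (N.con 1 N.:+ p)) ≡.refl p γ k)) (α^+m k γ)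

  positive-label : ∀ k → α ^F k ≈F lab 1# (p *ℕ γ +ℕ (γ +ℕ k))
  positive-label k = F.sym (F.trans (F.*-identityˡ _) (last-label k))

  -- Adding the odd number `m` changes the parity of an exponent but not the power, so for odd `m`
  -- every parity condition can be met.
  adjust : odd m ≡ true → ∀ n b → ∃ λ n′ → α ^F n′ ≈F α ^F n × odd n′ ≡ b
  adjust om n b = decide (odd n) b ≡.refl
    where
    shifted : ∀ a → odd n ≡ a → odd (n +ℕ 1 *ℕ m) ≡ not a
    shifted a e = ≡.trans (odd-sum n (1 *ℕ m) e (≡.trans (≡.cong odd (ℕ.*-identityˡ m)) om)) (xor-true a)
      where
      xor-true : ∀ a → a xor true ≡ not a
      xor-true true = ≡.refl
      xor-true false = ≡.refl
    decide : ∀ a b → odd n ≡ a → ∃ λ n′ → α ^F n′ ≈F α ^F n × odd n′ ≡ b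
    decide true true e = n , F.refl , e
    decide false false e = n , F.refl , e
    decide true false e = n +ℕ 1 *ℕ m , α^+m n 1 , shifted true e
    decide false true e = n +ℕ 1 *ℕ m , α^+m n 1 , shifted false e

  module OddOrder (om : odd m ≡ true) where
    path : ∀ i j k → Ham (Mem Parabolic) ε (V i j (α ^F k))
    path i j k = withExponent (adjust om (γ +ℕ k) true)
      where
      withExponent : (∃ λ e → α ^F e ≈F α ^F (γ +ℕ k) × odd e ≡ true) → Ham (Mem Parabolic) ε (V i j (α ^F k))
      withExponent (e , e≈ , oe) = withRow (adjust om i (not (odd (j +ℕ (e +ℕ p)))))
        where
        x≈ : α ^F k ≈F lab 1# (p *ℕ γ +ℕ e)
        x≈ = F.trans (positive-label k) (F.*-congˡ (F.trans (^-homo-* α (p *ℕ γ) (γ +ℕ k))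
          (F.trans (F.*-congˡ (F.sym e≈)) (F.sym (^-homo-* α (p *ℕ γ) e)))))
        xor-not : ∀ a → not a xor a ≡ true
        xor-not true = ≡.refl
        xor-not false = ≡.refl
        withRow : (∃ λ i′ → α ^F i′ ≈F α ^F i × odd i′ ≡ not (odd (j +ℕ (e +ℕ p)))) → Ham (Mem Parabolic) ε (V i j (α ^F k))
        withRow (i′ , i≈ , oi) = ends refl (V-cong i≈ F.refl F.refl)
          (direct {1#} (inj₁ F.refl) e i′ j (α ^F k) x≈ oe
            (≡.trans (≡.cong odd (ℕ.+-assoc i′ j (e +ℕ p))) (≡.trans (odd-sum i′ (j +ℕ (e +ℕ p)) oi ≡.refl) (xor-not (odd (j +ℕ (e +ℕ p)))))))

  module EvenOrder (em : odd m ≡ false) where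
    private
      op : odd p ≡ true
      op = odd-p em

    ascending : ∀ i j k → odd (i +ℕ j) ≡ true → odd k ≡ false → Ham (Mem Parabolic) ε (V i j (α ^F k))
    ascending i j k o ek = direct {1#} (inj₁ F.refl) (γ +ℕ k) i j (α ^F k) (positive-label k) oe
      (odd-sum (i +ℕ j) ((γ +ℕ k) +ℕ p) o (odd-sum (γ +ℕ k) p oe op))
      where
      oe : odd (γ +ℕ k) ≡ true
      oe = odd-sum γ k odd-γ ek

    -- The inverse of V i j (α ^ k) has label − α ^ e with e even, and inversion reverses paths.
    descending : ∀ i j k → odd (i +ℕ j) ≡ true → odd k ≡ true → Ham (Mem Parabolic) ε (V i j (α ^F k))
    descending i j k o ok = reverse (ends (identityˡ h) inverts
      (recast (λ {z} z∈ → resp Parabolic {(z ∙ h ⁻¹) ∙ h} {z} (solve 2 (λ z h → (z ⊙ inv h) ⊙ h ⊜ z) refl z h) (∙∈ Parabolic {z ∙ h ⁻¹} {h} z∈ (V∈Parabolic i j (α ^F k))))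
              (λ {z} z∈ → ∙∈ Parabolic {z} {h ⁻¹} z∈ (⁻¹∈ Parabolic {h} (V∈Parabolic i j (α ^F k))))
        (translate Parabolic {ε} {h′} {h} (direct { -F 1# } (inj₂ F.refl) (γ +ℕ e) (p *ℕ i) (p *ℕ j) (lab (-F 1#) e)
          (F.*-congˡ (F.sym (last-label e))) oe (odd-sum (p *ℕ i +ℕ p *ℕ j) ((γ +ℕ e) +ℕ p) parity (odd-sum (γ +ℕ e) p oe op))))))
      where
      open SetoidReasoning F.setoid
      -- The inverse of V i j x is V (-i) (-j) (-αʲ⁻ⁱ x). For x = α^k its label is therefore minus
      -- the power of `α` with exponent k + j - i, which is even here.
      e : ℕ
      e = k +ℕ (j +ℕ p *ℕ i)
      h h′ : GL
      h = V i j (α ^F k)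
      h′ = V (p *ℕ i) (p *ℕ j) (lab (-F 1#) e)
      parity : odd (p *ℕ i +ℕ p *ℕ j) ≡ true
      parity = ≡.trans (≡.cong odd (≡.sym (ℕ.*-distribˡ-+ p i j))) (≡.trans (odd-* p (i +ℕ j)) (≡.cong₂ _∧_ op o))
      ee : odd e ≡ false
      ee = odd-sum k (j +ℕ p *ℕ i) ok (≡.trans (odd-back em j i) (≡.trans (≡.cong odd (ℕ.+-comm j i)) o))
      oe : odd (γ +ℕ e) ≡ true
      oe = odd-sum γ e odd-γ ee
      unit-power : ∀ a → α ^F (p *ℕ a) *F α ^F a ≈F 1#
      unit-power a = F.trans (F.sym (^-homo-* α (p *ℕ a) a)) (power-back 0 a)
      inverts : h′ ∙ h ≈ ε
      inverts = trans (entries-ext (product-entries (V-entries (p *ℕ i) (p *ℕ j) (lab (-F 1#) e)) (V-entries i j (α ^F k)))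
        (entries-cong (V-entries 0 0 0#) (F.sym (unit-power i)) F.refl (F.trans (F.zeroʳ 1#) (F.sym vanish)) (F.sym (unit-power j)))) V-ε
        where
        vanish : (α ^F (p *ℕ j) *F lab (-F 1#) e) *F α ^F i +F α ^F (p *ℕ j) *F (α ^F j *F α ^F k) ≈F 0#
        vanish = begin
          (α ^F (p *ℕ j) *F (-F 1# *F α ^F e)) *F α ^F i +F α ^F (p *ℕ j) *F (α ^F j *F α ^F k)
            ≈⟨ F.+-congʳ (F.*-congʳ (F.*-congˡ (F.*-congˡ (F.trans (^-homo-* α k (j +ℕ p *ℕ i)) (F.*-congˡ (^-homo-* α j (p *ℕ i))))))) ⟩
          (α ^F (p *ℕ j) *F (-F 1# *F (α ^F k *F (α ^F j *F α ^F (p *ℕ i))))) *F α ^F i +F α ^F (p *ℕ j) *F (α ^F j *F α ^F k)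
            ≈⟨ R.solve 5 (λ u k j v i → (u R.:* (R.:- R.con ℤ.1ℤ R.:* (k R.:* (j R.:* v)))) R.:* i R.:+ u R.:* (j R.:* k) R.:= u R.:* j R.:* k R.:* (R.con ℤ.1ℤ R.:- v R.:* i)) F.refl
                 (α ^F (p *ℕ j)) (α ^F k) (α ^F j) (α ^F (p *ℕ i)) (α ^F i) ⟩
          α ^F (p *ℕ j) *F α ^F j *F α ^F k *F (1# -F α ^F (p *ℕ i) *F α ^F i)
            ≈⟨ F.*-congˡ (F.trans (F.+-congˡ (F.-‿cong (unit-power i))) (F.-‿inverseʳ 1#)) ⟩
          α ^F (p *ℕ j) *F α ^F j *F α ^F k *F 0#           ≈⟨ F.zeroʳ _ ⟩
          0#                                                ∎

    private
      h₂ : ∃ λ h → m ≡ h +ℕ h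
      h₂ with half m
      ... | inj₁ (_ , k , e) = k , e
      ... | inj₂ (o , _) with ≡.trans (≡.sym em) o
      ... | ()

      hm : ℕ
      hm = proj₁ h₂

      m≡ : m ≡ hm +ℕ hm
      m≡ = proj₂ h₂

      hm>0 : 0 < hm
      hm>0 = positive hm m≡
        where
        positive : ∀ h → m ≡ h +ℕ h → 0 < h
        positive (suc h) _ = s≤s z≤n

      instance
        hm-nonZero : NonZero hm
        hm-nonZero = >-nonZero hm>0

      hm≤m∸ : ∀ {r} → r < hm → hm ≤ m ∸ suc r
      hm≤m∸ {r} r<hm = ≡.subst (λ k → hm ≤ k ∸ suc r) (≡.sym m≡)
        (≡.subst (_≤ (hm +ℕ hm) ∸ suc r) (ℕ.m+n∸n≡m hm hm) (ℕ.∸-monoʳ-≤ (hm +ℕ hm) r<hm))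

    -- Odd offsets are of the form 2 r + 1 with r < m / 2.
    halfway : ∀ a b → odd (a +ℕ b) ≡ true → ∃ λ r → r < hm × α ^F (suc r +ℕ (b +ℕ r)) ≈F α ^F a
    halfway a b o = found (odd⇒ {a +ℕ p *ℕ b} (≡.trans (odd-back em a b) o))
      where
      open SetoidReasoning F.setoid
      found : (∃ λ k → a +ℕ p *ℕ b ≡ suc (k +ℕ k)) → ∃ λ r → r < hm × α ^F (suc r +ℕ (b +ℕ r)) ≈F α ^F a
      found (k , e) = r , m%n<n k hm , (begin
        α ^F (suc r +ℕ (b +ℕ r))                         ≈⟨ α^+m (suc r +ℕ (b +ℕ r)) s ⟨
        α ^F ((suc r +ℕ (b +ℕ r)) +ℕ s *ℕ m)             ≈⟨ power-≡ (≡.cong (λ u → (suc r +ℕ (b +ℕ r)) +ℕ s *ℕ u) m≡) ⟩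
        α ^F ((suc r +ℕ (b +ℕ r)) +ℕ s *ℕ (hm +ℕ hm))    ≈⟨ power-≡ (N.solve 4 (λ r b s h → (N.con 1 N.:+ r N.:+ (b N.:+ r)) N.:+ s N.:* (h N.:+ h) N.:=
             (N.con 1 N.:+ ((r N.:+ s N.:* h) N.:+ (r N.:+ s N.:* h))) N.:+ b) ≡.refl r b s hm) ⟩
        α ^F (suc ((r +ℕ s *ℕ hm) +ℕ (r +ℕ s *ℕ hm)) +ℕ b)   ≈⟨ power-≡ (≡.cong (λ u → suc (u +ℕ u) +ℕ b) (≡.sym (m≡m%n+[m/n]*n k hm))) ⟩
        α ^F (suc (k +ℕ k) +ℕ b)                         ≈⟨ power-≡ (≡.cong (_+ℕ b) (≡.sym e)) ⟩
        α ^F ((a +ℕ p *ℕ b) +ℕ b)                        ≈⟨ power-back a b ⟩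
        α ^F a                                           ∎)
        where
        r s : ℕ
        r = k % hm
        s = k / hm

    private
      -- If 2 = 0, then x = α^(m/2) satisfies (x - 1)² = x² - 1 = 0, so x = 1, against the
      -- minimality of `m`.
      2≉0 : ¬ 1# +F 1# ≈F 0#
      2≉0 two = h≢0 (ℕ.≤-antisym (ℕ.≮⇒≥ (λ 0<h → ℕ.<⇒≱ h<m (∣⇒≤′ 0<h (divides-order hm x≈1)))) z≤n)
        where
        x : K
        x = α ^F hm
        h<m : hm < m
        h<m = ≡.subst (hm <_) (≡.sym m≡) (ℕ.m<m+n hm hm>0)
        h≢0 : hm ≢ 0
        h≢0 e = ℕ.<⇒≢ hm>0 (≡.sym e)
        ∣⇒≤′ : 0 < hm → m ∣ hm → m ≤ hm
        ∣⇒≤′ _ d = ∣⇒≤ d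
        x² : x *F x ≈F 1#
        x² = F.trans (F.sym (^-homo-* α hm hm)) (F.trans (power-≡ (≡.sym m≡)) α^m)
        square : (x -F 1#) *F (x -F 1#) ≈F 0#
        square = begin
          (x -F 1#) *F (x -F 1#)                       ≈⟨ R.solve 1 (λ x → (x R.:- R.con ℤ.1ℤ) R.:* (x R.:- R.con ℤ.1ℤ) R.:= (x R.:* x R.:- R.con ℤ.1ℤ) R.:+ (R.con ℤ.1ℤ R.:+ R.con ℤ.1ℤ) R.:* (R.con ℤ.1ℤ R.:- x)) F.refl x ⟩
          (x *F x -F 1#) +F (1# +F 1#) *F (1# -F x)    ≈⟨ F.+-cong (F.trans (F.+-congʳ x²) (F.-‿inverseʳ 1#)) (F.trans (F.*-congʳ two) (F.zeroˡ _)) ⟩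
          0# +F 0#                                     ≈⟨ F.+-identityˡ 0# ⟩
          0#                                           ∎
          where open SetoidReasoning F.setoid
        x≈1 : x ≈F 1#
        x≈1 with (x -F 1#) ≟F 0#
        ... | yes e = difference e
        ... | no n = ⊥-elim (nonzero-* n n square)

      -- Otherwise α² = 1, although the order `m` is at least three.
      α+1≉0 : ¬ α +F 1# ≈F 0#
      α+1≉0 e = ℕ.<⇒≱ (s≤s 2≤p) (∣⇒≤ (divides-order 2 (begin
        α *F (α *F 1#)              ≈⟨ R.solve 1 (λ a → a R.:* (a R.:* R.con ℤ.1ℤ) R.:= (a R.:+ R.con ℤ.1ℤ) R.:* (a R.:- R.con ℤ.1ℤ) R.:+ R.con ℤ.1ℤ) F.refl α ⟩
        (α +F 1#) *F (α -F 1#) +F 1#  ≈⟨ F.+-congʳ (F.trans (F.*-congʳ e) (F.zeroˡ _)) ⟩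
        0# +F 1#                    ≈⟨ F.+-identityˡ 1# ⟩
        1#                          ∎)))
        where open SetoidReasoning F.setoid

    Summands : ℕ → Set ℓ
    Summands k = ∃₂ λ w o → odd w ≡ false × odd o ≡ true × α ^F k ≈F α ^F w +F α ^F o

    -- (α + 1)² = (α − 1)² + 4 α writes every nonzero element as the sum of an even and an odd power.
    summands : ∀ k → Summands k
    summands k = build (logarithm {α -F 1#} (λ e → α≉1 (difference e))) (logarithm α+1≉0) (logarithm 2≉0)
      where
      open SetoidReasoning F.setoid
      build : (∃ λ a → α -F 1# ≈F α ^F a) → (∃ λ b → α +F 1# ≈F α ^F b) → (∃ λ c → 1# +F 1# ≈F α ^F c) → Summands k
      build (a , ea) (b , eb) (d , ed) = choose (odd k) ≡.refl
        where
        u₁ u₂ e₁ e₂ : ℕ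
        u₁ = a +ℕ p *ℕ b
        u₂ = d +ℕ p *ℕ b
        e₁ = k +ℕ (u₁ +ℕ u₁)
        e₂ = suc k +ℕ (u₂ +ℕ u₂)
        quotient : ∀ a → α ^F (a +ℕ p *ℕ b) *F α ^F b ≈F α ^F a
        quotient a = F.trans (F.sym (^-homo-* α (a +ℕ p *ℕ b) b)) (power-back a b)
        sum : α ^F k ≈F α ^F e₁ +F α ^F e₂
        sum = cancel (nonzero-* (power≉0 b) (power≉0 b)) (begin
          α ^F b *F α ^F b *F α ^F k                     ≈⟨ F.*-congʳ (F.*-cong (F.sym eb) (F.sym eb)) ⟩
          (α +F 1#) *F (α +F 1#) *F α ^F k               ≈⟨ R.solve 2 (λ a k → (a R.:+ R.con ℤ.1ℤ) R.:* (a R.:+ R.con ℤ.1ℤ) R.:* k R.:=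
               k R.:* ((a R.:- R.con ℤ.1ℤ) R.:* (a R.:- R.con ℤ.1ℤ)) R.:+ (a R.:* k) R.:* ((R.con ℤ.1ℤ R.:+ R.con ℤ.1ℤ) R.:* (R.con ℤ.1ℤ R.:+ R.con ℤ.1ℤ))) F.refl α (α ^F k) ⟩
          α ^F k *F ((α -F 1#) *F (α -F 1#)) +F α ^F suc k *F ((1# +F 1#) *F (1# +F 1#))
            ≈⟨ F.+-cong (F.*-congˡ (F.*-cong ea′ ea′)) (F.*-congˡ (F.*-cong ed′ ed′)) ⟩
          α ^F k *F ((α ^F u₁ *F α ^F b) *F (α ^F u₁ *F α ^F b)) +F α ^F suc k *F ((α ^F u₂ *F α ^F b) *F (α ^F u₂ *F α ^F b))
            ≈⟨ R.solve 5 (λ k l u v b → k R.:* ((u R.:* b) R.:* (u R.:* b)) R.:+ l R.:* ((v R.:* b) R.:* (v R.:* b)) R.:= b R.:* b R.:* (k R.:* (u R.:* u) R.:+ l R.:* (v R.:* v))) F.refl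
                 (α ^F k) (α ^F suc k) (α ^F u₁) (α ^F u₂) (α ^F b) ⟩
          α ^F b *F α ^F b *F (α ^F k *F (α ^F u₁ *F α ^F u₁) +F α ^F suc k *F (α ^F u₂ *F α ^F u₂))
            ≈⟨ F.*-congˡ (F.+-cong (square k u₁) (square (suc k) u₂)) ⟩
          α ^F b *F α ^F b *F (α ^F e₁ +F α ^F e₂)       ∎)
          where
          ea′ : α -F 1# ≈F α ^F u₁ *F α ^F b
          ea′ = F.trans ea (F.sym (quotient a))
          ed′ : 1# +F 1# ≈F α ^F u₂ *F α ^F b
          ed′ = F.trans ed (F.sym (quotient d))
          square : ∀ k u → α ^F k *F (α ^F u *F α ^F u) ≈F α ^F (k +ℕ (u +ℕ u))
          square k u = F.sym (F.trans (^-homo-* α k (u +ℕ u)) (F.*-congˡ (^-homo-* α u u)))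
        choose : ∀ s → odd k ≡ s → Summands k
        choose false ek = e₁ , e₂ , ≡.trans (odd-+double k u₁) ek , ≡.trans (odd-+double (suc k) u₂) (≡.cong not ek) , sum
        choose true ok = e₂ , e₁ , ≡.trans (odd-+double (suc k) u₂) (≡.cong not ok) , ≡.trans (odd-+double k u₁) ok , F.trans sum (F.+-comm _ _)

    true≢false : ∀ {a} {A : Set a} → true ≡ false → A
    true≢false ()

    -- The runs used so far enter their last torus in even colour and hence end in odd colour. For i
    -- + j even the torus of d = α^k is visited twice. It is cut into two bands `S₂` and `S₁`: `S₂`
    -- is traversed when the turn of `d` comes, and the run goes on to its last label α^w. From
    -- there d = α^w + α^o gives an edge at odd offset into `S₁`, where the path ends. The exponent
    -- `w` is even so that the run can begin at the odd exponent γ + w.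
    module Doubled (i j k : ℕ) (eij : odd (i +ℕ j) ≡ false) (w o : ℕ) (ew : odd w ≡ false) (oo : odd o ≡ true)
                   (d≈ : α ^F k ≈F α ^F w +F α ^F o) where
      e₀ : ℕ
      e₀ = γ +ℕ w

      oe₀ : odd e₀ ≡ true
      oe₀ = odd-sum γ w odd-γ ew

      plus : Sign 1#
      plus = inj₁ F.refl

      label : ℕ → K
      label r = lab 1# (r *ℕ γ +ℕ e₀)

      d : K
      d = α ^F k

      label-p : label p ≈F α ^F w
      label-p = F.sym (positive-label w)

      gap : ∀ a b {t} → a < b → b ≤ p → Lab (label a) t → Lab (label b) t → ⊥
      gap a b a<b b≤p l l′ = ℕ.<⇒≱ (s≤s (ℕ.≤-trans (ℕ.m∸n≤m b a) b≤p)) (divisor (b ∸ a) (ℕ.m<n⇒0<n∸m a<b)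
          (lab-injective plus {a} {b ∸ a} {e₀} (F.trans (Lab-disjoint {label a} {label b} l l′)
            (lab-≡ 1# (≡.cong (λ n → n *ℕ γ +ℕ e₀) (≡.sym (ℕ.m+[n∸m]≡n (ℕ.<⇒≤ a<b))))))))
        where
        divisor : ∀ n → 0 < n → m ∣ n → m ≤ n
        divisor (suc n) _ m∣n = ∣⇒≤ m∣n

      index-≡ : ∀ {a b t} → a ≤ p → b ≤ p → Lab (label a) t → Lab (label b) t → a ≡ b
      index-≡ {a} {b} a≤p b≤p l l′ = compare (ℕ.<-cmp a b)
        where
        compare : B.Tri (a < b) (a ≡ b) (b < a) → a ≡ b
        compare (tri≈ _ e _) = e
        compare (tri< a<b _ _) = ⊥-elim (gap a b a<b b≤p l l′)
        compare (tri> _ _ b<a) = ⊥-elim (gap b a b<a a≤p l′ l)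

      -- What precedes the torus of `d`, which has number `l` in the run; for l = 0 this is the
      -- torus of 0 alone.
      Lead : ℕ → Pred GL ℓ
      Lead zero = Lab 0#
      Lead (suc l) = Start l 1# e₀

      -- The row `b` of the arrival can be prescribed, and will be the first row of `S₂`; the other
      -- exponent `a` then follows from the offset of the edge.
      arrive : ∀ l b → l ≤ p → ∃₂ λ a X → odd ((a +ℕ b) +ℕ (l *ℕ γ +ℕ e₀)) ≡ false × Ham (Lead l) (V 0 0 0#) X × X ~ V a b (label l)
      arrive zero b _ = e₀ +ℕ b , V (e₀ +ℕ b) b 0# ,
        ≡.trans (≡.cong odd (N.solve 2 (λ e b → ((e N.:+ b) N.:+ b) N.:+ e N.:= (e N.:+ b) N.:+ (e N.:+ b)) ≡.refl e₀ b)) (odd-double (e₀ +ℕ b)) ,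
        torusPath 0 0 (e₀ +ℕ b) b 0# (inj₁ (em , ≡.trans (≡.cong odd (ℕ.+-assoc e₀ b b)) (≡.trans (odd-+double e₀ b) oe₀))) ,
        signEdge plus e₀ b (F.sym (F.+-identityˡ (lab 1# e₀)))
      arrive (suc l) b l<p = a , V a b (label l) , parity₁ , begin-tour l plus e₀ a b (ℕ.<⇒≤ l<p) oe₀ parity₂ ,
        ~-resp {V a b (label l)} {V a b (label l)} {V a b (lab 1# (γ +ℕ el))} {V a b (label (suc l))} refl
          (V-cong {a} {b} F.refl F.refl (lab-≡ 1# (≡.sym (ℕ.+-assoc γ (l *ℕ γ) e₀))))
          (signEdge (sign-* plus sign) (β +ℕ el) b (lab-step 1# el))
        where
        el a : ℕ
        el = l *ℕ γ +ℕ e₀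
        a = (β +ℕ el) +ℕ b
        parity₁ : odd ((a +ℕ b) +ℕ (suc l *ℕ γ +ℕ e₀)) ≡ false
        parity₁ = ≡.trans (≡.cong odd (N.solve 5 (λ β l γ e b → ((β N.:+ (l N.:* γ N.:+ e) N.:+ b) N.:+ b) N.:+ ((γ N.:+ l N.:* γ) N.:+ e) N.:=
            (β N.:+ γ) N.:+ (((l N.:* γ N.:+ e) N.:+ b) N.:+ ((l N.:* γ N.:+ e) N.:+ b))) ≡.refl β l γ e₀ b))
          (≡.trans (odd-+double (β +ℕ γ) (el +ℕ b)) (odd-sum β γ odd-β odd-γ))
        odd-lγ : odd (l *ℕ γ +ℕ l) ≡ false
        odd-lγ = ≡.trans (odd-sum (l *ℕ γ) l (odd-* l γ) ≡.refl) (≡.trans (≡.cong (λ b → (odd l ∧ b) xor odd l) odd-γ) (self (odd l)))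
          where
          self : ∀ a → (a ∧ true) xor a ≡ false
          self true = ≡.refl
          self false = ≡.refl
        parity₂ : odd ((a +ℕ b) +ℕ (e₀ +ℕ l)) ≡ true
        parity₂ = ≡.trans (≡.cong odd (N.solve 5 (λ β l γ e b → ((β N.:+ (l N.:* γ N.:+ e) N.:+ b) N.:+ b) N.:+ (e N.:+ l) N.:=
            (β N.:+ (l N.:* γ N.:+ l)) N.:+ ((e N.:+ b) N.:+ (e N.:+ b))) ≡.refl β l γ e₀ b))
          (≡.trans (odd-+double (β +ℕ (l *ℕ γ +ℕ l)) (e₀ +ℕ b)) (odd-sum β (l *ℕ γ +ℕ l) odd-β odd-lγ))

      segment⇒lab : ∀ {K b t} → Segment K b d t → Lab d t
      segment⇒lab {b = b} (i , r , _ , e) = i , r +ℕ b , e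

      segments-disjoint : ∀ {u t} → u < m → Segment u j d t → ¬ Segment (m ∸ u) (u +ℕ j) d t
      segments-disjoint {u} u<m (i₁ , r , r<u , e) (i₂ , s , s<m∸u , e′) =
        ℕ.<⇒≱ r<u (ℕ.≤-trans (ℕ.m≤n+m u s) (ℕ.≤-reflexive (≡.sym (power-injective (ℕ.<-trans r<u u<m) s+u<m
          (cancel (power≉0 j) (begin
            α ^F j *F α ^F r            ≈⟨ F.*-comm _ _ ⟩
            α ^F r *F α ^F j            ≈⟨ ^-homo-* α r j ⟨
            α ^F (r +ℕ j)               ≈⟨ proj₁ (proj₂ (V-injective {i₁} {r +ℕ j} {d} {i₂} {s +ℕ (u +ℕ j)} {d} (trans (sym e) e′))) ⟩
            α ^F (s +ℕ (u +ℕ j))        ≈⟨ power-≡ (≡.sym (ℕ.+-assoc s u j)) ⟩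
            α ^F ((s +ℕ u) +ℕ j)        ≈⟨ ^-homo-* α (s +ℕ u) j ⟩
            α ^F (s +ℕ u) *F α ^F j     ≈⟨ F.*-comm _ _ ⟩
            α ^F j *F α ^F (s +ℕ u)     ∎))))))
        where
        open SetoidReasoning F.setoid
        s+u<m : s +ℕ u < m
        s+u<m = ≡.subst (s +ℕ u <_) (ℕ.m∸n+n≡m (ℕ.<⇒≤ u<m)) (ℕ.+-monoˡ-< u s<m∸u)

      lab⇒segments : ∀ {u t} → u < m → Lab d t → Segment u j d t ⊎ Segment (m ∸ u) (u +ℕ j) d t
      lab⇒segments {u} {t} u<m (i₁ , j₁ , e) = split (r ℕ.<? u)
        where
        r : ℕ
        r = (j₁ +ℕ p *ℕ j) % m
        row : t ≈ V i₁ (r +ℕ j) d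
        row = trans e (V-cong {i₁} {j₁} {d} {i₁} {r +ℕ j} {d} F.refl (F.sym (F.trans (^-homo-* α r j) (F.trans (F.*-congʳ (F.sym (α^% (j₁ +ℕ p *ℕ j))))
          (F.trans (F.sym (^-homo-* α (j₁ +ℕ p *ℕ j) j)) (power-back j₁ j))))) F.refl)
        split : Dec (r < u) → Segment u j d t ⊎ Segment (m ∸ u) (u +ℕ j) d t
        split (yes r<u) = inj₁ (i₁ , r , r<u , row)
        split (no r≮u) = inj₂ (i₁ , r ∸ u , ℕ.∸-monoˡ-< (m%n<n (j₁ +ℕ p *ℕ j) m) u≤r , trans row (reflexive (≡.cong (λ n → V i₁ n d)
          (≡.trans (≡.cong (_+ℕ j) (≡.sym (ℕ.m∸n+n≡m u≤r))) (ℕ.+-assoc (r ∸ u) u j)))))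
          where
          u≤r : u ≤ r
          u≤r = ℕ.≮⇒≥ r≮u

      path : Ham (Mem Parabolic) ε (V i j d)
      path = locate (atLabel 1# plus e₀ {d} (power≉0 k)) (halfway i (o +ℕ j) parity-v)
        where
        parity-v : odd (i +ℕ (o +ℕ j)) ≡ true
        parity-v = ≡.trans (≡.cong odd (N.solve 3 (λ i o j → i N.:+ (o N.:+ j) N.:= o N.:+ (i N.:+ j)) ≡.refl i o j)) (odd-sum o (i +ℕ j) oo eij)
        locate : (∃ λ l → l ≤ p × d ≈F label l) → (∃ λ r → r < hm × α ^F (suc r +ℕ ((o +ℕ j) +ℕ r)) ≈F α ^F i) → Ham (Mem Parabolic) ε (V i j d)
        locate (l , l≤p , d-l) (r₁ , r₁<h , e₁) = afterArrival (arrive l b l≤p)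
          where
          -- The last label of the run is α^w, and `d` differs from it by α^o.
          l<p : l < p
          l<p = ℕ.≤∧≢⇒< l≤p λ l≡p → power≉0 o (begin
            α ^F o                               ≈⟨ R.solve 2 (λ w o → o R.:= (w R.:+ o) R.:- w) F.refl (α ^F w) (α ^F o) ⟩
            (α ^F w +F α ^F o) -F α ^F w         ≈⟨ F.+-congʳ (F.trans (F.sym d≈) (F.trans d-l (F.trans (lab-≡ 1# (≡.cong (λ n → n *ℕ γ +ℕ e₀) l≡p)) label-p))) ⟩
            α ^F w -F α ^F w                     ≈⟨ F.-‿inverseʳ _ ⟩
            0#                                   ∎)
            where open SetoidReasoning F.setoid
          -- `S₁` consists of the `u` rows that begin with row `j` of the target. It is entered in
          -- its last row, r₁ + j, at offset `o`; row `b` is the next one and begins `S₂`.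
          u b v₁ : ℕ
          u = suc r₁
          b = u +ℕ j
          v₁ = o +ℕ (r₁ +ℕ j)
          u<m : u < m
          u<m = ℕ.≤-<-trans r₁<h (≡.subst (hm <_) (≡.sym m≡) (ℕ.m<m+n hm hm>0))
          S₁ S₂ : Pred GL ℓ
          S₁ = Segment u j d
          S₂ = Segment (m ∸ u) b d
          final : Ham S₁ (V v₁ (r₁ +ℕ j) d) (V i j d)
          final = reverse (segmentPath u r₁ i j v₁ d (ℕ.n<1+n r₁) (ℕ.<⇒≤ u<m)
            (F.trans (power-≡ (N.solve 3 (λ r o j → N.con 1 N.:+ r N.:+ (o N.:+ (r N.:+ j)) N.:= N.con 1 N.:+ r N.:+ ((o N.:+ j) N.:+ r)) ≡.refl r₁ o j)) e₁))
          afterArrival : (∃₂ λ a X → odd ((a +ℕ b) +ℕ (l *ℕ γ +ℕ e₀)) ≡ false × Ham (Lead l) (V 0 0 0#) X × X ~ V a b (label l)) →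
                         Ham (Mem Parabolic) ε (V i j d)
          afterArrival (a , X , parity-a , lead , edge) = withBand (halfway a ((β +ℕ el) +ℕ b) parity-b)
            where
            el : ℕ
            el = l *ℕ γ +ℕ e₀
            parity-b : odd (a +ℕ ((β +ℕ el) +ℕ b)) ≡ true
            parity-b = ≡.trans (≡.cong odd (N.solve 4 (λ a β e b → a N.:+ ((β N.:+ e) N.:+ b) N.:= β N.:+ ((a N.:+ b) N.:+ e)) ≡.refl a β el b))
              (odd-sum β ((a +ℕ b) +ℕ el) odd-β parity-a)
            withBand : (∃ λ r → r < hm × α ^F (suc r +ℕ (((β +ℕ el) +ℕ b) +ℕ r)) ≈F α ^F a) → Ham (Mem Parabolic) ε (V i j d)
            withBand (r₂ , r₂<h , e₂) = ends V-ε refl (recast to from whole-path)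
              where
              s r b₂ v₂ : ℕ
              s = suc l
              r = p ∸ s
              b₂ = r₂ +ℕ b
              v₂ = (β +ℕ el) +ℕ b₂
              r+s : r +ℕ s ≡ p
              r+s = ℕ.m∸n+n≡m l<p
              L : Pred GL ℓ
              L = Labels r 1# (γ +ℕ el)
              index : ∀ n → n *ℕ γ +ℕ (γ +ℕ el) ≡ (n +ℕ s) *ℕ γ +ℕ e₀
              index n = N.solve 4 (λ n l γ e → n N.:* γ N.:+ (γ N.:+ (l N.:* γ N.:+ e)) N.:= (n N.:+ (N.con 1 N.:+ l)) N.:* γ N.:+ e) ≡.refl n l γ e₀
              toIndex : ∀ {t} → L t → ∃ λ n → s ≤ n × n ≤ p × Lab (label n) t
              toIndex (n , n≤r , q) = n +ℕ s , ℕ.m≤n+m s n , ≡.subst (n +ℕ s ≤_) r+s (ℕ.+-monoˡ-≤ s n≤r) , Lab-cong (lab-≡ 1# (index n)) q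
              d⇒label : ∀ {t} → Lab d t → Lab (label l) t
              d⇒label = Lab-cong d-l
              -- `halfway` needs at most half of the rows, and as `u` is at most m / 2, at least
              -- half of them are left to `S₂`.
              band₂ : Ham S₂ (V a b (label l)) (V v₂ b₂ (label l))
              band₂ = ends (V-cong {a} {b} F.refl F.refl d-l) (V-cong {v₂} {b₂} F.refl F.refl d-l)
                (segmentPath (m ∸ u) r₂ a b v₂ d (ℕ.<-≤-trans r₂<h (hm≤m∸ r₁<h)) (ℕ.m∸n≤m m u)
                  (F.trans (power-≡ (N.solve 4 (λ r β e b → N.con 1 N.:+ r N.:+ ((β N.:+ e) N.:+ (r N.:+ b)) N.:= N.con 1 N.:+ r N.:+ (((β N.:+ e) N.:+ b) N.:+ r)) ≡.refl r₂ β el b)) e₂))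
              last-≡ : lab 1# (r *ℕ γ +ℕ (γ +ℕ el)) ≈F α ^F w
              last-≡ = F.trans (lab-≡ 1# (≡.trans (index r) (≡.cong (λ n → n *ℕ γ +ℕ e₀) r+s))) label-p
              odd-index : odd ((γ +ℕ el) +ℕ r) ≡ false
              odd-index = ≡.trans (≡.cong odd (N.solve 4 (λ γ l e r → (γ N.:+ (l N.:* γ N.:+ e)) N.:+ r N.:= ((N.con 1 N.:+ l) N.:* γ N.:+ r) N.:+ e) ≡.refl γ l e₀ r))
                (odd-sum (s *ℕ γ +ℕ r) e₀ (≡.trans (odd-sum (s *ℕ γ) r (odd-* s γ) ≡.refl) (≡.trans (≡.cong (λ b → (odd s ∧ b) xor odd r) odd-γ)
                  (≡.trans (and-true (odd s) (odd r)) (≡.trans (≡.sym (odd-+ r s)) (≡.trans (≡.cong odd r+s) op))))) oe₀)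
                where
                and-true : ∀ a b → (a ∧ true) xor b ≡ b xor a
                and-true true true = ≡.refl
                and-true true false = ≡.refl
                and-true false true = ≡.refl
                and-true false false = ≡.refl
              passing : Ham L (V v₂ b₂ (lab 1# (γ +ℕ el))) (V v₁ (r₁ +ℕ j) (α ^F w))
              passing = ends refl (V-cong {v₁} {r₁ +ℕ j} F.refl F.refl last-≡)
                (pass r plus (γ +ℕ el) v₂ b₂ v₁ (r₁ +ℕ j) (ℕ.m∸n≤m p s)
                  (≡.trans (≡.cong odd (N.solve 4 (λ β e b γ → (((β N.:+ e) N.:+ b) N.:+ b) N.:+ (γ N.:+ e) N.:= (β N.:+ γ) N.:+ ((e N.:+ b) N.:+ (e N.:+ b))) ≡.refl β el b₂ γ))
                    (≡.trans (odd-+double (β +ℕ γ) (el +ℕ b₂)) (odd-sum β γ odd-β odd-γ)))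
                  (odd-sum (v₁ +ℕ (r₁ +ℕ j)) ((γ +ℕ el) +ℕ r) (≡.trans (≡.cong odd (ℕ.+-assoc o (r₁ +ℕ j) (r₁ +ℕ j))) (≡.trans (odd-+double o (r₁ +ℕ j)) oo)) odd-index)
                  (λ _ om → true≢false (≡.trans (≡.sym om) em)))
              exit₂ : V v₂ b₂ (label l) ~ V v₂ b₂ (lab 1# (γ +ℕ el))
              exit₂ = signEdge (sign-* plus sign) (β +ℕ el) b₂ (lab-step 1# el)
              exit₃ : V v₁ (r₁ +ℕ j) (α ^F w) ~ V v₁ (r₁ +ℕ j) d
              exit₃ = signEdge plus o (r₁ +ℕ j) (F.trans d≈ (F.+-congˡ (F.sym (F.*-identityˡ _))))
              whole-path : Ham (Lead l ∪ (S₂ ∪ (L ∪ S₁))) (V 0 0 0#) (V i j d)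
              whole-path = join {P = Lead l} {Q = S₂ ∪ (L ∪ S₁)} lead edge
                (join {P = S₂} {Q = L ∪ S₁} band₂ exit₂
                  (join {P = L} {Q = S₁} passing exit₃ final (λ q q′ → L#d q (segment⇒lab q′)))
                  (λ { q (inj₁ q′) → L#d q′ (segment⇒lab q) ; q (inj₂ q′) → segments-disjoint u<m q′ q }))
                (λ { q (inj₁ q′) → lead#d l l≤p (d⇒label (segment⇒lab q′)) q ; q (inj₂ (inj₁ q′)) → lead#L q (toIndex q′)
                   ; q (inj₂ (inj₂ q′)) → lead#d l l≤p (d⇒label (segment⇒lab q′)) q })
                where
                L#d : ∀ {t} → L t → Lab d t → ⊥
                L#d q q′ = let (n , s≤n , n≤p , x) = toIndex q in ℕ.<⇒≱ s≤n (ℕ.≤-reflexive (index-≡ n≤p l≤p x (d⇒label q′)))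
                lead#d : ∀ n {t} → n ≤ p → Lab (label n) t → Lead n t → ⊥
                lead#d zero _ q q′ = lab≉0 plus e₀ (Lab-disjoint q q′)
                lead#d (suc n) n≤p q (inj₁ q′) = lab≉0 plus (suc n *ℕ γ +ℕ e₀) (Lab-disjoint q q′)
                lead#d (suc n) n≤p q (inj₂ (n′ , n′≤n , q′)) = ℕ.<⇒≱ (s≤s n′≤n) (ℕ.≤-reflexive (index-≡ n≤p (ℕ.≤-trans n′≤n (ℕ.<⇒≤ n≤p)) q q′))
                lead#L : ∀ {t} → Lead l t → (∃ λ n → s ≤ n × n ≤ p × Lab (label n) t) → ⊥
                lead#L q (n , s≤n , n≤p , q′) = helper l s≤n q
                  where
                  helper : ∀ l → suc l ≤ n → Lead l _ → ⊥
                  helper zero _ x = lab≉0 plus (n *ℕ γ +ℕ e₀) (Lab-disjoint q′ x)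
                  helper (suc l) _ (inj₁ x) = lab≉0 plus (n *ℕ γ +ℕ e₀) (Lab-disjoint q′ x)
                  helper (suc l) l<n (inj₂ (l′ , l′≤l , x)) = ℕ.<⇒≱ (ℕ.<-≤-trans (s≤s l′≤l) (ℕ.<⇒≤ l<n))
                    (ℕ.≤-reflexive (index-≡ n≤p (ℕ.≤-trans l′≤l (ℕ.≤-trans (ℕ.n≤1+n l) (ℕ.≤-trans (ℕ.<⇒≤ l<n) n≤p))) q′ x))
              lead⇒start : ∀ n → n ≤ p → ∀ {t} → Lead n t → Start p 1# e₀ t
              lead⇒start zero _ q = inj₁ q
              lead⇒start (suc n) n≤p (inj₁ q) = inj₁ q
              lead⇒start (suc n) n≤p (inj₂ (n′ , n′≤n , q)) = inj₂ (n′ , ℕ.≤-trans n′≤n (ℕ.<⇒≤ n≤p) , q)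
              to : ∀ {t} → (Lead l ∪ (S₂ ∪ (L ∪ S₁))) t → Mem Parabolic t
              to {t} q = start⇒parabolic {p} {1#} {e₀} {t} (sort q)
                where
                sort : (Lead l ∪ (S₂ ∪ (L ∪ S₁))) t → Start p 1# e₀ t
                sort (inj₁ q) = lead⇒start l l≤p q
                sort (inj₂ (inj₁ q)) = inj₂ (l , l≤p , d⇒label (segment⇒lab q))
                sort (inj₂ (inj₂ (inj₁ q))) = let (n , _ , n≤p , x) = toIndex q in inj₂ (n , n≤p , x)
                sort (inj₂ (inj₂ (inj₂ q))) = inj₂ (l , l≤p , d⇒label (segment⇒lab q))
              toLead : ∀ l → ∀ {t} → Lab 0# t → Lead l t
              toLead zero q = q
              toLead (suc l) q = inj₁ q
              before : ∀ l n → n < l → ∀ {t} → Lab (label n) t → Lead l t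
              before (suc l) n (s≤s n≤l) q = inj₂ (n , n≤l , q)
              from : ∀ {t} → Mem Parabolic t → (Lead l ∪ (S₂ ∪ (L ∪ S₁))) t
              from {t} t∈ = sort (parabolic⇒start plus e₀ {t} t∈)
                where
                sort : Start p 1# e₀ t → (Lead l ∪ (S₂ ∪ (L ∪ S₁))) t
                sort (inj₁ q) = inj₁ (toLead l q)
                sort (inj₂ (n , n≤p , q)) = compare (ℕ.<-cmp n l)
                  where
                  compare : B.Tri (n < l) (n ≡ l) (l < n) → (Lead l ∪ (S₂ ∪ (L ∪ S₁))) t
                  compare (tri< n<l _ _) = inj₁ (before l n n<l q)
                  compare (tri≈ _ n≡l _) = [ (λ x → inj₂ (inj₂ (inj₂ x))) , (λ x → inj₂ (inj₁ x)) ]′ (lab⇒segments u<m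
                    (Lab-cong (F.trans (lab-≡ 1# (≡.cong (λ n → n *ℕ γ +ℕ e₀) n≡l)) (F.sym d-l)) q))
                  compare (tri> _ _ l<n) = inj₂ (inj₂ (inj₁ (n ∸ s , ℕ.∸-monoˡ-≤ s n≤p ,
                        Lab-cong (lab-≡ 1# (≡.trans (≡.cong (λ n → n *ℕ γ +ℕ e₀) (≡.sym (ℕ.m∸n+n≡m l<n))) (≡.sym (index (n ∸ s))))) q)))

-- Neighbours of the identity

module Neighbours {c ℓ : Level} {q : ℕ} (F : FiniteField c ℓ q) (α : FiniteField.Carrier F)
                  {n : ℕ} (T : TransitionGraph n) where
  open OperationGroup F α T
  open GroupSolver 𝔾 using (solve; _⊜_; _⊙_; inv; one)

  Elementary : GL → Set ℓ
  Elementary h = (∃₂ λ x y → TransitionGraph.Edge T x y × mat h ≋ addMatrix x y) ⊎ (q > 2 × ∃ λ x → mat h ≋ scaleMatrix α x)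

  -- The four kinds of operations and the two directions of an edge collapse to an elementary matrix
  -- or the inverse of one.
  elementary : ∀ {g} → ε ~ g → ∃ λ h → (g ≈ h ⊎ g ≈ h ⁻¹) × Elementary h
  elementary {g} (_ , inj₁ (S , S∈ , e)) = from S∈
    where
    g≈S : g ≈ S
    g≈S = entrywise (≋-trans e (≋-trans (⊗-cong (≋-refl {mat S}) mat-ε) (⊗𝟙 (mat S))))
    S⁻¹ : GL
    S⁻¹ = Matrices._⁻¹ F n S
    g≈ : g ≈ S⁻¹ ⁻¹
    g≈ = trans g≈S (entrywise (≋-sym (mat-⁻¹ S⁻¹)))
    from : Ops α T S → ∃ λ h → (g ≈ h ⊎ g ≈ h ⁻¹) × Elementary h
    from (add x y e p) = S , inj₁ g≈S , inj₁ (x , y , e , p)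
    from (add⁻¹ x y e p) = S⁻¹ , inj₂ g≈ , inj₁ (x , y , e , p)
    from (scale q>2 x p) = S , inj₁ g≈S , inj₂ (q>2 , x , p)
    from (scale⁻¹ q>2 x p) = S⁻¹ , inj₂ g≈ , inj₂ (q>2 , x , p)
  elementary {g} (_ , inj₂ (S , S∈ , e)) = from S∈
    where
    g≈S⁻ : g ≈ S ⁻¹
    g≈S⁻ = trans (solve 2 (λ s g → g ⊜ inv s ⊙ (s ⊙ g)) refl S g)
      (trans (∙-congˡ {S ⁻¹} (entrywise (≋-trans (mat-∙ S g) (≋-sym e)))) (identityʳ (S ⁻¹)))
    S⁻¹ : GL
    S⁻¹ = Matrices._⁻¹ F n S
    g≈ : g ≈ S⁻¹
    g≈ = trans g≈S⁻ (entrywise (mat-⁻¹ S))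
    from : Ops α T S → ∃ λ h → (g ≈ h ⊎ g ≈ h ⁻¹) × Elementary h
    from (add x y e p) = S , inj₂ g≈S⁻ , inj₁ (x , y , e , p)
    from (add⁻¹ x y e p) = S⁻¹ , inj₁ g≈ , inj₁ (x , y , e , p)
    from (scale q>2 x p) = S , inj₂ g≈S⁻ , inj₂ (q>2 , x , p)
    from (scale⁻¹ q>2 x p) = S⁻¹ , inj₁ g≈ , inj₂ (q>2 , x , p)

-- The plane over a field with at least four elements

module PlaneWhole {c ℓ : Level} {q : ℕ} (F : FiniteField c ℓ q) (α : FiniteField.Carrier F) (generates : IsGenerator F α)
             (T : TransitionGraph 2) (α≉1 : ¬ FiniteField._≈_ F α (FiniteField.1# F))
             (e₁₂ : TransitionGraph.Edge T zero (suc zero)) (e₂₁ : TransitionGraph.Edge T (suc zero) zero)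
             (2≤p : 2 ≤ Generator.p F α generates) where
  open PlaneParabolic F α generates T α≉1 e₁₂ 2≤p
  open ParabolicToWhole zero e₂₁
  open Neighbours F α T
  open GroupSolver 𝔾 using (solve; _⊜_; _⊙_; inv; one)
  open Entries

  -- The diagonal matrices form the torus of label 0, which contains the start. The runs end at
  -- nonzero labels only, so this is the exceptional subgroup given to `Join`.
  Diagonal : Subgroup
  Diagonal = Parabolic ∩ fixesLine top

  offDiagonal : ∀ {h} → Mem Parabolic h → ¬ Mem Diagonal h → ∃ λ k → Lab (α ^F k) h
  offDiagonal {h} h∈ h∉ = form (parabolicForm h h∈)
    where
    diagonal : ∀ i j {x} → h ≈ V i j x → x ≈F 0# → Mem (fixesLine top) h
    diagonal i j {x} e z = resp (fixesLine top) {V i j x} {h} (sym e) (eigenline {top} {V i j x} {α ^F i} λ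
      { zero → F.trans (▹unit (mat (V i j x)) top top) (F.trans (tt≈ (V-entries i j x)) (F.sym (F.*-identityʳ (α ^F i))))
      ; (suc zero) → F.trans (▹unit (mat (V i j x)) top bot) (F.trans (bt≈ (V-entries i j x))
          (F.trans (F.trans (F.*-congˡ z) (F.zeroʳ (α ^F j))) (F.sym (F.zeroʳ (α ^F i))))) })
    form : (∃ λ x → Lab x h) → ∃ λ k → Lab (α ^F k) h
    form (x , i , j , e) = let (k , x≈) = logarithm {x} (λ z → h∉ (h∈ , diagonal i j e z)) in k , Lab-cong x≈ (i , j , e)

  pathInParabolic : ∀ i j k → Ham (Mem Parabolic) ε (V i j (α ^F k))
  pathInParabolic i j k = cases (odd m) (odd (i +ℕ j)) (odd k) ≡.refl ≡.refl ≡.refl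
    where
    cases : ∀ a b c → odd m ≡ a → odd (i +ℕ j) ≡ b → odd k ≡ c → Ham (Mem Parabolic) ε (V i j (α ^F k))
    cases true _ _ om _ _ = OddOrder.path om i j k
    cases false true false em o e = EvenOrder.ascending em i j k o e
    cases false true true em o e = EvenOrder.descending em i j k o e
    cases false false _ em e _ = let (w , o , ew , oo , d≈) = EvenOrder.summands em k in
      EvenOrder.Doubled.path em i j k e w o ew oo d≈

  parabolicConnected : ConnectedOff Diagonal Parabolic
  parabolicConnected {h} h∈ h∉ = let (k , i , j , e) = offDiagonal {h} h∈ h∉ in ends refl (sym e) (pathInParabolic i j k)

  -- The multipliers 1, α, α² of `v₀` are different because `α` has order at least three.
  κ : Fin 3 → GL
  κ i = homothety (α ^F toℕ i) (power≉0 (toℕ i))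

  κ∈ : ∀ i → Mem Parabolic (κ i)
  κ∈ i = column⇒line {end} {κ i} (homothety∈ (α ^F toℕ i) (power≉0 (toℕ i)))

  homothety-entries : ∀ t t≉0 → Entries (homothety t t≉0) t 0# (1# -F t) 1#
  homothety-entries t t≉0 = record
    { tt≈ = R.solve 1 (λ t → R.con ℤ.1ℤ R.:+ ((t R.:- R.con ℤ.1ℤ) R.:* (R.con ℤ.1ℤ R.:- R.con ℤ.0ℤ)) R.:* R.con ℤ.1ℤ R.:= t) F.refl t
    ; tb≈ = R.solve 1 (λ t → R.con ℤ.0ℤ R.:+ ((t R.:- R.con ℤ.1ℤ) R.:* (R.con ℤ.1ℤ R.:- R.con ℤ.0ℤ)) R.:* R.con ℤ.0ℤ R.:= R.con ℤ.0ℤ) F.refl t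
    ; bt≈ = homothety-entry t t≉0
    ; bb≈ = R.solve 1 (λ t → R.con ℤ.1ℤ R.:+ ((t R.:- R.con ℤ.1ℤ) R.:* (R.con ℤ.0ℤ R.:- R.con ℤ.1ℤ)) R.:* R.con ℤ.0ℤ R.:= R.con ℤ.1ℤ) F.refl t }

  -- If g = D h with D diagonal, the corners equal to 1 force the lower entry of D to be 1, and then
  -- the lower left entries 1 - t and 1 - u agree.
  apart : ∀ g h {t u} → Entries g t 0# (1# -F t) 1# → Entries h u 0# (1# -F u) 1# → Mem Diagonal (g ∙ h ⁻¹) → t ≈F u
  apart g h {t} {u} eg eh (p₁ , p₂) = begin
    t                                          ≈⟨ R.solve 1 (λ t → t R.:= R.con ℤ.1ℤ R.:- (R.con ℤ.1ℤ R.:- t)) F.refl t ⟩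
    1# -F (1# -F t)                            ≈⟨ F.+-congˡ (F.-‿cong (F.trans (F.sym (bt≈ eg)) (bt≈ E))) ⟩
    1# -F (0# *F u +F δ *F (1# -F u))         ≈⟨ F.+-congˡ (F.-‿cong (F.+-congˡ (F.*-congʳ δ≈1))) ⟩
    1# -F (0# *F u +F 1# *F (1# -F u))        ≈⟨ R.solve 1 (λ t → R.con ℤ.1ℤ R.:- (R.con ℤ.0ℤ R.:* t R.:+ R.con ℤ.1ℤ R.:* (R.con ℤ.1ℤ R.:- t)) R.:= t) F.refl u ⟩
    u                                          ∎
    where
    open SetoidReasoning F.setoid
    D : GL
    D = g ∙ h ⁻¹
    δ : K
    δ = mat D bot bot
    D-entries : Entries D (mat D top top) 0# 0# δ
    D-entries = record
      { tt≈ = F.refl ; bb≈ = F.refl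
      ; tb≈ = F.trans (F.sym (▹unit (mat D) bot top)) (F.trans (p₁ top) (F.zeroʳ δ))
      ; bt≈ = F.trans (F.sym (▹unit (mat D) top bot)) (F.trans (p₂ bot) (F.zeroʳ (mat D top top))) }
    E : Entries g (mat D top top *F u) 0# (0# *F u +F δ *F (1# -F u)) (δ *F 1#)
    E = entries-resp (solve 2 (λ a b → (a ⊙ inv b) ⊙ b ⊜ a) refl g h) (product-entries D-entries eh)
    δ≈1 : δ ≈F 1#
    δ≈1 = F.trans (F.sym (F.*-identityʳ δ)) (F.trans (F.sym (bb≈ E)) (bb≈ eg))

  κ-apart : ∀ {i j} → i ≢ j → ¬ Mem Diagonal (κ i ∙ κ j ⁻¹)
  κ-apart {i} {j} i≢j p = i≢j (Fin.toℕ-injective (power-injective (bound i) (bound j)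
    (apart (κ i) (κ j) {α ^F toℕ i} {α ^F toℕ j} (homothety-entries (α ^F toℕ i) (power≉0 (toℕ i))) (homothety-entries (α ^F toℕ j) (power≉0 (toℕ j))) p)))
    where
    bound : ∀ (i : Fin 3) → toℕ i < m
    bound i = ℕ.≤-trans (Fin.toℕ<n i) (s≤s 2≤p)

  s▹top : mat s ▹ unit top ≗ unit top
  s▹top i = F.trans (s▹ (unit top) i) (F.trans (F.+-congˡ (F.zeroʳ (unit top i))) (F.+-identityʳ (unit top i)))

  -- `s` fixes the line of the first basis vector, so conjugation by it does not affect that half of
  -- membership in `Diagonal`. The other half holds for all quotients of the `κ i`.
  κˢ-apart : ∀ {i j} → i ≢ j → ¬ Mem Diagonal (s ∙ (κ i ∙ κ j ⁻¹) ∙ s ⁻¹)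
  κˢ-apart {i} {j} i≢j (_ , p₂) = κ-apart {i} {j} i≢j
    ( ∙∈ Parabolic {κ i} {κ j ⁻¹} (κ∈ i) (⁻¹∈ Parabolic {κ j} (κ∈ j))
    , resp (fixesLine top) {s ⁻¹ ∙ y ∙ s} {D} (solve 2 (λ s d → inv s ⊙ (s ⊙ d ⊙ inv s) ⊙ s ⊜ d) refl s D)
        (∙∈ (fixesLine top) {s ⁻¹ ∙ y} {s} (∙∈ (fixesLine top) {s ⁻¹} {y} (⁻¹∈ (fixesLine top) {s} s∈) p₂) s∈))
    where
    D y : GL
    D = κ i ∙ κ j ⁻¹
    y = s ∙ D ∙ s ⁻¹
    s∈ : Mem (fixesLine top) s
    s∈ = column⇒line {top} {s} s▹top

  -- A matrix g whose conjugate by s is parabolic maps v₀ = (−1 , 1) to a multiple of itself.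
  balanced : ∀ g → Mem Parabolic (s ∙ g ∙ s ⁻¹) → (mat g ▹ v₀) top +F (mat g ▹ v₀) bot ≈F 0#
  balanced g g∈ = begin
    (mat g ▹ v₀) top +F (mat g ▹ v₀) bot     ≈⟨ F.+-cong (eigen top) (eigen bot) ⟩
    t′ *F v₀ top +F t′ *F v₀ bot             ≈⟨ F.+-cong (F.*-congˡ v₀-j) (F.*-congˡ v₀-end) ⟩
    t′ *F (-F 1#) +F t′ *F 1#                ≈⟨ R.solve 1 (λ t → t R.:* (R.:- R.con ℤ.1ℤ) R.:+ t R.:* R.con ℤ.1ℤ R.:= R.con ℤ.0ℤ) F.refl t′ ⟩
    0#                                       ∎
    where
    open SetoidReasoning F.setoid
    y : GL
    y = s ∙ g ∙ s ⁻¹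
    t′ : K
    t′ = mat y end end
    eigen : mat g ▹ v₀ ≗ t′ · v₀
    eigen = ▹-resp {s ⁻¹ ∙ y ∙ s} {g} {v₀} {t′ · v₀} (solve 2 (λ s g → inv s ⊙ (s ⊙ g ⊙ inv s) ⊙ s ⊜ g) refl s g)
      (▹-∙ (s ⁻¹ ∙ y) s {v₀} {unit end} {t′ · v₀} s▹v₀
        (▹-∙ (s ⁻¹) y {unit end} {t′ · unit end} {t′ · v₀} g∈
          (λ i → F.trans (▹-scale (mat (s ⁻¹)) t′ (unit end) i) (F.*-congˡ (s⁻¹▹end i)))))

  -- g v₀ is the second column of g minus the first, so the condition is that both columns have the
  -- same sum. Every elementary matrix violates it.
  unbalanced : ∀ g {a b c d} → Mem Parabolic (s ∙ g ∙ s ⁻¹) → Entries g a b c d → (b +F d) -F (a +F c) ≈F 0#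
  unbalanced g {a} {b} {c} {d} g∈ e = begin
    (b +F d) -F (a +F c)
      ≈⟨ R.solve 4 (λ a b c d → (b R.:+ d) R.:- (a R.:+ c) R.:=
           (a R.:* (R.:- R.con ℤ.1ℤ) R.:+ (b R.:* R.con ℤ.1ℤ R.:+ R.con ℤ.0ℤ)) R.:+ (c R.:* (R.:- R.con ℤ.1ℤ) R.:+ (d R.:* R.con ℤ.1ℤ R.:+ R.con ℤ.0ℤ))) F.refl a b c d ⟩
    (a *F (-F 1#) +F (b *F 1# +F 0#)) +F (c *F (-F 1#) +F (d *F 1# +F 0#))
      ≈⟨ F.+-cong (F.+-cong (F.*-cong (F.sym (tt≈ e)) (F.sym v₀-j)) (F.+-congʳ (F.*-cong (F.sym (tb≈ e)) (F.sym v₀-end))))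
                  (F.+-cong (F.*-cong (F.sym (bt≈ e)) (F.sym v₀-j)) (F.+-congʳ (F.*-cong (F.sym (bb≈ e)) (F.sym v₀-end)))) ⟩
    (mat g ▹ v₀) top +F (mat g ▹ v₀) bot        ≈⟨ balanced g g∈ ⟩
    0#                                          ∎
    where open SetoidReasoning F.setoid

  far-elementary : ∀ h → Elementary h → ¬ Mem Parabolic (s ∙ h ∙ s ⁻¹)
  far-elementary h (inj₁ (x , y , e , p)) h∈ = addition-case x y (λ { ≡.refl → TransitionGraph.loopless T ≡.refl e }) p
    where
    addition-case : ∀ x y → x ≢ y → mat h ≋ addMatrix x y → ⊥
    addition-case zero zero n _ = n ≡.refl
    addition-case zero (suc zero) _ p = F.1≉0 (F.trans
      (R.solve 0 (R.con ℤ.1ℤ R.:= R.:- ((R.con ℤ.0ℤ R.:+ R.con ℤ.1ℤ) R.:- (R.con ℤ.1ℤ R.:+ R.con ℤ.1ℤ))) F.refl)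
      (F.trans (F.-‿cong (unbalanced h {1#} {0#} {1#} {1#} h∈ (record { tt≈ = p top top ; tb≈ = p top bot ; bt≈ = p bot top ; bb≈ = p bot bot })))
        (R.solve 0 (R.:- R.con ℤ.0ℤ R.:= R.con ℤ.0ℤ) F.refl)))
    addition-case (suc zero) zero _ p = F.1≉0 (F.trans
      (R.solve 0 (R.con ℤ.1ℤ R.:= (R.con ℤ.1ℤ R.:+ R.con ℤ.1ℤ) R.:- (R.con ℤ.1ℤ R.:+ R.con ℤ.0ℤ)) F.refl)
      (unbalanced h {1#} {1#} {0#} {1#} h∈ (record { tt≈ = p top top ; tb≈ = p top bot ; bt≈ = p bot top ; bb≈ = p bot bot })))
    addition-case (suc zero) (suc zero) n _ = n ≡.refl
  far-elementary h (inj₂ (_ , x , p)) h∈ = scaling-case x p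
    where
    scaling-case : ∀ x → mat h ≋ scaleMatrix α x → ⊥
    scaling-case zero p = α≉1 (F.sym (difference (F.trans
      (R.solve 1 (λ a → R.con ℤ.1ℤ R.:- a R.:= (R.con ℤ.0ℤ R.:+ R.con ℤ.1ℤ) R.:- (a R.:+ R.con ℤ.0ℤ)) F.refl α)
      (unbalanced h {α} {0#} {0#} {1#} h∈ (record { tt≈ = p top top ; tb≈ = p top bot ; bt≈ = p bot top ; bb≈ = p bot bot })))))
    scaling-case (suc zero) p = α≉1 (difference (F.trans
      (R.solve 1 (λ a → a R.:- R.con ℤ.1ℤ R.:= (R.con ℤ.0ℤ R.:+ a) R.:- (R.con ℤ.1ℤ R.:+ R.con ℤ.0ℤ)) F.refl α)
      (unbalanced h {1#} {0#} {0#} {α} h∈ (record { tt≈ = p top top ; tb≈ = p top bot ; bt≈ = p bot top ; bb≈ = p bot bot }))))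

  far : ∀ {g} → ε ~ g → Mem Parabolic g → ¬ Mem Parabolic (s ∙ g ∙ s ⁻¹)
  far {g} e _ g∈ = cases (elementary {g} e)
    where
    cases : (∃ λ h → (g ≈ h ⊎ g ≈ h ⁻¹) × Elementary h) → ⊥
    cases (h , inj₁ g≈h , el) = far-elementary h el (resp Parabolic {s ∙ g ∙ s ⁻¹} {s ∙ h ∙ s ⁻¹} (∙-congʳ (∙-congˡ {s} g≈h)) g∈)
    cases (h , inj₂ g≈h⁻¹ , el) = far-elementary h el (resp Parabolic {(s ∙ g ∙ s ⁻¹) ⁻¹} {s ∙ h ∙ s ⁻¹}
      (trans (⁻¹-cong (∙-congʳ (∙-congˡ {s} g≈h⁻¹))) (solve 2 (λ s h → inv (s ⊙ inv h ⊙ inv s) ⊜ s ⊙ h ⊙ inv s) refl s h))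
      (⁻¹∈ Parabolic {s ∙ g ∙ s ⁻¹} g∈))

  Diagonal⊆Parabolic : ∀ {x} → Mem Diagonal x → Mem Parabolic x
  Diagonal⊆Parabolic (x∈ , _) = x∈

  wholeConnected : Connected whole
  wholeConnected = Join.connected Diagonal Parabolic whole (λ {x} → Diagonal⊆Parabolic {x}) (λ {x} _ → tt) (λ {x} → parabolicConnected {x}) s ε~s tt s∉
    (λ {x} → double {x}) κ κ∈ (λ i → conjugate (κ i) (α ^F toℕ i) (homothety▹v₀ (α ^F toℕ i) (power≉0 (toℕ i))))
    (λ {i} {j} → κ-apart {i} {j}) (λ {i} {j} → κˢ-apart {i} {j}) mover mover∈ moves (inj₂ (λ {g} → far {g}))

-- The plane over the field with three elements

module PlaneOverThree {c ℓ : Level} {q : ℕ} (F : FiniteField c ℓ q) (α : FiniteField.Carrier F) (generates : IsGenerator F α)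
             (T : TransitionGraph 2) (α≉1 : ¬ FiniteField._≈_ F α (FiniteField.1# F))
             (e₁₂ : TransitionGraph.Edge T zero (suc zero)) (e₂₁ : TransitionGraph.Edge T (suc zero) zero)
             (p≡1 : Generator.p F α generates ≡ 1) where
  open Plane F α generates T α≉1 e₁₂
  open Entries

  α²≈1 : α *F (α *F 1#) ≈F 1#
  α²≈1 = F.trans (F.reflexive (≡.cong (λ k → α ^F suc k) (≡.sym p≡1))) α^m

  α≈-1 : α ≈F -F 1#
  α≈-1 = difference (cancel {α -F 1#} (λ z → α≉1 (difference z)) (begin
    (α -F 1#) *F (α -F -F 1#)      ≈⟨ R.solve 1 (λ a → (a R.:- R.con ℤ.1ℤ) R.:* (a R.:- (R.:- R.con ℤ.1ℤ)) R.:= a R.:* (a R.:* R.con ℤ.1ℤ) R.:- R.con ℤ.1ℤ) F.refl α ⟩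
    α *F (α *F 1#) -F 1#           ≈⟨ F.+-congʳ α²≈1 ⟩
    1# -F 1#                       ≈⟨ R.solve 1 (λ a → R.con ℤ.1ℤ R.:- R.con ℤ.1ℤ R.:= (a R.:- R.con ℤ.1ℤ) R.:* R.con ℤ.0ℤ) F.refl α ⟩
    (α -F 1#) *F 0#                ∎))
    where open SetoidReasoning F.setoid

  sign : ∀ {x} → ¬ x ≈F 0# → Sign x
  sign {x} x≉0 = from (bounded x≉0)
    where
    from : (∃ λ k → k ≤ p × x ≈F α ^F k) → Sign x
    from (zero , _ , e) = inj₁ e
    from (suc zero , _ , e) = inj₂ (F.trans e (F.trans (F.*-identityʳ α) α≈-1))
    from (suc (suc k) , k≤p , _) with ≡.subst (suc (suc k) ≤_) p≡1 k≤p
    ... | s≤s ()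

  1+1≈-1 : 1# +F 1# ≈F -F 1#
  1+1≈-1 = from (sign 2≉0)
    where
    2≉0 : ¬ 1# +F 1# ≈F 0#
    2≉0 e = α≉1 (F.trans α≈-1 (F.trans (R.solve 0 (R.:- R.con ℤ.1ℤ R.:= R.con ℤ.1ℤ R.:- (R.con ℤ.1ℤ R.:+ R.con ℤ.1ℤ)) F.refl)
      (F.trans (F.+-congˡ (F.-‿cong e)) (R.solve 0 (R.con ℤ.1ℤ R.:- R.con ℤ.0ℤ R.:= R.con ℤ.1ℤ) F.refl))))
    from : Sign (1# +F 1#) → 1# +F 1# ≈F -F 1#
    from (inj₂ e) = e
    from (inj₁ e) = ⊥-elim (F.1≉0 (F.trans (R.solve 0 (R.con ℤ.1ℤ R.:= (R.con ℤ.1ℤ R.:+ R.con ℤ.1ℤ) R.:- R.con ℤ.1ℤ) F.refl)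
      (F.trans (F.+-congʳ e) (F.-‿inverseʳ 1#))))

  opposite : ∀ {x} → Sign x → Sign (-F x)
  opposite (inj₁ e) = inj₂ (F.-‿cong e)
  opposite (inj₂ e) = inj₁ (F.trans (F.-‿cong e) (R.solve 0 (R.:- (R.:- R.con ℤ.1ℤ) R.:= R.con ℤ.1ℤ) F.refl))

  compare : ∀ {x y} → Sign x → Sign y → (y ≈F -F x) ⊎ (y ≈F x)
  compare (inj₁ e) (inj₁ e′) = inj₂ (F.trans e′ (F.sym e))
  compare (inj₂ e) (inj₂ e′) = inj₂ (F.trans e′ (F.sym e))
  compare (inj₁ e) (inj₂ e′) = inj₁ (F.trans e′ (F.sym (F.-‿cong e)))
  compare (inj₂ e) (inj₁ e′) = inj₁ (F.trans e′ (F.sym (F.trans (F.-‿cong e) (R.solve 0 (R.:- (R.:- R.con ℤ.1ℤ) R.:= R.con ℤ.1ℤ) F.refl))))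

  -- With m = 2 a torus has only two exits of a given offset, too few for `exitChoice`. Instead the
  -- chain is prolonged downwards, to a group of order three on which `t` acts as a triangle.
  Unipotent : Subgroup
  Unipotent = Affine ∩ fixesRow (unit top)

  unipotent : ∀ x → Mem Unipotent (V 0 0 x)
  unipotent x =
      (λ { zero → F.trans (▹unit (mat (V 0 0 x)) bot top) (tb≈ (V-entries 0 0 x))
         ; (suc zero) → F.trans (▹unit (mat (V 0 0 x)) bot bot) (bb≈ (V-entries 0 0 x)) })
    , (λ { zero → F.trans (unit◃ top (mat (V 0 0 x)) top) (tt≈ (V-entries 0 0 x))
         ; (suc zero) → F.trans (unit◃ top (mat (V 0 0 x)) bot) (tb≈ (V-entries 0 0 x)) })

  unipotent-top : ∀ z → Mem Unipotent z → mat z top top ≈F 1#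
  unipotent-top z (_ , r) = F.trans (F.sym (unit◃ top (mat z) top)) (r top)

  unipotentForm : ∀ z → Mem Unipotent z → ∃ λ x → z ≈ V 0 0 x
  unipotentForm z z∈@(a , r) = mat z bot top , entries-ext (record
      { tt≈ = unipotent-top z z∈
      ; tb≈ = F.trans (F.sym (unit◃ top (mat z) bot)) (r bot)
      ; bt≈ = F.sym (F.*-identityˡ (mat z bot top))
      ; bb≈ = F.trans (F.sym (▹unit (mat z) bot bot)) (a bot) })
    (V-entries 0 0 (mat z bot top))

  -- The labels 0, -x, x are visited in this order: each step adds -x, since 3 = 0.
  unipotentConnected : Connected Unipotent
  unipotentConnected {h} h∈ h≉ε = from (unipotentForm h h∈)
    where
    from : (∃ λ x → h ≈ V 0 0 x) → Ham (Mem Unipotent) ε h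
    from (x , e) = ends V-ε (sym e) (recast {P = P₀ ∪ (P₁ ∪ P₂)} {Q = Mem Unipotent} (λ {z} → to {z}) (λ {z} z∈ → back (unipotentForm z z∈))
      (join {P = P₀} {Q = P₁ ∪ P₂} (singleton (V 0 0 0#)) (signEdge (opposite σ) 0 0 {0#} { -F x } step₁)
        (join {P = P₁} {Q = P₂} (singleton (V 0 0 (-F x))) (signEdge (opposite σ) 0 0 { -F x } {x} step₂) (singleton (V 0 0 x))
          (λ {z} p p′ → x≉0 (twice (proj₂ (proj₂ (V-injective {0} {0} { -F x } {0} {0} {x} (trans (sym p) p′)))))))
        (λ {z} p → λ { (inj₁ p′) → x≉0 (F.trans (R.solve 1 (λ x → x R.:= R.:- (R.:- x)) F.refl x)
                          (F.trans (F.-‿cong (F.sym (proj₂ (proj₂ (V-injective {0} {0} {0#} {0} {0} { -F x } (trans (sym p) p′))))))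
                            (R.solve 0 (R.:- R.con ℤ.0ℤ R.:= R.con ℤ.0ℤ) F.refl)))
                     ; (inj₂ p′) → x≉0 (F.sym (proj₂ (proj₂ (V-injective {0} {0} {0#} {0} {0} {x} (trans (sym p) p′))))) })))
      where
      x≉0 : ¬ x ≈F 0#
      x≉0 z = h≉ε (trans e (trans (V-cong {0} {0} {x} {0} {0} {0#} F.refl F.refl z) V-ε))
      σ : Sign x
      σ = sign x≉0
      P₀ P₁ P₂ : Pred GL ℓ
      P₀ = _≈ V 0 0 0#
      P₁ = _≈ V 0 0 (-F x)
      P₂ = _≈ V 0 0 x
      step₁ : -F x ≈F 0# +F (-F x) *F α ^F 0
      step₁ = R.solve 1 (λ x → R.:- x R.:= R.con ℤ.0ℤ R.:+ (R.:- x) R.:* R.con ℤ.1ℤ) F.refl x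
      step₂ : x ≈F -F x +F (-F x) *F α ^F 0
      step₂ = begin
        x                              ≈⟨ R.solve 1 (λ x → x R.:= (R.:- R.con ℤ.1ℤ) R.:* (R.:- x)) F.refl x ⟩
        (-F 1#) *F (-F x)              ≈⟨ F.*-congʳ 1+1≈-1 ⟨
        (1# +F 1#) *F (-F x)           ≈⟨ R.solve 1 (λ x → (R.con ℤ.1ℤ R.:+ R.con ℤ.1ℤ) R.:* (R.:- x) R.:= R.:- x R.:+ (R.:- x) R.:* R.con ℤ.1ℤ) F.refl x ⟩
        -F x +F (-F x) *F α ^F 0       ∎
        where open SetoidReasoning F.setoid
      twice : -F x ≈F x → x ≈F 0#
      twice e = begin
        x                              ≈⟨ step₂ ⟩
        -F x +F (-F x) *F 1#           ≈⟨ F.+-congʳ e ⟩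
        x +F (-F x) *F 1#              ≈⟨ R.solve 1 (λ x → x R.:+ (R.:- x) R.:* R.con ℤ.1ℤ R.:= R.con ℤ.0ℤ) F.refl x ⟩
        0#                             ∎
        where open SetoidReasoning F.setoid
      to : ∀ {z} → (P₀ ∪ (P₁ ∪ P₂)) z → Mem Unipotent z
      to {z} (inj₁ p) = resp Unipotent {V 0 0 0#} {z} (sym p) (unipotent 0#)
      to {z} (inj₂ (inj₁ p)) = resp Unipotent {V 0 0 (-F x)} {z} (sym p) (unipotent (-F x))
      to {z} (inj₂ (inj₂ p)) = resp Unipotent {V 0 0 x} {z} (sym p) (unipotent x)
      back : ∀ {z} → (∃ λ y → z ≈ V 0 0 y) → (P₀ ∪ (P₁ ∪ P₂)) z
      back {z} (y , e) = decide (y ≟F 0#)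
        where
        decide : Dec (y ≈F 0#) → (P₀ ∪ (P₁ ∪ P₂)) z
        decide (yes y≈0) = inj₁ (trans e (V-cong {0} {0} {y} {0} {0} {0#} F.refl F.refl y≈0))
        decide (no y≉0) = [ (λ y≈ → inj₂ (inj₁ (trans e (V-cong {0} {0} {y} {0} {0} { -F x } F.refl F.refl y≈))))
                          , (λ y≈ → inj₂ (inj₂ (trans e (V-cong {0} {0} {y} {0} {0} {x} F.refl F.refl y≈)))) ]′ (compare σ (sign y≉0))

  another : ∀ x y → ∃ λ z → Mem Unipotent z × ¬ z ≈ x × ¬ z ≈ y
  another x y = pick (avoidTwo {P = λ i → V 0 0 (values i) ≈ x} {Q = λ i → V 0 0 (values i) ≈ y}
      (λ i → V 0 0 (values i) ≟G x) (λ i → V 0 0 (values i) ≟G y)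
      (λ {i} {j} → distinct x i j) (λ {i} {j} → distinct y i j))
    where
    distinct : ∀ w i j → i ≢ j → V 0 0 (values i) ≈ w → V 0 0 (values j) ≈ w → ⊥
    distinct w i j n e e′ = values-injective α≉1 i j n
      (proj₂ (proj₂ (V-injective {0} {0} {values i} {0} {0} {values j} (trans e (sym e′)))))
    pick : (∃ λ i → ¬ V 0 0 (values i) ≈ x × ¬ V 0 0 (values i) ≈ y) → ∃ λ z → Mem Unipotent z × ¬ z ≈ x × ¬ z ≈ y
    pick (i , n , n′) = V 0 0 (values i) , unipotent (values i) , n , n′

  M₁^-alone : ∀ k → Entries (M₁ ^ k) (α ^F k) 0# 0# 1#
  M₁^-alone k = entries-resp (trans (∙-congˡ V-ε) (identityʳ (M₁ ^ k)))
    (entries-cong (M₁^-entries k (V-entries 0 0 0#)) (F.*-identityʳ _) (F.zeroʳ _) (F.zeroʳ _) F.refl)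

  -- Moving `M₁ ^ k` from the left of a unipotent factor to its right divides the label by α^k.
  pastPower : ∀ k y → ∃ λ w → V 0 0 w ∙ M₁ ^ k ≈ V k 0 y
  pastPower k y = w , entries-ext (product-entries (V-entries 0 0 w) (M₁^-alone k))
      (entries-cong (V-entries k 0 y) (F.sym (F.*-identityˡ _)) F.refl (F.sym corner) (F.sym (F.*-identityˡ _)))
    where
    open SetoidReasoning F.setoid
    r = recip (power≉0 k)
    w : K
    w = proj₁ r *F y
    corner : (1# *F w) *F α ^F k +F 1# *F 0# ≈F 1# *F y
    corner = begin
      (1# *F (proj₁ r *F y)) *F α ^F k +F 1# *F 0#     ≈⟨ R.solve 3 (λ r y a → (R.con ℤ.1ℤ R.:* (r R.:* y)) R.:* a R.:+ R.con ℤ.1ℤ R.:* R.con ℤ.0ℤ R.:= (r R.:* a) R.:* y) F.refl (proj₁ r) y (α ^F k) ⟩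
      (proj₁ r *F α ^F k) *F y                         ≈⟨ F.*-congʳ (proj₂ r) ⟩
      1# *F y                                          ∎

  coset : ∀ k y {z} → z ≈ V k 0 y → Mem Unipotent (z ∙ (M₁ ^ k) ⁻¹)
  coset k y {z} e = from (pastPower k y)
    where
    from : (∃ λ w → V 0 0 w ∙ M₁ ^ k ≈ V k 0 y) → Mem Unipotent (z ∙ (M₁ ^ k) ⁻¹)
    from (w , e′) = resp Unipotent {V 0 0 w} {z ∙ (M₁ ^ k) ⁻¹}
      (trans (solve 2 (λ v m → v ⊜ (v ⊙ m) ⊙ inv m) refl (V 0 0 w) (M₁ ^ k)) (∙-congʳ (trans e′ (sym e)))) (unipotent w)
      where open GroupSolver 𝔾 using (solve; _⊜_; _⊙_; inv)

  normal : ∀ {x} → Mem Unipotent x → Mem Unipotent (M₁ ∙ x ∙ M₁ ⁻¹)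
  normal {x} x∈ = from (unipotentForm x x∈)
    where
    from : (∃ λ y → x ≈ V 0 0 y) → Mem Unipotent (M₁ ∙ x ∙ M₁ ⁻¹)
    from (y , e) = resp Unipotent {M₁ ∙ x ∙ (M₁ ^ 1) ⁻¹} {M₁ ∙ x ∙ M₁ ⁻¹} (∙-congˡ {M₁ ∙ x} (⁻¹-cong (^-1 M₁)))
      (coset 1 y {M₁ ∙ x} (trans (∙-congˡ {M₁} e) (trans (∙-congʳ (sym (^-1 M₁)))
        (trans (∙-congˡ {M₁ ^ 1} (sym (identityˡ (V 0 0 y)))) (V-shift 1 0 0 0 y)))))

  apart : ∀ k → 0 < k → k ≤ p → ¬ Mem Unipotent (M₁ ^ k)
  apart (suc k) _ k≤p e = ℕ.<⇒≱ (s≤s k≤p) (∣⇒≤ (divides-order (suc k) (F.trans (F.sym (tt≈ (M₁^-alone (suc k)))) (unipotent-top (M₁ ^ suc k) e))))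

  cosets : ∀ {x} → Mem Affine x → ∃ λ k → k ≤ p × Same Unipotent x (M₁ ^ k)
  cosets {x} x∈ = from (parabolicForm x (column⇒line {end} {x} x∈))
    where
    from : (∃ λ y → Lab y x) → ∃ λ k → k ≤ p × Same Unipotent x (M₁ ^ k)
    from (y , i , j , e) = place (bounded (power≉0 i))
      where
      j≈0 : α ^F j ≈F 1#
      j≈0 = F.trans (F.sym (bb≈ (entries-resp (sym e) (V-entries i j y)))) (F.trans (F.sym (▹unit (mat x) bot bot)) (x∈ bot))
      place : (∃ λ k → k ≤ p × α ^F i ≈F α ^F k) → ∃ λ k → k ≤ p × Same Unipotent x (M₁ ^ k)
      place (k , k≤p , i≈k) = k , k≤p , coset k y {x} (trans e (V-cong {i} {j} {y} {k} {0} {y} i≈k j≈0 F.refl))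

  M₁∈Affine : Mem Affine M₁
  M₁∈Affine = resp Affine {M₁ ^ 1} {M₁} (^-1 M₁) λ
    { zero → F.trans (▹unit (mat (M₁ ^ 1)) bot top) (tb≈ (M₁^-alone 1))
    ; (suc zero) → F.trans (▹unit (mat (M₁ ^ 1)) bot bot) (bb≈ (M₁^-alone 1)) }

  Unipotent⊆Affine : ∀ {x} → Mem Unipotent x → Mem Affine x
  Unipotent⊆Affine (x∈ , _) = x∈

  affineConnected : Connected Affine
  affineConnected = Chain.connected Unipotent Affine (λ {x} → Unipotent⊆Affine {x}) (λ {x} → unipotentConnected {x}) another
    M₁ ε~M₁ M₁∈Affine (λ {x} → normal {x}) p apart (λ {x} → cosets {x})

  wholeConnected : Connected whole
  wholeConnected = ParabolicToWhole.connectedByScaling zero e₂₁ α≉1 (AffineToParabolic.connected α≉1 zero (λ {x} → affineConnected {x}))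

-- Three by three matrices over the field with two elements

-- Three rows of two bits stand for the matrix with these rows and with last column (0 , 0 , 1).
module BooleanModel where
  open import Data.List.Membership.Propositional using (_∈_)
  open import Data.List.Membership.Propositional.Properties using (∈-filter⁺; ∈-cartesianProduct⁺)

  Row State : Set
  Row = Bool × Bool
  State = Row × Row × Row

  _⊞_ : Row → Row → Row
  (a , b) ⊞ (c , d) = a xor c , b xor d

  ⊞-self : ∀ u → u ⊞ u ≡ (false , false)
  ⊞-self (a , b) = ≡.cong₂ _,_ (Bool.xor-same a) (Bool.xor-same b)

  -- Two rows are added to each other, and one of them to the third. Up to the names of the first
  -- two vertices, every bypass transition graph on three vertices has these edges.
  source target : Fin 3 → Fin 3
  source zero = zero
  source (suc zero) = suc zero
  source (suc (suc zero)) = zero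
  target zero = suc zero
  target (suc zero) = zero
  target (suc (suc zero)) = suc (suc zero)

  act : Fin 3 → State → State
  act zero (u , v , w) = u , v ⊞ u , w
  act (suc zero) (u , v , w) = u ⊞ v , v , w
  act (suc (suc zero)) (u , v , w) = u , v , w ⊞ u

  entry : State → Fin 3 → Fin 3 → Bool
  entry ((a , b) , _) zero zero = a
  entry ((a , b) , _) zero (suc zero) = b
  entry _ zero (suc (suc zero)) = false
  entry (_ , (a , b) , _) (suc zero) zero = a
  entry (_ , (a , b) , _) (suc zero) (suc zero) = b
  entry _ (suc zero) (suc (suc zero)) = false
  entry (_ , _ , (a , b)) (suc (suc zero)) zero = a
  entry (_ , _ , (a , b)) (suc (suc zero)) (suc zero) = b
  entry _ (suc (suc zero)) (suc (suc zero)) = true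

  entry-target : ∀ l s j → entry (act l s) (target l) j ≡ entry s (target l) j xor entry s (source l) j
  entry-target zero _ zero = ≡.refl
  entry-target zero _ (suc zero) = ≡.refl
  entry-target zero _ (suc (suc zero)) = ≡.refl
  entry-target (suc zero) _ zero = ≡.refl
  entry-target (suc zero) _ (suc zero) = ≡.refl
  entry-target (suc zero) _ (suc (suc zero)) = ≡.refl
  entry-target (suc (suc zero)) _ zero = ≡.refl
  entry-target (suc (suc zero)) _ (suc zero) = ≡.refl
  entry-target (suc (suc zero)) _ (suc (suc zero)) = ≡.refl

  entry-other : ∀ l s r j → r ≢ target l → entry (act l s) r j ≡ entry s r j
  entry-other zero _ zero zero _ = ≡.refl
  entry-other zero _ zero (suc zero) _ = ≡.refl
  entry-other zero _ zero (suc (suc zero)) _ = ≡.refl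
  entry-other zero _ (suc zero) _ n = ⊥-elim (n ≡.refl)
  entry-other zero _ (suc (suc zero)) zero _ = ≡.refl
  entry-other zero _ (suc (suc zero)) (suc zero) _ = ≡.refl
  entry-other zero _ (suc (suc zero)) (suc (suc zero)) _ = ≡.refl
  entry-other (suc zero) _ zero _ n = ⊥-elim (n ≡.refl)
  entry-other (suc zero) _ (suc zero) zero _ = ≡.refl
  entry-other (suc zero) _ (suc zero) (suc zero) _ = ≡.refl
  entry-other (suc zero) _ (suc zero) (suc (suc zero)) _ = ≡.refl
  entry-other (suc zero) _ (suc (suc zero)) zero _ = ≡.refl
  entry-other (suc zero) _ (suc (suc zero)) (suc zero) _ = ≡.refl
  entry-other (suc zero) _ (suc (suc zero)) (suc (suc zero)) _ = ≡.refl
  entry-other (suc (suc zero)) _ zero zero _ = ≡.refl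
  entry-other (suc (suc zero)) _ zero (suc zero) _ = ≡.refl
  entry-other (suc (suc zero)) _ zero (suc (suc zero)) _ = ≡.refl
  entry-other (suc (suc zero)) _ (suc zero) zero _ = ≡.refl
  entry-other (suc (suc zero)) _ (suc zero) (suc zero) _ = ≡.refl
  entry-other (suc (suc zero)) _ (suc zero) (suc (suc zero)) _ = ≡.refl
  entry-other (suc (suc zero)) _ (suc (suc zero)) _ n = ⊥-elim (n ≡.refl)

  entry-injective : ∀ s t → (∀ r j → entry s r j ≡ entry t r j) → s ≡ t
  entry-injective s t e = ≡.cong₂ _,_ (row zero) (≡.cong₂ _,_ (row (suc zero)) (row (suc (suc zero))))
    where
    row : ∀ r → (entry s r zero , entry s r (suc zero)) ≡ (entry t r zero , entry t r (suc zero))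
    row r = ≡.cong₂ _,_ (e r zero) (e r (suc zero))

  _≟R_ : B.DecidableEquality Row
  _≟R_ = Product.≡-dec Bool._≟_ Bool._≟_

  _≟S_ : B.DecidableEquality State
  _≟S_ = Product.≡-dec _≟R_ (Product.≡-dec _≟R_ _≟R_)

  open import Data.List.Membership.DecPropositional _≟S_ using (_∈?_)
  open import Data.List.Relation.Unary.Unique.DecPropositional _≟S_ using (Unique; unique?)

  origin : State
  origin = (true , false) , (false , true) , (false , false)

  origin-entry : ∀ r j → does (r Fin.≟ j) ≡ entry origin r j
  origin-entry zero zero = ≡.refl
  origin-entry zero (suc zero) = ≡.refl
  origin-entry zero (suc (suc zero)) = ≡.refl
  origin-entry (suc zero) zero = ≡.refl
  origin-entry (suc zero) (suc zero) = ≡.refl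
  origin-entry (suc zero) (suc (suc zero)) = ≡.refl
  origin-entry (suc (suc zero)) zero = ≡.refl
  origin-entry (suc (suc zero)) (suc zero) = ≡.refl
  origin-entry (suc (suc zero)) (suc (suc zero)) = ≡.refl

  -- Two different nonzero vectors over the field with two elements are a basis of the plane.
  Independent : State → Set
  Independent (u , v , _) = u ≢ (false , false) × v ≢ (false , false) × u ≢ v

  independent? : ∀ s → Dec (Independent s)
  independent? (u , v , _) = ¬? (u ≟R _) ×-dec (¬? (v ≟R _) ×-dec ¬? (u ≟R v))

  rows : List Row
  rows = cartesianProduct (false ∷ true ∷ []) (false ∷ true ∷ [])

  bases : List State
  bases = filter independent? (cartesianProduct rows (cartesianProduct rows rows))

  bases-complete : ∀ {s} → Independent s → s ∈ bases
  bases-complete {u , v , w} = ∈-filter⁺ independent?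
    (∈-cartesianProduct⁺ (row u) (∈-cartesianProduct⁺ (row v) (row w)))
    where
    bit : ∀ b → b ∈ false ∷ true ∷ []
    bit false = here ≡.refl
    bit true = there (here ≡.refl)
    row : ∀ u → u ∈ rows
    row (a , b) = ∈-cartesianProduct⁺ (bit a) (bit b)

  trace : State → List (Fin 3) → List State
  trace s [] = s ∷ []
  trace s (l ∷ ls) = s ∷ trace (act l s) ls

  final : State → List (Fin 3) → State
  final s [] = s
  final s (l ∷ ls) = final (act l s) ls

  record Spanning (t : State) (w : List (Fin 3)) : Set where
    constructor spanning
    field
      arrives : final origin w ≡ t
      unique  : Unique (trace origin w)
      covers  : All (_∈ trace origin w) bases

  spanning? : ∀ t w → Dec (Spanning t w)
  spanning? t w with final origin w ≟S t ×-dec (unique? (trace origin w) ×-dec All.all? (_∈? trace origin w) bases)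
  ... | yes (a , u , c) = yes (spanning a u c)
  ... | no n = no λ (spanning a u c) → n (a , u , c)

  -- A word of 23 letters is coded by its ternary digits, the first letter being the lowest digit.
  decode : ℕ → ℕ → List (Fin 3)
  decode zero _ = []
  decode (suc k) n = (n mod 3) ∷ decode k (n / 3)

  -- A path through the 24 elements of Affine has 23 steps, and there is one word for each of the 23
  -- ends other than `origin`. That they serve is decided by evaluation in `certificate`.
  words : List (List (Fin 3))
  words = map (decode 23)
    ( 11897214906 ∷ 81211307430 ∷ 81513269652 ∷ 66727857520 ∷ 19474343220 ∷ 37631713890 ∷ 56471856996 ∷ 82359856398
    ∷ 56471553219 ∷ 13017269460 ∷ 55323472020 ∷ 81125910159 ∷ 82236555510 ∷ 58552449078 ∷ 75386299485 ∷ 23084522319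
    ∷ 35529864735 ∷ 82236455661 ∷ 58552149837 ∷ 82279502517 ∷ 37655707251 ∷ 74616287403 ∷ 71899503933 ∷ [])

  abstract
    -- Opaque, so that the evaluated search is not unfolded where the words are used.
    spanningWord : ∀ {t} → Independent t → t ≢ origin → ∃ (Spanning t)
    spanningWord {t} i n = Any.satisfied (All.lookup certificate (bases-complete i) n)
      where
      certificate : All (λ t → t ≢ origin → Any (Spanning t) words) bases
      certificate = toWitness {a? = All.all? (λ t → ¬? (t ≟S origin) →-dec Any.any? (spanning? t) words) bases} _

-- The field with two elements as Booleans

module TwoElements {c ℓ : Level} {q : ℕ} (F : FiniteField c ℓ q) (α : FiniteField.Carrier F) (generates : IsGenerator F α)
                   (α≈1 : FiniteField._≈_ F α (FiniteField.1# F)) where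
  open Generator F α generates
  private module F = FiniteField F
  open F using (0#; 1#) renaming (_≈_ to _≈F_; _+_ to _+F_; _*_ to _*F_; -_ to -F_; _-_ to _-F_; Carrier to K)
  open FieldFacts F
  private module R = IntegerSolver F.commutativeRing

  φ : Bool → K
  φ false = 0#
  φ true = 1#

  φ-surjective : ∀ x → ∃ λ b → x ≈F φ b
  φ-surjective x = decide (x ≟F 0#)
    where
    decide : Dec (x ≈F 0#) → ∃ λ b → x ≈F φ b
    decide (yes e) = false , e
    decide (no n) = let (k , e) = logarithm n in true , F.trans e (F.trans (^-congˡ k α≈1) (1^ k))

  φ-injective : ∀ a b → φ a ≈F φ b → a ≡ b
  φ-injective false false _ = ≡.refl
  φ-injective false true e = ⊥-elim (F.1≉0 (F.sym e))
  φ-injective true false e = ⊥-elim (F.1≉0 e)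
  φ-injective true true _ = ≡.refl

  φ-xor : ∀ a b → φ a +F φ b ≈F φ (a xor b)
  φ-xor false b = F.+-identityˡ (φ b)
  φ-xor true false = F.+-identityʳ 1#
  φ-xor true true = from (φ-surjective (1# +F 1#))
    where
    from : (∃ λ b → 1# +F 1# ≈F φ b) → 1# +F 1# ≈F 0#
    from (false , e) = e
    from (true , e) = ⊥-elim (F.1≉0 (F.trans (R.solve 0 (R.con ℤ.1ℤ R.:= (R.con ℤ.1ℤ R.:+ R.con ℤ.1ℤ) R.:- R.con ℤ.1ℤ) F.refl)
      (F.trans (F.+-congʳ e) (F.-‿inverseʳ 1#))))

module SpaceOverTwo {c ℓ : Level} {q : ℕ} (F : FiniteField c ℓ q) (α : FiniteField.Carrier F) (generates : IsGenerator F α)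
                    (T : TransitionGraph 3) (α≈1 : FiniteField._≈_ F α (FiniteField.1# F))
                    (i o : Fin 2) (i≢o : i ≢ o)
                    (e₁ : TransitionGraph.Edge T (inject₁ i) (inject₁ o)) (e₂ : TransitionGraph.Edge T (inject₁ o) (inject₁ i))
                    (e₃ : TransitionGraph.Edge T (inject₁ i) (fromℕ 2)) where
  open import Data.List.Membership.Propositional using (_∈_)
  open import Data.List.Relation.Binary.Pointwise.Base using (Pointwise; []; _∷_)
  open UpperLevels F α generates T
  open Generator F α generates
  open BooleanModel
  private module F = FiniteField F
  open F using (0#; 1#) renaming (_≈_ to _≈F_; _+_ to _+F_; _*_ to _*F_; -_ to -F_; _-_ to _-F_; Carrier to K)
  open FieldFacts F
  open Subgroup
  open TwoElements F α generates α≈1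

  -- Row i is the row that is added to the last one; it comes first in the model.
  place : Fin 3 → Fin 3
  place zero = inject₁ i
  place (suc zero) = inject₁ o
  place (suc (suc zero)) = end

  -- Replaces matching on `Fin 3`, since it is not fixed which of the first two rows is `i` and
  -- which is `o`.
  place-surjective : ∀ (P : Fin 3 → Set ℓ) → (∀ r → P (place r)) → ∀ j → P j
  place-surjective P f = cases i o i≢o (f zero) (f (suc zero)) (f (suc (suc zero)))
    where
    cases : ∀ i o → i ≢ o → P (inject₁ i) → P (inject₁ o) → P end → ∀ j → P j
    cases zero zero n _ _ _ _ = ⊥-elim (n ≡.refl)
    cases (suc zero) (suc zero) n _ _ _ _ = ⊥-elim (n ≡.refl)
    cases zero (suc zero) _ a b c zero = a
    cases zero (suc zero) _ a b c (suc zero) = b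
    cases zero (suc zero) _ a b c (suc (suc zero)) = c
    cases (suc zero) zero _ a b c zero = b
    cases (suc zero) zero _ a b c (suc zero) = a
    cases (suc zero) zero _ a b c (suc (suc zero)) = c

  inject-apart : inject₁ i ≢ inject₁ o
  inject-apart e = i≢o (Fin.inject₁-injective e)

  place-injective : ∀ r s → r ≢ s → place r ≢ place s
  place-injective zero zero n = λ _ → n ≡.refl
  place-injective zero (suc zero) _ = inject-apart
  place-injective zero (suc (suc zero)) _ = ≢end i
  place-injective (suc zero) zero _ e = inject-apart (≡.sym e)
  place-injective (suc zero) (suc zero) n = λ _ → n ≡.refl
  place-injective (suc zero) (suc (suc zero)) _ = ≢end o
  place-injective (suc (suc zero)) zero _ = end≢ i
  place-injective (suc (suc zero)) (suc zero) _ = end≢ o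
  place-injective (suc (suc zero)) (suc (suc zero)) n = λ _ → n ≡.refl

  source≢target : ∀ l → source l ≢ target l
  source≢target zero ()
  source≢target (suc zero) ()
  source≢target (suc (suc zero)) ()

  apart : ∀ l → place (source l) ≢ place (target l)
  apart l = place-injective (source l) (target l) (source≢target l)

  gen : Fin 3 → GL
  gen l = addition (place (source l)) (place (target l)) (apart l)

  ε~gen : ∀ l → ε ~ gen l
  ε~gen l = ε~addition (apart l) (edge l)
    where
    edge : ∀ l → TransitionGraph.Edge T (place (source l)) (place (target l))
    edge zero = e₁
    edge (suc zero) = e₂
    edge (suc (suc zero)) = e₃

  record Represents (s : State) (X : GL) : Set ℓ where
    constructor represents
    field
      bits : ∀ r j → mat X (place r) (place j) ≈F φ (entry s r j)
  open Represents

  step-represents : ∀ l {s X} → Represents s X → Represents (act l s) (gen l ∙ X)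
  step-represents l {s} {X} R = represents λ r j → cases r j (r Fin.≟ target l)
    where
    open SetoidReasoning F.setoid
    cases : ∀ r j → Dec (r ≡ target l) → mat (gen l ∙ X) (place r) (place j) ≈F φ (entry (act l s) r j)
    cases r j (yes ≡.refl) = begin
      mat (gen l ∙ X) (place r) (place j)                                                   ≈⟨ addition-row (place (source l)) (place (target l)) (apart l) X (place r) (place j) ⟩
      mat X (place r) (place j) +F unit (place r) (place r) *F mat X (place (source l)) (place j)   ≈⟨ F.+-congˡ (F.trans (F.*-congʳ (𝟙-diag (place r))) (F.*-identityˡ _)) ⟩
      mat X (place r) (place j) +F mat X (place (source l)) (place j)                               ≈⟨ F.+-cong (bits R r j) (bits R (source l) j) ⟩
      φ (entry s r j) +F φ (entry s (source l) j)                                   ≈⟨ φ-xor (entry s r j) (entry s (source l) j) ⟩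
      φ (entry s r j xor entry s (source l) j)                                      ≡⟨ ≡.cong φ (entry-target l s j) ⟨
      φ (entry (act l s) r j)                                                       ∎
    cases r j (no n) = begin
      mat (gen l ∙ X) (place r) (place j)                                                   ≈⟨ addition-row (place (source l)) (place (target l)) (apart l) X (place r) (place j) ⟩
      mat X (place r) (place j) +F unit (place (target l)) (place r) *F mat X (place (source l)) (place j)
                                     ≈⟨ F.+-congˡ (F.trans (F.*-congʳ (𝟙-off (place-injective r (target l) n))) (F.zeroˡ _)) ⟩
      mat X (place r) (place j) +F 0#                                                       ≈⟨ F.+-identityʳ _ ⟩
      mat X (place r) (place j)                                                             ≈⟨ bits R r j ⟩
      φ (entry s r j)                                                               ≡⟨ ≡.cong φ (entry-other l s r j n) ⟨
      φ (entry (act l s) r j)                                                       ∎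

  represents-≈ : ∀ {s X Y} → Represents s X → Represents s Y → X ≈ Y
  represents-≈ {s} {X} {Y} R R′ = entrywise (place-surjective (λ i → ∀ j → mat X i j ≈F mat Y i j) λ r →
    place-surjective (λ j → mat X (place r) j ≈F mat Y (place r) j) λ j → F.trans (bits R r j) (F.sym (bits R′ r j)))

  represents-≡ : ∀ {s t X Y} → Represents s X → Represents t Y → X ≈ Y → s ≡ t
  represents-≡ {s} {t} R R′ e = entry-injective s t λ r j → φ-injective (entry s r j) (entry t r j)
    (F.trans (F.sym (bits R r j)) (F.trans (entries e (place r) (place j)) (bits R′ r j)))

  last-column : ∀ s r → φ (entry s r end) ≈F unit end (place r)
  last-column s zero = F.sym (𝟙-off (≢end i))
  last-column s (suc zero) = F.sym (𝟙-off (≢end o))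
  last-column s (suc (suc zero)) = F.sym (𝟙-diag end)

  represented⇒affine : ∀ {s X} → Represents s X → Mem Affine X
  represented⇒affine {s} {X} R = place-surjective (λ i → (mat X ▹ unit end) i ≈F unit end i)
    (λ r → F.trans (▹unit (mat X) end (place r)) (F.trans (bits R r end) (last-column s r)))

  ε-represented : Represents origin ε
  ε-represented = represents λ r j → F.trans (mat-ε (place r) (place j)) (identity-bits r j)
    where
    identity-bits : ∀ r j → 𝟙 (place r) (place j) ≈F φ (entry origin r j)
    identity-bits r j = F.trans (same (r Fin.≟ j)) (F.reflexive (≡.cong φ (origin-entry r j)))
      where
      same : (d : Dec (r ≡ j)) → 𝟙 (place r) (place j) ≈F φ (does d)
      same (yes ≡.refl) = 𝟙-diag (place r)
      same (no n) = 𝟙-off (place-injective r j n)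

  zeroTop : ∀ {v w X} → ¬ Represents ((false , false) , v , w) X
  zeroTop {X = X} R = nonzeroRow X (place zero) (place-surjective (λ j → mat X (place zero) j ≈F 0#) λ
    { zero → bits R zero zero ; (suc zero) → bits R zero (suc zero) ; (suc (suc zero)) → bits R zero (suc (suc zero)) })

  -- A zero row contradicts invertibility, and equal rows would give a zero row after one addition.
  represented⇒independent : ∀ {s X} → Represents s X → Independent s
  represented⇒independent {u , v , w} {X} R =
      (λ { ≡.refl → zeroTop R })
    , (λ { ≡.refl → nonzeroRow X (place (suc zero)) (place-surjective (λ j → mat X (place (suc zero)) j ≈F 0#) λ
         { zero → bits R (suc zero) zero ; (suc zero) → bits R (suc zero) (suc zero) ; (suc (suc zero)) → bits R (suc zero) (suc (suc zero)) }) })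
    , (λ { ≡.refl → zeroTop (≡.subst (λ u′ → Represents (u′ , v , w) (gen (suc zero) ∙ X)) (⊞-self u) (step-represents (suc zero) R)) })

  affine⇒represented : ∀ {X} → Mem Affine X → ∃ λ s → Represents s X
  affine⇒represented {X} X∈ = s , represents holds
    where
    b : ∀ r j → ∃ λ b → mat X (place r) (place j) ≈F φ b
    b r j = φ-surjective (mat X (place r) (place j))
    row : Fin 3 → Row
    row r = proj₁ (b r zero) , proj₁ (b r (suc zero))
    s : State
    s = row zero , row (suc zero) , row (suc (suc zero))
    column : ∀ r → mat X (place r) end ≈F φ (entry s r end)
    column r = F.trans (F.sym (▹unit (mat X) end (place r))) (F.trans (X∈ (place r)) (F.sym (last-column s r)))
    holds : ∀ r j → mat X (place r) (place j) ≈F φ (entry s r j)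
    holds r (suc (suc zero)) = column r
    holds zero zero = proj₂ (b zero zero)
    holds zero (suc zero) = proj₂ (b zero (suc zero))
    holds (suc zero) zero = proj₂ (b (suc zero) zero)
    holds (suc zero) (suc zero) = proj₂ (b (suc zero) (suc zero))
    holds (suc (suc zero)) zero = proj₂ (b (suc (suc zero)) zero)
    holds (suc (suc zero)) (suc zero) = proj₂ (b (suc (suc zero)) (suc zero))

  Lifts : List State → List GL → Set (c ⊔ ℓ)
  Lifts = Pointwise Represents

  walkAlong : ∀ w {s X} → Represents s X → ∃₂ λ Y xs → Walk X xs Y × Represents (final s w) Y × Lifts (trace s w) xs
  walkAlong [] {s} {X} R = X , X ∷ [] , stop refl , R , R ∷ []
  walkAlong (l ∷ w) {s} {X} R = extended (walkAlong w (step-represents l R))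
    where
    extended : (∃₂ λ Y xs → Walk (gen l ∙ X) xs Y × Represents (final (act l s) w) Y × Lifts (trace (act l s) w) xs) →
               ∃₂ λ Y xs → Walk X xs Y × Represents (final (act l s) w) Y × Lifts (s ∷ trace (act l s) w) xs
    extended (Y , xs , walk , R′ , lifts) = Y , X ∷ xs , step (generator {gen l} X (ε~gen l)) walk , R′ , R ∷ lifts

  open import Data.List.Membership.Setoid setoid using () renaming (_∈_ to _∈G_)
  open import Data.List.Relation.Unary.Unique.Setoid setoid using () renaming (Unique to UniqueG)
  open import Data.List.Relation.Unary.Unique.Propositional using (Unique)

  lift-fresh : ∀ {s X ss xs} → Represents s X → All (s ≢_) ss → Lifts ss xs → All (λ Y → ¬ X ≈ Y) xs
  lift-fresh R [] [] = []
  lift-fresh R (n ∷ ns) (R′ ∷ Rs) = (λ e → n (represents-≡ R R′ e)) ∷ lift-fresh R ns Rs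

  lift-unique : ∀ {ss xs} → Unique ss → Lifts ss xs → UniqueG xs
  lift-unique [] [] = []
  lift-unique (n ∷ u) (R ∷ Rs) = lift-fresh R n Rs ∷ lift-unique u Rs

  lift-sound : ∀ {ss xs X} → Lifts ss xs → X ∈G xs → Mem Affine X
  lift-sound {X = X} (_∷_ {y = Y} R _) (here e) = resp Affine {Y} {X} (sym e) (represented⇒affine R)
  lift-sound (_ ∷ Rs) (there i) = lift-sound Rs i

  lift-complete : ∀ {ss xs s X} → Lifts ss xs → Represents s X → s ∈ ss → X ∈G xs
  lift-complete (R ∷ _) R′ (here ≡.refl) = here (represents-≈ R′ R)
  lift-complete (_ ∷ Rs) R′ (there i) = there (lift-complete Rs R′ i)

  affineConnected : Connected Affine
  affineConnected {h} h∈ h≉ε = from (affine⇒represented {h} h∈)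
    where
    from : (∃ λ t → Represents t h) → Ham (Mem Affine) ε h
    from (t , R) = follow (spanningWord (represented⇒independent R) λ { ≡.refl → h≉ε (represents-≈ R ε-represented) })
      where
      follow : ∃ (Spanning t) → Ham (Mem Affine) ε h
      follow (w , spanning arrives unique covers) = along (walkAlong w ε-represented)
        where
        along : (∃₂ λ Y xs → Walk ε xs Y × Represents (final origin w) Y × Lifts (trace origin w) xs) → Ham (Mem Affine) ε h
        along (Y , xs , walk , R′ , lifts) = ends refl (represents-≈ (≡.subst (λ s → Represents s Y) arrives R′) R)
          (ham walk (lift-unique unique lifts) (λ {z} → lift-sound {X = z} lifts) (λ {z} z∈ → complete (affine⇒represented {z} z∈)))
          where
          complete : ∀ {z} → (∃ λ s → Represents s z) → z ∈G xs
          complete (s , R″) = lift-complete lifts R″ (All.lookup covers (bases-complete (represented⇒independent R″)))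

-- Cycles

module Circular {a e r : Level} (G : SimpleGraph a e r) (k : ℕ) where
  open SimpleGraph G
  private
    module V = Setoid vertices
    N : ℕ
    N = suc (suc (suc k))

  -- The predecessor of `f i` is described by an index j with `f i ≈ f (suc j)`, so that the passage
  -- from 0 back to the last vertex needs no subtraction.
  record Rotation : Set (a ⊔ e ⊔ r) where
    field
      f          : ℕ → Vertex
      injective  : ∀ {i j} → i < N → j < N → f i ≈ f j → i ≡ j
      closes     : f N ≈ f 0
      index      : ∀ v → ∃ λ i → i < N × v ≈ f i
      forward    : ∀ i → Adj (f i) (f (suc i))
      neighbours : ∀ {i y} → i < N → Adj (f i) y → y ≈ f (suc i) ⊎ ∃ λ j → j < N × f i ≈ f (suc j) × y ≈ f j

  isCycle : Rotation → IsCycle G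
  isCycle R = k , record
    { bijection = record
      { to = to
      ; from = f ∘ toℕ
      ; to-cong = λ {u} {v} → to-cong {u} {v}
      ; from-cong = λ { ≡.refl → V.refl }
      ; inverse = (λ { {x} {y} e → ≡.trans (to-cong {y} {f (toℕ x)} e) (to-f x) })
                , (λ { {x} {y} ≡.refl → V.sym (at x) }) }
    ; adjacency = λ u v → mk⇔ (adjacent⇒ u v) [ next⇒ u v , (λ n → SimpleGraph.sym G (next⇒ v u n)) ]′ }
    where
    open Rotation R
    to : Vertex → Fin N
    to v = fromℕ< (proj₁ (proj₂ (index v)))
    pos : Vertex → ℕ
    pos v = toℕ (to v)
    at : ∀ v → v ≈ f (pos v)
    at v = V.trans (proj₂ (proj₂ (index v))) (V.reflexive (≡.cong f (≡.sym (Fin.toℕ-fromℕ< (proj₁ (proj₂ (index v)))))))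
    same : ∀ {u v i} → i < N → f (pos u) ≈ f i → pos u ≡ i
    same {u} i<N e = injective (Fin.toℕ<n (to u)) i<N e
    to-cong : ∀ {u v} → u ≈ v → to u ≡ to v
    to-cong {u} {v} e = Fin.toℕ-injective (same {u} {v} (Fin.toℕ<n (to v)) (V.trans (V.sym (at u)) (V.trans e (at v))))
    to-f : ∀ i → to (f (toℕ i)) ≡ i
    to-f i = Fin.toℕ-injective (same {f (toℕ i)} {f (toℕ i)} (Fin.toℕ<n i) (V.sym (at (f (toℕ i)))))
    wrap : ∀ i → i < N → f (suc i % N) ≈ f (suc i)
    wrap i i<N = [ (λ s<N → V.reflexive (≡.cong f (m<n⇒m%n≡m s<N)))
                 , (λ s≡N → V.trans (V.reflexive (≡.cong f (≡.trans (≡.cong (_% N) s≡N) (n%n≡0 N))))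
                     (V.trans (V.sym closes) (V.reflexive (≡.cong f (≡.sym s≡N))))) ]′ (ℕ.m≤n⇒m<n∨m≡n i<N)
    next : ∀ u v {i} → i < N → u ≈ f i → v ≈ f (suc i) → pos v ≡ suc (pos u) % N
    next u v {i} i<N u≈ v≈ = ≡.trans
      (same {v} {v} (m%n<n (suc i) N) (V.trans (V.sym (at v)) (V.trans v≈ (V.sym (wrap i i<N)))))
      (≡.cong (λ j → suc j % N) (≡.sym (same {u} {u} i<N (V.trans (V.sym (at u)) u≈))))
    adjacent⇒ : ∀ u v → Adj u v → (pos v ≡ suc (pos u) % N) ⊎ (pos u ≡ suc (pos v) % N)
    adjacent⇒ u v adj = [ (λ v≈ → inj₁ (next u v (Fin.toℕ<n (to u)) (at u) v≈))
                        , (λ (j , j<N , u≈ , v≈) → inj₂ (next v u j<N v≈ (V.trans (at u) u≈))) ]′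
                        (neighbours (Fin.toℕ<n (to u)) (proj₂ resp (at u) adj))
    next⇒ : ∀ u v → pos v ≡ suc (pos u) % N → Adj u v
    next⇒ u v e = proj₁ resp
      (V.sym (V.trans (at v) (V.trans (V.reflexive (≡.cong f e)) (wrap (pos u) (Fin.toℕ<n (to u))))))
      (proj₂ resp (V.sym (at u)) (forward (pos u)))

-- Dimension one

module Line {c ℓ : Level} {q : ℕ} (F : FiniteField c ℓ q) (α : FiniteField.Carrier F) (generates : IsGenerator F α)
            (T : TransitionGraph 1) where
  open Stabilizers F α T
  open Subgroup
  open Generator F α generates
  open Neighbours F α T
  private module F = FiniteField F
  open F using (0#; 1#) renaming (_≈_ to _≈F_; _*_ to _*F_; _+_ to _+F_; Carrier to K)
  open FieldFacts F
  open GroupSolver 𝔾 using (solve; _⊜_; _⊙_; inv)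

  abstract
    M : GL
    M = scaling {α} α≉0 zero

    M≋ : mat M ≋ scaleMatrix α zero
    M≋ = scaling≋ {α} α≉0 zero

    ε~M : ¬ α ≈F 1# → ε ~ M
    ε~M α≉1 = ε~scaling α≉0 (q>2 α≉1) α≉1 zero

    M-row : ∀ X → mat (M ∙ X) zero zero ≈F α *F mat X zero zero
    M-row X = scaleRow {α} α≉0 zero X zero

  power-entry : ∀ k → mat (M ^ k) zero zero ≈F α ^F k
  power-entry zero = F.trans (mat-ε zero zero) (𝟙-diag zero)
  power-entry (suc k) = F.trans (M-row (M ^ k)) (F.*-congˡ (power-entry k))

  entry-≈ : ∀ {X Y} → mat X zero zero ≈F mat Y zero zero → X ≈ Y
  entry-≈ e = entrywise λ { zero zero → e }

  index : ∀ X → ∃ λ k → k ≤ p × X ≈ M ^ k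
  index X = from (bounded (λ z → nonzeroRow X zero λ { zero → z }))
    where
    from : (∃ λ k → k ≤ p × mat X zero zero ≈F α ^F k) → ∃ λ k → k ≤ p × X ≈ M ^ k
    from (k , k≤p , e) = k , k≤p , entry-≈ (F.trans e (F.sym (power-entry k)))

  powers-injective : ∀ {i j} → i < m → j < m → M ^ i ≈ M ^ j → i ≡ j
  powers-injective {i} {j} i<m j<m e = power-injective i<m j<m
    (F.trans (F.sym (power-entry i)) (F.trans (entries e zero zero) (power-entry j)))

  elementary-M : ∀ {h} → Elementary h → h ≈ M
  elementary-M (inj₁ (zero , zero , e , _)) = ⊥-elim (TransitionGraph.loopless T ≡.refl e)
  elementary-M {h} (inj₂ (_ , zero , e)) = entrywise (≋-trans e (≋-sym M≋))

  connected : p ≤ 1 → Connected whole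
  connected p≤1 {h} _ h≉ε = place (index h)
    where
    place : (∃ λ k → k ≤ p × h ≈ M ^ k) → Ham (Mem whole) ε h
    place (zero , _ , e) = ⊥-elim (h≉ε e)
    place (suc (suc k) , k≤p , _) = ⊥-elim (ℕ.<⇒≱ (s≤s (s≤s z≤n)) (ℕ.≤-trans k≤p p≤1))
    place (suc zero , 0<p , h≈) = recast {P = (_≈ ε) ∪ (_≈ h)} {Q = Mem whole} (λ _ → _) (λ {z} _ → sort (index z))
      (join {P = _≈ ε} {Q = _≈ h} (singleton ε) (~-resp {ε} {ε} {M} {h} (refl {ε}) (sym h≈M) (ε~M α≉1)) (singleton h)
        (λ p q → h≉ε (trans (sym q) p)))
      where
      h≈M : h ≈ M
      h≈M = trans h≈ (identityʳ M)
      α≉1 : ¬ α ≈F 1#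
      α≉1 = p≢0⇒α≉1 0<p
      sort : ∀ {z} → (∃ λ k → k ≤ p × z ≈ M ^ k) → ((_≈ ε) ∪ (_≈ h)) z
      sort (zero , _ , e) = inj₁ e
      sort (suc zero , _ , e) = inj₂ (trans e (sym h≈))
      sort (suc (suc k) , k≤p , _) = ⊥-elim (ℕ.<⇒≱ (s≤s (s≤s z≤n)) (ℕ.≤-trans k≤p p≤1))

  -- The group is cyclic of order `m`, and multiplication by `M` and its inverse gives all the
  -- edges.
  isCycle : 2 ≤ p → IsCycle (operationGraph F α T)
  -- `p` is opaque, so its shape is brought in through an equation.
  isCycle 2≤p = cycle p ≡.refl 2≤p
    where
    α≉1 : ¬ α ≈F 1#
    α≉1 = p≢0⇒α≉1 (ℕ.≤-trans (s≤s z≤n) 2≤p)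
    cycle : ∀ p′ → p ≡ p′ → 2 ≤ p′ → IsCycle (operationGraph F α T)
    cycle (suc zero) _ (s≤s ())
    cycle (suc (suc k)) eq _ = Circular.isCycle (operationGraph F α T) k (record
      { f = M ^_
      ; injective = λ i<N j<N e → powers-injective (bound i<N) (bound j<N) (entrywise e)
      ; closes = entries (entry-≈ {M ^ suc (suc (suc k))} {M ^ 0} (F.trans (power-entry (suc (suc (suc k))))
          (F.trans (F.trans (F.reflexive (≡.cong (λ j → α ^F suc j) (≡.sym eq))) α^m) (F.sym (power-entry 0)))))
      ; index = λ X → let (i , i≤p , e) = index X in i , ≡.subst (λ j → i < suc j) eq (s≤s i≤p) , entries e
      ; forward = λ i → generator {M} (M ^ i) (ε~M α≉1)
      ; neighbours = λ {i} {y} i<N adj → neighbours i y (elementary {y ∙ (M ^ i) ⁻¹} (~-resp {M ^ i ∙ (M ^ i) ⁻¹} {ε} {y ∙ (M ^ i) ⁻¹} {y ∙ (M ^ i) ⁻¹}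
          (inverseʳ (M ^ i)) (refl {y ∙ (M ^ i) ⁻¹}) (~-∙ʳ {M ^ i} {y} ((M ^ i) ⁻¹) adj))) })
      where
      bound : ∀ {i} → i < suc (suc (suc k)) → i < m
      bound {i} = ≡.subst (λ j → i < suc j) (≡.sym eq)
      neighbours : ∀ i y → (∃ λ h → (y ∙ (M ^ i) ⁻¹ ≈ h ⊎ y ∙ (M ^ i) ⁻¹ ≈ h ⁻¹) × Elementary h) →
                   mat y ≋ mat (M ^ suc i) ⊎ ∃ λ j → j < suc (suc (suc k)) × mat (M ^ i) ≋ mat (M ^ suc j) × mat y ≋ mat (M ^ j)
      neighbours i y (h , inj₁ e , el) = inj₁ (entries (trans (solve 2 (λ y x → y ⊜ (y ⊙ inv x) ⊙ x) refl y (M ^ i)) (∙-congʳ (trans e (elementary-M el)))))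
      neighbours i y (h , inj₂ e , el) = inj₂ (back (index y))
        where
        back : (∃ λ j → j ≤ p × y ≈ M ^ j) → ∃ λ j → j < suc (suc (suc k)) × mat (M ^ i) ≋ mat (M ^ suc j) × mat y ≋ mat (M ^ j)
        back (j , j≤p , y≈) = j , ≡.subst (λ l → j < suc l) eq (s≤s j≤p) , entries (begin
            M ^ i                                   ≈⟨ solve 2 (λ y x → x ⊜ inv (y ⊙ inv x) ⊙ y) refl y (M ^ i) ⟩
            (y ∙ (M ^ i) ⁻¹) ⁻¹ ∙ y                 ≈⟨ ∙-congʳ (⁻¹-cong (trans e (⁻¹-cong (elementary-M el)))) ⟩
            (M ⁻¹) ⁻¹ ∙ y                           ≈⟨ solve 2 (λ m y → inv (inv m) ⊙ y ⊜ m ⊙ y) refl M y ⟩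
            M ∙ y                                   ≈⟨ ∙-congˡ {M} y≈ ⟩
            M ∙ M ^ j                               ∎) , entries y≈
          where open SetoidReasoning setoid

-- Dimension two over the field with two elements

module Hexagon {c ℓ : Level} {q : ℕ} (F : FiniteField c ℓ q) (α : FiniteField.Carrier F) (generates : IsGenerator F α)
               (T : TransitionGraph 2) (α≈1 : FiniteField._≈_ F α (FiniteField.1# F))
               (e₁₂ : TransitionGraph.Edge T zero (suc zero)) (e₂₁ : TransitionGraph.Edge T (suc zero) zero) where
  open Stabilizers F α T
  open Generator F α generates
  open Neighbours F α T
  open TwoElements F α generates α≈1
  open BooleanModel using (Row; _⊞_; ⊞-self)
  private module F = FiniteField F
  open F using (0#; 1#) renaming (_≈_ to _≈F_; _*_ to _*F_; _+_ to _+F_; Carrier to K)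
  open GroupSolver 𝔾 using (solve; _⊜_; _⊙_; inv)

  Frame : Set
  Frame = Row × Row

  act : Bool → Frame → Frame
  act false (u , v) = u , v ⊞ u
  act true (u , v) = u ⊞ v , v

  entry : Frame → Fin 2 → Fin 2 → Bool
  entry ((a , _) , _) zero zero = a
  entry ((_ , b) , _) zero (suc zero) = b
  entry (_ , (a , _)) (suc zero) zero = a
  entry (_ , (_ , b)) (suc zero) (suc zero) = b

  -- The two additions, applied alternately, run through all six bases and return after six steps.
  frame : ℕ → Frame
  frame zero = (true , false) , (false , true)
  frame (suc i) = act (odd i) (frame i)

  -- Inverts `frame` on 0, ..., 5 and so shows these frames to be distinct. The default 0 is also
  -- the value at `frame 0`.
  rank : Frame → ℕ
  rank ((true , false) , (true , true)) = 1
  rank ((false , true) , (true , true)) = 2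
  rank ((false , true) , (true , false)) = 3
  rank ((true , true) , (true , false)) = 4
  rank ((true , true) , (false , true)) = 5
  rank _ = 0

  rank-frame : ∀ {i} → i < 6 → rank (frame i) ≡ i
  rank-frame {0} _ = ≡.refl
  rank-frame {1} _ = ≡.refl
  rank-frame {2} _ = ≡.refl
  rank-frame {3} _ = ≡.refl
  rank-frame {4} _ = ≡.refl
  rank-frame {5} _ = ≡.refl
  rank-frame {suc (suc (suc (suc (suc (suc i)))))} (s≤s (s≤s (s≤s (s≤s (s≤s (s≤s ()))))))

  frame-surjective : ∀ u v → u ≢ (false , false) → v ≢ (false , false) → u ≢ v → ∃ λ i → i < 6 × (u , v) ≡ frame i
  frame-surjective (false , false) _ n _ _ = ⊥-elim (n ≡.refl)
  frame-surjective (false , true) (false , false) _ n _ = ⊥-elim (n ≡.refl)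
  frame-surjective (true , _) (false , false) _ n _ = ⊥-elim (n ≡.refl)
  frame-surjective (false , true) (false , true) _ _ n = ⊥-elim (n ≡.refl)
  frame-surjective (true , false) (true , false) _ _ n = ⊥-elim (n ≡.refl)
  frame-surjective (true , true) (true , true) _ _ n = ⊥-elim (n ≡.refl)
  frame-surjective (true , false) (false , true) _ _ _ = 0 , s≤s z≤n , ≡.refl
  frame-surjective (true , false) (true , true) _ _ _ = 1 , s≤s (s≤s z≤n) , ≡.refl
  frame-surjective (false , true) (true , true) _ _ _ = 2 , s≤s (s≤s (s≤s z≤n)) , ≡.refl
  frame-surjective (false , true) (true , false) _ _ _ = 3 , s≤s (s≤s (s≤s (s≤s z≤n))) , ≡.refl
  frame-surjective (true , true) (true , false) _ _ _ = 4 , s≤s (s≤s (s≤s (s≤s (s≤s z≤n)))) , ≡.refl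
  frame-surjective (true , true) (false , true) _ _ _ = 5 , s≤s (s≤s (s≤s (s≤s (s≤s (s≤s z≤n))))) , ≡.refl

  top≢bot : _≢_ {A = Fin 2} zero (suc zero)
  top≢bot ()

  bot≢top : _≢_ {A = Fin 2} (suc zero) zero
  bot≢top ()

  abstract
    gen : Bool → GL
    gen false = addition zero (suc zero) top≢bot
    gen true = addition (suc zero) zero bot≢top

    ε~gen : ∀ b → ε ~ gen b
    ε~gen false = ε~addition top≢bot e₁₂
    ε~gen true = ε~addition bot≢top e₂₁

    lower-row : ∀ X i j → mat (gen false ∙ X) i j ≈F mat X i j +F unit (suc zero) i *F mat X zero j
    lower-row = addition-row zero (suc zero) top≢bot

    upper-row : ∀ X i j → mat (gen true ∙ X) i j ≈F mat X i j +F unit zero i *F mat X (suc zero) j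
    upper-row = addition-row (suc zero) zero bot≢top

    elementary-gen : ∀ {h} → Elementary h → ∃ λ b → h ≈ gen b
    elementary-gen (inj₁ (zero , zero , e , _)) = ⊥-elim (TransitionGraph.loopless T ≡.refl e)
    elementary-gen (inj₁ (suc zero , suc zero , e , _)) = ⊥-elim (TransitionGraph.loopless T ≡.refl e)
    elementary-gen (inj₁ (zero , suc zero , _ , e)) = false , entrywise (≋-trans e (≋-sym (addition≋ zero (suc zero) top≢bot)))
    elementary-gen (inj₁ (suc zero , zero , _ , e)) = true , entrywise (≋-trans e (≋-sym (addition≋ (suc zero) zero bot≢top)))
    elementary-gen (inj₂ (q>2 , _)) = ⊥-elim (q≯2 α≈1 q>2)

  record Represents (s : Frame) (X : GL) : Set ℓ where
    constructor represents
    field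
      bits : ∀ i j → mat X i j ≈F φ (entry s i j)
  open Represents

  represents-≈ : ∀ {s X Y} → Represents s X → Represents s Y → X ≈ Y
  represents-≈ R R′ = entrywise λ i j → F.trans (bits R i j) (F.sym (bits R′ i j))

  represents-≡ : ∀ {s t X Y} → Represents s X → Represents t Y → X ≈ Y → s ≡ t
  represents-≡ {s} {t} R R′ e = ≡.cong₂ _,_ (≡.cong₂ _,_ (bit zero zero) (bit zero (suc zero)))
                                            (≡.cong₂ _,_ (bit (suc zero) zero) (bit (suc zero) (suc zero)))
    where
    bit : ∀ i j → entry s i j ≡ entry t i j
    bit i j = φ-injective (entry s i j) (entry t i j) (F.trans (F.sym (bits R i j)) (F.trans (entries e i j) (bits R′ i j)))

  represents-ε : Represents (frame 0) ε
  represents-ε = represents λ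
    { zero zero → mat-ε zero zero ; zero (suc zero) → mat-ε zero (suc zero)
    ; (suc zero) zero → mat-ε (suc zero) zero ; (suc zero) (suc zero) → mat-ε (suc zero) (suc zero) }

  step-represents : ∀ b {s X} → Represents s X → Represents (act b s) (gen b ∙ X)
  step-represents false {s} {X} R = represents λ
    { zero zero → kept zero ; zero (suc zero) → kept (suc zero) ; (suc zero) zero → changed zero ; (suc zero) (suc zero) → changed (suc zero) }
    where
    kept : ∀ j → mat (gen false ∙ X) zero j ≈F φ (entry s zero j)
    kept j = F.trans (lower-row X zero j) (F.trans (F.+-congˡ (F.zeroˡ _)) (F.trans (F.+-identityʳ _) (bits R zero j)))
    changed : ∀ j → mat (gen false ∙ X) (suc zero) j ≈F φ (entry s (suc zero) j xor entry s zero j)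
    changed j = F.trans (lower-row X (suc zero) j) (F.trans (F.+-cong (bits R (suc zero) j) (F.trans (F.*-identityˡ _) (bits R zero j)))
      (φ-xor (entry s (suc zero) j) (entry s zero j)))
  step-represents true {s} {X} R = represents λ
    { zero zero → changed zero ; zero (suc zero) → changed (suc zero) ; (suc zero) zero → kept zero ; (suc zero) (suc zero) → kept (suc zero) }
    where
    kept : ∀ j → mat (gen true ∙ X) (suc zero) j ≈F φ (entry s (suc zero) j)
    kept j = F.trans (upper-row X (suc zero) j) (F.trans (F.+-congˡ (F.zeroˡ _)) (F.trans (F.+-identityʳ _) (bits R (suc zero) j)))
    changed : ∀ j → mat (gen true ∙ X) zero j ≈F φ (entry s zero j xor entry s (suc zero) j)
    changed j = F.trans (upper-row X zero j) (F.trans (F.+-cong (bits R zero j) (F.trans (F.*-identityˡ _) (bits R (suc zero) j)))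
      (φ-xor (entry s zero j) (entry s (suc zero) j)))

  -- Since 1 + 1 = 0, each generator is its own inverse, so a generator that leads to a vertex also
  -- leads back.
  involution : ∀ b X → gen b ∙ (gen b ∙ X) ≈ X
  involution b X = trans (solve 2 (λ g x → g ⊙ (g ⊙ x) ⊜ (g ⊙ g) ⊙ x) refl (gen b) X) (trans (∙-congʳ (trans (∙-congˡ {gen b} (sym (identityʳ (gen b)))) (square b))) (identityˡ X))
    where
    square : ∀ b → gen b ∙ (gen b ∙ ε) ≈ ε
    square false = represents-≈ (step-represents false (step-represents false represents-ε)) represents-ε
    square true = represents-≈ (step-represents true (step-represents true represents-ε)) represents-ε

  vertex : ℕ → GL
  vertex zero = ε
  vertex (suc i) = gen (odd i) ∙ vertex i

  vertex-represented : ∀ i → Represents (frame i) (vertex i)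
  vertex-represented zero = represents-ε
  vertex-represented (suc i) = step-represents (odd i) (vertex-represented i)

  index : ∀ X → ∃ λ i → i < 6 × X ≈ vertex i
  index X = located (frame-surjective u v (λ e → nonzeroRow X zero (zeros X zero (u , v) bitwise e))
      (λ e → nonzeroRow X (suc zero) (zeros X (suc zero) (u , v) bitwise e))
      (λ e → nonzeroRow (gen true ∙ X) zero (zeros (gen true ∙ X) zero (u ⊞ v , v) (step-represents true bitwise)
        (≡.trans (≡.cong (u ⊞_) (≡.sym e)) (⊞-self u)))))
    where
    b : ∀ i j → ∃ λ b → mat X i j ≈F φ b
    b i j = φ-surjective (mat X i j)
    u v : Row
    u = proj₁ (b zero zero) , proj₁ (b zero (suc zero))
    v = proj₁ (b (suc zero) zero) , proj₁ (b (suc zero) (suc zero))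
    bitwise : Represents (u , v) X
    bitwise = represents λ
      { zero zero → proj₂ (b zero zero) ; zero (suc zero) → proj₂ (b zero (suc zero))
      ; (suc zero) zero → proj₂ (b (suc zero) zero) ; (suc zero) (suc zero) → proj₂ (b (suc zero) (suc zero)) }
    zeros : ∀ Y i s → Represents s Y → (entry s i zero , entry s i (suc zero)) ≡ (false , false) → ∀ j → mat Y i j ≈F 0#
    zeros Y i s R e zero = F.trans (bits R i zero) (F.reflexive (≡.cong φ (≡.cong proj₁ e)))
    zeros Y i s R e (suc zero) = F.trans (bits R i (suc zero)) (F.reflexive (≡.cong φ (≡.cong proj₂ e)))
    located : (∃ λ i → i < 6 × (u , v) ≡ frame i) → ∃ λ i → i < 6 × X ≈ vertex i
    located (i , i<6 , e) = i , i<6 , represents-≈ (≡.subst (λ s → Represents s X) e bitwise) (vertex-represented i)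

  closes : vertex 6 ≈ vertex 0
  closes = represents-≈ (vertex-represented 6) (vertex-represented 0)

  -- At each vertex one generator leads on and the other leads back, according to the parity of `i`.
  -- From vertex 0 the way back goes to vertex 5, as the cycle closes after six steps.
  neighbour : ∀ i b → i < 6 → (b ≡ odd i) ⊎ ∃ λ j → j < 6 × vertex i ≈ vertex (suc j) × b ≡ odd j
  neighbour zero false _ = inj₁ ≡.refl
  neighbour zero true _ = inj₂ (5 , ℕ.≤-refl , sym closes , ≡.refl)
  neighbour (suc j) b j<6 = compare b (odd j) ≡.refl
    where
    compare : ∀ b d → odd j ≡ d → (b ≡ not (odd j)) ⊎ ∃ λ k → k < 6 × vertex (suc j) ≈ vertex (suc k) × b ≡ odd k
    compare false false e = inj₂ (j , ℕ.<⇒≤ j<6 , refl , ≡.sym e)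
    compare true true e = inj₂ (j , ℕ.<⇒≤ j<6 , refl , ≡.sym e)
    compare true false e = inj₁ (≡.sym (≡.cong not e))
    compare false true e = inj₁ (≡.sym (≡.cong not e))

  isCycle : IsCycle (operationGraph F α T)
  isCycle = Circular.isCycle (operationGraph F α T) 3 (record
    { f = vertex
    ; injective = λ {i} {j} i<6 j<6 e → ≡.trans (≡.sym (rank-frame i<6))
        (≡.trans (≡.cong rank (represents-≡ (vertex-represented i) (vertex-represented j) (entrywise e))) (rank-frame j<6))
    ; closes = entries closes
    ; index = λ X → let (i , i<6 , e) = index X in i , i<6 , entries e
    ; forward = λ i → generator {gen (odd i)} (vertex i) (ε~gen (odd i))
    ; neighbours = λ {i} {y} i<6 adj → neighbours i y i<6 (elementary {y ∙ (vertex i) ⁻¹}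
        (~-resp {vertex i ∙ (vertex i) ⁻¹} {ε} {y ∙ (vertex i) ⁻¹} {y ∙ (vertex i) ⁻¹}
          (inverseʳ (vertex i)) (refl {y ∙ (vertex i) ⁻¹}) (~-∙ʳ {vertex i} {y} ((vertex i) ⁻¹) adj))) })
    where
    neighbours : ∀ i y → i < 6 → (∃ λ h → (y ∙ (vertex i) ⁻¹ ≈ h ⊎ y ∙ (vertex i) ⁻¹ ≈ h ⁻¹) × Elementary h) →
                 mat y ≋ mat (vertex (suc i)) ⊎ ∃ λ j → j < 6 × mat (vertex i) ≋ mat (vertex (suc j)) × mat y ≋ mat (vertex j)
    neighbours i y i<6 (h , g≈ , el) = from (elementary-gen el)
      where
      inverse-gen : ∀ b → gen b ⁻¹ ≈ gen b
      inverse-gen b = trans (solve 1 (λ g → inv g ⊜ inv (g ⊙ g) ⊙ g) refl (gen b))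
        (trans (∙-congʳ (⁻¹-cong (trans (sym (∙-congˡ {gen b} (identityʳ (gen b)))) (involution b ε)))) (solve 1 (λ g → inv one ⊙ g ⊜ g) refl (gen b)))
        where open GroupSolver 𝔾 using (one)
      from : (∃ λ b → h ≈ gen b) → mat y ≋ mat (vertex (suc i)) ⊎ ∃ λ j → j < 6 × mat (vertex i) ≋ mat (vertex (suc j)) × mat y ≋ mat (vertex j)
      from (b , h≈) = choose (neighbour i b i<6)
        where
        y≈ : y ≈ gen b ∙ vertex i
        y≈ = trans (solve 2 (λ y x → y ⊜ (y ⊙ inv x) ⊙ x) refl y (vertex i)) (∙-congʳ
          ([ (λ e → trans e h≈) , (λ e → trans e (trans (⁻¹-cong h≈) (inverse-gen b))) ]′ g≈))
        choose : (b ≡ odd i) ⊎ (∃ λ j → j < 6 × vertex i ≈ vertex (suc j) × b ≡ odd j) →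
                 mat y ≋ mat (vertex (suc i)) ⊎ ∃ λ j → j < 6 × mat (vertex i) ≋ mat (vertex (suc j)) × mat y ≋ mat (vertex j)
        choose (inj₁ ≡.refl) = inj₁ (entries y≈)
        choose (inj₂ (j , j<6 , e , ≡.refl)) = inj₂ (j , j<6 , entries e ,
          entries (trans y≈ (trans (∙-congˡ {gen (odd j)} e) (involution (odd j) (vertex j)))))

-- The induction on n

module HamiltonPaths {c ℓ : Level} {q : ℕ} (F : FiniteField c ℓ q) (α : FiniteField.Carrier F)
                     {n : ℕ} (T : TransitionGraph n) where
  open import Data.List.Base using (head; last)
  open import Data.List.Relation.Unary.Linked using (Linked; [-]; _∷_)
  open Stabilizers F α T
  open import Data.List.Membership.Setoid setoid using (_∈_)

  private
    G : SimpleGraph _ _ _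
    G = operationGraph F α T

  -- A walk ends at v up to equality of matrices; here its last vertex is replaced by v itself.
  route : ∀ {u xs v} → Walk u xs v → List GL
  route {v = v} (stop _) = v ∷ []
  route {u} (step _ w) = u ∷ route w

  route-last : ∀ {u xs v} (w : Walk u xs v) → last (route w) ≡ just v
  route-last (stop _) = ≡.refl
  route-last (step _ (stop _)) = ≡.refl
  route-last (step _ w@(step _ _)) = route-last w

  route-linked : ∀ {u xs v} (w : Walk u xs v) → Linked _~_ (route w)
  route-linked (stop _) = [-]
  route-linked (step {u} {x} {v} e (stop x≈v)) = ~-resp {u} {u} {x} {v} refl x≈v e ∷ [-]
  route-linked (step e w@(step _ _)) = e ∷ route-linked w

  route-all : ∀ {p} {P : GL → Set p} → (∀ {x y} → x ≈ y → P x → P y) → ∀ {u xs v} (w : Walk u xs v) → All P xs → All P (route w)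
  route-all resp (stop e) (p ∷ []) = resp e p ∷ []
  route-all resp (step _ w) (p ∷ ps) = p ∷ route-all resp w ps

  route-unique : ∀ {u xs v} (w : Walk u xs v) → AllPairs (λ x y → ¬ x ≈ y) xs → AllPairs (λ x y → ¬ mat x ≋ mat y) (route w)
  route-unique (stop _) _ = [] ∷ []
  route-unique (step _ w) (n ∷ u) =
    All.map (λ n e → n (entrywise e)) (route-all (λ e n e′ → n (trans e′ (sym e))) w n) ∷ route-unique w u

  route-covers : ∀ {u xs v z} (w : Walk u xs v) → z ∈ xs → Any (λ y → mat z ≋ mat y) (route w)
  route-covers (stop e) (here p) = here (entries (trans p e))
  route-covers (step _ w) (here p) = here (entries p)
  route-covers (step _ w) (there i) = there (route-covers w i)

  hamiltonConnected : Connected whole → HamiltonConnected G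
  hamiltonConnected hc u v u≉v = from (withinCoset {trivial} {whole} (λ {x} → hc {x}) {u} {v} _ (λ e → u≉v (entries (sym (same-trivial e)))))
    where
    from : Ham (λ z → Subgroup.Same whole z u) u v → HamiltonPath G u v
    from (ham {xs} w unique _ complete) = record
      { path = route w
      ; starts = starts w
      ; ends = route-last w
      ; adjacent = route-linked w
      ; unique = route-unique w unique
      ; spanning = λ z → route-covers w (complete {z} _) }
      where
      starts : ∀ {ys} (w : Walk u ys v) → head (route w) ≡ just u
      starts (stop e) = ⊥-elim (u≉v (entries e))
      starts (step _ _) = ≡.refl

another-index : ∀ {n} (i : Fin (suc (suc n))) → ∃ λ l → l ≢ i
another-index zero = suc zero , λ ()
another-index (suc _) = zero , λ ()

two-others : ∀ {n} (i : Fin (suc (suc (suc n)))) → ∃₂ λ l o → l ≢ i × o ≢ i × o ≢ l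
two-others zero = suc zero , suc (suc zero) , (λ ()) , (λ ()) , (λ ())
two-others (suc zero) = zero , suc (suc zero) , (λ ()) , (λ ()) , (λ ())
two-others (suc (suc _)) = zero , suc zero , (λ ()) , (λ ()) , (λ ())

module Induction {c ℓ : Level} {q : ℕ} (F : FiniteField c ℓ q) (α : FiniteField.Carrier F) (generates : IsGenerator F α) where
  open Generator F α generates using (p; p≢0⇒α≉1; α≉1⇒0<p)
  private module F = FiniteField F
  open FieldFacts F using (_≟F_)

  WholeConnected : ∀ {n} → TransitionGraph n → Set _
  WholeConnected T = Stabilizers.Connected F α T (Stabilizers.whole F α T)

  -- α ≠ 1 excludes p = 0. The case p = 1 is the field with three elements, and from p = 2 on the
  -- tori are large enough for the runs.
  plane : (T : TransitionGraph 2) → IsBypass T → ¬ α F.≈ F.1# → WholeConnected T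
  plane T (extend (zero , e₁₂) (zero , e₂₁) _) α≉1 = byOrder p ≡.refl
    where
    byOrder : ∀ k → p ≡ k → WholeConnected T
    byOrder zero eq = ⊥-elim (ℕ.<⇒≢ (α≉1⇒0<p α≉1) (≡.sym eq))
    byOrder (suc zero) eq = PlaneOverThree.wholeConnected F α generates T α≉1 e₁₂ e₂₁ eq
    byOrder (suc (suc k)) eq = PlaneWhole.wholeConnected F α generates T α≉1 e₁₂ e₂₁ (≡.subst (2 ≤_) (≡.sym eq) (s≤s (s≤s z≤n)))

  -- At least two indices lie below the last one, which provides an index different from `i` and one
  -- different from `j`.
  module Extend {k : ℕ} (T : TransitionGraph (suc (suc (suc k)))) {i j : Fin (suc (suc k))}
                (eᵢ : TransitionGraph.Edge T (inject₁ i) (fromℕ (suc (suc k))))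
                (eⱼ : TransitionGraph.Edge T (fromℕ (suc (suc k))) (inject₁ j)) where
    open UpperLevels F α generates T
    open BlockToAffine i eᵢ
    open ParabolicToWhole j eⱼ using () renaming (connectedByScaling to wholeByScaling; connectedByAddition to wholeByAddition)

    byScaling : ¬ α F.≈ F.1# → WholeConnected (removeLast T) → Connected whole
    byScaling α≉1 hc = wholeByScaling α≉1 (AffineToParabolic.connected α≉1 i
      (connectedByScaling (proj₂ (another-index i)) α≉1 (Extension.connected F α generates T (λ {x} → hc {x}))))

    fromAffine : α F.≈ F.1# → Connected Affine → Connected whole
    fromAffine α≈1 hc = wholeByAddition (proj₂ (another-index j)) (affine⇒parabolic α≈1 (λ {x} → hc {x}))

  -- For q = 2 the graph on the first two vertices is a hexagon, which is not Hamilton connected and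
  -- gives the induction nothing to start from; so `Affine` is treated directly.
  space : (T : TransitionGraph 3) → IsBypass T → WholeConnected T
  space T (extend (i , eᵢ) (j , eⱼ) b@(extend (zero , e₁₂) (zero , e₂₁) _)) = decide (α ≟F F.1#)
    where
    open Extend T eᵢ eⱼ
    affine : α F.≈ F.1# → ∀ i → TransitionGraph.Edge T (inject₁ i) (fromℕ 2) →
             Levels.Connected F α generates T (Levels.Affine F α generates T)
    affine α≈1 zero e = SpaceOverTwo.affineConnected F α generates T α≈1 zero (suc zero) (λ ()) e₁₂ e₂₁ e
    affine α≈1 (suc zero) e = SpaceOverTwo.affineConnected F α generates T α≈1 (suc zero) zero (λ ()) e₂₁ e₁₂ e
    decide : Dec (α F.≈ F.1#) → WholeConnected T
    decide (yes α≈1) = fromAffine α≈1 (λ {x} → affine α≈1 i eᵢ {x})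
    decide (no α≉1) = byScaling α≉1 (plane (removeLast T) b α≉1)

  -- Beyond n = 3 even q = 2 is covered by the general step: the last index has three others below
  -- it, as `connectedByAddition` demands.
  higher : ∀ k (T : TransitionGraph (suc (suc (suc k)))) → IsBypass T → WholeConnected T
  higher zero T b = space T b
  higher (suc k) T (extend (i , eᵢ) (j , eⱼ) b) = decide (α ≟F F.1#)
    where
    open Extend T eᵢ eⱼ
    hc : WholeConnected (removeLast T)
    hc = higher k (removeLast T) b
    affine : (∃₂ λ l o → l ≢ i × o ≢ i × o ≢ l) → Levels.Connected F α generates T (Levels.Affine F α generates T)
    affine (l , o , l≢i , o≢i , o≢l) = Levels.BlockToAffine.connectedByAddition F α generates T i eᵢ l≢i o≢i o≢l
      (Extension.connected F α generates T (λ {x} → hc {x}))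
    decide : Dec (α F.≈ F.1#) → WholeConnected T
    decide (yes α≈1) = fromAffine α≈1 (λ {x} → affine (two-others i) {x})
    decide (no α≉1) = byScaling α≉1 (λ {x} → hc {x})

  connected : ∀ {n} (T : TransitionGraph n) → IsBypass T → ¬ IsCycle (operationGraph F α T) → WholeConnected T
  connected T single acyclic with p ℕ.≤? 1
  ... | yes p≤1 = Line.connected F α generates T p≤1
  ... | no p≰1 = ⊥-elim (acyclic (Line.isCycle F α generates T (ℕ.≰⇒> p≰1)))
  connected {suc (suc zero)} T b@(extend (zero , e₁₂) (zero , e₂₁) _) acyclic with α ≟F F.1#
  ... | yes α≈1 = ⊥-elim (acyclic (Hexagon.isCycle F α generates T α≈1 e₁₂ e₂₁))
  ... | no α≉1 = plane T b α≉1
  connected {suc (suc (suc k))} T b@(extend _ _ _) _ = higher k T b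

corollary2 : ∀ {c ℓ} (n q : ℕ) → n ≥ 1 → IsPrimePower q →
    (F : FiniteField c ℓ q) (α : FiniteField.Carrier F) → IsGenerator F α →
    (T : TransitionGraph n) → IsBypass T →
    ¬ IsCycle (operationGraph F α T) →
    HamiltonConnected (operationGraph F α T)
corollary2 n q _ _ F α generates T b acyclic =
  HamiltonPaths.hamiltonConnected F α T (Induction.connected F α generates T b acyclic)
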